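{- Every even integer $N\geqslant 4$ can be written as the sum of a prime and a product of at most $e^{29.3}$ primes. -}

module Defs where

open import Data.Nat using (ℕ; _*_)
open import Data.List using (List; foldr)

-- ⌊ e^29.3 ⌋ = ⌊ 5306746226525.5008996… ⌋.
-- For a natural number k:  k ≤ e^29.3  ⇔  k ≤ ⌊ e^29.3 ⌋.
expBound : ℕ
expBound = 5306746226525

prodList : List ℕ → ℕ
prodList = foldr _*_ 1

{-# OPTIONS --safe #-}
module Submission where

-- Let W be an absolute constant, z a small fixed power of N and y = z ^ 1024, still a power of N. It suffices
-- to find a prime p for which N - p has no prime factor in [ W , z ) and few prime factors below W, since at
-- most a bounded number of its prime factors can be ≥ z. Let f (n) be the indicator that N - n has no prime
-- factor in [ W , z ), minus the density of this condition among the n without small prime factors.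
-- By the fundamental lemma of the sieve, f has sum nearly 0 over the n ≤ N without prime factors below y.
-- Apart from the primes, such n are products p m with p prime and p , m ≥ y, and weighting n = p m by
-- 1 / (ω (m) + 1) makes the weight depend on m only. The sum of f over these products is small by
-- Cauchy–Schwarz: f (p₁ m) and f (p₂ m) are nearly uncorrelated as m varies, because the two conditions
-- interact only at the primes l ≥ W dividing p₁ - p₂. As m and the p are weighted by sieves, no logarithm is
-- lost and the saving 1 / W is enough; no information on primes in progressions is needed. Hence the sum of f
-- over the primes is small compared with Chebyshev's lower bound for the number of primes, and many primes
-- are as required; the prime factors below W are few on average by an upper bound sieve.
-- For N below 2 ^ 2 ^ 42 the number N - 2 has few enough prime factors for trivial reasons.

-- All scales are doubly exponential: z = 2 ^ 2 ^ r, y is the same with r + 10, and N - 1 lies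
-- between those with r + 20 and r + 21. So 2 ^ r plays the part of log z and every logarithm
-- becomes an exponent. The exponent 1024 exceeds 706, the power of z that the fundamental lemma
-- asks for at accuracy 2 ^ -200. W is fixed by one comparison. The correlations deviate from
-- independence by about 48 / W on average, and Cauchy-Schwarz saves the square root of this. The
-- bilinear sum runs over at most 2 ^ (r + 21) dyadic shells for p, each carrying two sieve
-- densities of size at most 2 / 2 ^ r, while the main term has density 1 / 2 ^ (r + 23). The shells
-- thus cancel against one density, and a fixed saving wins: W = 2 ^ 128 gives 2 ^ -56. Increasing W
-- is not free, as the average number of prime factors below W is controlled through the sum of 1 /
-- q over q < W, here at most 2 ^ 7. The outcome is 2 ^ 36 factors below W, counted with
-- multiplicity, and 2 ^ 21 factors from z on. The stated bound is large enough for the trivial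
-- range to reach exponent 2 ^ 42, hence r ≥ 22.

-- Rational arithmetic: order, the embedding of ℕ, reciprocals, powers of two.

module Rationals where

  open import Data.Nat as ℕ using (ℕ; zero; suc; z≤n; s≤s)
  import Data.Nat.Properties as ℕP
  open import Data.Integer as ℤ using (ℤ)
  import Data.Integer.Properties as ℤP
  open import Data.Rational using (ℚ; 0ℚ; 1ℚ; _+_; _*_; -_; _-_; _≤_; _<_; toℚᵘ; nonNegative; positive; _/_)
  open import Data.Rational.Properties
  open import Data.Rational.Unnormalised as ℚᵘ using (mkℚᵘ; *≡*; *≤*)
  import Data.Rational.Unnormalised.Properties as ℚᵘP
  open import Data.Maybe using (Maybe; just; nothing)
  open import Data.Product using (_×_; _,_)
  open import Data.Sum using (inj₁; inj₂)
  open import Relation.Nullary using (yes; no)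
  open import Relation.Binary.PropositionalEquality using (_≡_; refl; sym; trans; cong; cong₂; subst)
  open import Level using (0ℓ)
  open import Tactic.RingSolver using (solve-∀)
  open import Tactic.RingSolver.Core.AlmostCommutativeRing using (AlmostCommutativeRing; fromCommutativeRing)

  isZero : (x : ℚ) → Maybe (0ℚ ≡ x)
  isZero x with 0ℚ ≟ x
  ... | yes p = just p
  ... | no _ = nothing

  ℚring : AlmostCommutativeRing 0ℓ 0ℓ
  ℚring = fromCommutativeRing +-*-commutativeRing isZero

  -- Reduces an inequality to an explicit nonnegative slack `d` and a polynomial identity for the
  -- ring solver. Many estimates below take this shape, the slack being built from known gaps and
  -- nonnegative products.
  nonneg⇒≤ : ∀ {x y d} → 0ℚ ≤ d → x + d ≡ y → x ≤ y
  nonneg⇒≤ {x} {y} {d} p refl = subst (_≤ x + d) (+-identityʳ x) (+-monoʳ-≤ x p)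

  gap : ∀ {x y} → x ≤ y → 0ℚ ≤ y - x
  gap {x} {y} p = subst (_≤ y - x) (+-inverseʳ x) (+-monoˡ-≤ (- x) p)

  0≤+ : ∀ {x y} → 0ℚ ≤ x → 0ℚ ≤ y → 0ℚ ≤ x + y
  0≤+ {x} {y} p q = subst (_≤ x + y) (+-identityˡ 0ℚ) (+-mono-≤ p q)

  0≤* : ∀ {x y} → 0ℚ ≤ x → 0ℚ ≤ y → 0ℚ ≤ x * y
  0≤* {x} {y} p q = subst (_≤ x * y) (*-zeroʳ x) (*-monoˡ-≤-nonNeg x {{nonNegative p}} q)

  0≤1 : 0ℚ ≤ 1ℚ
  0≤1 = Data.Rational.Properties.≤ᵇ⇒≤ {0ℚ} {1ℚ} _

  *-monoʳ : ∀ {r p q} → 0ℚ ≤ r → p ≤ q → r * p ≤ r * q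
  *-monoʳ {r} r≥0 = *-monoˡ-≤-nonNeg r {{nonNegative r≥0}}

  *-monoˡ : ∀ {r p q} → 0ℚ ≤ r → p ≤ q → p * r ≤ q * r
  *-monoˡ {r} r≥0 = *-monoʳ-≤-nonNeg r {{nonNegative r≥0}}

  *-mono : ∀ {p q r s} → 0ℚ ≤ p → 0ℚ ≤ s → p ≤ q → r ≤ s → p * r ≤ q * s
  *-mono p≥0 s≥0 p≤q r≤s = ≤-trans (*-monoʳ p≥0 r≤s) (*-monoˡ s≥0 p≤q)

  *-cancel : ∀ {r p q} → 0ℚ < r → r * p ≤ r * q → p ≤ q
  *-cancel {r} r>0 = *-cancelˡ-≤-pos r {{positive r>0}}

  0≤sq : ∀ x → 0ℚ ≤ x * x
  0≤sq x with ≤-total 0ℚ x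
  ... | inj₁ p = 0≤* p p
  ... | inj₂ p = subst (0ℚ ≤_) (e x) (0≤* q q)
    where
    q : 0ℚ ≤ - x
    q = neg-antimono-≤ p
    e : ∀ x → (- x) * (- x) ≡ x * x
    e = solve-∀ ℚring

  x≤x+y : ∀ {x y} → 0ℚ ≤ y → x ≤ x + y
  x≤x+y p = nonneg⇒≤ p refl

  ≤-via : ∀ {x x' y y'} → x ≡ x' → x' ≤ y' → y' ≡ y → x ≤ y
  ≤-via refl p refl = p

  infix 4 ∣_∣≤_
  -- A pair of inequalities in place of an absolute value: either half can be used without a case
  -- distinction on the sign.
  ∣_∣≤_ : ℚ → ℚ → Set
  ∣ x ∣≤ y = (- y ≤ x) × (x ≤ y)

  abs-+ : ∀ {x y u v} → ∣ x ∣≤ u → ∣ y ∣≤ v → ∣ x + y ∣≤ u + v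
  abs-+ {x} {y} {u} {v} (a , b) (c , d) = ≤-via (neg-distrib-+ u v) (+-mono-≤ a c) refl , +-mono-≤ b d

  abs-neg : ∀ {x u} → ∣ x ∣≤ u → ∣ - x ∣≤ u
  abs-neg {x} {u} (a , b) = neg-antimono-≤ b , ≤-via refl (neg-antimono-≤ a) (e u)
    where
    e : ∀ u → - (- u) ≡ u
    e = solve-∀ ℚring

  abs-weaken : ∀ {x u v} → u ≤ v → ∣ x ∣≤ u → ∣ x ∣≤ v
  abs-weaken p (a , b) = ≤-trans (neg-antimono-≤ p) a , ≤-trans b p

  abs-≡ : ∀ {x y u} → x ≡ y → ∣ x ∣≤ u → ∣ y ∣≤ u
  abs-≡ refl p = p

  abs-both : ∀ {x y u} → 0ℚ ≤ x → x ≤ u → 0ℚ ≤ y → y ≤ u → ∣ x - y ∣≤ u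
  abs-both {x} {y} {u} a b c d =
    nonneg⇒≤ (0≤+ (gap d) a) (e x y u) , nonneg⇒≤ (0≤+ (gap b) c) (e' x y u)
    where
    e : ∀ x y u → - u + ((u - y) + x) ≡ x - y
    e = solve-∀ ℚring
    e' : ∀ x y u → (x - y) + ((u - x) + y) ≡ u
    e' = solve-∀ ℚring

  abs-hi : ∀ {s m e} → ∣ s - m ∣≤ e → s ≤ m + e
  abs-hi {s} {m} {e} (_ , b) = nonneg⇒≤ (gap b) (p s m e)
    where
    p : ∀ s m e → s + (e - (s - m)) ≡ m + e
    p = solve-∀ ℚring

  abs-lo : ∀ {s m e} → ∣ s - m ∣≤ e → m - e ≤ s
  abs-lo {s} {m} {e} (a , _) = nonneg⇒≤ (gap a) (p s m e)
    where
    p : ∀ s m e → (m - e) + ((s - m) - - e) ≡ s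
    p = solve-∀ ℚring

  -- Opaque, so that fractions with huge numerators are never normalised; outside, only the laws
  -- proved in this block are available. `inv 0` is 0, which keeps `inv` total with values in
  -- [0, 1].
  abstract
    ι : ℕ → ℚ
    ι n = ℤ.+ n / 1

    inv : ℕ → ℚ
    inv zero = 0ℚ
    inv (suc n) = ℤ.+ 1 / suc n

    toᵘ-ι : ∀ n → toℚᵘ (ι n) ℚᵘ.≃ mkℚᵘ (ℤ.+ n) 0
    toᵘ-ι n = toℚᵘ-fromℚᵘ (mkℚᵘ (ℤ.+ n) 0)

    toᵘ-inv : ∀ n → toℚᵘ (inv (suc n)) ℚᵘ.≃ mkℚᵘ (ℤ.+ 1) n
    toᵘ-inv n = toℚᵘ-fromℚᵘ (mkℚᵘ (ℤ.+ 1) n)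

    ι-+ : ∀ m n → ι (m ℕ.+ n) ≡ ι m + ι n
    ι-+ m n = toℚᵘ-injective (ℚᵘP.≃-trans (toᵘ-ι (m ℕ.+ n)) (ℚᵘP.≃-trans (*≡* e)
      (ℚᵘP.≃-sym (ℚᵘP.≃-trans (toℚᵘ-homo-+ (ι m) (ι n)) (ℚᵘP.+-cong (toᵘ-ι m) (toᵘ-ι n))))))
      where
      e : ℤ.+ (m ℕ.+ n) ℤ.* ℤ.+ 1 ≡ (ℤ.+ m ℤ.* ℤ.+ 1 ℤ.+ ℤ.+ n ℤ.* ℤ.+ 1) ℤ.* ℤ.+ 1
      e = cong (ℤ._* ℤ.+ 1) (trans (ℤP.pos-+ m n) (sym (cong₂ ℤ._+_ (ℤP.*-identityʳ (ℤ.+ m)) (ℤP.*-identityʳ (ℤ.+ n)))))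

    ι-* : ∀ m n → ι (m ℕ.* n) ≡ ι m * ι n
    ι-* m n = toℚᵘ-injective (ℚᵘP.≃-trans (toᵘ-ι (m ℕ.* n)) (ℚᵘP.≃-trans (*≡* (cong (ℤ._* ℤ.+ 1) (ℤP.pos-* m n)))
      (ℚᵘP.≃-sym (ℚᵘP.≃-trans (toℚᵘ-homo-* (ι m) (ι n)) (ℚᵘP.*-cong (toᵘ-ι m) (toᵘ-ι n))))))

    ι-mono : ∀ {m n} → m ℕ.≤ n → ι m ≤ ι n
    ι-mono {m} {n} p = toℚᵘ-cancel-≤ (ℚᵘP.≤-trans (ℚᵘP.≤-reflexive (toᵘ-ι m)) (ℚᵘP.≤-trans (*≤* (ℤP.*-monoʳ-≤-nonNeg (ℤ.+ 1) (ℤ.+≤+ p))) (ℚᵘP.≤-reflexive (ℚᵘP.≃-sym (toᵘ-ι n)))))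

    ι-inv : ∀ n → ι (suc n) * inv (suc n) ≡ 1ℚ
    ι-inv n = toℚᵘ-injective (ℚᵘP.≃-trans (toℚᵘ-homo-* (ι (suc n)) (inv (suc n))) (ℚᵘP.≃-trans (ℚᵘP.*-cong (toᵘ-ι (suc n)) (toᵘ-inv n)) (*≡* e)))
      where
      e : (ℤ.+ suc n ℤ.* ℤ.+ 1) ℤ.* ℤ.+ 1 ≡ ℤ.+ 1 ℤ.* ℤ.+ suc (n ℕ.+ 0)
      e = trans (ℤP.*-identityʳ _) (trans (ℤP.*-identityʳ _) (trans (cong (λ k → ℤ.+ suc k) (sym (ℕP.+-identityʳ n))) (sym (ℤP.*-identityˡ _))))

    ι0≡0 : ι 0 ≡ 0ℚ
    ι0≡0 = refl

    ι1≡1 : ι 1 ≡ 1ℚ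
    ι1≡1 = refl

    inv0≡0 : inv 0 ≡ 0ℚ
    inv0≡0 = refl

  0≤ι : ∀ n → 0ℚ ≤ ι n
  0≤ι n = ≤-via (sym ι0≡0) (ι-mono {0} {n} z≤n) refl

  0<1 : 0ℚ < 1ℚ
  0<1 = ≰⇒> λ p → 1≢0 (≤-antisym p 0≤1)

  1≤ι : ∀ n → 1ℚ ≤ ι (suc n)
  1≤ι n = ≤-via (sym ι1≡1) (ι-mono {1} {suc n} (s≤s z≤n)) refl

  0<ι : ∀ n → 0ℚ < ι (suc n)
  0<ι n = <-≤-trans 0<1 (1≤ι n)

  0≤inv : ∀ n → 0ℚ ≤ inv n
  0≤inv zero = ≤-reflexive (sym inv0≡0)
  0≤inv (suc n) = *-cancel (0<ι n) (≤-via (*-zeroʳ (ι (suc n))) 0≤1 (sym (ι-inv n)))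

  ι-suc : ∀ n → ι (suc n) ≡ 1ℚ + ι n
  ι-suc n = trans (ι-+ 1 n) (cong (_+ ι n) ι1≡1)

  ι-inv′ : ∀ {n} → 1 ℕ.≤ n → ι n * inv n ≡ 1ℚ
  ι-inv′ (s≤s {n = n} _) = ι-inv n

  0<inv : ∀ n → 0ℚ < inv (suc n)
  0<inv n = ≰⇒> λ p → <-irrefl refl (<-≤-trans 0<1 (≤-via (sym (ι-inv n)) (*-monoʳ (0≤ι (suc n)) p) (*-zeroʳ (ι (suc n)))))

  private
    *-unique : ∀ {r x y} → r * x ≡ 1ℚ → r * y ≡ 1ℚ → x ≡ y
    *-unique {r} {x} {y} p q = trans (trans (sym (*-identityˡ x)) (trans (cong (_* x) (sym q)) (e r x y))) (trans (cong (_* y) p) (*-identityˡ y))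
      where
      e : ∀ r x y → r * y * x ≡ r * x * y
      e = solve-∀ ℚring

  inv-unique : ∀ {n x} → 1 ℕ.≤ n → ι n * x ≡ 1ℚ → x ≡ inv n
  inv-unique {n} p q = *-unique {ι n} q (ι-inv′ p)

  inv1≡1 : inv 1 ≡ 1ℚ
  inv1≡1 = sym (inv-unique {1} (s≤s z≤n) (trans (*-identityʳ (ι 1)) ι1≡1))

  inv-* : ∀ m n → 1 ℕ.≤ m → 1 ℕ.≤ n → inv (m ℕ.* n) ≡ inv m * inv n
  inv-* m n p q = sym (inv-unique (ℕP.*-mono-≤ p q) (trans (cong (_* (inv m * inv n)) (ι-* m n)) (trans (e (ι m) (ι n) (inv m) (inv n)) (trans (cong₂ _*_ (ι-inv′ p) (ι-inv′ q)) (*-identityˡ 1ℚ)))))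
    where
    e : ∀ a b c d → a * b * (c * d) ≡ (a * c) * (b * d)
    e = solve-∀ ℚring

  inv-anti : ∀ {m n} → 1 ℕ.≤ m → m ℕ.≤ n → inv n ≤ inv m
  inv-anti {m} {n} p q = ≤-via (sym (*-identityˡ (inv n))) (*-monoˡ (0≤inv n) 1≤) (trans (e (inv m) (ι n) (inv n)) (trans (cong (inv m *_) (ι-inv′ (ℕP.≤-trans p q))) (*-identityʳ (inv m))))
    where
    1≤ : 1ℚ ≤ inv m * ι n
    1≤ = ≤-via (trans (sym (ι-inv′ p)) (*-comm (ι m) (inv m))) (*-monoʳ (0≤inv m) (ι-mono q)) refl
    e : ∀ a b c → (a * b) * c ≡ a * (b * c)
    e = solve-∀ ℚring

  inv≤1 : ∀ n → inv n ≤ 1ℚ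
  inv≤1 zero = ≤-via inv0≡0 0≤1 refl
  inv≤1 (suc n) = ≤-via refl (inv-anti {1} {suc n} (s≤s z≤n) (s≤s z≤n)) inv1≡1

  ι-cancel-≤ : ∀ {m n} → ι m ≤ ι n → m ℕ.≤ n
  ι-cancel-≤ {m} {n} p = ℕP.≮⇒≥ λ q → <-irrefl refl (<-≤-trans (lt n) (≤-trans (ι-mono q) p))
    where
    lt : ∀ n → ι n < ι (suc n)
    lt n = ≤-<-trans (≤-via (sym (+-identityˡ (ι n))) ≤-refl refl) (<-≤-trans (+-monoˡ-< (ι n) 0<1) (≤-via refl ≤-refl (sym (ι-suc n))))

  -- `pw` and `hp` are the positive and the negative powers of 2, kept apart so that exponents stay
  -- natural numbers and sizes are compared by adding exponents.
  pw : ℕ → ℚ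
  pw k = ι (2 ℕ.^ k)

  hp : ℕ → ℚ
  hp k = inv (2 ℕ.^ k)

  1≤2^ : ∀ k → 1 ℕ.≤ 2 ℕ.^ k
  1≤2^ k = ℕP.m^n>0 2 k

  pw-+ : ∀ a b → pw (a ℕ.+ b) ≡ pw a * pw b
  pw-+ a b = trans (cong ι (ℕP.^-distribˡ-+-* 2 a b)) (ι-* (2 ℕ.^ a) (2 ℕ.^ b))

  hp-+ : ∀ a b → hp (a ℕ.+ b) ≡ hp a * hp b
  hp-+ a b = trans (cong inv (ℕP.^-distribˡ-+-* 2 a b)) (inv-* (2 ℕ.^ a) (2 ℕ.^ b) (1≤2^ a) (1≤2^ b))

  pw-hp : ∀ k → pw k * hp k ≡ 1ℚ
  pw-hp k = ι-inv′ (1≤2^ k)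

  0≤pw : ∀ k → 0ℚ ≤ pw k
  0≤pw k = 0≤ι (2 ℕ.^ k)

  0≤hp : ∀ k → 0ℚ ≤ hp k
  0≤hp k = 0≤inv (2 ℕ.^ k)

  0<pw : ∀ k → 0ℚ < pw k
  0<pw k = <-≤-trans 0<1 (≤-via (sym ι1≡1) (ι-mono (1≤2^ k)) refl)

  pw-mono : ∀ {a b} → a ℕ.≤ b → pw a ≤ pw b
  pw-mono p = ι-mono (ℕP.^-monoʳ-≤ 2 p)

  hp-anti : ∀ {a b} → a ℕ.≤ b → hp b ≤ hp a
  hp-anti {a} p = inv-anti (1≤2^ a) (ℕP.^-monoʳ-≤ 2 p)

  hp≤1 : ∀ k → hp k ≤ 1ℚ
  hp≤1 k = inv≤1 (2 ℕ.^ k)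

  pw-hp-+ : ∀ a b → pw a * hp (a ℕ.+ b) ≡ hp b
  pw-hp-+ a b = trans (cong (pw a *_) (hp-+ a b)) (trans (sym (*-assoc (pw a) (hp a) (hp b))) (trans (cong (_* hp b) (pw-hp a)) (*-identityˡ (hp b))))

  hp-pw-+ : ∀ a b → hp a * pw (a ℕ.+ b) ≡ pw b
  hp-pw-+ a b = trans (cong (hp a *_) (pw-+ a b)) (trans (e (hp a) (pw a) (pw b)) (trans (cong (_* pw b) (pw-hp a)) (*-identityˡ (pw b))))
    where
    e : ∀ x y z → x * (y * z) ≡ y * x * z
    e = solve-∀ ℚring

  infixr 8 _^_
  _^_ : ℚ → ℕ → ℚ
  x ^ zero = 1ℚ
  x ^ suc n = x * x ^ n

  0≤^ : ∀ {x} n → 0ℚ ≤ x → 0ℚ ≤ x ^ n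
  0≤^ zero _ = 0≤1
  0≤^ (suc n) p = 0≤* p (0≤^ n p)

  ^-mono : ∀ {x y} n → 0ℚ ≤ x → x ≤ y → x ^ n ≤ y ^ n
  ^-mono zero _ _ = ≤-refl
  ^-mono (suc n) p q = *-mono p (0≤^ n (≤-trans p q)) q (^-mono n p q)

  ^-distrib-* : ∀ x y n → (x * y) ^ n ≡ x ^ n * y ^ n
  ^-distrib-* x y zero = refl
  ^-distrib-* x y (suc n) = trans (cong (x * y *_) (^-distrib-* x y n)) (e x y (x ^ n) (y ^ n))
    where
    e : ∀ a b c d → a * b * (c * d) ≡ a * c * (b * d)
    e = solve-∀ ℚring

  1^ : ∀ n → 1ℚ ^ n ≡ 1ℚ
  1^ zero = refl
  1^ (suc n) = trans (*-identityˡ _) (1^ n)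

  bernoulli : ∀ {x} n → 0ℚ ≤ x → 1ℚ + ι n * x ≤ (1ℚ + x) ^ n
  bernoulli {x} zero p = ≤-reflexive (trans (cong (λ u → 1ℚ + u * x) ι0≡0) (e x))
    where
    e : ∀ x → 1ℚ + 0ℚ * x ≡ 1ℚ
    e = solve-∀ ℚring
  bernoulli {x} (suc n) p = ≤-trans (nonneg⇒≤ (0≤* (0≤ι n) (0≤sq x)) (trans (cong (λ u → 1ℚ + u * x + ι n * (x * x)) (ι-suc n)) (e (ι n) x)))
    (*-monoʳ (0≤+ 0≤1 p) (bernoulli n p))
    where
    e : ∀ n x → 1ℚ + (1ℚ + n) * x + n * (x * x) ≡ (1ℚ + x) * (1ℚ + n * x)
    e = solve-∀ ℚring

  hp-^ : ∀ a n → hp a ^ n ≡ hp (n ℕ.* a)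
  hp-^ a zero = sym inv1≡1
  hp-^ a (suc n) = trans (cong (hp a *_) (hp-^ a n)) (sym (hp-+ a (n ℕ.* a)))

  pw-^ : ∀ a n → pw a ^ n ≡ pw (n ℕ.* a)
  pw-^ a zero = sym ι1≡1
  pw-^ a (suc n) = trans (cong (pw a *_) (pw-^ a n)) (sym (pw-+ a (n ℕ.* a)))

  ι2≡ : ι 2 ≡ 1ℚ + 1ℚ
  ι2≡ = trans (ι-+ 1 1) (cong₂ _+_ ι1≡1 ι1≡1)

  *-assoc-inv : ∀ {n} x → 1 ℕ.≤ n → x * ι n * inv n ≡ x
  *-assoc-inv {n} x p = trans (*-assoc x (ι n) (inv n)) (trans (cong (x *_) (ι-inv′ p)) (*-identityʳ x))

  ≤-move : ∀ {x y n} → 1 ℕ.≤ n → x * ι n ≤ y → x ≤ y * inv n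
  ≤-move {x} {y} {n} p h = ≤-via (sym (*-assoc-inv x p)) (*-monoˡ (0≤inv n) h) refl

-- Finite sums and products over initial segments, and indicators.

module FiniteSums where

  open Rationals
  open import Data.Bool using (Bool; true; false)
  open import Data.Nat as ℕ using (ℕ; zero; suc; s≤s)
  import Data.Nat.Properties as ℕP
  open import Data.Rational using (ℚ; 0ℚ; 1ℚ; _+_; _*_; -_; _-_; _≤_)
  open import Data.Rational.Properties
  open import Relation.Nullary using (Dec; yes; no; ¬_; contradiction)
  open import Relation.Binary.PropositionalEquality using (_≡_; refl; sym; trans; cong; cong₂)
  open import Tactic.RingSolver using (solve-∀)

  ∑ ∏ : ℕ → (ℕ → ℚ) → ℚ
  ∑ zero f = 0ℚ
  ∑ (suc n) f = ∑ n f + f n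
  ∏ zero f = 1ℚ
  ∏ (suc n) f = ∏ n f * f n

  private
    lt : ∀ {i n} → i ℕ.< n → i ℕ.< suc n
    lt = ℕP.m<n⇒m<1+n

  ∑-cong : ∀ n {f g} → (∀ i → i ℕ.< n → f i ≡ g i) → ∑ n f ≡ ∑ n g
  ∑-cong zero h = refl
  ∑-cong (suc n) h = cong₂ _+_ (∑-cong n (λ i p → h i (lt p))) (h n ℕP.≤-refl)

  ∑-mono : ∀ n {f g} → (∀ i → i ℕ.< n → f i ≤ g i) → ∑ n f ≤ ∑ n g
  ∑-mono zero h = ≤-refl
  ∑-mono (suc n) h = +-mono-≤ (∑-mono n (λ i p → h i (lt p))) (h n ℕP.≤-refl)

  ∑-nonneg : ∀ n {f} → (∀ i → i ℕ.< n → 0ℚ ≤ f i) → 0ℚ ≤ ∑ n f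
  ∑-nonneg zero h = ≤-refl
  ∑-nonneg (suc n) h = 0≤+ (∑-nonneg n (λ i p → h i (lt p))) (h n ℕP.≤-refl)

  ∑-+ : ∀ n f g → ∑ n (λ i → f i + g i) ≡ ∑ n f + ∑ n g
  ∑-+ zero f g = refl
  ∑-+ (suc n) f g = trans (cong (_+ (f n + g n)) (∑-+ n f g)) (e (∑ n f) (∑ n g) (f n) (g n))
    where
    e : ∀ a b c d → a + b + (c + d) ≡ a + c + (b + d)
    e = solve-∀ ℚring

  ∑-minus : ∀ n f g → ∑ n (λ i → f i - g i) ≡ ∑ n f - ∑ n g
  ∑-minus zero f g = refl
  ∑-minus (suc n) f g = trans (cong (_+ (f n - g n)) (∑-minus n f g)) (e (∑ n f) (∑ n g) (f n) (g n))
    where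
    e : ∀ a b c d → a - b + (c - d) ≡ a + c - (b + d)
    e = solve-∀ ℚring

  ∑-*ˡ : ∀ n c f → ∑ n (λ i → c * f i) ≡ c * ∑ n f
  ∑-*ˡ zero c f = sym (*-zeroʳ c)
  ∑-*ˡ (suc n) c f = trans (cong (_+ c * f n) (∑-*ˡ n c f)) (sym (*-distribˡ-+ c (∑ n f) (f n)))

  ∑-*ʳ : ∀ n c f → ∑ n (λ i → f i * c) ≡ ∑ n f * c
  ∑-*ʳ n c f = trans (∑-cong n (λ i _ → *-comm (f i) c)) (trans (∑-*ˡ n c f) (*-comm c (∑ n f)))

  ∑-zero : ∀ n → ∑ n (λ _ → 0ℚ) ≡ 0ℚ
  ∑-zero zero = refl
  ∑-zero (suc n) = trans (+-identityʳ _) (∑-zero n)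

  ∑-const : ∀ n c → ∑ n (λ _ → c) ≡ ι n * c
  ∑-const zero c = sym (trans (cong (_* c) ι0≡0) (*-zeroˡ c))
  ∑-const (suc n) c = trans (cong (_+ c) (∑-const n c)) (trans (e (ι n) c) (cong (_* c) (sym (ι-suc n))))
    where
    e : ∀ n c → n * c + c ≡ (1ℚ + n) * c
    e = solve-∀ ℚring

  ∑-swap : ∀ m n (f : ℕ → ℕ → ℚ) → ∑ m (λ i → ∑ n (f i)) ≡ ∑ n (λ j → ∑ m (λ i → f i j))
  ∑-swap zero n f = sym (∑-zero n)
  ∑-swap (suc m) n f = trans (cong (_+ ∑ n (f m)) (∑-swap m n f)) (sym (∑-+ n (λ j → ∑ m (λ i → f i j)) (f m)))

  ∑-split : ∀ m n f → ∑ (m ℕ.+ n) f ≡ ∑ m f + ∑ n (λ i → f (m ℕ.+ i))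
  ∑-split m zero f = trans (cong (λ k → ∑ k f) (ℕP.+-identityʳ m)) (sym (+-identityʳ _))
  ∑-split m (suc n) f = trans (cong (λ k → ∑ k f) (ℕP.+-suc m n)) (trans (cong (_+ f (m ℕ.+ n)) (∑-split m n f)) (+-assoc (∑ m f) _ _))

  ∑-≤-len : ∀ {m n} f → (∀ i → 0ℚ ≤ f i) → m ℕ.≤ n → ∑ m f ≤ ∑ n f
  ∑-≤-len {m} {n} f h p = ≤-via refl (x≤x+y (∑-nonneg (n ℕ.∸ m) (λ i _ → h (m ℕ.+ i)))) (trans (sym (∑-split m (n ℕ.∸ m) f)) (cong (λ k → ∑ k f) (ℕP.m+[n∸m]≡n p)))

  ∑-≤-const : ∀ n c f → (∀ i → i ℕ.< n → f i ≤ c) → ∑ n f ≤ ι n * c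
  ∑-≤-const n c f h = ≤-via refl (∑-mono n h) (∑-const n c)

  term≤∑ : ∀ n f → (∀ i → 0ℚ ≤ f i) → ∀ i → i ℕ.< n → f i ≤ ∑ n f
  term≤∑ n f h i p = ≤-trans (nonneg⇒≤ (∑-nonneg i (λ j _ → h j)) (+-comm (f i) (∑ i f))) (∑-≤-len f h p)

  ∏-cong : ∀ n {f g} → (∀ i → i ℕ.< n → f i ≡ g i) → ∏ n f ≡ ∏ n g
  ∏-cong zero h = refl
  ∏-cong (suc n) h = cong₂ _*_ (∏-cong n (λ i p → h i (lt p))) (h n ℕP.≤-refl)

  ∏-nonneg : ∀ n {f} → (∀ i → i ℕ.< n → 0ℚ ≤ f i) → 0ℚ ≤ ∏ n f
  ∏-nonneg zero h = 0≤1
  ∏-nonneg (suc n) h = 0≤* (∏-nonneg n (λ i p → h i (lt p))) (h n ℕP.≤-refl)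

  ∏-mono : ∀ n {f g} → (∀ i → i ℕ.< n → 0ℚ ≤ f i) → (∀ i → i ℕ.< n → f i ≤ g i) → ∏ n f ≤ ∏ n g
  ∏-mono zero _ _ = ≤-refl
  ∏-mono (suc n) h k = *-mono (∏-nonneg n (λ i p → h i (lt p))) (≤-trans (h n ℕP.≤-refl) (k n ℕP.≤-refl)) (∏-mono n (λ i p → h i (lt p)) (λ i p → k i (lt p))) (k n ℕP.≤-refl)

  ∏-one : ∀ n → ∏ n (λ _ → 1ℚ) ≡ 1ℚ
  ∏-one zero = refl
  ∏-one (suc n) = trans (*-identityʳ _) (∏-one n)

  ∏-≤1 : ∀ n {f} → (∀ i → i ℕ.< n → 0ℚ ≤ f i) → (∀ i → i ℕ.< n → f i ≤ 1ℚ) → ∏ n f ≤ 1ℚ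
  ∏-≤1 n h k = ≤-via refl (∏-mono n h k) (∏-one n)

  ∏-≥1 : ∀ n {f} → (∀ i → i ℕ.< n → 1ℚ ≤ f i) → 1ℚ ≤ ∏ n f
  ∏-≥1 n k = ≤-via (sym (∏-one n)) (∏-mono n (λ _ _ → 0≤1) k) refl

  ∏-* : ∀ n f g → ∏ n (λ i → f i * g i) ≡ ∏ n f * ∏ n g
  ∏-* zero f g = refl
  ∏-* (suc n) f g = trans (cong (_* (f n * g n)) (∏-* n f g)) (e (∏ n f) (∏ n g) (f n) (g n))
    where
    e : ∀ a b c d → a * b * (c * d) ≡ a * c * (b * d)
    e = solve-∀ ℚring

  ∏-^ : ∀ n f k → ∏ n (λ i → f i ^ k) ≡ ∏ n f ^ k
  ∏-^ zero f k = sym (1^ k)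
  ∏-^ (suc n) f k = trans (cong (_* f n ^ k) (∏-^ n f k)) (sym (^-distrib-* (∏ n f) (f n) k))

  ∏-split : ∀ m n f → ∏ (m ℕ.+ n) f ≡ ∏ m f * ∏ n (λ i → f (m ℕ.+ i))
  ∏-split m zero f = trans (cong (λ k → ∏ k f) (ℕP.+-identityʳ m)) (sym (*-identityʳ _))
  ∏-split m (suc n) f = trans (cong (λ k → ∏ k f) (ℕP.+-suc m n)) (trans (cong (_* f (m ℕ.+ n)) (∏-split m n f)) (*-assoc (∏ m f) _ _))

  ∏-antitone : ∀ m n {f} → (∀ i → 0ℚ ≤ f i) → (∀ i → f i ≤ 1ℚ) → ∏ (m ℕ.+ n) f ≤ ∏ m f
  ∏-antitone m n {f} h k = ≤-via (∏-split m n f) (*-monoʳ (∏-nonneg m (λ i _ → h i)) (∏-≤1 n (λ i _ → h (m ℕ.+ i)) (λ i _ → k (m ℕ.+ i)))) (*-identityʳ _)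

  ∏-zero : ∀ n f i → i ℕ.< n → f i ≡ 0ℚ → ∏ n f ≡ 0ℚ
  ∏-zero (suc n) f i (s≤s p) h with i ℕP.≟ n
  ... | yes refl = trans (cong (∏ n f *_) h) (*-zeroʳ (∏ n f))
  ... | no i≢n = trans (cong (_* f n) (∏-zero n f i (ℕP.≤∧≢⇒< p i≢n) h)) (*-zeroˡ (f n))

  ∏-weierstrass : ∀ n f → (∀ i → i ℕ.< n → 0ℚ ≤ f i) → (∀ i → i ℕ.< n → f i ≤ 1ℚ) → 1ℚ - ∑ n f ≤ ∏ n (λ i → 1ℚ - f i)
  ∏-weierstrass zero f h k = ≤-refl
  ∏-weierstrass (suc n) f h k = ≤-trans (nonneg⇒≤ (0≤* (∑-nonneg n h') (h n ℕP.≤-refl)) (e (∑ n f) (f n))) (*-monoˡ (gap (k n ℕP.≤-refl)) (∏-weierstrass n f h' (λ i p → k i (lt p))))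
    where
    h' : ∀ i → i ℕ.< n → 0ℚ ≤ f i
    h' i p = h i (lt p)
    e : ∀ s x → 1ℚ - (s + x) + s * x ≡ (1ℚ - s) * (1ℚ - x)
    e = solve-∀ ℚring

  -- Allows one factor to be worse by `c`, as happens to a sieve density when one more prime is left
  -- out of the sieve.
  ∏-except : ∀ n {f g} c l → 1ℚ ≤ c → (∀ i → 0ℚ ≤ f i) → (∀ i → 0ℚ ≤ g i) → (∀ i → ¬ i ≡ l → f i ≤ g i) → f l ≤ c * g l → ∏ n f ≤ c * ∏ n g
  ∏-except zero c l 1≤c hf hg h hl = ≤-via refl 1≤c (sym (*-identityʳ c))
  ∏-except (suc n) {f} {g} c l 1≤c hf hg h hl with n ℕP.≟ l
  ... | no n≢l = ≤-via refl (*-mono (∏-nonneg n (λ i _ → hf i)) (hg n) (∏-except n c l 1≤c hf hg h hl) (h n n≢l)) (*-assoc c (∏ n g) (g n))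
  ... | yes refl = ≤-via refl (*-mono (∏-nonneg n (λ i _ → hf i)) (0≤* (≤-trans 0≤1 1≤c) (hg n)) (∏-mono n (λ i _ → hf i) (λ i p → h i (ℕP.<⇒≢ p))) hl) (e (∏ n g) c (g n))
    where
    e : ∀ p c g → p * (c * g) ≡ c * (p * g)
    e = solve-∀ ℚring

  ind : Bool → ℚ
  ind true = 1ℚ
  ind false = 0ℚ

  ⟨_⟩ : ∀ {a} {A : Set a} → Dec A → ℚ
  ⟨ d ⟩ = ind (Dec.does d)

  ⟨⟩-yes : ∀ {a} {A : Set a} (d : Dec A) → A → ⟨ d ⟩ ≡ 1ℚ
  ⟨⟩-yes (yes _) _ = refl
  ⟨⟩-yes (no ¬p) p = contradiction p ¬p

  ⟨⟩-no : ∀ {a} {A : Set a} (d : Dec A) → ¬ A → ⟨ d ⟩ ≡ 0ℚ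
  ⟨⟩-no (yes p) ¬p = contradiction p ¬p
  ⟨⟩-no (no _) _ = refl

  0≤⟨⟩ : ∀ {a} {A : Set a} (d : Dec A) → 0ℚ ≤ ⟨ d ⟩
  0≤⟨⟩ (yes _) = 0≤1
  0≤⟨⟩ (no _) = ≤-refl

  ⟨⟩≤1 : ∀ {a} {A : Set a} (d : Dec A) → ⟨ d ⟩ ≤ 1ℚ
  ⟨⟩≤1 (yes _) = ≤-refl
  ⟨⟩≤1 (no _) = 0≤1

  ⟨⟩-⇔ : ∀ {a b} {A : Set a} {B : Set b} (d : Dec A) (e : Dec B) → (A → B) → (B → A) → ⟨ d ⟩ ≡ ⟨ e ⟩
  ⟨⟩-⇔ (yes p) e f g = sym (⟨⟩-yes e (f p))
  ⟨⟩-⇔ (no ¬p) e f g = sym (⟨⟩-no e (λ q → ¬p (g q)))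

  ⟨⟩-⇒ : ∀ {a b} {A : Set a} {B : Set b} (d : Dec A) (e : Dec B) → (A → B) → ⟨ d ⟩ ≤ ⟨ e ⟩
  ⟨⟩-⇒ (yes p) e f = ≤-reflexive (sym (⟨⟩-yes e (f p)))
  ⟨⟩-⇒ (no ¬p) e f = 0≤⟨⟩ e

  1-≤1 : ∀ {x} → 0ℚ ≤ x → 1ℚ - x ≤ 1ℚ
  1-≤1 {x} p = nonneg⇒≤ p (e x)
    where
    e : ∀ x → 1ℚ - x + x ≡ 1ℚ
    e = solve-∀ ℚring

  ∑-single : ∀ n {f} a → (∀ i → ¬ i ≡ a → f i ≤ 0ℚ) → 0ℚ ≤ f a → ∑ n f ≤ f a
  ∑-single n {f} a h p = go n
    where
    below : ∀ m → m ℕ.≤ a → ∑ m f ≤ 0ℚ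
    below zero _ = ≤-refl
    below (suc m) q = ≤-via refl (+-mono-≤ (below m (ℕP.<⇒≤ q)) (h m (ℕP.<⇒≢ q))) (+-identityʳ 0ℚ)
    go : ∀ n → ∑ n f ≤ f a
    go zero = p
    go (suc m) with m ℕP.≟ a
    ... | yes refl = ≤-via refl (+-monoˡ-≤ (f m) (below m ℕP.≤-refl)) (+-identityˡ (f m))
    ... | no m≢a = ≤-via refl (+-mono-≤ (go m) (h m m≢a)) (+-identityʳ (f a))

  -- The shells [2 ^ j, 2 ^ (j + 1)) are split off one at a time. Only their number enters the
  -- bound, which is how logarithms arise below.
  ∑-dyadic : ∀ f c J → (∀ j → J ℕ.≤ j → ∑ (2 ℕ.^ j) (λ k → f (2 ℕ.^ j ℕ.+ k)) ≤ c) → ∀ n → ∑ (2 ℕ.^ (J ℕ.+ n)) f ≤ ∑ (2 ℕ.^ J) f + ι n * c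
  ∑-dyadic f c J h zero = ≤-reflexive (trans (cong (λ j → ∑ (2 ℕ.^ j) f) (ℕP.+-identityʳ J)) (sym (trans (cong (∑ (2 ℕ.^ J) f +_) (trans (cong (_* c) ι0≡0) (*-zeroˡ c))) (+-identityʳ _))))
  ∑-dyadic f c J h (suc n) = ≤-via (trans (cong (λ j → ∑ j f) (trans (cong (2 ℕ.^_) (ℕP.+-suc J n)) (cong (2 ℕ.^ (J ℕ.+ n) ℕ.+_) (ℕP.+-identityʳ _)))) (∑-split (2 ℕ.^ (J ℕ.+ n)) (2 ℕ.^ (J ℕ.+ n)) f))
    (+-mono-≤ (∑-dyadic f c J h n) (h (J ℕ.+ n) (ℕP.m≤m+n J n)))
    (trans (e (∑ (2 ℕ.^ J) f) (ι n) c) (cong (λ w → ∑ (2 ℕ.^ J) f + w * c) (sym (ι-suc n))))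
    where
    e : ∀ s n c → s + n * c + c ≡ s + (1ℚ + n) * c
    e = solve-∀ ℚring

-- Congruences and subprogressions in a residue class.

module Congruences where

  open Rationals
  open FiniteSums
  open import Data.Nat as ℕ using (ℕ; zero; suc; z≤n; s≤s)
  import Data.Nat.Properties as ℕP
  import Data.Nat.Divisibility as ℕD
  import Data.Nat.DivMod as ℕM
  open import Data.Nat.Coprimality using (Coprime; coprime-Bézout; coprime-divisor)
  import Data.Nat.Coprimality as Coprimality
  open import Data.Nat.GCD using (module Bézout)
  open import Data.Nat.Primality using (Prime; prime⇒irreducible; prime⇒nonZero; prime⇒nonTrivial)
  import Data.Nat.Tactic.RingSolver as ℕSolver
  open import Data.Integer as ℤ using (ℤ)
  import Data.Integer.Properties as ℤP
  import Data.Integer.Divisibility.Signed as ℤD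
  import Data.Integer.Tactic.RingSolver as ℤSolver
  open import Data.Rational using (ℚ; _+_; _*_; -_; _-_; _≤_)
  open import Data.Rational.Properties
  open import Data.Product using (Σ; _×_; _,_)
  open import Data.Sum using (inj₁; inj₂)
  open import Relation.Nullary using (Dec; yes; no; ¬_; contradiction; map′)
  open import Relation.Binary.PropositionalEquality using (_≡_; refl; sym; trans; cong; cong₂; subst)
  open import Tactic.RingSolver using (solve-∀)

  -- Divisibility of an integer difference, which avoids truncated subtraction. The record wrapper
  -- lets `l`, `a` and `b` be inferred from a proof.
  record Cg (l a b : ℕ) : Set where
    constructor mkCg
    field
      dvd : ℤ.+ l ℤD.∣ (ℤ.+ a ℤ.- ℤ.+ b)

  abstract
    cg? : ∀ l a b → Dec (Cg l a b)
    cg? l a b = map′ mkCg Cg.dvd (ℤ.+ l ℤD.∣? (ℤ.+ a ℤ.- ℤ.+ b))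

  cg-refl : ∀ {l a} → Cg l a a
  cg-refl {l} {a} = mkCg (ℤD.divides ℤ.0ℤ (ℤP.+-inverseʳ (ℤ.+ a)))

  cg-sym : ∀ {l a b} → Cg l a b → Cg l b a
  cg-sym {l} {a} {b} (mkCg p) = mkCg (subst (ℤ.+ l ℤD.∣_) (e (ℤ.+ a) (ℤ.+ b)) (ℤD.∣m⇒∣-m p))
    where
    e : ∀ x y → ℤ.- (x ℤ.- y) ≡ y ℤ.- x
    e = ℤSolver.solve-∀

  cg-trans : ∀ {l a b c} → Cg l a b → Cg l b c → Cg l a c
  cg-trans {l} {a} {b} {c} (mkCg p) (mkCg q) = mkCg (subst (ℤ.+ l ℤD.∣_) (e (ℤ.+ a) (ℤ.+ b) (ℤ.+ c)) (ℤD.∣m∣n⇒∣m+n p q))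
    where
    e : ∀ x y z → (x ℤ.- y) ℤ.+ (y ℤ.- z) ≡ x ℤ.- z
    e = ℤSolver.solve-∀

  cg-+ : ∀ {l a b} k → Cg l a b → Cg l (k ℕ.+ a) (k ℕ.+ b)
  cg-+ {l} {a} {b} k (mkCg p) = mkCg (subst (ℤ.+ l ℤD.∣_) (trans (e (ℤ.+ k) (ℤ.+ a) (ℤ.+ b)) (cong₂ ℤ._-_ (sym (ℤP.pos-+ k a)) (sym (ℤP.pos-+ k b)))) p)
    where
    e : ∀ x y z → y ℤ.- z ≡ x ℤ.+ y ℤ.- (x ℤ.+ z)
    e = ℤSolver.solve-∀

  cg-cancel-+ : ∀ {l a b} k → Cg l (k ℕ.+ a) (k ℕ.+ b) → Cg l a b
  cg-cancel-+ {l} {a} {b} k (mkCg p) = mkCg (subst (ℤ.+ l ℤD.∣_) (trans (cong₂ ℤ._-_ (ℤP.pos-+ k a) (ℤP.pos-+ k b)) (e (ℤ.+ k) (ℤ.+ a) (ℤ.+ b))) p)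
    where
    e : ∀ x y z → x ℤ.+ y ℤ.- (x ℤ.+ z) ≡ y ℤ.- z
    e = ℤSolver.solve-∀

  private
    *-distrib-minus : ∀ x y z → x ℤ.* (y ℤ.- z) ≡ x ℤ.* y ℤ.- x ℤ.* z
    *-distrib-minus = ℤSolver.solve-∀

    pos-*-minus : ∀ k a b → ℤ.+ k ℤ.* (ℤ.+ a ℤ.- ℤ.+ b) ≡ ℤ.+ (k ℕ.* a) ℤ.- ℤ.+ (k ℕ.* b)
    pos-*-minus k a b = trans (*-distrib-minus (ℤ.+ k) (ℤ.+ a) (ℤ.+ b)) (cong₂ ℤ._-_ (sym (ℤP.pos-* k a)) (sym (ℤP.pos-* k b)))

  cg-* : ∀ {l a b} k → Cg l a b → Cg l (k ℕ.* a) (k ℕ.* b)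
  cg-* {l} {a} {b} k (mkCg p) = mkCg (subst (ℤ.+ l ℤD.∣_) (pos-*-minus k a b) (ℤD.∣n⇒∣m*n (ℤ.+ k) p))

  cg-cancel-* : ∀ {l a b} k → Coprime l k → Cg l (k ℕ.* a) (k ℕ.* b) → Cg l a b
  cg-cancel-* {l} {a} {b} k c (mkCg p) = mkCg (ℤD.∣ᵤ⇒∣ (coprime-divisor c (subst (l ℕD.∣_) (ℤP.abs-* (ℤ.+ k) (ℤ.+ a ℤ.- ℤ.+ b)) (ℤD.∣⇒∣ᵤ (subst (ℤ.+ l ℤD.∣_) (sym (pos-*-minus k a b)) p)))))

  cg-mk : ∀ {l a b} j k → a ℕ.+ j ℕ.* l ≡ b ℕ.+ k ℕ.* l → Cg l a b
  cg-mk {l} {a} {b} j k p = mkCg (ℤD.divides (ℤ.+ k ℤ.- ℤ.+ j) (trans (e (ℤ.+ a) (ℤ.+ b) (ℤ.+ j) (ℤ.+ k) (ℤ.+ l)) (trans (cong (λ u → u ℤ.- (ℤ.+ b ℤ.+ ℤ.+ k ℤ.* ℤ.+ l) ℤ.+ (ℤ.+ k ℤ.- ℤ.+ j) ℤ.* ℤ.+ l) p') (e' (ℤ.+ b ℤ.+ ℤ.+ k ℤ.* ℤ.+ l) ((ℤ.+ k ℤ.- ℤ.+ j) ℤ.* ℤ.+ l)))))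
    where
    p' : ℤ.+ a ℤ.+ ℤ.+ j ℤ.* ℤ.+ l ≡ ℤ.+ b ℤ.+ ℤ.+ k ℤ.* ℤ.+ l
    p' = trans (cong (ℤ._+_ (ℤ.+ a)) (sym (ℤP.pos-* j l))) (trans (sym (ℤP.pos-+ a _)) (trans (cong ℤ.+_ p) (trans (ℤP.pos-+ b _) (cong (ℤ._+_ (ℤ.+ b)) (ℤP.pos-* k l)))))
    e : ∀ a b j k l → a ℤ.- b ≡ a ℤ.+ j ℤ.* l ℤ.- (b ℤ.+ k ℤ.* l) ℤ.+ (k ℤ.- j) ℤ.* l
    e = ℤSolver.solve-∀
    e' : ∀ x y → x ℤ.- x ℤ.+ y ≡ y
    e' = ℤSolver.solve-∀

  cg⇒∣∸ : ∀ {l a b} → b ℕ.≤ a → Cg l a b → l ℕD.∣ a ℕ.∸ b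
  cg⇒∣∸ {l} {a} {b} b≤a (mkCg p) = subst (l ℕD.∣_) (cong ℤ.∣_∣ (trans (ℤP.m-n≡m⊖n a b) (ℤP.⊖-≥ b≤a))) (ℤD.∣⇒∣ᵤ p)

  ∣∸⇒cg : ∀ {l a b} → b ℕ.≤ a → l ℕD.∣ a ℕ.∸ b → Cg l a b
  ∣∸⇒cg {l} {a} {b} b≤a p = mkCg (ℤD.∣ᵤ⇒∣ (subst (l ℕD.∣_) (sym (cong ℤ.∣_∣ (trans (ℤP.m-n≡m⊖n a b) (ℤP.⊖-≥ b≤a)))) p))

  cg0⇒∣ : ∀ {l a} → Cg l a 0 → l ℕD.∣ a
  cg0⇒∣ = cg⇒∣∸ z≤n

  ∣⇒cg0 : ∀ {l a} → l ℕD.∣ a → Cg l a 0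
  ∣⇒cg0 = ∣∸⇒cg z≤n

  coprime-sym : ∀ {m n} → Coprime m n → Coprime n m
  coprime-sym = Coprimality.sym

  -- A Bézout coefficient inverts q up to sign. It is multiplied by a natural number congruent to c
  -- - a, or to a - c for the other sign, and the product is reduced mod l.
  root : ∀ l q a c → 1 ℕ.≤ l → Coprime q l → Σ ℕ λ t → t ℕ.< l × Cg l (a ℕ.+ q ℕ.* t) c
  root (suc l) q a c _ cop with coprime-Bézout cop
  ... | Bézout.+- x y eq = t ℕM.% suc l , ℕM.m%n<n t (suc l) , cg-trans (cg-+ a (cg-* q t%)) main
    where
    e t : ℕ
    e = c ℕ.+ l ℕ.* a
    t = x ℕ.* e
    t% : Cg (suc l) (t ℕM.% suc l) t
    t% = cg-mk (t ℕM./ suc l) 0 (trans (sym (ℕM.m≡m%n+[m/n]*n t (suc l))) (sym (ℕP.+-identityʳ t)))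
    f : ∀ a q x e → a ℕ.+ q ℕ.* (x ℕ.* e) ℕ.+ 0 ≡ a ℕ.+ x ℕ.* q ℕ.* e
    f = ℕSolver.solve-∀
    g : ∀ a l c y → a ℕ.+ (1 ℕ.+ y ℕ.* (1 ℕ.+ l)) ℕ.* (c ℕ.+ l ℕ.* a) ≡ c ℕ.+ (a ℕ.+ y ℕ.* (c ℕ.+ l ℕ.* a)) ℕ.* (1 ℕ.+ l)
    g = ℕSolver.solve-∀
    main : Cg (suc l) (a ℕ.+ q ℕ.* t) c
    main = cg-mk 0 (a ℕ.+ y ℕ.* e) (trans (f a q x e) (trans (cong (λ u → a ℕ.+ u ℕ.* e) (sym eq)) (g a l c y)))
  ... | Bézout.-+ x y eq = t ℕM.% suc l , ℕM.m%n<n t (suc l) , cg-trans (cg-+ a (cg-* q t%)) main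
    where
    e t : ℕ
    e = a ℕ.+ l ℕ.* c
    t = x ℕ.* e
    t% : Cg (suc l) (t ℕM.% suc l) t
    t% = cg-mk (t ℕM./ suc l) 0 (trans (sym (ℕM.m≡m%n+[m/n]*n t (suc l))) (sym (ℕP.+-identityʳ t)))
    f : ∀ a q x c l → a ℕ.+ q ℕ.* (x ℕ.* (a ℕ.+ l ℕ.* c)) ℕ.+ c ℕ.* (1 ℕ.+ l) ≡ c ℕ.+ (1 ℕ.+ x ℕ.* q) ℕ.* (a ℕ.+ l ℕ.* c)
    f = ℕSolver.solve-∀
    g : ∀ c y l e → c ℕ.+ y ℕ.* l ℕ.* e ≡ c ℕ.+ y ℕ.* e ℕ.* l
    g = ℕSolver.solve-∀
    main : Cg (suc l) (a ℕ.+ q ℕ.* t) c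
    main = cg-mk c (y ℕ.* e) (trans (f a q x c l) (trans (cong (λ u → c ℕ.+ u ℕ.* e) eq) (g c y (suc l) e)))

  private
    -- Induction on T with the invariant that t₀ + l T' is the next member of the class at or after
    -- T. Hence T itself is in the class exactly when it equals that number.
    subAP₀ : ∀ l t₀ → t₀ ℕ.< l → (P : ℕ → Set) (P? : ∀ t → Dec (P t)) → (∀ t → P t → Cg l t t₀) → (∀ t → Cg l t t₀ → P t) →
      ∀ T → Σ ℕ λ T' → T ℕ.≤ t₀ ℕ.+ l ℕ.* T' × t₀ ℕ.+ l ℕ.* T' ℕ.< T ℕ.+ l ×
        (∀ (φ : ℕ → ℚ) → ∑ T (λ t → ⟨ P? t ⟩ * φ t) ≡ ∑ T' (λ s → φ (t₀ ℕ.+ l ℕ.* s)))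
    subAP₀ l t₀ t₀<l P P? to from zero = 0 , z≤n , ℕP.≤-trans (s≤s (ℕP.≤-reflexive (trans (cong (t₀ ℕ.+_) (ℕP.*-zeroʳ l)) (ℕP.+-identityʳ t₀)))) t₀<l , λ φ → refl
    subAP₀ l t₀ t₀<l P P? to from (suc T) with subAP₀ l t₀ t₀<l P P? to from T
    ... | T' , lo , hi , eq with T ℕP.≟ t₀ ℕ.+ l ℕ.* T'
    ...   | yes T≡ = suc T' , lo' , hi' , λ φ → cong₂ _+_ (eq φ) (trans (cong (_* φ T) (⟨⟩-yes (P? T) (from T T≡t₀))) (trans (*-identityˡ (φ T)) (cong φ T≡)))
      where
      step : t₀ ℕ.+ l ℕ.* suc T' ≡ T ℕ.+ l
      step = trans (cong (t₀ ℕ.+_) (trans (ℕP.*-suc l T') (ℕP.+-comm l (l ℕ.* T')))) (trans (sym (ℕP.+-assoc t₀ _ l)) (cong (ℕ._+ l) (sym T≡)))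
      lo' : suc T ℕ.≤ t₀ ℕ.+ l ℕ.* suc T'
      lo' = subst (suc T ℕ.≤_) (sym step) (subst (ℕ._≤ T ℕ.+ l) (ℕP.+-comm T 1) (ℕP.+-monoʳ-≤ T (ℕP.≤-trans (s≤s z≤n) t₀<l)))
      hi' : t₀ ℕ.+ l ℕ.* suc T' ℕ.< suc T ℕ.+ l
      hi' = subst (ℕ._< suc T ℕ.+ l) (sym step) ℕP.≤-refl
      T≡t₀ : Cg l T t₀
      T≡t₀ = cg-mk 0 T' (trans (ℕP.+-identityʳ T) (trans T≡ (cong (t₀ ℕ.+_) (ℕP.*-comm l T'))))
    ...   | no T≢ = T' , ℕP.≤∧≢⇒< lo T≢ , ℕP.m<n⇒m<1+n hi , λ φ → trans (cong₂ _+_ (eq φ) (trans (cong (_* φ T) (⟨⟩-no (P? T) (λ pT → not (to T pT)))) (*-zeroˡ (φ T)))) (+-identityʳ _)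
      where
      u : ℕ
      u = t₀ ℕ.+ l ℕ.* T'
      not : ¬ Cg l T t₀
      not p = ℕP.<⇒≱ d<l (ℕD.∣⇒≤ {{ℕ.>-nonZero 0<d}} (cg⇒∣∸ lo (cg-trans (cg-mk 0 T' (trans (ℕP.+-identityʳ u) (cong (t₀ ℕ.+_) (ℕP.*-comm l T')))) (cg-sym p))))
        where
        0<d : 0 ℕ.< u ℕ.∸ T
        0<d = ℕP.m<n⇒0<n∸m (ℕP.≤∧≢⇒< lo T≢)
        d<l : u ℕ.∸ T ℕ.< l
        d<l = ℕP.+-cancelˡ-< T (u ℕ.∸ T) l (subst (ℕ._< T ℕ.+ l) (sym (ℕP.m+[n∸m]≡n lo)) hi)

  SubAP : ℕ → ℕ → ℕ → ℕ → ℕ → Set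
  SubAP l q a c T = Σ ℕ λ a' → Σ ℕ λ T' →
    (T ℕ.≤ l ℕ.* T' ℕ.+ l) × (l ℕ.* T' ℕ.≤ T ℕ.+ l) ×
    (∀ (φ : ℕ → ℚ) → ∑ T (λ t → ⟨ cg? l (a ℕ.+ q ℕ.* t) c ⟩ * φ (a ℕ.+ q ℕ.* t)) ≡ ∑ T' (λ s → φ (a' ℕ.+ q ℕ.* l ℕ.* s)))

  -- The terms of a progression that lie in a residue class to a coprime modulus form a progression.
  subAP : ∀ l q a c T → 1 ℕ.≤ l → Coprime q l → SubAP l q a c T
  subAP l q a c T 1≤l cop = fromRoot (root l q a c 1≤l cop)
    where
    f : ∀ a q t l s → a ℕ.+ q ℕ.* (t ℕ.+ l ℕ.* s) ≡ a ℕ.+ q ℕ.* t ℕ.+ q ℕ.* l ℕ.* s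
    f = ℕSolver.solve-∀
    fromRoot : (Σ ℕ λ t → t ℕ.< l × Cg l (a ℕ.+ q ℕ.* t) c) → SubAP l q a c T
    fromRoot (t₀ , t₀<l , r) = finish (subAP₀ l t₀ t₀<l (λ t → Cg l (a ℕ.+ q ℕ.* t) c) (λ t → cg? l (a ℕ.+ q ℕ.* t) c)
        (λ t p → cg-cancel-* q (coprime-sym cop) (cg-cancel-+ a (cg-trans p (cg-sym r))))
        (λ t p → cg-trans (cg-+ a (cg-* q p)) r) T)
      where
      finish : (Σ ℕ λ T' → T ℕ.≤ t₀ ℕ.+ l ℕ.* T' × t₀ ℕ.+ l ℕ.* T' ℕ.< T ℕ.+ l ×
        (∀ (φ : ℕ → ℚ) → ∑ T (λ t → ⟨ cg? l (a ℕ.+ q ℕ.* t) c ⟩ * φ t) ≡ ∑ T' (λ s → φ (t₀ ℕ.+ l ℕ.* s)))) → SubAP l q a c T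
      finish (T' , lo , hi , eq) = a ℕ.+ q ℕ.* t₀ , T' ,
        ℕP.≤-trans lo (subst (t₀ ℕ.+ l ℕ.* T' ℕ.≤_) (ℕP.+-comm l (l ℕ.* T')) (ℕP.+-monoˡ-≤ (l ℕ.* T') (ℕP.<⇒≤ t₀<l))) ,
        ℕP.≤-trans (ℕP.m≤n+m (l ℕ.* T') t₀) (ℕP.<⇒≤ hi) ,
        λ φ → trans (eq (λ t → φ (a ℕ.+ q ℕ.* t))) (∑-cong T' (λ s _ → cong φ (f a q t₀ l s)))

  prime⇒1≤ : ∀ {p} → Prime p → 1 ℕ.≤ p
  prime⇒1≤ {p} pr = ℕ.>-nonZero⁻¹ p {{prime⇒nonZero pr}}

  prime⇒2≤ : ∀ {p} → Prime p → 2 ℕ.≤ p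
  prime⇒2≤ {p} pr = ℕ.nonTrivial⇒n>1 p {{prime⇒nonTrivial pr}}

  ∤⇒coprime : ∀ {p n} → Prime p → ¬ p ℕD.∣ n → Coprime p n
  ∤⇒coprime pr p∤n (d∣p , d∣n) with prime⇒irreducible pr d∣p
  ... | inj₁ d≡1 = d≡1
  ... | inj₂ refl = contradiction d∣n p∤n

  prime∣prime : ∀ {p q} → Prime p → Prime q → p ℕD.∣ q → p ≡ q
  prime∣prime pp pq p∣q with prime⇒irreducible pq p∣q
  ... | inj₁ refl = contradiction (prime⇒2≤ pp) λ { (s≤s ()) }
  ... | inj₂ e = e

  primes-coprime : ∀ {p q} → Prime p → Prime q → ¬ p ≡ q → Coprime p q
  primes-coprime pp pq p≢q = ∤⇒coprime pp λ p∣q → p≢q (prime∣prime pp pq p∣q)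

  coprime-* : ∀ {m n l} → Coprime m l → Coprime n l → Coprime (m ℕ.* n) l
  coprime-* {m} {n} {l} a b (d∣mn , d∣l) = b (coprime-divisor (λ (e∣d , e∣m) → a (e∣m , ℕD.∣-trans e∣d d∣l)) d∣mn , d∣l)

  Multiples : ℕ → ℕ → Set
  Multiples l T = Σ ℕ λ T' → T ℕ.≤ l ℕ.* T' × l ℕ.* T' ℕ.< T ℕ.+ l ×
    (∀ (φ : ℕ → ℚ) → ∑ T (λ t → ⟨ l ℕD.∣? t ⟩ * φ t) ≡ ∑ T' (λ s → φ (l ℕ.* s)))

  multiples : ∀ l T → 1 ℕ.≤ l → Multiples l T
  multiples l T 1≤l = subAP₀ l 0 1≤l (l ℕD.∣_) (l ℕD.∣?_) (λ t → ∣⇒cg0) (λ t → cg0⇒∣) T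

-- The fundamental lemma of the sieve, by Buchstab's identity on doubly exponential blocks.

module FundamentalLemma where

  open Rationals
  open FiniteSums
  open Congruences
  open import Data.List using (List; []; _∷_; length)
  open import Data.Nat as ℕ using (ℕ; zero; suc; z≤n; s≤s)
  import Data.Nat.Properties as ℕP
  open import Data.Nat.Coprimality using (Coprime)
  open import Data.Nat.Primality using (Prime)
  import Data.Nat.Tactic.RingSolver as ℕSolver
  open import Data.Rational using (ℚ; 0ℚ; 1ℚ; _+_; _*_; -_; _-_; _≤_)
  open import Data.Rational.Properties
  open import Data.Product using (_×_; _,_; proj₁; proj₂)
  open import Relation.Nullary using (contradiction)
  open import Relation.Binary.PropositionalEquality using (_≡_; refl; sym; trans; cong; cong₂; subst)
  open import Tactic.RingSolver using (solve-∀)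

  ∑L : List ℕ → (ℕ → ℚ) → ℚ
  ∑L [] f = 0ℚ
  ∑L (c ∷ cs) f = f c + ∑L cs f

  0≤∑L : ∀ cs {f} → (∀ c → 0ℚ ≤ f c) → 0ℚ ≤ ∑L cs f
  0≤∑L [] h = ≤-refl
  0≤∑L (c ∷ cs) h = 0≤+ (h c) (0≤∑L cs h)

  -- Squaring leads from one endpoint to the next, and the reciprocals of the primes between two
  -- neighbours have bounded sum, so one block changes a sieve density by a bounded factor.
  bl : ℕ → ℕ
  bl i = 2 ℕ.^ (2 ℕ.^ i)

  bl-suc : ∀ i → bl (suc i) ≡ bl i ℕ.* bl i
  bl-suc i = trans (cong (2 ℕ.^_) (cong (2 ℕ.^ i ℕ.+_) (ℕP.+-identityʳ (2 ℕ.^ i)))) (ℕP.^-distribˡ-+-* 2 (2 ℕ.^ i) (2 ℕ.^ i))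

  bl-mono : ∀ {i j} → i ℕ.≤ j → bl i ℕ.≤ bl j
  bl-mono p = ℕP.^-monoʳ-≤ 2 (ℕP.^-monoʳ-≤ 2 p)

  1≤bl : ∀ i → 1 ℕ.≤ bl i
  1≤bl i = 1≤2^ (2 ℕ.^ i)

  len : ℕ → ℕ
  len i = bl (suc i) ℕ.∸ bl i

  bl+len : ∀ i → bl i ℕ.+ len i ≡ bl (suc i)
  bl+len i = ℕP.m+[n∸m]≡n (bl-mono (ℕP.n≤1+n i))

  -- For each l, the residue classes mod l to be removed; they are nonempty only for prime l.
  record Sieve : Set where
    field
      C : ℕ → List ℕ
      C-prime : ∀ {l c cs} → C l ≡ c ∷ cs → Prime l
    β : ℕ → ℕ → ℚ
    β l n = ∑L (C l) (λ c → ⟨ cg? l n c ⟩)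
    g : ℕ → ℚ
    g l = ι (length (C l)) * inv l
    field
      β≤1 : ∀ l n → β l n ≤ 1ℚ
      g≤½ : ∀ l → ι 2 * g l ≤ 1ℚ
      -- The dimension of the sieve: 6 = 3 · 2 for up to three classes per prime, the reciprocals of
      -- the primes in a block adding up to at most 2.
      block : ∀ i → ∑ (len i) (λ k → g (bl i ℕ.+ k)) ≤ ι 6

  private
    -- From (1 - x)(1 + x) ≤ 1 and Bernoulli, (1 - x) ^ 24 (1 + 24 x) ≤ 1, while (1 + 24 x)(1 - 12
    -- x) = 1 + 12 x (1 - 24 x) ≥ 1.
    24-power : ∀ {x} → 0ℚ ≤ x → ι 24 * x ≤ 1ℚ → (1ℚ - x) ^ 24 ≤ 1ℚ - ι 12 * x
    24-power {x} p q = *-cancel pos (≤-trans (≤-via (*-comm D _) below refl) above)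
      where
      D : ℚ
      D = 1ℚ + ι 24 * x
      pos : 0ℚ Data.Rational.< D
      pos = <-≤-trans 0<1 (x≤x+y (0≤* (0≤ι 24) p))
      24x : x ≤ ι 24 * x
      24x = ≤-via (sym (*-identityˡ x)) (*-monoˡ p (1≤ι 23)) refl
      0≤1-x : 0ℚ ≤ 1ℚ - x
      0≤1-x = gap (≤-trans 24x q)
      e : ∀ x → (1ℚ - x) * (1ℚ + x) ≡ 1ℚ - x * x
      e = solve-∀ ℚring
      below : (1ℚ - x) ^ 24 * D ≤ 1ℚ
      below = ≤-trans (*-monoʳ (0≤^ 24 0≤1-x) (bernoulli 24 p))
        (≤-via (sym (^-distrib-* (1ℚ - x) (1ℚ + x) 24)) (^-mono 24 (0≤* 0≤1-x (0≤+ 0≤1 p)) (≤-via (e x) (1-≤1 (0≤sq x)) refl)) (1^ 24))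
      ι24 : ι 24 ≡ ι 2 * ι 12
      ι24 = ι-* 2 12
      f : ∀ a b x → b ≡ (1ℚ + 1ℚ) * a → 1ℚ + a * x * (1ℚ - b * x) ≡ (1ℚ + b * x) * (1ℚ - a * x)
      f a b x refl = f' a x
        where
        f' : ∀ a x → 1ℚ + a * x * (1ℚ - (1ℚ + 1ℚ) * a * x) ≡ (1ℚ + (1ℚ + 1ℚ) * a * x) * (1ℚ - a * x)
        f' = solve-∀ ℚring
      above : 1ℚ ≤ D * (1ℚ - ι 12 * x)
      above = nonneg⇒≤ (0≤* (0≤* (0≤ι 12) p) (gap q)) (f (ι 12) (ι 24) x (trans ι24 (cong (_* ι 12) ι2≡)))

  -- T' differs from T / l by at most 1, so an error of 2 becomes 2 / l + 1, which is again at most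
  -- 2 because l ≥ 2. The rounding error therefore does not grow under iteration.
  close-sub : ∀ {l T T' X} → 2 ℕ.≤ l → T ℕ.≤ l ℕ.* T' ℕ.+ l → l ℕ.* T' ℕ.≤ T ℕ.+ l → ∣ ι T - X ∣≤ ι 2 → ∣ ι T' - X * inv l ∣≤ ι 2
  close-sub {l} {T} {T'} {X} 2≤l lo hi (cl , ch) =
    nonneg⇒≤ (0≤+ (0≤+ (0≤* 0≤ν (gap cl)) (0≤* 0≤ν (gap lo'))) (gap 2ν≤1)) (trans (e₁ (ι T') (ι T) X ν (ι l)) (f₁ νl)) ,
    nonneg⇒≤ (0≤+ (0≤+ (0≤* 0≤ν (gap ch)) (0≤* 0≤ν (gap hi'))) (gap 2ν≤1)) (trans (e₂ (ι T') (ι T) X ν (ι l)) (f₂ νl))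
    where
    ν : ℚ
    ν = inv l
    0≤ν : 0ℚ ≤ ν
    0≤ν = 0≤inv l
    νl : ν * ι l ≡ 1ℚ
    νl = trans (*-comm ν (ι l)) (ι-inv′ (ℕP.≤-trans (s≤s z≤n) 2≤l))
    2ν≤1 : ι 2 * ν ≤ 1ℚ
    2ν≤1 = ≤-via refl (*-monoˡ 0≤ν (ι-mono 2≤l)) (ι-inv′ (ℕP.≤-trans (s≤s z≤n) 2≤l))
    lo' : ι T ≤ ι l * ι T' + ι l
    lo' = ≤-via refl (ι-mono lo) (trans (ι-+ (l ℕ.* T') l) (cong (_+ ι l) (ι-* l T')))
    hi' : ι l * ι T' ≤ ι T + ι l
    hi' = ≤-via (sym (ι-* l T')) (ι-mono hi) (ι-+ T l)
    e₁ : ∀ T' T X ν l → - ι 2 + (ν * ((T - X) - - ι 2) + ν * ((l * T' + l) - T) + (1ℚ - ι 2 * ν)) ≡ - ι 2 + 1ℚ + ν * l * T' + ν * l - X * ν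
    e₁ T' T X ν l = e (ι 2) T' T X ν l
      where
      e : ∀ two T' T X ν l → - two + (ν * ((T - X) - - two) + ν * ((l * T' + l) - T) + (1ℚ - two * ν)) ≡ - two + 1ℚ + ν * l * T' + ν * l - X * ν
      e = solve-∀ ℚring
    f₁ : ∀ {u} → u ≡ 1ℚ → - ι 2 + 1ℚ + u * ι T' + u - X * ν ≡ ι T' - X * ν
    f₁ refl = trans (cong (λ w → - w + 1ℚ + 1ℚ * ι T' + 1ℚ - X * ν) ι2≡) (e (ι T') (X * ν))
      where
      e : ∀ a b → - (1ℚ + 1ℚ) + 1ℚ + 1ℚ * a + 1ℚ - b ≡ a - b
      e = solve-∀ ℚring
    e₂ : ∀ T' T X ν l → T' - X * ν + (ν * (ι 2 - (T - X)) + ν * ((T + l) - l * T') + (1ℚ - ι 2 * ν)) ≡ T' + ν * l + 1ℚ - ν * l * T'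
    e₂ T' T X ν l = e (ι 2) T' T X ν l
      where
      e : ∀ two T' T X ν l → T' - X * ν + (ν * (two - (T - X)) + ν * ((T + l) - l * T') + (1ℚ - two * ν)) ≡ T' + ν * l + 1ℚ - ν * l * T'
      e = solve-∀ ℚring
    f₂ : ∀ {u} → u ≡ 1ℚ → ι T' + u + 1ℚ - u * ι T' ≡ ι 2
    f₂ refl = trans (e (ι T')) (sym ι2≡)
      where
      e : ∀ a → a + 1ℚ + 1ℚ - 1ℚ * a ≡ 1ℚ + 1ℚ
      e = solve-∀ ℚring

  module Fundamental (𝒮 : Sieve) where
    open Sieve 𝒮

    h : ℕ → ℕ → ℚ
    h Z n = ∏ Z (λ l → 1ℚ - β l n)

    V : ℕ → ℚ
    V Z = ∏ Z (λ l → 1ℚ - g l)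

    S : ℕ → ℕ → ℕ → ℕ → ℚ
    S Z a q T = ∑ T (λ t → h Z (a ℕ.+ q ℕ.* t))

    Cop : ℕ → ℕ → Set
    Cop q Z = ∀ {l c cs} → l ℕ.< Z → C l ≡ c ∷ cs → Coprime q l

    Close : ℕ → ℚ → Set
    Close T X = ∣ ι T - X ∣≤ ι 2

    -- Uniform in the progression and in a rational length X, since the induction passes to
    -- differences q Z and to lengths X / Z, which are only close to a number of terms.
    Near : ℕ → ℚ → ℚ → Set
    Near Z Y R = ∀ a q T X → Cop q Z → Close T X → Y ≤ X → ∣ S Z a q T - X * V Z ∣≤ X * R

    0≤β : ∀ l n → 0ℚ ≤ β l n
    0≤β l n = 0≤∑L (C l) (λ c → 0≤⟨⟩ (cg? l n c))

    0≤g : ∀ l → 0ℚ ≤ g l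
    0≤g l = 0≤* (0≤ι (length (C l))) (0≤inv l)

    g≤1 : ∀ l → g l ≤ 1ℚ
    g≤1 l = ≤-trans (≤-via (sym (*-identityˡ (g l))) (*-monoˡ (0≤g l) (1≤ι 1)) refl) (g≤½ l)

    0≤h : ∀ Z n → 0ℚ ≤ h Z n
    0≤h Z n = ∏-nonneg Z (λ l _ → gap (β≤1 l n))

    0≤V : ∀ Z → 0ℚ ≤ V Z
    0≤V Z = ∏-nonneg Z (λ l _ → gap (g≤1 l))

    V-antitone : ∀ Z k → V (Z ℕ.+ k) ≤ V Z
    V-antitone Z k = ∏-antitone Z k (λ l → gap (g≤1 l)) (λ l → 1-≤1 (0≤g l))

    0≤S : ∀ Z a q T → 0ℚ ≤ S Z a q T
    0≤S Z a q T = ∑-nonneg T (λ t _ → 0≤h Z _)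

    S-antitone : ∀ Z k a q T → S (Z ℕ.+ k) a q T ≤ S Z a q T
    S-antitone Z k a q T = ∑-mono T (λ t _ → ∏-antitone Z k {λ l → 1ℚ - β l (a ℕ.+ q ℕ.* t)} (λ l → gap (β≤1 l (a ℕ.+ q ℕ.* t))) (λ l → 1-≤1 (0≤β l (a ℕ.+ q ℕ.* t))))

    module Block (z U : ℕ) (Y ε : ℚ) (0≤Y : 0ℚ ≤ Y) (0≤ε : 0ℚ ≤ ε) (ε≤1 : ε ≤ 1ℚ) (1≤U : 1 ℕ.≤ U) (near : Near z Y (V z * ε)) where

      E F : ℕ → ℚ
      E k = ∏ k (λ i → 1ℚ + g (z ℕ.+ i))
      F k = ∏ k (λ i → 1ℚ + ι 16 * g (z ℕ.+ i))

      -- Relative error after k moduli with a budget of t further splittings. The first term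
      -- propagates the initial error ε. The second is the price of stopping when the budget is used
      -- up: spending one splitting multiplies 16 ^ -t by 16, which the factors 1 + 16 g of `F`
      -- absorb.
      R : ℕ → ℕ → ℚ
      R k t = ε * E k + ι 2 * hp 4 ^ t * F k

      1≤E : ∀ k → 1ℚ ≤ E k
      1≤E k = ∏-≥1 k (λ i _ → x≤x+y (0≤g (z ℕ.+ i)))

      1≤F : ∀ k → 1ℚ ≤ F k
      1≤F k = ∏-≥1 k (λ i _ → x≤x+y (0≤* (0≤ι 16) (0≤g (z ℕ.+ i))))

      1≤U^ : ∀ t → 1ℚ ≤ ι U ^ t
      1≤U^ t = ≤-via (sym (1^ t)) (^-mono t 0≤1 (≤-via (sym ι1≡1) (ι-mono 1≤U) refl)) refl

      Y≤ : ∀ t → Y ≤ Y * ι U ^ t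
      Y≤ t = ≤-via (sym (*-identityʳ Y)) (*-monoʳ 0≤Y (1≤U^ t)) refl

      cop-down : ∀ {q} k → Cop q (z ℕ.+ k) → Cop q z
      cop-down k cop p = cop (ℕP.≤-trans p (ℕP.m≤m+n z k))

      -- With no budget left, monotonicity in the sieving limit suffices: the sifted sum and the
      -- expected value both lie between 0 and 2 X V z.
      trivial : ∀ k → Near (z ℕ.+ k) (Y * ι U ^ 0) (V z * R k 0)
      trivial k a q T X cop cl Y≤X = abs-weaken (*-monoʳ 0≤X (*-monoʳ (0≤V z) R≥2)) (abs-both (0≤S (z ℕ.+ k) a q T) S≤ (0≤* 0≤X (0≤V (z ℕ.+ k))) XV≤)
        where
        Y≤X' : Y ≤ X
        Y≤X' = ≤-trans (Y≤ 0) Y≤X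
        0≤X : 0ℚ ≤ X
        0≤X = ≤-trans 0≤Y Y≤X'
        R≥2 : ι 2 ≤ R k 0
        R≥2 = ≤-trans (≤-via (sym (trans (*-identityʳ _) (*-identityʳ (ι 2)))) (*-monoʳ (0≤* (0≤ι 2) 0≤1) (1≤F k)) refl)
          (nonneg⇒≤ (0≤* 0≤ε (≤-trans 0≤1 (1≤E k))) (+-comm (ι 2 * 1ℚ * F k) (ε * E k)))
        e : ∀ X v ε → X * v + X * (v * ε) + X * v * (1ℚ - ε) ≡ X * (v * (1ℚ + 1ℚ))
        e = solve-∀ ℚring
        S≤ : S (z ℕ.+ k) a q T ≤ X * (V z * ι 2)
        S≤ = ≤-trans (S-antitone z k a q T) (≤-trans (abs-hi (near a q T X (cop-down k cop) cl Y≤X'))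
          (nonneg⇒≤ (0≤* (0≤* 0≤X (0≤V z)) (gap ε≤1)) (trans (e X (V z) ε) (cong (λ w → X * (V z * w)) (sym ι2≡)))))
        XV≤ : X * V (z ℕ.+ k) ≤ X * (V z * ι 2)
        XV≤ = *-monoʳ 0≤X (≤-trans (V-antitone z k) (≤-via (sym (*-identityʳ (V z))) (*-monoʳ (0≤V z) (1≤ι 1)) refl))

      hp4-16 : hp 4 * ι 16 ≡ 1ℚ
      hp4-16 = trans (*-comm (hp 4) (ι 16)) (pw-hp 4)

      -- Buchstab's identity: sieving by one more modulus Z subtracts, for every class removed mod
      -- Z, the sifted sum over a progression of difference q Z and length X / Z. The first term
      -- keeps the budget, the subtracted ones spend one unit of it, and the errors add up to
      -- exactly R (k + 1) (t + 1).
      claim : ∀ k t → z ℕ.+ k ℕ.≤ U → Near (z ℕ.+ k) (Y * ι U ^ t) (V z * R k t)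
      claim k zero _ = trivial k
      claim zero (suc t) _ a q T X cop cl Y≤X = abs-weaken (*-monoʳ 0≤X (*-monoʳ (0≤V z) ε≤R))
          (abs-≡ (cong (λ w → S w a q T - X * V w) (sym (ℕP.+-identityʳ z))) (near a q T X (cop-down 0 cop) cl Y≤X'))
        where
        Y≤X' : Y ≤ X
        Y≤X' = ≤-trans (Y≤ (suc t)) Y≤X
        0≤X : 0ℚ ≤ X
        0≤X = ≤-trans 0≤Y Y≤X'
        ε≤R : ε ≤ R 0 (suc t)
        ε≤R = ≤-via (sym (*-identityʳ ε)) (x≤x+y (0≤* (0≤* (0≤ι 2) (0≤^ (suc t) (0≤hp 4))) 0≤1)) refl
      claim (suc k) (suc t) Z≤U a q T X cop cl Y≤X = goal
        where
        Z : ℕ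
        Z = z ℕ.+ k
        Z<U : Z ℕ.< U
        Z<U = subst (ℕ._≤ U) (ℕP.+-suc z k) Z≤U
        cop' : Cop q Z
        cop' {l} p = cop (subst (suc l ℕ.≤_) (sym (ℕP.+-suc z k)) (ℕP.m≤n⇒m≤1+n p))
        ν : ℚ
        ν = inv Z
        0≤ν : 0ℚ ≤ ν
        0≤ν = 0≤inv Z
        0≤YU : ∀ t → 0ℚ ≤ Y * ι U ^ t
        0≤YU t = 0≤* 0≤Y (0≤^ t (0≤ι U))
        n : ℕ → ℕ
        n t = a ℕ.+ q ℕ.* t
        v : ℚ
        v = V z
        sifted : List ℕ → ℚ
        sifted cs = ∑ T (λ t → ∑L cs (λ c → ⟨ cg? Z (n t) c ⟩) * h Z (n t))

        one : ∀ c → Prime Z → Coprime q Z → ∣ ∑ T (λ t → ⟨ cg? Z (n t) c ⟩ * h Z (n t)) - X * ν * V Z ∣≤ X * ν * (v * R k t)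
        one c pZ qZ = use (subAP Z q a c T (prime⇒1≤ pZ) qZ)
          where
          -- Since Z < U, dividing the length by Z costs no more than the one factor U by which the
          -- smaller budget relaxes the requirement.
          YU≤ : Y * ι U ^ t ≤ X * ν
          YU≤ = ≤-via (trans (sym (*-identityʳ (Y * ι U ^ t))) (trans (cong (Y * ι U ^ t *_) (sym (ι-inv′ (prime⇒1≤ pZ)))) (sym (*-assoc (Y * ι U ^ t) (ι Z) ν))))
            (*-monoˡ 0≤ν (≤-trans (*-monoʳ (0≤YU t) (ι-mono (ℕP.<⇒≤ Z<U))) (≤-via (e Y (ι U ^ t) (ι U)) Y≤X refl))) refl
            where
            e : ∀ y p u → y * p * u ≡ y * (u * p)
            e = solve-∀ ℚring
          copZ : Cop (q ℕ.* Z) Z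
          copZ {l} l<Z eq = coprime-* (cop' l<Z eq) (primes-coprime pZ (C-prime eq) (λ e → ℕP.<⇒≢ l<Z (sym e)))
          use : SubAP Z q a c T → ∣ ∑ T (λ t → ⟨ cg? Z (n t) c ⟩ * h Z (n t)) - X * ν * V Z ∣≤ X * ν * (v * R k t)
          use (a' , T' , lo , hi , eq) = abs-≡ (cong (_- X * ν * V Z) (sym (eq (h Z))))
            (claim k t (ℕP.<⇒≤ Z<U) a' (q ℕ.* Z) T' (X * ν) copZ (close-sub (prime⇒2≤ pZ) lo hi cl) YU≤)

        many : ∀ cs → (∀ {c cs'} → cs ≡ c ∷ cs' → Prime Z × Coprime q Z) →
          ∣ sifted cs - ι (length cs) * (X * ν * V Z) ∣≤ ι (length cs) * (X * ν * (v * R k t))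
        many [] _ = abs-≡ (sym e₀) (≤-reflexive (cong -_ e₁) , ≤-reflexive (sym e₁))
          where
          e₁ : ι 0 * (X * ν * (v * R k t)) ≡ 0ℚ
          e₁ = trans (cong (_* (X * ν * (v * R k t))) ι0≡0) (*-zeroˡ (X * ν * (v * R k t)))
          e₀ : sifted [] - ι 0 * (X * ν * V Z) ≡ 0ℚ
          e₀ = cong₂ _-_ (trans (∑-cong T (λ t _ → *-zeroˡ (h Z (n t)))) (∑-zero T)) (trans (cong (_* (X * ν * V Z)) ι0≡0) (*-zeroˡ (X * ν * V Z)))
        many (c ∷ cs) pr = abs-≡ e₀ (abs-weaken (≤-reflexive e₁) (abs-+ (one c (proj₁ (pr refl)) (proj₂ (pr refl))) (many cs (λ _ → pr refl))))
          where
          f : ∀ x m → x + m * x ≡ (1ℚ + m) * x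
          f = solve-∀ ℚring
          e₁ : X * ν * (v * R k t) + ι (length cs) * (X * ν * (v * R k t)) ≡ ι (suc (length cs)) * (X * ν * (v * R k t))
          e₁ = trans (f (X * ν * (v * R k t)) (ι (length cs))) (cong (_* (X * ν * (v * R k t))) (sym (ι-suc (length cs))))
          s₁ : ℚ
          s₁ = ∑ T (λ t → ⟨ cg? Z (n t) c ⟩ * h Z (n t))
          f' : ∀ s s' x m → s - x + (s' - m * x) ≡ s + s' - (1ℚ + m) * x
          f' = solve-∀ ℚring
          e₀ : s₁ - X * ν * V Z + (sifted cs - ι (length cs) * (X * ν * V Z)) ≡ sifted (c ∷ cs) - ι (suc (length cs)) * (X * ν * V Z)
          e₀ = trans (f' s₁ (sifted cs) (X * ν * V Z) (ι (length cs))) (cong₂ _-_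
            (trans (sym (∑-+ T (λ t → ⟨ cg? Z (n t) c ⟩ * h Z (n t)) (λ t → ∑L cs (λ c → ⟨ cg? Z (n t) c ⟩) * h Z (n t))))
              (∑-cong T (λ t _ → sym (*-distribʳ-+ (h Z (n t)) ⟨ cg? Z (n t) c ⟩ (∑L cs (λ c → ⟨ cg? Z (n t) c ⟩))))))
            (cong (_* (X * ν * V Z)) (sym (ι-suc (length cs)))))

        m : ℚ
        m = ι (length (C Z))
        eS : S (suc Z) a q T ≡ S Z a q T - sifted (C Z)
        eS = trans (∑-cong T (λ t _ → e (h Z (n t)) (β Z (n t)))) (∑-minus T (λ t → h Z (n t)) (λ t → β Z (n t) * h Z (n t)))
          where
          e : ∀ x y → x * (1ℚ - y) ≡ x - y * x
          e = solve-∀ ℚring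
        eMain : (S Z a q T - X * V Z) + - (sifted (C Z) - m * (X * ν * V Z)) ≡ S (z ℕ.+ suc k) a q T - X * V (z ℕ.+ suc k)
        eMain = trans (e (S Z a q T) (sifted (C Z)) X (V Z) m ν) (trans (cong (_- X * V (suc Z)) (sym eS)) (cong (λ w → S w a q T - X * V w) (sym (ℕP.+-suc z k))))
          where
          e : ∀ s s' X V m ν → s - X * V + - (s' - m * (X * ν * V)) ≡ s - s' - X * (V * (1ℚ - m * ν))
          e = solve-∀ ℚring
        eErr : X * (v * R k (suc t)) + m * (X * ν * (v * R k t)) ≡ X * (v * R (suc k) (suc t))
        eErr = trans (cong (λ w → X * (v * R k (suc t)) + m * (X * ν * (v * (ε * E k + ι 2 * w * F k)))) p≡)
            (e X v ε (E k) (F k) (ι 2) (hp 4) (hp 4 ^ t) (ι 16) m ν)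
          where
          p≡ : hp 4 ^ t ≡ hp 4 * hp 4 ^ t * ι 16
          p≡ = trans (sym (*-identityˡ (hp 4 ^ t))) (trans (cong (_* hp 4 ^ t) (sym hp4-16)) (e' (hp 4) (ι 16) (hp 4 ^ t)))
            where
            e' : ∀ a b c → a * b * c ≡ a * c * b
            e' = solve-∀ ℚring
          e : ∀ X v ε E F two μ p s m ν → X * (v * (ε * E + two * (μ * p) * F)) + m * (X * ν * (v * (ε * E + two * (μ * p * s) * F)))
            ≡ X * (v * (ε * (E * (1ℚ + m * ν)) + two * (μ * p) * (F * (1ℚ + s * (m * ν)))))
          e = solve-∀ ℚring
        Y≤X' : Y * ι U ^ suc t ≤ X
        Y≤X' = Y≤X
        goal : ∣ S (z ℕ.+ suc k) a q T - X * V (z ℕ.+ suc k) ∣≤ X * (v * R (suc k) (suc t))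
        goal = abs-≡ eMain (abs-weaken (≤-reflexive eErr) (abs-+ (claim k (suc t) (ℕP.<⇒≤ Z<U) a q T X cop' cl Y≤X)
          (abs-neg (many (C Z) (λ eq → C-prime eq , cop (subst (suc Z ℕ.≤_) (sym (ℕP.+-suc z k)) ℕP.≤-refl) eq)))))

    module BlockProducts (i : ℕ) where
      z : ℕ
      z = bl i
      gᵢ : ℕ → ℚ
      gᵢ k = g (z ℕ.+ k)
      G E F : ℚ
      G = ∏ (len i) (λ k → 1ℚ - gᵢ k)
      E = ∏ (len i) (λ k → 1ℚ + gᵢ k)
      F = ∏ (len i) (λ k → 1ℚ + ι 16 * gᵢ k)

      x : ℕ → ℚ
      x k = inv 12 * gᵢ k
      0≤x : ∀ k → 0ℚ ≤ x k
      0≤x k = 0≤* (0≤inv 12) (0≤g (z ℕ.+ k))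
      12x : ∀ k → ι 12 * x k ≡ gᵢ k
      12x k = trans (sym (*-assoc (ι 12) (inv 12) (gᵢ k))) (trans (cong (_* gᵢ k) (ι-inv′ {12} (s≤s z≤n))) (*-identityˡ _))
      24x≤1 : ∀ k → ι 24 * x k ≤ 1ℚ
      24x≤1 k = ≤-via (trans (cong (_* x k) (ι-* 2 12)) (trans (*-assoc (ι 2) (ι 12) (x k)) (cong (ι 2 *_) (12x k)))) (g≤½ (z ℕ.+ k)) refl
      x≤1 : ∀ k → x k ≤ 1ℚ
      x≤1 k = ≤-trans (≤-via (sym (*-identityˡ (x k))) (*-monoˡ (0≤x k) (1≤ι 23)) refl) (24x≤1 k)

      half : hp 1 ≤ 1ℚ - ∑ (len i) x
      half = nonneg⇒≤ (0≤* (0≤inv 12) (gap (block i))) (trans (e (hp 1) (inv 12) (ι 6) (∑ (len i) gᵢ)) (cong₂ _-_ two (sym (∑-*ˡ (len i) (inv 12) gᵢ))))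
        where
        e : ∀ a b c d → a + b * (c - d) ≡ a + b * c - b * d
        e = solve-∀ ℚring
        two : hp 1 + inv 12 * ι 6 ≡ 1ℚ
        two = trans (cong (hp 1 +_) (trans (cong (_* ι 6) (inv-* 2 6 (s≤s z≤n) (s≤s z≤n))) (trans (*-assoc (inv 2) (inv 6) (ι 6)) (trans (cong (inv 2 *_) (trans (*-comm (inv 6) (ι 6)) (ι-inv′ {6} (s≤s z≤n)))) (*-identityʳ (inv 2))))))
          (trans (e' (inv 2)) (trans (cong (_* inv 2) (sym ι2≡)) (ι-inv′ {2} (s≤s z≤n))))
          where
          e' : ∀ a → a + a ≡ (1ℚ + 1ℚ) * a
          e' = solve-∀ ℚring

      -- The sum of g may be as large as 6, too much for Weierstrass' inequality. For g / 12 it is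
      -- at most 1 / 2, the product is at least 1 / 2, and the 24th power returns to 1 - g.
      G≥ : hp 24 ≤ G
      G≥ = ≤-via (sym (hp-^ 1 24)) (≤-trans (^-mono 24 (0≤hp 1) (≤-trans half (∏-weierstrass (len i) x (λ k _ → 0≤x k) (λ k _ → x≤1 k))))
          (≤-via (sym (∏-^ (len i) (λ k → 1ℚ - x k) 24)) (∏-mono (len i) (λ k _ → 0≤^ 24 (gap (x≤1 k))) (λ k _ → ≤-via refl (24-power (0≤x k) (24x≤1 k)) (cong (λ w → 1ℚ - w) (12x k)))) refl)) refl

      EG≤1 : E * G ≤ 1ℚ
      EG≤1 = ≤-via (sym (∏-* (len i) (λ k → 1ℚ + gᵢ k) (λ k → 1ℚ - gᵢ k))) (∏-≤1 (len i) (λ k _ → 0≤* (0≤+ 0≤1 (0≤g _)) (gap (g≤1 _))) (λ k _ → ≤-via (e (gᵢ k)) (1-≤1 (0≤sq (gᵢ k))) refl)) refl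
        where
        e : ∀ x → (1ℚ + x) * (1ℚ - x) ≡ 1ℚ - x * x
        e = solve-∀ ℚring

      0≤E : 0ℚ ≤ E
      0≤E = ∏-nonneg (len i) (λ k _ → 0≤+ 0≤1 (0≤g _))

      E≤ : E ≤ pw 24
      E≤ = ≤-via (trans (sym (*-identityˡ E)) (trans (cong (_* E) (sym (pw-hp 24))) (*-assoc (pw 24) (hp 24) E)))
        (*-monoʳ (0≤pw 24) (≤-trans (*-monoˡ 0≤E G≥) (≤-via (*-comm G E) EG≤1 refl))) (*-identityʳ (pw 24))

      -- Bernoulli bounds 1 + 16 g by (1 + g) ^ 16, whence the exponent 24 · 16.
      F≤ : F ≤ pw 384
      F≤ = ≤-trans (∏-mono (len i) (λ k _ → 0≤+ 0≤1 (0≤* (0≤ι 16) (0≤g _))) (λ k _ → bernoulli 16 (0≤g _)))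
        (≤-via (∏-^ (len i) (λ k → 1ℚ + gᵢ k) 16) (^-mono 16 0≤E E≤) (pw-^ 24 16))

    -- The shape 2 e + 306 of the exponent is the one stable under passing to the next block, which
    -- costs e + 103 prime factors and a loss of 2^50 in accuracy.
    level : ℕ → ℕ → ℕ
    level i e = 2 ℕ.^ i ℕ.* (e ℕ.+ e ℕ.+ 306)

    private
      pw-hp-cancel : ∀ a b c → b ℕ.+ a ≡ c → pw a * hp c ≡ hp b
      pw-hp-cancel a b c refl = trans (cong (λ c → pw a * hp c) (ℕP.+-comm b a)) (pw-hp-+ a b)

      -- With t = e + 103 splittings the truncation costs 2 · 16 ^ -t · 2 ^ 384 = 2 ^ -(4 e + 27),
      -- and the inherited error is at most 2 ^ -(e + 50) · 2 ^ 24. Together they are at most 2 ^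
      -- -(e + 25), and the density of the new block is smaller by at most 2 ^ -24.
      next : ∀ i e t → t ≡ e ℕ.+ 103 → Near (bl i) (pw (level i (e ℕ.+ 50))) (V (bl i) * hp (e ℕ.+ 50)) → Near (bl (suc i)) (pw (level (suc i) e)) (V (bl (suc i)) * hp e)
      next i e t t≡ near a q T X cop cl Y≤X = abs-weaken bound (abs-≡ (cong (λ w → S w a q T - X * V w) (bl+len i))
          (claim (len i) t (ℕP.≤-reflexive (bl+len i)) a q T X (subst (Cop q) (sym (bl+len i)) cop) cl (≤-via Y≡ Y≤X refl)))
        where
        open BlockProducts i using (G; E≤; F≤; G≥; 0≤E)
        ε : ℚ
        ε = hp (e ℕ.+ 50)
        open Block (bl i) (bl (suc i)) (pw (level i (e ℕ.+ 50))) ε (0≤pw (level i (e ℕ.+ 50))) (0≤hp (e ℕ.+ 50)) (hp≤1 (e ℕ.+ 50)) (1≤bl (suc i)) near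
        Y≡ : pw (level i (e ℕ.+ 50)) * ι (bl (suc i)) ^ t ≡ pw (level (suc i) e)
        Y≡ = trans (cong (pw (level i (e ℕ.+ 50)) *_) (pw-^ (2 ℕ.^ suc i) t)) (trans (sym (pw-+ (level i (e ℕ.+ 50)) (t ℕ.* 2 ℕ.^ suc i))) (cong pw (trans (cong (λ t → level i (e ℕ.+ 50) ℕ.+ t ℕ.* 2 ℕ.^ suc i) t≡) (e' (2 ℕ.^ i) e))))
          where
          e' : ∀ x e → x ℕ.* ((e ℕ.+ 50) ℕ.+ (e ℕ.+ 50) ℕ.+ 306) ℕ.+ (e ℕ.+ 103) ℕ.* (2 ℕ.* x) ≡ 2 ℕ.* x ℕ.* (e ℕ.+ e ℕ.+ 306)
          e' = ℕSolver.solve-∀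
        0≤X : 0ℚ ≤ X
        0≤X = ≤-trans (0≤pw (level (suc i) e)) Y≤X
        R≤ : R (len i) t ≤ hp (e ℕ.+ 25)
        R≤ = ≤-trans (+-mono-≤ (*-monoʳ (0≤hp (e ℕ.+ 50)) E≤) (*-monoʳ (0≤* (0≤ι 2) (0≤^ t (0≤hp 4))) F≤))
            (≤-trans (+-mono-≤ first second) (≤-reflexive (trans (e₂ (hp (e ℕ.+ 26))) (trans (cong (_* hp (e ℕ.+ 26)) (sym ι2≡)) (pw-hp-cancel 1 (e ℕ.+ 25) (e ℕ.+ 26) (e₅ e))))))
          where
          e₂ : ∀ x → x + x ≡ (1ℚ + 1ℚ) * x
          e₂ = solve-∀ ℚring
          e₅ : ∀ e → (e ℕ.+ 25) ℕ.+ 1 ≡ e ℕ.+ 26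
          e₅ = ℕSolver.solve-∀
          e₆ : ∀ e → (e ℕ.+ 26) ℕ.+ 24 ≡ e ℕ.+ 50
          e₆ = ℕSolver.solve-∀
          first : hp (e ℕ.+ 50) * pw 24 ≤ hp (e ℕ.+ 26)
          first = ≤-reflexive (trans (*-comm (hp (e ℕ.+ 50)) (pw 24)) (pw-hp-cancel 24 (e ℕ.+ 26) (e ℕ.+ 50) (e₆ e)))
          second : ι 2 * hp 4 ^ t * pw 384 ≤ hp (e ℕ.+ 26)
          second = ≤-via (trans (e₃ (ι 2) (hp 4 ^ t) (pw 384)) (trans (cong (_* hp 4 ^ t) (sym (pw-+ 1 384))) (trans (cong (pw 385 *_) (hp-^ 4 t)) (pw-hp-cancel 385 (e ℕ.+ (3 ℕ.* e ℕ.+ 27)) (t ℕ.* 4) t4))))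
            (hp-anti (ℕP.+-monoʳ-≤ e {26} {3 ℕ.* e ℕ.+ 27} (ℕP.≤-trans (ℕP.n≤1+n 26) (ℕP.m≤n+m 27 (3 ℕ.* e))))) refl
            where
            e₃ : ∀ a b c → a * b * c ≡ a * c * b
            e₃ = solve-∀ ℚring
            e₄ : ∀ e → (e ℕ.+ (3 ℕ.* e ℕ.+ 27)) ℕ.+ 385 ≡ (e ℕ.+ 103) ℕ.* 4
            e₄ = ℕSolver.solve-∀
            t4 : (e ℕ.+ (3 ℕ.* e ℕ.+ 27)) ℕ.+ 385 ≡ t ℕ.* 4
            t4 = subst (λ u → (e ℕ.+ (3 ℕ.* e ℕ.+ 27)) ℕ.+ 385 ≡ u ℕ.* 4) (sym t≡) (e₄ e)
        Ghp : hp (e ℕ.+ 25) ≤ G * hp e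
        Ghp = ≤-trans (hp-anti (ℕP.+-monoʳ-≤ e (ℕP.n≤1+n 24))) (≤-via (trans (hp-+ e 24) (*-comm (hp e) (hp 24))) (*-monoˡ (0≤hp e) G≥) refl)
        bound : X * (V (bl i) * R (len i) t) ≤ X * (V (bl (suc i)) * hp e)
        bound = *-monoʳ 0≤X (≤-via refl (*-monoʳ (0≤V (bl i)) (≤-trans R≤ Ghp)) (trans (sym (*-assoc (V (bl i)) G (hp e))) (cong (_* hp e) (sym (trans (cong V (sym (bl+len i))) (∏-split (bl i) (len i) (λ l → 1ℚ - g l)))))))

      -- There is no prime below `bl 0` = 2, so nothing is sifted and only the rounding error of the
      -- count remains.
      base : ∀ Z e → Z ≡ bl 0 → Near Z (pw (level 0 e)) (V Z * hp e)
      base Z e Z≡ a q T X cop cl Y≤X = abs-weaken 2≤ (abs-≡ eq cl)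
        where
        no-small : ∀ {l} → l ℕ.< Z → C l ≡ []
        no-small {l} p = f (C l) refl
          where
          f : ∀ cs → C l ≡ cs → cs ≡ []
          f [] _ = refl
          f (c ∷ cs) e = contradiction (prime⇒2≤ (C-prime e)) (ℕP.<⇒≱ (subst (l ℕ.<_) Z≡ p))
        V≡1 : V Z ≡ 1ℚ
        V≡1 = trans (∏-cong Z {λ l → 1ℚ - g l} {λ _ → 1ℚ} (λ l p → trans (cong (λ cs → 1ℚ - ι (length cs) * inv l) (no-small p)) (trans (cong (λ w → 1ℚ - w * inv l) ι0≡0) (e' (inv l))))) (∏-one Z)
          where
          e' : ∀ x → 1ℚ - 0ℚ * x ≡ 1ℚ
          e' = solve-∀ ℚring
        h≡1 : ∀ n → h Z n ≡ 1ℚ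
        h≡1 n = trans (∏-cong Z {λ l → 1ℚ - β l n} {λ _ → 1ℚ} (λ l p → cong (λ cs → 1ℚ - ∑L cs (λ c → ⟨ cg? l n c ⟩)) (no-small p))) (∏-one Z)
        eq : ι T - X ≡ S Z a q T - X * V Z
        eq = cong₂ _-_ (sym (trans (∑-cong T (λ t _ → h≡1 _)) (trans (∑-const T 1ℚ) (*-identityʳ (ι T))))) (sym (trans (cong (X *_) V≡1) (*-identityʳ X)))
        p : e ℕ.+ 1 ℕ.≤ level 0 e
        p = ℕP.≤-trans (ℕP.+-mono-≤ (ℕP.m≤m+n e e) (s≤s {0} {305} z≤n)) (ℕP.≤-reflexive (sym (ℕP.+-identityʳ (e ℕ.+ e ℕ.+ 306))))
        2≤ : ι 2 ≤ X * (V Z * hp e)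
        2≤ = ≤-trans (≤-via (sym (trans (*-comm (pw (e ℕ.+ 1)) (hp e)) (hp-pw-+ e 1))) (*-monoˡ (0≤hp e) (≤-trans (pw-mono p) Y≤X)) refl) (≤-reflexive (cong (X *_) (sym (trans (cong (_* hp e) V≡1) (*-identityˡ (hp e))))))

    fundamental-lemma : ∀ i e → Near (bl i) (pw (level i e)) (V (bl i) * hp e)
    fundamental-lemma zero e = base (bl 0) e refl
    fundamental-lemma (suc i) e = next i e (e ℕ.+ 103) refl (fundamental-lemma i (e ℕ.+ 50))

-- Chebyshev's bounds for the number of primes, from binomial coefficients.

module ChebyshevBounds where

  open Congruences using (prime⇒1≤; prime⇒2≤; ∤⇒coprime; prime∣prime; coprime-*)
  open import Data.Nat
  open import Data.Nat.Properties
  open import Data.Nat.Divisibility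
  open import Data.Nat.Coprimality using (Coprime; coprime-divisor; 1-coprimeTo)
  open import Data.Nat.Primality using (Prime; prime?; euclidsLemma; ¬prime[1])
  open import Data.Nat.Primality.Factorisation using (factorise)
  open import Data.Nat.Induction using (<-rec)
  open import Data.Nat.Tactic.RingSolver using (solve-∀)
  open import Data.List using ([]; _∷_)
  open import Data.List.Relation.Unary.All using ([]; _∷_)
  open import Data.Product using (Σ; _×_; _,_)
  open import Data.Sum using (inj₁; inj₂)
  open import Relation.Nullary using (Dec; yes; no; ¬_; contradiction)
  open import Relation.Binary.PropositionalEquality using (_≡_; refl; sym; trans; cong; cong₂; subst)

  abstract
    isPrime? : ∀ n → Dec (Prime n)
    isPrime? = prime?

  -- Binomial coefficients by Pascal's rule, zero for k > n.
  B : ℕ → ℕ → ℕ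
  B _ zero = 1
  B zero (suc k) = 0
  B (suc n) (suc k) = B n k + B n (suc k)

  B≤2^ : ∀ n k → B n k ≤ 2 ^ n
  B≤2^ n zero = m^n>0 2 n
  B≤2^ zero (suc k) = z≤n
  B≤2^ (suc n) (suc k) = ≤-trans (+-mono-≤ (B≤2^ n k) (B≤2^ n (suc k))) (≤-reflexive (cong (2 ^ n +_) (sym (+-identityʳ (2 ^ n)))))

  B-beyond : ∀ n k → B n (suc (n + k)) ≡ 0
  B-beyond zero k = refl
  B-beyond (suc n) k = cong₂ _+_ (B-beyond n k) (trans (cong (λ j → B n (suc j)) (sym (+-suc n k))) (B-beyond n (suc k)))

  B-diag : ∀ n → B n n ≡ 1
  B-diag zero = refl
  B-diag (suc n) = cong₂ _+_ (B-diag n) (trans (cong (λ j → B n (suc j)) (sym (+-identityʳ n))) (B-beyond n 0))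

  -- The absorption identity (k + 1) C(n, k + 1) = (n - k) C(n, k), with n = m + k in order to avoid
  -- subtraction.
  B-absorb : ∀ m k → suc k * B (m + k) (suc k) ≡ m * B (m + k) k
  B-absorb zero k = trans (cong (suc k *_) (trans (cong (λ j → B k (suc j)) (sym (+-identityʳ k))) (B-beyond k 0))) (*-zeroʳ (suc k))
  B-absorb (suc m) zero = cong suc (trans (+-identityʳ _) (trans (f (m + 0)) (trans (+-identityʳ m) (sym (*-identityʳ m)))))
    where
    f : ∀ n → B n 1 ≡ n
    f zero = refl
    f (suc n) = cong suc (f n)
  B-absorb (suc m) (suc k) = trans (e₁ (suc k) (B (m + suc k) (suc k)) (B (m + suc k) (suc (suc k)))) (trans (cong₂ (λ x y → B (m + suc k) (suc k) + x + y) ih₁ (B-absorb m (suc k)))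
    (trans (e₂ m (B (m + suc k) k) (B (m + suc k) (suc k))) refl))
    where
    ih₁ : suc k * B (m + suc k) (suc k) ≡ suc m * B (m + suc k) k
    ih₁ = subst (λ j → suc k * B j (suc k) ≡ suc m * B j k) (sym (+-suc m k)) (B-absorb (suc m) k)
    e₁ : ∀ k x y → (1 + k) * (x + y) ≡ x + k * x + (1 + k) * y
    e₁ = solve-∀
    e₂ : ∀ m x y → y + (1 + m) * x + m * y ≡ (1 + m) * (x + y)
    e₂ = solve-∀

  B-factorial : ∀ m n → B (m + n) m * (m ! * n !) ≡ (m + n) !
  B-factorial zero n = trans (+-identityʳ _) (+-identityʳ (n !))
  B-factorial (suc m) zero = trans (cong₂ _*_ (trans (cong (λ j → B j (suc m)) (+-identityʳ (suc m))) (B-diag (suc m))) (*-identityʳ (suc m !))) (trans (+-identityʳ _) (cong _! (sym (+-identityʳ (suc m)))))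
  B-factorial (suc m) (suc n) = trans (e (B (m + suc n) m) (B (m + suc n) (suc m)) m n (m !) (n !)) (trans (cong₂ (λ x y → suc m * x + suc n * y) (B-factorial m (suc n)) ih)
    (trans (cong (λ j → suc m * (m + suc n) ! + suc n * j !) (sym (+-suc m n))) (e' m n ((m + suc n) !))))
    where
    ih : B (m + suc n) (suc m) * (suc m ! * n !) ≡ (suc m + n) !
    ih = subst (λ j → B j (suc m) * (suc m ! * n !) ≡ (suc m + n) !) (sym (+-suc m n)) (B-factorial (suc m) n)
    e : ∀ x y m n a b → (x + y) * ((1 + m) * a * ((1 + n) * b)) ≡ (1 + m) * (x * (a * ((1 + n) * b))) + (1 + n) * (y * ((1 + m) * a * b))
    e = solve-∀
    e' : ∀ m n x → (1 + m) * x + (1 + n) * x ≡ (1 + (m + (1 + n))) * x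
    e' = solve-∀

  -- By Pascal's rule C(2m + 2, m + 1) is the sum of two coefficients from row 2m + 1, each at least
  -- C(2m, m).
  2^≤B : ∀ m → 2 ^ m ≤ B (m + m) m
  2^≤B zero = ≤-refl
  2^≤B (suc m) = ≤-trans (*-monoʳ-≤ 2 (2^≤B m)) (≤-trans (≤-trans (*-monoʳ-≤ 2 le) (≤-reflexive (cong (B (m + suc m) m +_) (+-identityʳ _)))) (+-monoʳ-≤ (B (m + suc m) m) sym'))
    where
    le : B (m + m) m ≤ B (m + suc m) m
    le = subst (λ j → B (m + m) m ≤ B j m) (sym (+-suc m m)) (mono (m + m) m)
      where
      mono : ∀ n k → B n k ≤ B (suc n) k
      mono n zero = ≤-refl
      mono n (suc k) = m≤n+m _ _
    -- C(2m+1, m) ≤ C(2m+1, m+1), both sides being equal after multiplication by m + 1.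
    sym' : B (m + suc m) m ≤ B (m + suc m) (suc m)
    sym' = *-cancelˡ-≤ (suc m) (≤-reflexive (subst (λ j → suc m * B j m ≡ suc m * B j (suc m)) (sym (+-suc m m)) (sym (B-absorb (suc m) m))))

  coprime-∣ : ∀ {a b m} → Coprime a b → a ∣ m → b ∣ m → a * b ∣ m
  coprime-∣ {a} {b} {m} c a∣m (divides q refl) with coprime-divisor {a} {b} {q} c (subst (a ∣_) (*-comm q b) a∣m)
  ... | divides r refl = divides r (*-assoc r a b)

  ∤! : ∀ {p} n → Prime p → n < p → ¬ p ∣ n !
  ∤! zero pr n<p d = contradiction (∣1⇒≡1 d) λ { refl → ¬prime[1] pr }
  ∤! (suc n) pr n<p d with euclidsLemma (suc n) (n !) pr d
  ... | inj₁ d' = <⇒≱ n<p (∣⇒≤ d')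
  ... | inj₂ d' = ∤! n pr (<-trans (n<1+n n) n<p) d'

  countPrimes productPrimes : ℕ → ℕ → ℕ
  countPrimes a zero = 0
  countPrimes a (suc k) with isPrime? (a + k)
  ... | yes _ = suc (countPrimes a k)
  ... | no _ = countPrimes a k
  productPrimes a zero = 1
  productPrimes a (suc k) with isPrime? (a + k)
  ... | yes _ = (a + k) * productPrimes a k
  ... | no _ = productPrimes a k

  ∤productPrimes : ∀ a k {p} → Prime p → a + k ≤ p → ¬ p ∣ productPrimes a k
  ∤productPrimes a zero pr le d = contradiction (∣1⇒≡1 d) λ { refl → ¬prime[1] pr }
  ∤productPrimes a (suc k) {p} pr le d with isPrime? (a + k)
  ... | no _ = ∤productPrimes a k pr (≤-trans (+-monoʳ-≤ a (n≤1+n k)) le) d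
  ... | yes pa with euclidsLemma (a + k) (productPrimes a k) pr d
  ...   | inj₁ d' = <⇒≢ (≤-trans (≤-reflexive (sym (+-suc a k))) le) (sym (prime∣prime pr pa d'))
  ...   | inj₂ d' = ∤productPrimes a k pr (≤-trans (+-monoʳ-≤ a (n≤1+n k)) le) d'

  -- A prime in (n, 2n] divides (2n)! but not n!, hence divides C(2n, n). Distinct primes are
  -- coprime, so their product divides it as well.
  productPrimes∣B : ∀ n k → k ≤ n → productPrimes (suc n) k ∣ B (n + n) n
  productPrimes∣B n zero _ = 1∣ _
  productPrimes∣B n (suc k) k<n with isPrime? (suc n + k)
  ... | no _ = productPrimes∣B n k (<⇒≤ k<n)
  ... | yes p = coprime-∣ (∤⇒coprime p (∤productPrimes (suc n) k p ≤-refl)) p∣B (productPrimes∣B n k (<⇒≤ k<n))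
    where
    n<p : n < suc n + k
    n<p = s≤s (m≤m+n n k)
    p∣! : suc n + k ∣ B (n + n) n * (n ! * n !)
    p∣! = subst (suc n + k ∣_) (sym (B-factorial n n)) (∣-trans (m∣m! _ {{>-nonZero (s≤s z≤n)}}) (m≤n⇒m!∣n! (subst (_≤ n + n) (+-suc n k) (+-monoʳ-≤ n k<n))))
      where
      m∣m! : ∀ m .{{_ : NonZero m}} → m ∣ m !
      m∣m! (suc m) = m∣m*n (m !)
    p∣B : suc n + k ∣ B (n + n) n
    p∣B with euclidsLemma (B (n + n) n) (n ! * n !) p p∣!
    ... | inj₁ d = d
    ... | inj₂ d with euclidsLemma (n !) (n !) p d
    ...   | inj₁ d' = contradiction d' (∤! n p n<p)
    ...   | inj₂ d' = contradiction d' (∤! n p n<p)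

  B-pos : ∀ m n → 1 ≤ B (m + n) m
  B-pos m n = n≢0⇒n>0 λ e → contradiction (trans (sym (B-factorial m n)) (cong (_* (m ! * n !)) e)) (m<n⇒n≢0 (n!>0 (m + n)))
    where
    n!>0 : ∀ n → 0 < n !
    n!>0 n = >-nonZero⁻¹ _ {{n !≢0}}

  productPrimes≥ : ∀ n k → n ^ countPrimes (suc n) k ≤ productPrimes (suc n) k
  productPrimes≥ n zero = ≤-refl
  productPrimes≥ n (suc k) with isPrime? (suc n + k)
  ... | no _ = productPrimes≥ n k
  ... | yes _ = *-mono-≤ (≤-trans (m≤m+n n k) (n≤1+n (n + k))) (productPrimes≥ n k)

  -- With n = 2 ^ j the c primes in (n, 2n] satisfy n ^ c ≤ C(2n, n) ≤ 2 ^ (2n); the exponents of 2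
  -- are compared.
  primes-in-shell : ∀ j → j * countPrimes (suc (2 ^ j)) (2 ^ j) ≤ 2 ^ suc j
  primes-in-shell j = ^-cancelʳ-≤ (≤-trans (≤-reflexive (sym (^-*-assoc 2 j c))) (≤-trans (productPrimes≥ (2 ^ j) (2 ^ j))
      (≤-trans (∣⇒≤ {{>-nonZero (B-pos (2 ^ j) (2 ^ j))}} (productPrimes∣B (2 ^ j) (2 ^ j) ≤-refl)) (≤-trans (B≤2^ (2 ^ j + 2 ^ j) (2 ^ j)) (≤-reflexive (cong (2 ^_) (cong (2 ^ j +_) (sym (+-identityʳ (2 ^ j))))))))))
    where
    c : ℕ
    c = countPrimes (suc (2 ^ j)) (2 ^ j)
    ^-cancelʳ-≤ : ∀ {a b} → 2 ^ a ≤ 2 ^ b → a ≤ b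
    ^-cancelʳ-≤ {a} {b} p = ≮⇒≥ λ q → <⇒≱ (^-monoʳ-< 2 ≤-refl q) p

  -- Leibniz' harmonic triangle, 1 / (k C(n, k)) + 1 / ((k + 1) C(n, k + 1)) = 1 / (k C(n - 1, k)), multiplied by D.
  leibniz : ∀ D n → (∀ i → 1 ≤ i → i ≤ n → i ∣ D) → ∀ k m → suc k + m ≤ n → suc k * B (suc k + m) (suc k) ∣ D
  leibniz D n h zero m le = subst (_∣ D) (sym e) (h (suc m) (s≤s z≤n) le)
    where
    f : ∀ n → B n 1 ≡ n
    f zero = refl
    f (suc n) = cong suc (f n)
    e : 1 * B (suc m) 1 ≡ suc m
    e = trans (*-identityˡ _) (f (suc m))
  leibniz D n h (suc k) m le = result (leibniz D n h k m (≤-trans (n≤1+n _) le)) (leibniz D n h k (suc m) (subst (_≤ n) (cong suc (sym (+-suc k m))) le))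
    where
    K b b₁ : ℕ
    K = suc k
    b = B (K + m) K
    b₁ = B (suc (K + m)) K
    top : suc m * b₁ ≡ (K + suc m) * b
    top = trans (sym (subst (λ j → suc K * B j (suc K) ≡ suc m * B j K) (cong suc (+-comm m K)) (B-absorb (suc m) K)))
      (trans (*-distribˡ-+ (suc K) b (B (K + m) (suc K)))
        (trans (cong (suc K * b +_) (subst (λ j → suc K * B j (suc K) ≡ m * B j K) (+-comm m K) (B-absorb m K))) (e K m b)))
      where
      e : ∀ K m b → (1 + K) * b + m * b ≡ (K + (1 + m)) * b
      e = solve-∀
    goal≡ : suc K * B (suc K + m) (suc K) ≡ suc m * b₁
    goal≡ = subst (λ j → suc K * B j (suc K) ≡ suc m * B j K) (cong suc (+-comm m K)) (B-absorb (suc m) K)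
    result : K * b ∣ D → K * B (K + suc m) K ∣ D → suc K * B (suc K + m) (suc K) ∣ D
    -- From D = x₁ K b = x₂ K b₁ and (m + 1) b₁ = (K + m + 1) b one gets K D = (x₁ - x₂) K (m + 1)
    -- b₁, so x₁ - x₂ is the quotient.
    result (divides x₁ e₁) (divides x₂ e₂') = subst (_∣ D) (sym goal≡) (divides (x₁ ∸ x₂) (*-cancelˡ-≡ D ((x₁ ∸ x₂) * (suc m * b₁)) K
        (trans (sym (m+n∸n≡m (K * D) (suc m * D))) (trans (cong₂ _∸_ total (trans (cong (suc m *_) e₂) (r₂ (suc m) x₂ K b₁))) (trans (sym (*-distribʳ-∸ (K * (suc m * b₁)) x₁ x₂)) (r₃ (x₁ ∸ x₂) K (suc m * b₁)))))))
      where
      e₂ : D ≡ x₂ * (K * b₁)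
      e₂ = trans e₂' (cong (λ j → x₂ * (K * B j K)) (+-suc K m))
      total : K * D + suc m * D ≡ x₁ * (K * (suc m * b₁))
      total = trans (sym (*-distribʳ-+ D K (suc m))) (trans (cong ((K + suc m) *_) e₁) (trans (r₁ (K + suc m) x₁ K b) (cong (λ w → x₁ * (K * w)) (sym top))))
        where
        r₁ : ∀ s x K b → s * (x * (K * b)) ≡ x * (K * (s * b))
        r₁ = solve-∀
      r₂ : ∀ s x K b → s * (x * (K * b)) ≡ x * (K * (s * b))
      r₂ = solve-∀
      r₃ : ∀ x K b → x * (K * b) ≡ K * (x * b)
      r₃ = solve-∀

  -- Searches downwards for the largest a ≤ f with p ^ a ≤ N. The choice f = N made later is large
  -- enough because a < 2 ^ a.
  exponent : ℕ → ℕ → ℕ → ℕ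
  exponent N p zero = 0
  exponent N p (suc f) with p ^ suc f ≤? N
  ... | yes _ = suc f
  ... | no _ = exponent N p f

  exponent-≤ : ∀ N p f → 1 ≤ N → p ^ exponent N p f ≤ N
  exponent-≤ N p zero 1≤N = 1≤N
  exponent-≤ N p (suc f) 1≤N with p ^ suc f ≤? N
  ... | yes q = q
  ... | no _ = exponent-≤ N p f 1≤N

  exponent-max : ∀ N p f a → a ≤ f → p ^ a ≤ N → a ≤ exponent N p f
  exponent-max N p zero a a≤f _ = a≤f
  exponent-max N p (suc f) a a≤f q with p ^ suc f ≤? N
  ... | yes _ = a≤f
  ... | no ¬q with m≤n⇒m<n∨m≡n a≤f
  ...   | inj₁ (s≤s a≤f') = exponent-max N p f a a≤f' q
  ...   | inj₂ refl = contradiction q ¬q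

  n<2^n : ∀ n → n < 2 ^ n
  n<2^n zero = s≤s z≤n
  n<2^n (suc n) = ≤-trans (+-mono-≤ (m^n>0 2 n) (n<2^n n)) (≤-reflexive (cong (2 ^ n +_) (sym (+-identityʳ (2 ^ n)))))

  -- The least common multiple of 1 , … , N, restricted to the primes below k.
  lcmUpTo : ℕ → ℕ → ℕ
  lcmUpTo N zero = 1
  lcmUpTo N (suc k) with isPrime? k
  ... | yes _ = k ^ exponent N k N * lcmUpTo N k
  ... | no _ = lcmUpTo N k

  lcmUpTo-≤ : ∀ N k → 1 ≤ N → lcmUpTo N k ≤ N ^ countPrimes 0 k
  lcmUpTo-≤ N zero _ = ≤-refl
  lcmUpTo-≤ N (suc k) 1≤N with isPrime? k
  ... | yes _ = *-mono-≤ (exponent-≤ N k N 1≤N) (lcmUpTo-≤ N k 1≤N)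
  ... | no _ = lcmUpTo-≤ N k 1≤N

  prime-power∣lcm : ∀ N k {p} a → Prime p → p < k → p ^ a ≤ N → p ^ a ∣ lcmUpTo N k
  prime-power∣lcm N (suc k) {p} a pp p<k le with isPrime? k | p ≟ k
  ... | yes _ | yes refl = ∣-trans (^-∣ (exponent-max N p N a (<⇒≤ (<-≤-trans (n<2^n a) (≤-trans (^-monoˡ-≤ a (prime⇒2≤ pp)) le))) le)) (m∣m*n (lcmUpTo N k))
    where
    ^-∣ : ∀ {a b} → a ≤ b → p ^ a ∣ p ^ b
    ^-∣ {a} {b} a≤b = divides (p ^ (b ∸ a)) (trans (cong (p ^_) (sym (m∸n+n≡m a≤b))) (^-distribˡ-+-* p (b ∸ a) a))
  ... | yes _ | no p≢k = ∣n⇒∣m*n (k ^ exponent N k N) (prime-power∣lcm N k a pp (≤∧≢⇒< (s≤s⁻¹ p<k) p≢k) le)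
  ... | no ¬p | yes refl = contradiction pp ¬p
  ... | no _ | no p≢k = prime-power∣lcm N k a pp (≤∧≢⇒< (s≤s⁻¹ p<k) p≢k) le

  prime-factor : ∀ n → 2 ≤ n → Σ ℕ λ p → Prime p × p ∣ n
  prime-factor n@(suc _) 2≤n with factorise n
  ... | record { factors = [] ; isFactorisation = e } = contradiction 2≤n (<⇒≱ (s≤s (≤-reflexive e)))
  ... | record { factors = p ∷ ps ; isFactorisation = e ; factorsPrime = pp ∷ _ } = p , pp , subst (p ∣_) (sym e) (m∣m*n _)

  split-off : ∀ {p} → Prime p → ∀ n → 1 ≤ n → Σ ℕ λ a → Σ ℕ λ m → n ≡ p ^ a * m × ¬ p ∣ m × 1 ≤ m
  split-off {p} pp = <-rec _ go
    where
    go : ∀ n → (∀ {m} → m < n → 1 ≤ m → Σ ℕ λ a → Σ ℕ λ k → m ≡ p ^ a * k × ¬ p ∣ k × 1 ≤ k) → 1 ≤ n → Σ ℕ λ a → Σ ℕ λ m → n ≡ p ^ a * m × ¬ p ∣ m × 1 ≤ m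
    go n rec 1≤n with p ∣? n
    ... | no p∤n = 0 , n , sym (+-identityʳ n) , p∤n , 1≤n
    ... | yes (divides q refl) with rec {q} q<n q≥1
      where
      q≥1 : 1 ≤ q
      q≥1 = n≢0⇒n>0 λ { refl → contradiction 1≤n (λ ()) }
      q<n : q < q * p
      q<n = subst (_< q * p) (*-identityʳ q) (*-monoʳ-< q {{>-nonZero q≥1}} (prime⇒2≤ pp))
    ...   | a , m , e , p∤m , 1≤m = suc a , m , trans (cong (_* p) e) (r (p ^ a) m p) , p∤m , 1≤m
      where
      r : ∀ x m p → x * m * p ≡ p * x * m
      r = solve-∀

  prime-powers-decide : ∀ D k → 1 ≤ k → (∀ {p} a → Prime p → p ^ a ∣ k → p ^ a ∣ D) → k ∣ D
  prime-powers-decide D = <-rec _ go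
    where
    go : ∀ k → (∀ {m} → m < k → 1 ≤ m → (∀ {p} a → Prime p → p ^ a ∣ m → p ^ a ∣ D) → m ∣ D) → 1 ≤ k → (∀ {p} a → Prime p → p ^ a ∣ k → p ^ a ∣ D) → k ∣ D
    go (suc zero) rec _ h = 1∣ D
    go k@(suc (suc _)) rec _ h with prime-factor k (s≤s (s≤s z≤n))
    ... | p , pp , p∣k with split-off pp k (s≤s z≤n)
    ...   | zero , m , e , p∤m , _ = contradiction (subst (p ∣_) (trans e (+-identityʳ m)) p∣k) p∤m
    ...   | suc a , m , e , p∤m , 1≤m = subst (_∣ D) (sym e) (coprime-∣ (pow-coprime (suc a)) (h (suc a) pp (subst (p ^ suc a ∣_) (sym e) (m∣m*n m)))
              (rec m<k 1≤m (λ b pq d → h b pq (∣-trans d (subst (m ∣_) (sym e) (n∣m*n (p ^ suc a)))))))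
      where
      pow-coprime : ∀ a → Coprime (p ^ a) m
      pow-coprime zero = 1-coprimeTo m
      pow-coprime (suc a) = coprime-* {p} {p ^ a} (∤⇒coprime pp p∤m) (pow-coprime a)
      m<k : m < k
      m<k = subst (m <_) (sym e) (subst (_< p ^ suc a * m) (*-identityˡ m) (*-monoˡ-< m {{>-nonZero 1≤m}} (<-≤-trans (prime⇒2≤ pp) (subst (_≤ p * p ^ a) (*-identityʳ p) (*-monoʳ-≤ p (m^n>0 p {{>-nonZero (prime⇒1≤ pp)}} a))))))

  -- m C(2m, m) divides the least common multiple of 1 , … , 2m, which is at most (2m) ^ π(2m).
  primes-below : ∀ m K → 1 ≤ m → m + m < 2 ^ K → m ≤ K * countPrimes 0 (suc (m + m))
  primes-below m@(suc m') K 1≤m lt = ^-cancelʳ-≤ (≤-trans (2^≤B m) (≤-trans (≤-trans (m≤n*m _ m) (∣⇒≤ {{>-nonZero D≥1}} (leibniz D N div m' m ≤-refl)))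
      (≤-trans (lcmUpTo-≤ N (suc N) (s≤s z≤n)) (≤-trans (^-monoˡ-≤ c (<⇒≤ lt)) (≤-reflexive (^-*-assoc 2 K c))))))
    where
    N D c : ℕ
    N = m + m
    D = lcmUpTo N (suc N)
    c = countPrimes 0 (suc N)
    div : ∀ i → 1 ≤ i → i ≤ N → i ∣ D
    div i 1≤i i≤N = prime-powers-decide D i 1≤i λ { zero _ _ → 1∣ D ; {p} (suc a) pp d →
      let le = ≤-trans (∣⇒≤ {{>-nonZero 1≤i}} d) i≤N in
      prime-power∣lcm N (suc N) (suc a) pp (s≤s (≤-trans (subst (_≤ p * p ^ a) (*-identityʳ p) (*-monoʳ-≤ p (m^n>0 p {{>-nonZero (prime⇒1≤ pp)}} a))) le)) le }
    D≥1 : 1 ≤ D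
    D≥1 = pos (suc N)
      where
      pos : ∀ k → 1 ≤ lcmUpTo N k
      pos zero = ≤-refl
      pos (suc k) with isPrime? k
      ... | yes pk = *-mono-≤ (m^n>0 k {{>-nonZero (prime⇒1≤ pk)}} (exponent N k N)) (pos k)
      ... | no _ = pos k
    ^-cancelʳ-≤ : ∀ {a b} → 2 ^ a ≤ 2 ^ b → a ≤ b
    ^-cancelʳ-≤ {a} {b} p = ≮⇒≥ λ q → <⇒≱ (^-monoʳ-< 2 ≤-refl q) p

-- Prime reciprocals and the Mertens product.

module MertensBounds where

  open Rationals
  open FiniteSums
  open Congruences
  open FundamentalLemma using (bl; len; bl+len)
  open ChebyshevBounds
  open import Data.Nat as ℕ using (ℕ; zero; suc; z≤n; s≤s; ⌊_/2⌋; ⌈_/2⌉)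
  import Data.Nat.Properties as ℕP
  import Data.Nat.Divisibility as ℕD
  import Data.Nat.Tactic.RingSolver as ℕSolver
  open import Data.Nat.Primality using (Prime; prime[2])
  open import Data.Rational using (ℚ; 0ℚ; 1ℚ; _+_; _*_; -_; _-_; _≤_)
  open import Data.Rational.Properties
  open import Data.Product using (_×_; _,_; proj₁; proj₂)
  open import Relation.Nullary using (Dec; yes; no; ¬_; contradiction; _×-dec_; _→-dec_)
  open import Relation.Binary.PropositionalEquality using (_≡_; refl; sym; trans; cong; cong₂; subst)
  open import Tactic.RingSolver using (solve-∀)

  pr : ℕ → ℚ
  pr l = ⟨ isPrime? l ⟩

  0≤pr : ∀ l → 0ℚ ≤ pr l
  0≤pr l = 0≤⟨⟩ (isPrime? l)

  pr≤1 : ∀ l → pr l ≤ 1ℚ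
  pr≤1 l = ⟨⟩≤1 (isPrime? l)

  ∑pr≡count : ∀ a k → ∑ k (λ i → pr (a ℕ.+ i)) ≡ ι (countPrimes a k)
  ∑pr≡count a zero = sym ι0≡0
  ∑pr≡count a (suc k) with isPrime? (a ℕ.+ k)
  ... | yes _ = trans (cong (_+ 1ℚ) (∑pr≡count a k)) (trans (+-comm (ι (countPrimes a k)) 1ℚ) (sym (ι-suc (countPrimes a k))))
  ... | no _ = trans (+-identityʳ (∑ k (λ i → pr (a ℕ.+ i)))) (∑pr≡count a k)

  -- At most 2 ^ (j + 1) / j primes, each contributing at most 2 ^ -j. Chebyshev's count is over (2
  -- ^ j, 2 ^ (j + 1)], so the shell is shifted by one, its left end being composite. For j = 1 that
  -- end is the prime 2, and the trivial bound is used.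
  shell-primes : ∀ j → 1 ℕ.≤ j → ∑ (2 ℕ.^ j) (λ k → pr (2 ℕ.^ j ℕ.+ k) * inv (2 ℕ.^ j ℕ.+ k)) ≤ ι 2 * inv j
  shell-primes 1 _ = ≤-trans (∑-≤-const 2 1ℚ (λ k → pr (2 ℕ.+ k) * inv (2 ℕ.+ k)) (λ k _ → ≤-via refl (*-mono (0≤pr (2 ℕ.+ k)) 0≤1 (pr≤1 (2 ℕ.+ k)) (inv≤1 (2 ℕ.+ k))) (*-identityʳ 1ℚ)))
    (≤-reflexive (cong (ι 2 *_) (sym inv1≡1)))
  shell-primes j@(suc (suc i)) 1≤j = ≤-trans (∑-mono n (λ k _ → *-monoʳ (0≤pr (n ℕ.+ k)) (inv-anti (1≤2^ j) (ℕP.m≤m+n n k))))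
    (≤-via (∑-*ʳ n (hp j) (λ k → pr (n ℕ.+ k))) (*-monoˡ (0≤hp j) count) (trans (e (pw (suc j)) (inv j) (hp j)) (cong (_* inv j) (trans (cong (_* hp j) (pw-+ 1 j)) (trans (*-assoc (pw 1) (pw j) (hp j)) (trans (cong (pw 1 *_) (pw-hp j)) (*-identityʳ (pw 1))))))))
    where
    n c : ℕ
    n = 2 ℕ.^ j
    c = countPrimes (suc n) n
    e : ∀ a b c → a * b * c ≡ a * c * b
    e = solve-∀ ℚring
    composite : ¬ Prime n
    composite pn = contradiction (prime∣prime two pn (ℕD.m∣m*n (2 ℕ.^ suc i))) (ℕP.<⇒≢ (ℕP.*-monoʳ-< 2 {1} {2 ℕ.* 2 ℕ.^ i} (ℕP.*-monoʳ-≤ 2 (1≤2^ i))))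
      where
      two : Prime 2
      two = prime[2]
    zeroth : pr (n ℕ.+ 0) ≡ 0ℚ
    zeroth = trans (cong pr (ℕP.+-identityʳ n)) (⟨⟩-no (isPrime? n) composite)
    count : ∑ n (λ k → pr (n ℕ.+ k)) ≤ pw (suc j) * inv j
    count = ≤-trans (shift n) (≤-move 1≤j (≤-via (trans (*-comm (ι c) (ι j)) (sym (ι-* j c))) (ι-mono (primes-in-shell j)) refl))
      where
      shift' : ∀ m → ∑ (suc m) (λ k → pr (n ℕ.+ k)) ≡ ι (countPrimes (suc n) m)
      shift' zero = trans (+-identityˡ _) (trans zeroth (sym ι0≡0))
      shift' (suc m) = trans (cong (_+ pr (n ℕ.+ suc m)) (shift' m)) (trans (cong₂ _+_ (sym (∑pr≡count (suc n) m)) (cong pr (ℕP.+-suc n m))) (∑pr≡count (suc n) (suc m)))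
      shift : ∀ m → ∑ m (λ k → pr (n ℕ.+ k)) ≤ ι (countPrimes (suc n) m)
      shift m = ≤-via refl (x≤x+y (0≤pr (n ℕ.+ m))) (shift' m)

  -- The block consists of 2 ^ i dyadic shells, each contributing at most 2 / 2 ^ i.
  block-primes : ∀ i → ∑ (len i) (λ k → pr (bl i ℕ.+ k) * inv (bl i ℕ.+ k)) ≤ ι 2
  block-primes i = nonneg⇒≤ (gap total) (trans (e (∑ (len i) (λ k → f (bl i ℕ.+ k))) (∑ (bl i) f) (ι (2 ℕ.^ i) * (ι 2 * inv (2 ℕ.^ i)))) (trans (e' (ι (2 ℕ.^ i)) (ι 2) (inv (2 ℕ.^ i))) (trans (cong (ι 2 *_) (pw-hp i)) (*-identityʳ (ι 2)))))
    where
    f : ℕ → ℚ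
    f l = pr l * inv l
    total : ∑ (bl i) f + ∑ (len i) (λ k → f (bl i ℕ.+ k)) ≤ ∑ (bl i) f + ι (2 ℕ.^ i) * (ι 2 * inv (2 ℕ.^ i))
    total = ≤-via (trans (sym (∑-split (bl i) (len i) f)) (cong (λ k → ∑ k f) (trans (bl+len i) (cong (λ k → 2 ℕ.^ (2 ℕ.^ i ℕ.+ k)) (ℕP.+-identityʳ (2 ℕ.^ i))))))
      (∑-dyadic f (ι 2 * inv (2 ℕ.^ i)) (2 ℕ.^ i) (λ j p → ≤-trans (shell-primes j (ℕP.≤-trans (1≤2^ i) p)) (*-monoʳ (0≤ι 2) (inv-anti (1≤2^ i) p))) (2 ℕ.^ i)) refl
    e : ∀ x y z → x + (y + z - (y + x)) ≡ z
    e = solve-∀ ℚring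
    e' : ∀ x y z → x * (y * z) ≡ y * (x * z)
    e' = solve-∀ ℚring

  -- Applies m ≤ K π(2m) to m = ⌊(N - 1) / 2⌋; the hypothesis 3 ≤ N ensures N ≤ 4 m.
  prime-count-lower : ∀ N K → 3 ℕ.≤ N → N ℕ.≤ 2 ℕ.^ K → ι N ≤ ι 4 * (ι K * ∑ N pr)
  prime-count-lower (suc n) K (s≤s 2≤n) N≤ = ≤-trans (ι-mono N≤4m) (≤-via (ι-* 4 m) (*-monoʳ (0≤ι 4) (≤-trans (≤-via refl (ι-mono (primes-below m K 1≤m m+m<)) (trans (ι-* K (countPrimes 0 (suc (m ℕ.+ m)))) (cong (ι K *_) (sym (∑pr≡count 0 (suc (m ℕ.+ m)))))))
      (*-monoʳ (0≤ι K) (∑-≤-len pr 0≤pr (s≤s m+m≤n))))) refl)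
    where
    m : ℕ
    m = ⌊ n /2⌋
    1≤m : 1 ℕ.≤ m
    1≤m = ℕP.⌊n/2⌋-mono 2≤n
    half≤ : ⌈ n /2⌉ ℕ.≤ suc m
    half≤ = ℕP.⌊n/2⌋-mono (ℕP.n≤1+n (suc n))
    m+m≤n : m ℕ.+ m ℕ.≤ n
    m+m≤n = ℕP.≤-trans (ℕP.+-monoʳ-≤ m (ℕP.⌊n/2⌋≤⌈n/2⌉ n)) (ℕP.≤-reflexive (ℕP.⌊n/2⌋+⌈n/2⌉≡n n))
    m+m< : m ℕ.+ m ℕ.< 2 ℕ.^ K
    m+m< = ℕP.≤-trans (s≤s m+m≤n) N≤
    N≤4m : suc n ℕ.≤ 4 ℕ.* m
    N≤4m = ℕP.≤-trans (s≤s (ℕP.≤-trans (ℕP.≤-reflexive (sym (ℕP.⌊n/2⌋+⌈n/2⌉≡n n))) (ℕP.+-monoʳ-≤ m half≤)))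
      (ℕP.≤-trans (ℕP.≤-reflexive (e m)) (ℕP.≤-trans (ℕP.+-monoˡ-≤ (m ℕ.+ m) (ℕP.+-mono-≤ 1≤m 1≤m)) (ℕP.≤-reflexive (e' m))))
      where
      e : ∀ m → suc (m ℕ.+ suc m) ≡ 2 ℕ.+ (m ℕ.+ m)
      e m = cong suc (ℕP.+-suc m m)
      e' : ∀ m → m ℕ.+ m ℕ.+ (m ℕ.+ m) ≡ 4 ℕ.* m
      e' = ℕSolver.solve-∀

  -- The density of the integers without prime factors below Z.
  ρ : ℕ → ℚ
  ρ Z = ∏ Z (λ l → 1ℚ - pr l * inv l)

  pr*inv≤1 : ∀ l → pr l * inv l ≤ 1ℚ
  pr*inv≤1 l = ≤-via refl (*-mono (0≤pr l) 0≤1 (pr≤1 l) (inv≤1 l)) (*-identityʳ 1ℚ)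

  0≤ρ : ∀ Z → 0ℚ ≤ ρ Z
  0≤ρ Z = ∏-nonneg Z (λ l _ → gap (pr*inv≤1 l))

  inv-step : ∀ m → inv (suc m) * (1ℚ - inv (suc (suc m))) ≡ inv (suc (suc m))
  inv-step m = inv-unique {suc (suc m)} (s≤s z≤n) (trans (e (ι (suc (suc m))) (inv (suc m)) (inv (suc (suc m)))) (trans (cong (λ w → inv (suc m) * (ι (suc (suc m)) - w)) (ι-inv (suc m)))
    (trans (cong (λ w → inv (suc m) * (w - 1ℚ)) (ι-suc (suc m))) (trans (e' (inv (suc m)) (ι (suc m))) (ι-inv m)))))
    where
    e : ∀ n x y → n * (x * (1ℚ - y)) ≡ x * (n - n * y)
    e = solve-∀ ℚring
    e' : ∀ x m → x * (1ℚ + m - 1ℚ) ≡ m * x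
    e' = solve-∀ ℚring

  -- Letting l run over all integers from 2 on, not only primes, makes the product smaller and
  -- telescoping.
  ρ-lower : ∀ m → inv (suc m) ≤ ρ (suc (suc m))
  ρ-lower zero = ≤-via inv1≡1 (∏-≥1 2 {λ l → 1ℚ - pr l * inv l} (λ l p → ≤-reflexive (sym (small l p)))) refl
    where
    small : ∀ l → l ℕ.< 2 → 1ℚ - pr l * inv l ≡ 1ℚ
    small l p = trans (cong (λ w → 1ℚ - w * inv l) (⟨⟩-no (isPrime? l) (λ q → ℕP.<⇒≱ p (prime⇒2≤ q)))) (e (inv l))
      where
      e : ∀ x → 1ℚ - 0ℚ * x ≡ 1ℚ
      e = solve-∀ ℚring
  ρ-lower (suc m) = ≤-via (sym (inv-step m)) (*-mono (0≤inv (suc m)) (gap (pr*inv≤1 l)) (ρ-lower m)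
      (nonneg⇒≤ (0≤* (gap (pr≤1 l)) (0≤inv l)) (e (pr l) (inv l)))) refl
    where
    l : ℕ
    l = suc (suc m)
    e : ∀ p x → 1ℚ - x + (1ℚ - p) * x ≡ 1ℚ - p * x
    e = solve-∀ ℚring

  private
    -- All prime factors lie below Z; the quantifier is bounded by n + 1 for decidability.
    Smooth : ℕ → ℕ → Set
    Smooth Z n = 1 ℕ.≤ n × (∀ {p} → p ℕ.< suc n → Prime p × p ℕD.∣ n → p ℕ.< Z)

    smooth? : ∀ Z n → Dec (Smooth Z n)
    smooth? Z n = (1 ℕ.≤? n) ×-dec ℕP.allUpTo? (λ p → (isPrime? p ×-dec (p ℕD.∣? n)) →-dec (p ℕ.<? Z)) (suc n)

    sm : ℕ → ℕ → ℚ
    sm Z n = ⟨ smooth? Z n ⟩ * inv n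

    s : ℕ → ℕ → ℚ
    s Z x = ∑ x (sm Z)

    0≤sm : ∀ Z n → 0ℚ ≤ sm Z n
    0≤sm Z n = 0≤* (0≤⟨⟩ (smooth? Z n)) (0≤inv n)

    smooth-skip : ∀ {Z n} → ¬ (Prime Z × Z ℕD.∣ n) → Smooth (suc Z) n → Smooth Z n
    smooth-skip h (a , b) = a , λ p<n q → ℕP.≤∧≢⇒< (ℕP.≤-pred (b p<n q)) λ { refl → h q }

    sm-skip : ∀ {Z n} → ¬ (Prime Z × Z ℕD.∣ n) → sm (suc Z) n ≤ sm Z n
    sm-skip {Z} {n} h = *-monoˡ (0≤inv n) (⟨⟩-⇒ (smooth? (suc Z) n) (smooth? Z n) (smooth-skip h))

    -- A smooth number is either prime to Z, and counted by `s Z x`, or of the form Z t with t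
    -- smooth and below x.
    s-prime : ∀ Z x → Prime Z → s (suc Z) x ≤ s Z x + inv Z * s (suc Z) x
    s-prime Z x pZ = ≤-trans (∑-mono x pointwise) (≤-via (∑-+ x (sm Z) (λ n → ⟨ Z ℕD.∣? n ⟩ * sm (suc Z) n)) (+-monoʳ-≤ (s Z x) (mult (multiples Z x (prime⇒1≤ pZ)))) refl)
      where
      pointwise : ∀ n → n ℕ.< x → sm (suc Z) n ≤ sm Z n + ⟨ Z ℕD.∣? n ⟩ * sm (suc Z) n
      pointwise n _ with Z ℕD.∣? n
      ... | yes _ = nonneg⇒≤ (0≤sm Z n) (e (sm (suc Z) n) (sm Z n))
        where
        e : ∀ x y → x + y ≡ y + 1ℚ * x
        e = solve-∀ ℚring
      ... | no Z∤n = ≤-via refl (sm-skip (λ q → Z∤n (proj₂ q))) (e (sm Z n) (sm (suc Z) n))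
        where
        e : ∀ y x → y ≡ y + 0ℚ * x
        e = solve-∀ ℚring
      mult : Multiples Z x → ∑ x (λ n → ⟨ Z ℕD.∣? n ⟩ * sm (suc Z) n) ≤ inv Z * s (suc Z) x
      mult (T , _ , hi , eq) = ≤-via (eq (sm (suc Z))) (≤-trans (∑-mono T term) (≤-via (∑-*ˡ T (inv Z) (sm (suc Z))) (*-monoʳ (0≤inv Z) (∑-≤-len (sm (suc Z)) (0≤sm (suc Z)) T≤x)) refl)) refl
        where
        T≤x : T ℕ.≤ x
        T≤x = quotient≤ T hi
          where
          quotient≤ : ∀ T → Z ℕ.* T ℕ.< x ℕ.+ Z → T ℕ.≤ x
          quotient≤ zero _ = z≤n
          quotient≤ (suc T') hi = ℕP.≤-trans (s≤s (ℕP.m≤n*m T' Z {{ℕ.>-nonZero (prime⇒1≤ pZ)}})) (ℕP.+-cancelʳ-< Z (Z ℕ.* T') x (subst (ℕ._< x ℕ.+ Z) (trans (ℕP.*-suc Z T') (ℕP.+-comm Z _)) hi))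
        smooth-quot : ∀ {t} → Smooth (suc Z) (Z ℕ.* t) → Smooth (suc Z) t
        smooth-quot {zero} (a , _) = contradiction (subst (1 ℕ.≤_) (ℕP.*-zeroʳ Z) a) λ ()
        smooth-quot {t@(suc _)} (a , b) = s≤s z≤n , λ p<t (pp , d) → b (ℕP.≤-trans p<t (s≤s (ℕP.m≤n*m t Z {{ℕ.>-nonZero (prime⇒1≤ pZ)}}))) (pp , ℕD.∣n⇒∣m*n Z d)
        term : ∀ t → t ℕ.< T → sm (suc Z) (Z ℕ.* t) ≤ inv Z * sm (suc Z) t
        term zero _ = ≤-via (trans (cong (λ w → ⟨ smooth? (suc Z) w ⟩ * inv w) (ℕP.*-zeroʳ Z)) (trans (cong (_* inv 0) (⟨⟩-no (smooth? (suc Z) 0) (λ { (() , _) }))) (*-zeroˡ (inv 0)))) (0≤* (0≤inv Z) (0≤sm (suc Z) 0)) refl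
        term t@(suc _) _ = ≤-via (cong (⟨ smooth? (suc Z) (Z ℕ.* t) ⟩ *_) (inv-* Z t (prime⇒1≤ pZ) (s≤s z≤n)))
          (*-monoˡ (0≤* (0≤inv Z) (0≤inv t)) (⟨⟩-⇒ (smooth? (suc Z) (Z ℕ.* t)) (smooth? (suc Z) t) smooth-quot)) (e ⟨ smooth? (suc Z) t ⟩ (inv Z) (inv t))
          where
          e : ∀ a b c → a * (b * c) ≡ b * (a * c)
          e = solve-∀ ℚring

    -- The Euler product bounds the sum of 1 / n over smooth n, one prime at a time.
    euler : ∀ Z x → ρ Z * s Z x ≤ 1ℚ
    euler zero x = ≤-via (*-identityˡ (s 0 x)) (≤-trans (∑-single x 1 off (0≤sm 0 1)) (≤-via refl (*-mono (0≤⟨⟩ (smooth? 0 1)) 0≤1 (⟨⟩≤1 (smooth? 0 1)) (inv≤1 1)) (*-identityʳ 1ℚ))) refl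
      where
      off : ∀ n → ¬ n ≡ 1 → sm 0 n ≤ 0ℚ
      off n n≢1 = ≤-reflexive (trans (cong (_* inv n) (⟨⟩-no (smooth? 0 n) not)) (*-zeroˡ (inv n)))
        where
        not : ¬ Smooth 0 n
        not (1≤n , b) with prime-factor n (ℕP.≤∧≢⇒< 1≤n (λ e → n≢1 (sym e)))
        ... | p , pp , p∣n = contradiction (b (s≤s (ℕD.∣⇒≤ {{ℕ.>-nonZero 1≤n}} p∣n)) (pp , p∣n)) λ ()
    euler (suc Z) x with isPrime? Z
    ... | yes pZ = ≤-trans (≤-via (*-assoc (ρ Z) _ _) (*-monoʳ (0≤ρ Z) (nonneg⇒≤ (gap (s-prime Z x pZ)) (e (inv Z) (s (suc Z) x) (s Z x)))) refl) (euler Z x)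
      where
      e : ∀ i s' s → (1ℚ - 1ℚ * i) * s' + (s + i * s' - s') ≡ s
      e = solve-∀ ℚring
    ... | no ¬pZ = ≤-trans (≤-via (trans (*-assoc (ρ Z) _ _) (cong (ρ Z *_) (e (inv Z) (s (suc Z) x)))) (*-monoʳ (0≤ρ Z) (∑-mono x (λ n _ → sm-skip {Z} {n} (λ q → ¬pZ (proj₁ q))))) refl) (euler Z x)
      where
      e : ∀ i s → (1ℚ - 0ℚ * i) * s ≡ s
      e = solve-∀ ℚring

  harmonic-lower : ∀ k → ι k * hp 1 ≤ ∑ (2 ℕ.^ k) inv
  harmonic-lower zero = ≤-via (trans (cong (_* hp 1) ι0≡0) (*-zeroˡ (hp 1))) (∑-nonneg 1 (λ n _ → 0≤inv n)) refl
  harmonic-lower (suc k) = ≤-via (trans (cong (_* hp 1) (ι-suc k)) (e (ι k) (hp 1))) (+-mono-≤ (harmonic-lower k) shell)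
      (trans (sym (∑-split n n inv)) (cong (λ m → ∑ (n ℕ.+ m) inv) (sym (ℕP.+-identityʳ n))))
    where
    n : ℕ
    n = 2 ℕ.^ k
    e : ∀ k h → (1ℚ + k) * h ≡ k * h + h
    e = solve-∀ ℚring
    shell : hp 1 ≤ ∑ n (λ i → inv (n ℕ.+ i))
    shell = ≤-trans (≤-reflexive (sym (trans (∑-const n (hp (k ℕ.+ 1))) (pw-hp-+ k 1)))) (∑-mono n (λ i i<n → inv-anti (ℕP.≤-trans (1≤2^ k) (ℕP.m≤m+n n i)) (ℕP.≤-trans (ℕP.+-monoʳ-≤ n (ℕP.<⇒≤ i<n)) (ℕP.≤-reflexive (trans (cong (n ℕ.+_) (sym (ℕP.+-identityʳ n))) (cong (2 ℕ.^_) (ℕP.+-comm 1 k)))))))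

  -- Every positive integer below 2 ^ k has its prime factors below 2 ^ k, so the Euler product
  -- bounds ρ by the reciprocal of a harmonic sum, which is at least k / 2.
  mertens : ∀ k → ρ (2 ℕ.^ k) * ι k ≤ ι 2
  mertens k = ≤-via (sym (trans (cong (ρ n * ι k *_) (trans (*-comm (hp 1) (pw 1)) (pw-hp 1))) (*-identityʳ _))) (≤-via (e (ρ n) (ι k) (hp 1) (pw 1)) (*-monoˡ (0≤pw 1) main) (*-identityˡ (pw 1))) refl
    where
    n : ℕ
    n = 2 ℕ.^ k
    e : ∀ r k h p → r * k * (h * p) ≡ r * (k * h) * p
    e = solve-∀ ℚring
    all-smooth : ∀ i → i ℕ.< n → inv i ≤ sm n i
    all-smooth zero _ = ≤-via inv0≡0 (0≤sm n 0) refl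
    all-smooth i@(suc _) i<n = ≤-reflexive (sym (trans (cong (_* inv i) (⟨⟩-yes (smooth? n i) (s≤s z≤n , λ p<i _ → ℕP.≤-trans p<i i<n))) (*-identityˡ (inv i))))
    main : ρ n * (ι k * hp 1) ≤ 1ℚ
    main = ≤-trans (*-monoʳ (0≤ρ n) (≤-trans (harmonic-lower k) (∑-mono n all-smooth))) (euler n n)

-- The sieves used: the class 0 and up to two further classes.

module Sieves where

  open Rationals
  open FiniteSums
  open Congruences
  open FundamentalLemma
  open ChebyshevBounds using (isPrime?)
  open MertensBounds
  open import Data.List using (List; []; _∷_; length)
  open import Data.Nat as ℕ using (ℕ; zero; suc; z≤n; s≤s)
  import Data.Nat.Properties as ℕP
  open import Data.Nat.Primality using (Prime)
  open import Data.Rational using (ℚ; 0ℚ; 1ℚ; _+_; _*_; -_; _-_; _≤_)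
  open import Data.Rational.Properties
  open import Relation.Nullary using (Dec; yes; no; ¬_; contradiction)
  open import Relation.Binary.PropositionalEquality using (_≡_; refl; sym; trans; cong; cong₂)
  open import Tactic.RingSolver using (solve-∀)

  inv-diff : ∀ {l} → 2 ℕ.≤ l → inv l * inv (l ℕ.∸ 1) ≡ inv (l ℕ.∸ 1) - inv l
  inv-diff {suc (suc n)} (s≤s (s≤s z≤n)) = trans (e (inv (suc n)) (inv (suc (suc n)))) (cong (λ w → inv (suc n) - w) (inv-step n))
    where
    e : ∀ a b → b * a ≡ a - a * (1ℚ - b)
    e = solve-∀ ℚring

  inv-diff′ : ∀ {l} → 3 ℕ.≤ l → inv (l ℕ.∸ 1) * inv (l ℕ.∸ 2) ≡ inv (l ℕ.∸ 2) - inv (l ℕ.∸ 1)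
  inv-diff′ {suc l} (s≤s p) = inv-diff p

  -- Removing the class 0 for l in P, and the classes of r₁ and r₂ for l in M.
  module Build (P M : ℕ → Set) (P? : ∀ l → Dec (P l)) (M? : ∀ l → Dec (M l))
    (P⇒prime : ∀ {l} → P l → Prime l) (M⇒P : ∀ {l} → M l → P l) (M⇒6≤ : ∀ {l} → M l → 6 ℕ.≤ l)
    (r₁ r₂ : ℕ → ℕ) (r₁≢0 : ∀ {l} → M l → ¬ Cg l (r₁ l) 0) (r₂≢0 : ∀ {l} → M l → ¬ Cg l (r₂ l) 0) where

    private
      -- Coinciding classes are listed once, as the density counts list entries; r₁ and r₂ differ
      -- from 0 by assumption.
      classes : ∀ {l} → Dec (P l) → Dec (M l) → Dec (Cg l (r₁ l) (r₂ l)) → List ℕ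
      classes (no _) _ _ = []
      classes (yes _) (no _) _ = 0 ∷ []
      classes {l} (yes _) (yes _) (yes _) = 0 ∷ r₁ l ∷ []
      classes {l} (yes _) (yes _) (no _) = 0 ∷ r₁ l ∷ r₂ l ∷ []

      Cl : ℕ → List ℕ
      Cl l = classes (P? l) (M? l) (cg? l (r₁ l) (r₂ l))

      -- Distinct classes are disjoint, so 1 minus the sum of their indicators is the product of the
      -- conditions of avoiding each. Where the two further classes coincide, the repeated condition
      -- is idempotent.
      factor : ∀ {l} n (dp : Dec (P l)) (dm : Dec (M l)) (dc : Dec (Cg l (r₁ l) (r₂ l))) →
        1ℚ - ∑L (classes dp dm dc) (λ c → ⟨ cg? l n c ⟩) ≡ (1ℚ - ⟨ dp ⟩ * ⟨ cg? l n 0 ⟩) * ((1ℚ - ⟨ dm ⟩ * ⟨ cg? l n (r₁ l) ⟩) * (1ℚ - ⟨ dm ⟩ * ⟨ cg? l n (r₂ l) ⟩))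
      factor n (no ¬p) (yes m) dc = contradiction (M⇒P m) ¬p
      factor {l} n (no ¬p) (no ¬m) dc = e ⟨ cg? l n 0 ⟩ ⟨ cg? l n (r₁ l) ⟩ ⟨ cg? l n (r₂ l) ⟩
        where
        e : ∀ a b c → 1ℚ - 0ℚ ≡ (1ℚ - 0ℚ * a) * ((1ℚ - 0ℚ * b) * (1ℚ - 0ℚ * c))
        e = solve-∀ ℚring
      factor {l} n (yes p) (no ¬m) dc = e ⟨ cg? l n 0 ⟩ ⟨ cg? l n (r₁ l) ⟩ ⟨ cg? l n (r₂ l) ⟩
        where
        e : ∀ a b c → 1ℚ - (a + 0ℚ) ≡ (1ℚ - 1ℚ * a) * ((1ℚ - 0ℚ * b) * (1ℚ - 0ℚ * c))
        e = solve-∀ ℚring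
      factor {l} n (yes p) (yes m) (yes c) with cg? l n 0 | cg? l n (r₁ l) | cg? l n (r₂ l)
      ... | yes a | yes b | _ = contradiction (cg-trans (cg-sym b) a) (r₁≢0 m)
      ... | yes a | no b | yes d = contradiction (cg-trans (cg-sym d) a) (r₂≢0 m)
      ... | yes a | no b | no d = refl
      ... | no a | yes b | yes d = refl
      ... | no a | yes b | no d = contradiction (cg-trans b c) d
      ... | no a | no b | yes d = contradiction (cg-trans d (cg-sym c)) b
      ... | no a | no b | no d = refl
      factor {l} n (yes p) (yes m) (no c) with cg? l n 0 | cg? l n (r₁ l) | cg? l n (r₂ l)
      ... | yes a | yes b | _ = contradiction (cg-trans (cg-sym b) a) (r₁≢0 m)
      ... | yes a | no b | yes d = contradiction (cg-trans (cg-sym d) a) (r₂≢0 m)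
      ... | yes a | no b | no d = refl
      ... | no a | yes b | yes d = contradiction (cg-trans (cg-sym b) d) c
      ... | no a | yes b | no d = refl
      ... | no a | no b | yes d = refl
      ... | no a | no b | no d = refl

      length-none : ∀ {l} (dp : Dec (P l)) (dm : Dec (M l)) dc → ¬ P l → length (classes dp dm dc) ≡ 0
      length-none (yes p) dm dc ¬p = contradiction p ¬p
      length-none (no _) dm dc ¬p = refl

      length-P : ∀ {l} (dp : Dec (P l)) (dm : Dec (M l)) dc → P l → ¬ M l → length (classes dp dm dc) ≡ 1
      length-P (no ¬p) dm dc p ¬m = contradiction p ¬p
      length-P (yes _) (yes m) dc p ¬m = contradiction m ¬m
      length-P (yes _) (no _) dc p ¬m = refl

      length-M≡ : ∀ {l} (dp : Dec (P l)) (dm : Dec (M l)) dc → M l → Cg l (r₁ l) (r₂ l) → length (classes dp dm dc) ≡ 2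
      length-M≡ (no ¬p) dm dc m c = contradiction (M⇒P m) ¬p
      length-M≡ (yes _) (no ¬m) dc m c = contradiction m ¬m
      length-M≡ (yes _) (yes _) (yes _) m c = refl
      length-M≡ (yes _) (yes _) (no ¬c) m c = contradiction c ¬c

      length-M≢ : ∀ {l} (dp : Dec (P l)) (dm : Dec (M l)) dc → M l → ¬ Cg l (r₁ l) (r₂ l) → length (classes dp dm dc) ≡ 3
      length-M≢ (no ¬p) dm dc m c = contradiction (M⇒P m) ¬p
      length-M≢ (yes _) (no ¬m) dc m c = contradiction m ¬m
      length-M≢ (yes _) (yes _) (yes c) m ¬c = contradiction c ¬c
      length-M≢ (yes _) (yes _) (no _) m c = refl

      nonempty : ∀ {l} (dp : Dec (P l)) (dm : Dec (M l)) dc {c cs} → classes dp dm dc ≡ c ∷ cs → P l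
      nonempty (yes p) _ _ _ = p

      gl : ℕ → ℚ
      gl l = ι (length (Cl l)) * inv l

      factor≥0 : ∀ {p} {A : Set p} {q} {B : Set q} (d : Dec A) (d' : Dec B) → 0ℚ ≤ 1ℚ - ⟨ d ⟩ * ⟨ d' ⟩
      factor≥0 d d' = gap (≤-via refl (*-mono (0≤⟨⟩ d) 0≤1 (⟨⟩≤1 d) (⟨⟩≤1 d')) (*-identityʳ 1ℚ))

      β≤1 : ∀ l n → ∑L (Cl l) (λ c → ⟨ cg? l n c ⟩) ≤ 1ℚ
      β≤1 l n = nonneg⇒≤ (0≤* (factor≥0 (P? l) (cg? l n 0)) (0≤* (factor≥0 (M? l) (cg? l n (r₁ l))) (factor≥0 (M? l) (cg? l n (r₂ l)))))
        (trans (cong (∑L (Cl l) (λ c → ⟨ cg? l n c ⟩) +_) (sym (factor n (P? l) (M? l) (cg? l (r₁ l) (r₂ l))))) (e (∑L (Cl l) (λ c → ⟨ cg? l n c ⟩))))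
        where
        e : ∀ x → x + (1ℚ - x) ≡ 1ℚ
        e = solve-∀ ℚring

      length≤3 : ∀ {l} (dp : Dec (P l)) (dm : Dec (M l)) dc → length (classes dp dm dc) ℕ.≤ 3
      length≤3 (no _) dm dc = z≤n
      length≤3 (yes _) (no _) dc = s≤s z≤n
      length≤3 (yes _) (yes _) (yes _) = s≤s (s≤s z≤n)
      length≤3 (yes _) (yes _) (no _) = ℕP.≤-refl

      -- Three classes are at most half of all classes once l ≥ 6.
      twice-length≤ : ∀ {l} (dp : Dec (P l)) (dm : Dec (M l)) dc → 2 ℕ.* length (classes dp dm dc) ℕ.≤ l
      twice-length≤ (no _) dm dc = z≤n
      twice-length≤ (yes p) (no _) dc = prime⇒2≤ (P⇒prime p)
      twice-length≤ dp@(yes p) dm@(yes m) dc = ℕP.≤-trans (ℕP.*-monoʳ-≤ 2 (length≤3 dp dm dc)) (M⇒6≤ m)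

      g≤½ : ∀ l → ι 2 * gl l ≤ 1ℚ
      g≤½ zero = ≤-via (trans (cong (λ w → ι 2 * (ι (length (Cl 0)) * w)) inv0≡0) (e (ι 2) (ι (length (Cl 0))))) 0≤1 refl
        where
        e : ∀ a b → a * (b * 0ℚ) ≡ 0ℚ
        e = solve-∀ ℚring
      g≤½ l@(suc _) = ≤-via (trans (sym (*-assoc (ι 2) (ι (length (Cl l))) (inv l))) (cong (_* inv l) (sym (ι-* 2 (length (Cl l))))))
        (*-monoˡ (0≤inv l) (ι-mono (twice-length≤ (P? l) (M? l) (cg? l (r₁ l) (r₂ l))))) (ι-inv′ {l} (s≤s z≤n))

      gl≤ : ∀ l → gl l ≤ ι 3 * (pr l * inv l)
      gl≤ l = ≤-via refl (*-monoˡ (0≤inv l) (bound (P? l) (M? l) (cg? l (r₁ l) (r₂ l)))) (*-assoc (ι 3) (pr l) (inv l))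
        where
        bound : (dp : Dec (P l)) (dm : Dec (M l)) (dc : Dec (Cg l (r₁ l) (r₂ l))) → ι (length (classes dp dm dc)) ≤ ι 3 * pr l
        bound (no _) dm dc = ≤-via ι0≡0 (0≤* (0≤ι 3) (0≤pr l)) refl
        bound dp@(yes p) dm dc = ≤-via refl (ι-mono (length≤3 dp dm dc)) (sym (trans (cong (ι 3 *_) (⟨⟩-yes (isPrime? l) (P⇒prime p))) (*-identityʳ (ι 3))))

    sieve : Sieve
    sieve = record
      { C = Cl
      ; C-prime = λ {l} eq → P⇒prime (nonempty (P? l) (M? l) (cg? l (r₁ l) (r₂ l)) eq)
      ; β≤1 = β≤1
      ; g≤½ = g≤½
      ; block = λ i → ≤-trans (∑-mono (len i) (λ k _ → gl≤ (bl i ℕ.+ k))) (≤-via (∑-*ˡ (len i) (ι 3) (λ k → pr (bl i ℕ.+ k) * inv (bl i ℕ.+ k))) (*-monoʳ (0≤ι 3) (block-primes i)) (sym (ι-* 3 2)))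
      }

    open Sieve sieve using (β; g)
    open Fundamental sieve using (h; V; S; Cop; Close; 0≤g; g≤1; fundamental-lemma) renaming (0≤S to S≥0; 0≤V to V≥0) public

    C⇒P : ∀ {l c cs} → Sieve.C sieve l ≡ c ∷ cs → P l
    C⇒P {l} = nonempty (P? l) (M? l) (cg? l (r₁ l) (r₂ l))

    1-β : ∀ l n → 1ℚ - β l n ≡ (1ℚ - ⟨ P? l ⟩ * ⟨ cg? l n 0 ⟩) * ((1ℚ - ⟨ M? l ⟩ * ⟨ cg? l n (r₁ l) ⟩) * (1ℚ - ⟨ M? l ⟩ * ⟨ cg? l n (r₂ l) ⟩))
    1-β l n = factor n (P? l) (M? l) (cg? l (r₁ l) (r₂ l))

    g-none : ∀ {l} → ¬ P l → g l ≡ 0ℚ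
    g-none {l} ¬p = trans (cong (λ k → ι k * inv l) (length-none (P? l) (M? l) (cg? l (r₁ l) (r₂ l)) ¬p)) (trans (cong (_* inv l) ι0≡0) (*-zeroˡ (inv l)))

    g-P : ∀ {l} → P l → ¬ M l → g l ≡ inv l
    g-P {l} p ¬m = trans (cong (λ k → ι k * inv l) (length-P (P? l) (M? l) (cg? l (r₁ l) (r₂ l)) p ¬m)) (trans (cong (_* inv l) ι1≡1) (*-identityˡ (inv l)))

    g-M≡ : ∀ {l} → M l → Cg l (r₁ l) (r₂ l) → g l ≡ ι 2 * inv l
    g-M≡ {l} m c = cong (λ k → ι k * inv l) (length-M≡ (P? l) (M? l) (cg? l (r₁ l) (r₂ l)) m c)

    g-M≢ : ∀ {l} → M l → ¬ Cg l (r₁ l) (r₂ l) → g l ≡ ι 3 * inv l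
    g-M≢ {l} m c = cong (λ k → ι k * inv l) (length-M≢ (P? l) (M? l) (cg? l (r₁ l) (r₂ l)) m c)

    private
      x y s : ℕ → ℚ
      x l = inv l
      y l = inv (l ℕ.∸ 1)
      s l = inv (l ℕ.∸ 2)

      -- Meant for x = 1 / l and y = 1 / (l - 1): removing the class 0 and then one of the remaining
      -- l - 1 classes leaves 1 - 2 / l.
      merge : ∀ x y → x * y ≡ y - x → (1ℚ - x) * (1ℚ - y) ≡ 1ℚ - (1ℚ + 1ℚ) * x
      merge x y e = trans (e₁ x y) (trans (cong (λ w → 1ℚ - x - y + w) e) (e₂ x y))
        where
        e₁ : ∀ x y → (1ℚ - x) * (1ℚ - y) ≡ 1ℚ - x - y + x * y
        e₁ = solve-∀ ℚring
        e₂ : ∀ x y → 1ℚ - x - y + (y - x) ≡ 1ℚ - (1ℚ + 1ℚ) * x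
        e₂ = solve-∀ ℚring

    -- The common further class is one of the l - 1 nonzero classes, so its density given that l
    -- does not divide n is 1 / (l - 1).
    1-g-same : (∀ {l} → M l → Cg l (r₁ l) (r₂ l)) → ∀ l → 1ℚ - g l ≡ (1ℚ - ⟨ P? l ⟩ * inv l) * (1ℚ - ⟨ M? l ⟩ * inv (l ℕ.∸ 1))
    1-g-same same l = go (P? l) (M? l)
      where
      go : (dp : Dec (P l)) (dm : Dec (M l)) → 1ℚ - g l ≡ (1ℚ - ⟨ dp ⟩ * inv l) * (1ℚ - ⟨ dm ⟩ * inv (l ℕ.∸ 1))
      go (no ¬p) (yes m) = contradiction (M⇒P m) ¬p
      go (no ¬p) (no _) = trans (cong (λ w → 1ℚ - w) (g-none ¬p)) (e (x l) (y l))
        where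
        e : ∀ x y → 1ℚ - 0ℚ ≡ (1ℚ - 0ℚ * x) * (1ℚ - 0ℚ * y)
        e = solve-∀ ℚring
      go (yes p) (no ¬m) = trans (cong (λ w → 1ℚ - w) (g-P p ¬m)) (e (x l) (y l))
        where
        e : ∀ x y → 1ℚ - x ≡ (1ℚ - 1ℚ * x) * (1ℚ - 0ℚ * y)
        e = solve-∀ ℚring
      go (yes p) (yes m) = trans (cong (λ w → 1ℚ - w) (trans (g-M≡ m (same m)) (cong (_* x l) ι2≡)))
        (sym (trans (cong₂ (λ a b → (1ℚ - a) * (1ℚ - b)) (*-identityˡ (x l)) (*-identityˡ (y l))) (merge (x l) (y l) (inv-diff (ℕP.≤-trans (s≤s (s≤s z≤n)) (M⇒6≤ m))))))

    -- Comparison with independent conditions. For distinct classes 1 - 3 / l is at most the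
    -- independent value. For coinciding ones a factor 1 - 1 / (l - 1) is in excess, and 1 + 1 / (l
    -- - 2) cancels it exactly.
    1-g-pair : (e : ℕ → ℚ) → (∀ l → 0ℚ ≤ e l) → (∀ {l} → M l → Cg l (r₁ l) (r₂ l) → e l ≡ 1ℚ) → ∀ l →
      1ℚ - g l ≤ (1ℚ - ⟨ P? l ⟩ * inv l) * ((1ℚ - ⟨ M? l ⟩ * inv (l ℕ.∸ 1)) * ((1ℚ - ⟨ M? l ⟩ * inv (l ℕ.∸ 1)) * (1ℚ + ⟨ M? l ⟩ * (e l * inv (l ℕ.∸ 2)))))
    1-g-pair ee 0≤e e≡1 l = go (P? l) (M? l) (cg? l (r₁ l) (r₂ l))
      where
      go : (dp : Dec (P l)) (dm : Dec (M l)) (dc : Dec (Cg l (r₁ l) (r₂ l))) → 1ℚ - g l ≤ (1ℚ - ⟨ dp ⟩ * x l) * ((1ℚ - ⟨ dm ⟩ * y l) * ((1ℚ - ⟨ dm ⟩ * y l) * (1ℚ + ⟨ dm ⟩ * (ee l * s l))))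
      go (no ¬p) (yes m) _ = contradiction (M⇒P m) ¬p
      go (no ¬p) (no _) _ = ≤-reflexive (trans (cong (λ w → 1ℚ - w) (g-none ¬p)) (e (x l) (y l) (ee l) (s l)))
        where
        e : ∀ x y u s → 1ℚ - 0ℚ ≡ (1ℚ - 0ℚ * x) * ((1ℚ - 0ℚ * y) * ((1ℚ - 0ℚ * y) * (1ℚ + 0ℚ * (u * s))))
        e = solve-∀ ℚring
      go (yes p) (no ¬m) _ = ≤-reflexive (trans (cong (λ w → 1ℚ - w) (g-P p ¬m)) (e (x l) (y l) (ee l) (s l)))
        where
        e : ∀ x y u s → 1ℚ - x ≡ (1ℚ - 1ℚ * x) * ((1ℚ - 0ℚ * y) * ((1ℚ - 0ℚ * y) * (1ℚ + 0ℚ * (u * s))))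
        e = solve-∀ ℚring
      go (yes p) (yes m) (yes c) = ≤-reflexive (trans (cong (λ w → 1ℚ - w) (trans (g-M≡ m c) (cong (_* x l) ι2≡)))
        (sym (trans (cong (λ u → (1ℚ - 1ℚ * x l) * ((1ℚ - 1ℚ * y l) * ((1ℚ - 1ℚ * y l) * (1ℚ + 1ℚ * (u * s l))))) (e≡1 m c))
          (trans (e (x l) (y l) (s l)) (trans (cong₂ _*_ (merge (x l) (y l) (inv-diff 2≤l)) cancel) (*-identityʳ _))))))
        where
        2≤l : 2 ℕ.≤ l
        2≤l = ℕP.≤-trans (s≤s (s≤s z≤n)) (M⇒6≤ m)
        cancel : 1ℚ - y l + s l - y l * s l ≡ 1ℚ
        cancel = trans (cong (λ w → 1ℚ - y l + s l - w) (inv-diff′ (ℕP.≤-trans (s≤s (s≤s (s≤s z≤n))) (M⇒6≤ m)))) (e' (y l) (s l))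
          where
          e' : ∀ y s → 1ℚ - y + s - (s - y) ≡ 1ℚ
          e' = solve-∀ ℚring
        e : ∀ x y s → (1ℚ - 1ℚ * x) * ((1ℚ - 1ℚ * y) * ((1ℚ - 1ℚ * y) * (1ℚ + 1ℚ * (1ℚ * s)))) ≡ (1ℚ - x) * (1ℚ - y) * (1ℚ - y + s - y * s)
        e = solve-∀ ℚring
      go (yes p) (yes m) (no ¬c) = ≤-trans (≤-via (cong (λ w → 1ℚ - w) (trans (g-M≢ m ¬c) (cong (_* x l) (trans (ι-+ 1 2) (cong₂ _+_ ι1≡1 ι2≡))))) (nonneg⇒≤ (gap x≤y) (e₁ (x l) (y l))) refl)
        (≤-via (sym (trans (cong₂ _*_ (merge (x l) (y l) (inv-diff 2≤l)) refl) (trans (e₂ (x l) (y l)) (cong (λ w → 1ℚ - (1ℚ + 1ℚ) * x l - y l + (1ℚ + 1ℚ) * w) (inv-diff 2≤l)))))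
          (nonneg⇒≤ (0≤* (0≤* (0≤* (gap (inv≤1 l)) (gap (inv≤1 (l ℕ.∸ 1)))) (gap (inv≤1 (l ℕ.∸ 1)))) (0≤* (0≤e l) (0≤inv (l ℕ.∸ 2)))) (e₄ (x l) (y l) (ee l) (s l))) refl)
        where
        2≤l : 2 ℕ.≤ l
        2≤l = ℕP.≤-trans (s≤s (s≤s z≤n)) (M⇒6≤ m)
        x≤y : x l ≤ y l
        x≤y = inv-anti (ℕP.∸-monoˡ-≤ 1 2≤l) (ℕP.m∸n≤m l 1)
        e₁ : ∀ x y → 1ℚ - (1ℚ + (1ℚ + 1ℚ)) * x + (y - x) ≡ 1ℚ - (1ℚ + 1ℚ) * x - y + (1ℚ + 1ℚ) * (y - x)
        e₁ = solve-∀ ℚring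
        e₂ : ∀ x y → (1ℚ - (1ℚ + 1ℚ) * x) * (1ℚ - y) ≡ 1ℚ - (1ℚ + 1ℚ) * x - y + (1ℚ + 1ℚ) * (x * y)
        e₂ = solve-∀ ℚring
        e₄ : ∀ x y u s → (1ℚ - x) * (1ℚ - y) * (1ℚ - y) + (1ℚ - x) * (1ℚ - y) * (1ℚ - y) * (u * s) ≡ (1ℚ - 1ℚ * x) * ((1ℚ - 1ℚ * y) * ((1ℚ - 1ℚ * y) * (1ℚ + 1ℚ * (u * s))))
        e₄ = solve-∀ ℚring

-- Rough numbers, the shifted condition, and its mean over rough numbers.

module TypeISums where

  open Rationals
  open FiniteSums
  open Congruences
  open FundamentalLemma
  open ChebyshevBounds using (isPrime?)
  open MertensBounds
  open Sieves
  open import Data.Empty using (⊥)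
  open import Data.Nat as ℕ using (ℕ; s≤s)
  import Data.Nat.Properties as ℕP
  import Data.Nat.Divisibility as ℕD
  open import Data.Nat.Coprimality using (1-coprimeTo)
  open import Data.Nat.Primality using (Prime)
  open import Data.Rational using (ℚ; 0ℚ; 1ℚ; _+_; _*_; -_; _-_; _≤_)
  open import Data.Rational.Properties
  open import Data.Product using (_×_; _,_; proj₁)
  open import Relation.Nullary using (Dec; yes; no; ¬_; contradiction; _×-dec_; ¬?)
  open import Relation.Binary.PropositionalEquality using (_≡_; refl; sym; trans; cong; cong₂; subst)
  open import Tactic.RingSolver using (solve-∀)

  ∏-tail : ∀ m n f → (∀ k → f (m ℕ.+ k) ≡ 1ℚ) → ∏ (m ℕ.+ n) f ≡ ∏ m f
  ∏-tail m n f h = trans (∏-split m n f) (trans (cong (∏ m f *_) (trans (∏-cong n (λ k _ → h k)) (∏-one n))) (*-identityʳ (∏ m f)))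

  0≤1-⟨⟩⟨⟩ : ∀ {p} {A : Set p} {q} {B : Set q} (d : Dec A) (d' : Dec B) → 0ℚ ≤ 1ℚ - ⟨ d ⟩ * ⟨ d' ⟩
  0≤1-⟨⟩⟨⟩ d d' = gap (≤-via refl (*-mono (0≤⟨⟩ d) 0≤1 (⟨⟩≤1 d) (⟨⟩≤1 d')) (*-identityʳ 1ℚ))

  1-⟨⟩⟨⟩≤1 : ∀ {p} {A : Set p} {q} {B : Set q} (d : Dec A) (d' : Dec B) → 1ℚ - ⟨ d ⟩ * ⟨ d' ⟩ ≤ 1ℚ
  1-⟨⟩⟨⟩≤1 d d' = 1-≤1 (0≤* (0≤⟨⟩ d) (0≤⟨⟩ d'))

  rough : ℕ → ℕ → ℚ
  rough Z n = ∏ Z (λ l → 1ℚ - pr l * ⟨ cg? l n 0 ⟩)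

  0≤rough : ∀ Z n → 0ℚ ≤ rough Z n
  0≤rough Z n = ∏-nonneg Z (λ l _ → 0≤1-⟨⟩⟨⟩ (isPrime? l) (cg? l n 0))

  rough≤1 : ∀ Z n → rough Z n ≤ 1ℚ
  rough≤1 Z n = ∏-≤1 Z (λ l _ → 0≤1-⟨⟩⟨⟩ (isPrime? l) (cg? l n 0)) (λ l _ → 1-⟨⟩⟨⟩≤1 (isPrime? l) (cg? l n 0))

  rough-antitone : ∀ {Z Z'} n → Z ℕ.≤ Z' → rough Z' n ≤ rough Z n
  rough-antitone {Z} {Z'} n p = ≤-via (cong (λ w → rough w n) (sym (ℕP.m+[n∸m]≡n p))) (∏-antitone Z (Z' ℕ.∸ Z) {λ l → 1ℚ - pr l * ⟨ cg? l n 0 ⟩} (λ l → 0≤1-⟨⟩⟨⟩ (isPrime? l) (cg? l n 0)) (λ l → 1-⟨⟩⟨⟩≤1 (isPrime? l) (cg? l n 0))) refl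

  rough-zero : ∀ {Z n p} → Prime p → p ℕ.< Z → p ℕD.∣ n → rough Z n ≡ 0ℚ
  rough-zero {Z} {n} {p} pp p<Z p∣n = ∏-zero Z (λ l → 1ℚ - pr l * ⟨ cg? l n 0 ⟩) p p<Z
    (cong₂ (λ a b → 1ℚ - a * b) (⟨⟩-yes (isPrime? p) pp) (⟨⟩-yes (cg? p n 0) (∣⇒cg0 p∣n)))

  rough-one : ∀ {Z n} → (∀ {p} → Prime p → p ℕ.< Z → ¬ p ℕD.∣ n) → rough Z n ≡ 1ℚ
  rough-one {Z} {n} h = trans (∏-cong Z (λ l l<Z → go l l<Z (isPrime? l) (cg? l n 0))) (∏-one Z)
    where
    go : ∀ l → l ℕ.< Z → (d : Dec (Prime l)) (d' : Dec (Cg l n 0)) → 1ℚ - ⟨ d ⟩ * ⟨ d' ⟩ ≡ 1ℚ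
    go l l<Z (yes p) (yes c) = contradiction (cg0⇒∣ c) (h p l<Z)
    go l l<Z (yes p) (no _) = refl
    go l l<Z (no _) d' = trans (cong (λ w → 1ℚ - w) (*-zeroˡ ⟨ d' ⟩)) refl

  ε : ℚ
  ε = hp 200

  -- The length at which sieving up to `bl i` is accurate to 2 ^ -200, with 706 = 200 + 200 + 306.
  -- As 706 ≤ 1024, ten squarings of `bl i` reach it.
  Large : ℕ → ℚ → Set
  Large i X = pw (2 ℕ.^ i ℕ.* (200 ℕ.+ 200 ℕ.+ 306)) ≤ X

  large : ∀ {i X} → ι (bl (i ℕ.+ 10)) ≤ X → Large i X
  large {i} h = ≤-trans (pw-mono (ℕP.≤-trans (ℕP.*-monoʳ-≤ (2 ℕ.^ i) {706} {1024} (ℕP.≤ᵇ⇒≤ 706 1024 _)) (ℕP.≤-reflexive (sym (ℕP.^-distribˡ-+-* 2 i 10))))) h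

  0≤ε : 0ℚ ≤ ε
  0≤ε = 0≤hp 200

  close-refl : ∀ T → ∣ ι T - ι T ∣≤ ι 2
  close-refl T = ≤-via refl (neg-antimono-≤ (0≤ι 2)) (sym (+-inverseʳ (ι T))) , ≤-via (+-inverseʳ (ι T)) (0≤ι 2) refl

  -- Along a progression of difference Q the primes dividing Q cannot be sieved by, so they are
  -- omitted.
  module Coprime-to (Q : ℕ) where

    P : ℕ → Set
    P l = Prime l × ¬ l ℕD.∣ Q

    P? : ∀ l → Dec (P l)
    P? l = isPrime? l ×-dec ¬? (l ℕD.∣? Q)

  module Setup (w r N : ℕ) (3≤w : 3 ℕ.≤ w) where

    W z : ℕ
    W = bl w
    z = bl r

    -- For l dividing N, the condition l ∣ N - p would mean l ∣ p, which a large prime p excludes by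
    -- itself. Leaving such l out makes N a nonzero class mod every l in M.
    M : ℕ → Set
    M l = Prime l × W ℕ.≤ l × l ℕ.< z × ¬ l ℕD.∣ N

    M? : ∀ l → Dec (M l)
    M? l = isPrime? l ×-dec (W ℕ.≤? l) ×-dec (l ℕ.<? z) ×-dec ¬? (l ℕD.∣? N)

    μ : ℕ → ℚ
    μ l = ⟨ M? l ⟩

    M⇒6≤ : ∀ {l} → M l → 6 ℕ.≤ l
    M⇒6≤ (_ , W≤l , _) = ℕP.≤-trans (ℕP.≤-trans (ℕP.≤ᵇ⇒≤ 6 256 _) (bl-mono 3≤w)) W≤l

    N≢0 : ∀ {l} → M l → ¬ Cg l N 0
    N≢0 (_ , _ , _ , l∤N) c = l∤N (cg0⇒∣ c)

    μ-beyond : ∀ k → μ (z ℕ.+ k) ≡ 0ℚ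
    μ-beyond k = ⟨⟩-no (M? (z ℕ.+ k)) λ (_ , _ , lt , _) → ℕP.<⇒≱ lt (ℕP.m≤m+n z k)

    -- The indicator of N - n having no prime factor in M, as a congruence to avoid truncated subtraction.
    χ : ℕ → ℚ
    χ n = ∏ z (λ l → 1ℚ - μ l * ⟨ cg? l n N ⟩)

    0≤χ : ∀ n → 0ℚ ≤ χ n
    0≤χ n = ∏-nonneg z (λ l _ → 0≤1-⟨⟩⟨⟩ (M? l) (cg? l n N))

    χ≤1 : ∀ n → χ n ≤ 1ℚ
    χ≤1 n = ∏-≤1 z (λ l _ → 0≤1-⟨⟩⟨⟩ (M? l) (cg? l n N)) (λ l _ → 1-⟨⟩⟨⟩≤1 (M? l) (cg? l n N))

    -- The density of the class of N among the nonzero classes mod l; `V₀` is the resulting density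
    -- of `χ` among rough numbers.
    κ : ℕ → ℚ
    κ l = μ l * inv (l ℕ.∸ 1)

    0≤κ : ∀ l → 0ℚ ≤ κ l
    0≤κ l = 0≤* (0≤⟨⟩ (M? l)) (0≤inv (l ℕ.∸ 1))

    κ≤1 : ∀ l → κ l ≤ 1ℚ
    κ≤1 l = ≤-via refl (*-mono (0≤⟨⟩ (M? l)) 0≤1 (⟨⟩≤1 (M? l)) (inv≤1 (l ℕ.∸ 1))) (*-identityʳ 1ℚ)

    V₀ : ℚ
    V₀ = ∏ z (λ l → 1ℚ - κ l)

    0≤V₀ : 0ℚ ≤ V₀
    0≤V₀ = ∏-nonneg z (λ l _ → gap (κ≤1 l))

    V₀≤1 : V₀ ≤ 1ℚ
    V₀≤1 = ∏-≤1 z (λ l _ → gap (κ≤1 l)) (λ l _ → 1-≤1 (0≤κ l))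

    f : ℕ → ℚ
    f n = χ n - V₀

    χ-tail : ∀ k n → ∏ (z ℕ.+ k) (λ l → 1ℚ - μ l * ⟨ cg? l n N ⟩) ≡ χ n
    χ-tail k n = ∏-tail z k (λ l → 1ℚ - μ l * ⟨ cg? l n N ⟩) (λ j → trans (cong (λ u → 1ℚ - u * ⟨ cg? (z ℕ.+ j) n N ⟩) (μ-beyond j)) (e ⟨ cg? (z ℕ.+ j) n N ⟩))
      where
      e : ∀ x → 1ℚ - 0ℚ * x ≡ 1ℚ
      e = solve-∀ ℚring

    V₀-tail : ∀ k → ∏ (z ℕ.+ k) (λ l → 1ℚ - κ l) ≡ V₀
    V₀-tail k = ∏-tail z k (λ l → 1ℚ - κ l) (λ j → trans (cong (λ u → 1ℚ - u * inv (z ℕ.+ j ℕ.∸ 1)) (μ-beyond j)) (e (inv (z ℕ.+ j ℕ.∸ 1))))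
      where
      e : ∀ x → 1ℚ - 0ℚ * x ≡ 1ℚ
      e = solve-∀ ℚring

    idem : ∀ {p} {A : Set p} {q} {B : Set q} (d : Dec A) (d' : Dec B) → (1ℚ - ⟨ d ⟩ * ⟨ d' ⟩) * (1ℚ - ⟨ d ⟩ * ⟨ d' ⟩) ≡ 1ℚ - ⟨ d ⟩ * ⟨ d' ⟩
    idem (yes _) (yes _) = refl
    idem (yes _) (no _) = refl
    idem (no _) (yes _) = refl
    idem (no _) (no _) = refl

    -- Sieving n by the class 0, and N - n by the primes in M.
    module Shifted (Q : ℕ) (M⇒∤Q : ∀ {l} → M l → ¬ l ℕD.∣ Q) where
      open Coprime-to Q public
      open Build P M P? M? proj₁ (λ m → proj₁ m , M⇒∤Q m) M⇒6≤ (λ _ → N) (λ _ → N) N≢0 N≢0 public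

      h≡ : ∀ k n → h (z ℕ.+ k) n ≡ ∏ (z ℕ.+ k) (λ l → 1ℚ - ⟨ P? l ⟩ * ⟨ cg? l n 0 ⟩) * χ n
      h≡ k n = trans (∏-cong (z ℕ.+ k) (λ l _ → trans (1-β l n) (cong ((1ℚ - ⟨ P? l ⟩ * ⟨ cg? l n 0 ⟩) *_) (idem (M? l) (cg? l n N)))))
        (trans (∏-* (z ℕ.+ k) (λ l → 1ℚ - ⟨ P? l ⟩ * ⟨ cg? l n 0 ⟩) (λ l → 1ℚ - μ l * ⟨ cg? l n N ⟩)) (cong (∏ (z ℕ.+ k) (λ l → 1ℚ - ⟨ P? l ⟩ * ⟨ cg? l n 0 ⟩) *_) (χ-tail k n)))

      V≡ : ∀ k → V (z ℕ.+ k) ≡ ∏ (z ℕ.+ k) (λ l → 1ℚ - ⟨ P? l ⟩ * inv l) * V₀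
      V≡ k = trans (∏-cong (z ℕ.+ k) (λ l _ → 1-g-same (λ _ → cg-refl) l))
        (trans (∏-* (z ℕ.+ k) (λ l → 1ℚ - ⟨ P? l ⟩ * inv l) (λ l → 1ℚ - κ l)) (cong (∏ (z ℕ.+ k) (λ l → 1ℚ - ⟨ P? l ⟩ * inv l) *_) (V₀-tail k)))

    M⇒1≢0 : ∀ {l} → M l → ¬ l ℕD.∣ 1
    M⇒1≢0 m l∣1 = contradiction (subst (6 ℕ.≤_) (ℕD.∣1⇒≡1 l∣1) (M⇒6≤ m)) λ { (s≤s ()) }

  module Unshifted (Q : ℕ) where
    open Coprime-to Q public
    open Build P (λ _ → ⊥) P? (λ _ → no λ ()) proj₁ (λ ()) (λ ()) (λ _ → 0) (λ _ → 0) (λ ()) (λ ()) public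

    h≡ : ∀ Z n → h Z n ≡ ∏ Z (λ l → 1ℚ - ⟨ P? l ⟩ * ⟨ cg? l n 0 ⟩)
    h≡ Z n = ∏-cong Z (λ l _ → trans (1-β l n) (e (1ℚ - ⟨ P? l ⟩ * ⟨ cg? l n 0 ⟩) ⟨ cg? l n 0 ⟩))
      where
      e : ∀ x y → x * ((1ℚ - 0ℚ * y) * (1ℚ - 0ℚ * y)) ≡ x
      e = solve-∀ ℚring

    V≡ : ∀ Z → V Z ≡ ∏ Z (λ l → 1ℚ - ⟨ P? l ⟩ * inv l)
    V≡ Z = ∏-cong Z (λ l _ → trans (1-g-same (λ ()) l) (e (1ℚ - ⟨ P? l ⟩ * inv l) (inv (l ℕ.∸ 1))))
      where
      e : ∀ x y → x * (1ℚ - 0ℚ * y) ≡ x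
      e = solve-∀ ℚring

  pr-coprime-1 : ∀ l → ⟨ Coprime-to.P? 1 l ⟩ ≡ pr l
  pr-coprime-1 l = ⟨⟩-⇔ (Coprime-to.P? 1 l) (isPrime? l) proj₁ (λ p → p , λ l∣1 → contradiction (subst (2 ℕ.≤_) (ℕD.∣1⇒≡1 l∣1) (prime⇒2≤ p)) λ { (s≤s ()) })

  rough-1 : ∀ Z n → ∏ Z (λ l → 1ℚ - ⟨ Coprime-to.P? 1 l ⟩ * ⟨ cg? l n 0 ⟩) ≡ rough Z n
  rough-1 Z n = ∏-cong Z (λ l _ → cong (λ u → 1ℚ - u * ⟨ cg? l n 0 ⟩) (pr-coprime-1 l))

  ρ-1 : ∀ Z → ∏ Z (λ l → 1ℚ - ⟨ Coprime-to.P? 1 l ⟩ * inv l) ≡ ρ Z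
  ρ-1 Z = ∏-cong Z (λ l _ → cong (λ u → 1ℚ - u * inv l) (pr-coprime-1 l))

  n≡0+1*n : ∀ n → 0 ℕ.+ 1 ℕ.* n ≡ n
  n≡0+1*n n = ℕP.+-identityʳ n

  rough-count : ∀ i T → Large i (ι T) → ∣ ∑ T (rough (bl i)) - ι T * ρ (bl i) ∣≤ ι T * (ρ (bl i) * ε)
  rough-count i T big = abs-≡ (cong₂ (λ a b → a - ι T * b) (∑-cong T (λ n _ → trans (h≡ (bl i) (0 ℕ.+ 1 ℕ.* n)) (trans (rough-1 (bl i) (0 ℕ.+ 1 ℕ.* n)) (cong (rough (bl i)) (n≡0+1*n n))))) V≡ρ)
      (abs-weaken (≤-reflexive (cong (λ b → ι T * (b * ε)) V≡ρ)) (fundamental-lemma i 200 0 1 T (ι T) (λ {l} _ _ → 1-coprimeTo l) (close-refl T) big))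
    where
    open Unshifted 1
    V≡ρ : V (bl i) ≡ ρ (bl i)
    V≡ρ = trans (V≡ (bl i)) (ρ-1 (bl i))

  module TypeI (w r N T k : ℕ) (3≤w : 3 ℕ.≤ w) (big : Large (r ℕ.+ k) (ι T)) where
    open Setup w r N 3≤w

    private
      i y d : ℕ
      i = r ℕ.+ k
      y = bl i
      d = y ℕ.∸ z
      z+d : z ℕ.+ d ≡ y
      z+d = ℕP.m+[n∸m]≡n (bl-mono (ℕP.m≤m+n r k))

    shifted-count : ∣ ∑ T (λ n → rough y n * χ n) - ι T * (ρ y * V₀) ∣≤ ι T * (ρ y * V₀ * ε)
    shifted-count = abs-≡ (cong₂ (λ a b → a - ι T * b) (∑-cong T (λ n _ → h≡χ n)) V≡ρ)
        (abs-weaken (≤-reflexive (cong (λ b → ι T * (b * ε)) V≡ρ)) (fundamental-lemma i 200 0 1 T (ι T) (λ {l} _ _ → 1-coprimeTo l) (close-refl T) big))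
      where
      open Shifted 1 M⇒1≢0
      V≡ρ : V y ≡ ρ y * V₀
      V≡ρ = trans (cong V (sym z+d)) (trans (V≡ d) (cong (_* V₀) (trans (ρ-1 (z ℕ.+ d)) (cong ρ z+d))))
      h≡χ : ∀ n → h y (0 ℕ.+ 1 ℕ.* n) ≡ rough y n * χ n
      h≡χ n = trans (cong₂ h (sym z+d) (n≡0+1*n n)) (trans (h≡ d n) (cong (_* χ n) (trans (rough-1 (z ℕ.+ d) n) (cong (λ u → rough u n) z+d))))

    -- The fundamental lemma evaluates the sums of `rough y * χ` and of `rough y` with densities ρ
    -- V₀ and ρ. The main terms cancel and two relative errors ε remain.
    typeI : - ((1ℚ + 1ℚ) * (ι T * (ρ y * V₀ * ε))) ≤ ∑ T (λ n → rough y n * f n)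
    typeI = ≤-via (e (ι T) (ρ y) V₀ ε) (+-mono-≤ (abs-lo {∑ T (λ n → rough y n * χ n)} {ι T * (ρ y * V₀)} shifted-count) (neg-antimono-≤ (*-monoˡ 0≤V₀ (abs-hi {∑ T (rough y)} {ι T * ρ y} (rough-count i T big)))))
        (trans (cong (λ u → ∑ T (λ n → rough y n * χ n) + - u) (sym (∑-*ʳ T V₀ (rough y)))) (trans (sym (∑-minus T (λ n → rough y n * χ n) (λ n → rough y n * V₀))) (∑-cong T (λ n _ → e' (rough y n) (χ n) V₀))))
      where
      e : ∀ t ρ v ε → - ((1ℚ + 1ℚ) * (t * (ρ * v * ε))) ≡ t * (ρ * v) - t * (ρ * v * ε) + - ((t * ρ + t * (ρ * ε)) * v)
      e = solve-∀ ℚring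
      e' : ∀ a b c → a * b - a * c ≡ a * (b - c)
      e' = solve-∀ ℚring

-- The mean of the correlation factor over rough multipliers.

module Correlations where

  open Rationals
  open FiniteSums
  open Congruences
  open FundamentalLemma
  open ChebyshevBounds using (isPrime?)
  open MertensBounds
  open Sieves
  open TypeISums
  open import Data.Nat as ℕ using (ℕ; zero; suc; z≤n; s≤s)
  import Data.Nat.Properties as ℕP
  import Data.Nat.Divisibility as ℕD
  open import Data.Nat.Primality using (Prime; euclidsLemma)
  open import Data.Rational using (ℚ; 0ℚ; 1ℚ; _+_; _*_; -_; _-_; _≤_)
  open import Data.Rational.Properties
  open import Data.Product using (Σ; _,_; proj₁; proj₂)
  open import Data.Sum using (_⊎_; inj₁; inj₂)
  open import Relation.Nullary using (Dec; yes; no; ¬_)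
  open import Relation.Binary.PropositionalEquality using (_≡_; refl; sym; trans; cong; cong₂; subst)
  open import Tactic.RingSolver using (solve-∀)

  ρ-off : ℕ → ℕ → ℚ
  ρ-off Q Z = ∏ Z (λ l → 1ℚ - ⟨ Coprime-to.P? Q l ⟩ * inv l)

  ρ-off-1 : ∀ Z → ρ-off 1 Z ≡ ρ Z
  ρ-off-1 = ρ-1

  private
    off≤1 : ∀ Q l → ⟨ Coprime-to.P? Q l ⟩ * inv l ≤ 1ℚ
    off≤1 Q l = ≤-via refl (*-mono (0≤⟨⟩ (Coprime-to.P? Q l)) 0≤1 (⟨⟩≤1 (Coprime-to.P? Q l)) (inv≤1 l)) (*-identityʳ 1ℚ)

  0≤ρ-off : ∀ Q Z → 0ℚ ≤ ρ-off Q Z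
  0≤ρ-off Q Z = ∏-nonneg Z (λ l _ → gap (off≤1 Q l))

  -- Omitting one more prime p loses at most the factor 1 / (1 - 1 / p) ≤ 2.
  ρ-off-extend : ∀ q Q p Z → 2 ℕ.≤ p → (∀ {l} → Prime l → ¬ l ≡ p → ¬ l ℕD.∣ q → ¬ l ℕD.∣ Q) → ρ-off Q Z ≤ ι 2 * ρ-off q Z
  ρ-off-extend q Q p Z 2≤p h = ∏-except Z (ι 2) p (1≤ι 1) (λ l → gap (off≤1 Q l)) (λ l → gap (off≤1 q l)) other at-p
    where
    module q = Coprime-to q
    module Q = Coprime-to Q
    other : ∀ l → ¬ l ≡ p → 1ℚ - ⟨ Q.P? l ⟩ * inv l ≤ 1ℚ - ⟨ q.P? l ⟩ * inv l
    other l l≢p = +-monoʳ-≤ 1ℚ (neg-antimono-≤ (*-monoˡ (0≤inv l) (⟨⟩-⇒ (q.P? l) (Q.P? l) (λ (pl , l∤q) → pl , h pl l≢p l∤q))))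
    half : ι 2 * inv p ≤ 1ℚ
    half = ≤-via refl (*-monoˡ (0≤inv p) (ι-mono 2≤p)) (ι-inv′ (ℕP.≤-trans (s≤s z≤n) 2≤p))
    at-p : 1ℚ - ⟨ Q.P? p ⟩ * inv p ≤ ι 2 * (1ℚ - ⟨ q.P? p ⟩ * inv p)
    at-p = ≤-trans (1-≤1 (0≤* (0≤⟨⟩ (Q.P? p)) (0≤inv p)))
      (nonneg⇒≤ (0≤+ (gap half) (0≤* (0≤* (0≤ι 2) (gap (⟨⟩≤1 (q.P? p)))) (0≤inv p))) (trans (e (ι 2) ⟨ q.P? p ⟩ (inv p)) (trans (cong (λ u → u - ι 2 * ⟨ q.P? p ⟩ * inv p) (sym ι2≡)) (e'' (ι 2) ⟨ q.P? p ⟩ (inv p)))))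
      where
      e : ∀ t a x → 1ℚ + (1ℚ - t * x + t * (1ℚ - a) * x) ≡ (1ℚ + 1ℚ) - t * a * x
      e = solve-∀ ℚring
      e'' : ∀ t a x → t - t * a * x ≡ t * (1ℚ - a * x)
      e'' = solve-∀ ℚring

  -- The second summand covers the progressions too short for the fundamental lemma.
  rough-in-AP : ∀ r a q T X → ∣ ι T - X ∣≤ ι 2 → 0ℚ ≤ X →
    ∑ T (λ t → rough (bl r) (a ℕ.+ q ℕ.* t)) ≤ ι 2 * (X * ρ-off q (bl r)) + (pw (2 ℕ.^ r ℕ.* 706) + ι 2)
  rough-in-AP r a q T X cl 0≤X with ≤-total (pw (2 ℕ.^ r ℕ.* 706)) X
  ... | inj₁ big = ≤-trans (∑-mono T (λ t _ → rough≤h (a ℕ.+ q ℕ.* t)))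
      (≤-trans (abs-hi {S (bl r) a q T} {X * V (bl r)} (fundamental-lemma r 200 a q T X cop cl big))
        (≤-trans (nonneg⇒≤ (0≤* (0≤* 0≤X (V≥0 (bl r))) (gap (hp≤1 200))) (trans (e X (V (bl r)) ε) (cong₂ (λ u v → u * (X * v)) (sym ι2≡) (V≡ (bl r)))))
          (x≤x+y (0≤+ (0≤pw (2 ℕ.^ r ℕ.* 706)) (0≤ι 2)))))
    where
    open Unshifted q
    e : ∀ X v ε → X * v + X * (v * ε) + X * v * (1ℚ - ε) ≡ (1ℚ + 1ℚ) * (X * v)
    e = solve-∀ ℚring
    cop : Cop q (bl r)
    cop _ eq = coprime-sym (∤⇒coprime (proj₁ (C⇒P eq)) (proj₂ (C⇒P eq)))
    rough≤h : ∀ n → rough (bl r) n ≤ h (bl r) n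
    rough≤h n = ≤-via refl (∏-mono (bl r) (λ l _ → 0≤1-⟨⟩⟨⟩ (isPrime? l) (cg? l n 0)) (λ l _ → +-monoʳ-≤ 1ℚ (neg-antimono-≤ (*-monoˡ (0≤⟨⟩ (cg? l n 0)) (⟨⟩-⇒ (P? l) (isPrime? l) proj₁))))) (sym (h≡ (bl r) n))
  ... | inj₂ small = ≤-trans (≤-via refl (∑-mono T (λ t _ → rough≤1 (bl r) (a ℕ.+ q ℕ.* t))) (trans (∑-const T 1ℚ) (*-identityʳ (ι T))))
      (≤-trans (abs-hi {ι T} {X} cl) (≤-trans (+-monoˡ-≤ (ι 2) small) (nonneg⇒≤ (0≤* (0≤ι 2) (0≤* 0≤X (0≤ρ-off q (bl r)))) (+-comm (pw (2 ℕ.^ r ℕ.* 706) + ι 2) (ι 2 * (X * ρ-off q (bl r)))))))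

  module Correlation (w r N : ℕ) (3≤w : 3 ℕ.≤ w) (w≤r : w ℕ.≤ r) where
    open Setup w r N 3≤w

    -- The densities of the conditions given by the multipliers p₁ and n multiply up to this factor, which
    -- comes from the l for which their classes coincide.
    H : ℕ → ℕ → ℕ → ℚ
    H p₁ Z n = ∏ Z (λ l → 1ℚ + μ l * (⟨ cg? l n p₁ ⟩ * inv (l ℕ.∸ 2)))

    -- `Π` bounds the mean of `H`: a share 1 / l of the n is congruent to p₁ mod l, and the 2
    -- accounts for l being lost to the sieve. `Π'` has no such share, as it multiplies the error E,
    -- which does not shrink on passing to subprogressions.
    Π Π' : ℕ → ℚ
    Π Z = ∏ Z (λ l → 1ℚ + μ l * (ι 2 * (inv l * inv (l ℕ.∸ 2))))
    Π' Z = ∏ Z (λ l → 1ℚ + μ l * inv (l ℕ.∸ 2))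

    0≤μ : ∀ l → 0ℚ ≤ μ l
    0≤μ l = 0≤⟨⟩ (M? l)

    1≤H : ∀ p₁ Z n → 1ℚ ≤ H p₁ Z n
    1≤H p₁ Z n = ∏-≥1 Z (λ l _ → x≤x+y (0≤* (0≤μ l) (0≤* (0≤⟨⟩ (cg? l n p₁)) (0≤inv (l ℕ.∸ 2)))))

    E : ℚ
    E = pw (2 ℕ.^ r ℕ.* 706) + ι 2

    0≤E : 0ℚ ≤ E
    0≤E = 0≤+ (0≤pw (2 ℕ.^ r ℕ.* 706)) (0≤ι 2)

    private
      Unit : ℕ → ℕ → Set
      Unit q Z = ∀ {l} → l ℕ.< Z → M l → ¬ l ℕD.∣ q

      HSum : ℕ → ℕ → ℕ → ℕ → ℕ → ℚ
      HSum p₁ Z a q T = ∑ T (λ t → rough z (a ℕ.+ q ℕ.* t) * H p₁ Z (a ℕ.+ q ℕ.* t))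

      -- The function φ is 0 for the sum of H and 1 for the sum of H - 1.
      step : ∀ p₁ Z a q T (φ : ℕ → ℚ) → ∑ T (λ t → rough z (a ℕ.+ q ℕ.* t) * (H p₁ (suc Z) (a ℕ.+ q ℕ.* t) - φ (a ℕ.+ q ℕ.* t))) ≡
        ∑ T (λ t → rough z (a ℕ.+ q ℕ.* t) * (H p₁ Z (a ℕ.+ q ℕ.* t) - φ (a ℕ.+ q ℕ.* t))) + μ Z * inv (Z ℕ.∸ 2) * ∑ T (λ t → ⟨ cg? Z (a ℕ.+ q ℕ.* t) p₁ ⟩ * (rough z (a ℕ.+ q ℕ.* t) * H p₁ Z (a ℕ.+ q ℕ.* t)))
      step p₁ Z a q T φ = trans (∑-cong T (λ t _ → e (rough z (n t)) (H p₁ Z (n t)) (μ Z) ⟨ cg? Z (n t) p₁ ⟩ (inv (Z ℕ.∸ 2)) (φ (n t))))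
        (trans (∑-+ T (λ t → rough z (n t) * (H p₁ Z (n t) - φ (n t))) (λ t → μ Z * inv (Z ℕ.∸ 2) * (⟨ cg? Z (n t) p₁ ⟩ * (rough z (n t) * H p₁ Z (n t)))))
          (cong (∑ T (λ t → rough z (n t) * (H p₁ Z (n t) - φ (n t))) +_) (∑-*ˡ T (μ Z * inv (Z ℕ.∸ 2)) (λ t → ⟨ cg? Z (n t) p₁ ⟩ * (rough z (n t) * H p₁ Z (n t))))))
        where
        n : ℕ → ℕ
        n t = a ℕ.+ q ℕ.* t
        e : ∀ R H m c s φ → R * (H * (1ℚ + m * (c * s)) - φ) ≡ R * (H - φ) + m * s * (c * (R * H))
        e = solve-∀ ℚring

      bound : ℕ → ℕ → ℚ → ℚ
      bound q Z X = ι 2 * (X * ρ-off q z) * Π Z + E * Π' Z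

      -- The factor of H at Z acts only on n ≡ p₁ mod Z, a progression of difference q Z to which
      -- the induction hypothesis `rec` applies; the sieve there omits Z as well, at the cost of a
      -- factor 2.
      sub-bound : ∀ p₁ Z a q T X → ∣ ι T - X ∣≤ ι 2 → 0ℚ ≤ X → Unit q (suc Z) →
        (∀ a' T' → ∣ ι T' - X * inv Z ∣≤ ι 2 → Unit (q ℕ.* Z) Z → HSum p₁ Z a' (q ℕ.* Z) T' ≤ bound (q ℕ.* Z) Z (X * inv Z)) →
        μ Z * inv (Z ℕ.∸ 2) * ∑ T (λ t → ⟨ cg? Z (a ℕ.+ q ℕ.* t) p₁ ⟩ * (rough z (a ℕ.+ q ℕ.* t) * H p₁ Z (a ℕ.+ q ℕ.* t)))
        ≤ ι 2 * (X * ρ-off q z) * (Π (suc Z) - Π Z) + E * (Π' (suc Z) - Π' Z)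
      sub-bound p₁ Z a q T X cl 0≤X unit rec = go (M? Z)
        where
        n : ℕ → ℕ
        n t = a ℕ.+ q ℕ.* t
        σ : ℚ
        σ = ∑ T (λ t → ⟨ cg? Z (n t) p₁ ⟩ * (rough z (n t) * H p₁ Z (n t)))
        go : (d : Dec (M Z)) → ⟨ d ⟩ * inv (Z ℕ.∸ 2) * σ ≤ ι 2 * (X * ρ-off q z) * (Π Z * (1ℚ + ⟨ d ⟩ * (ι 2 * (inv Z * inv (Z ℕ.∸ 2)))) - Π Z) + E * (Π' Z * (1ℚ + ⟨ d ⟩ * inv (Z ℕ.∸ 2)) - Π' Z)
        go (no _) = ≤-reflexive (e (inv (Z ℕ.∸ 2)) σ (ι 2 * (X * ρ-off q z)) (Π Z) (ι 2 * (inv Z * inv (Z ℕ.∸ 2))) E (Π' Z))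
          where
          e : ∀ s σ x p y E p' → 0ℚ * s * σ ≡ x * (p * (1ℚ + 0ℚ * y) - p) + E * (p' * (1ℚ + 0ℚ * s) - p')
          e = solve-∀ ℚring
        go (yes m) = ≤-trans (*-monoʳ (0≤* 0≤1 (0≤inv (Z ℕ.∸ 2))) (use (subAP Z q a p₁ T (prime⇒1≤ pZ) (coprime-sym (∤⇒coprime pZ (unit ℕP.≤-refl m))))))
            (nonneg⇒≤ (0≤* (0≤* (0≤* (0≤inv (Z ℕ.∸ 2)) (0≤* (0≤ι 2) (0≤* 0≤X (0≤inv Z)))) 0≤Π) (gap extend)) (e (inv (Z ℕ.∸ 2)) (ι 2) X (inv Z) (Π Z) (ρ-off q z) (ρ-off (q ℕ.* Z) z) E (Π' Z)))
          where
          pZ : Prime Z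
          pZ = proj₁ m
          0≤Π : 0ℚ ≤ Π Z
          0≤Π = ∏-nonneg Z (λ l _ → 0≤+ 0≤1 (0≤* (0≤μ l) (0≤* (0≤ι 2) (0≤* (0≤inv l) (0≤inv (l ℕ.∸ 2))))))
          unit' : Unit (q ℕ.* Z) Z
          unit' {l} l<Z ml l∣ with euclidsLemma q Z (proj₁ ml) l∣
          ... | inj₁ d = unit (ℕP.m<n⇒m<1+n l<Z) ml d
          ... | inj₂ d = ℕP.<⇒≢ l<Z (prime∣prime (proj₁ ml) pZ d)
          extend : ρ-off (q ℕ.* Z) z ≤ ι 2 * ρ-off q z
          extend = ρ-off-extend q (q ℕ.* Z) Z z (prime⇒2≤ pZ) λ pl l≢Z l∤q l∣ → not pl l≢Z l∤q (euclidsLemma q Z pl l∣)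
            where
            not : ∀ {l} → Prime l → ¬ l ≡ Z → ¬ l ℕD.∣ q → ¬ (l ℕD.∣ q ⊎ l ℕD.∣ Z)
            not pl l≢Z l∤q (inj₁ d) = l∤q d
            not pl l≢Z l∤q (inj₂ d) = l≢Z (prime∣prime pl pZ d)
          use : SubAP Z q a p₁ T → σ ≤ bound (q ℕ.* Z) Z (X * inv Z)
          use (a' , T' , lo , hi , eq) = ≤-via (eq (λ n → rough z n * H p₁ Z n)) (rec a' T' (close-sub (prime⇒2≤ pZ) lo hi cl) unit') refl
          e : ∀ s t X i p ρ ρ' E p' → 1ℚ * s * (t * (X * i * ρ') * p + E * p') + s * (t * (X * i)) * p * (t * ρ - ρ') ≡ t * (X * ρ) * (p * (1ℚ + 1ℚ * (t * (i * s))) - p) + E * (p' * (1ℚ + 1ℚ * s) - p')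
          e = solve-∀ ℚring

      HSum≤ : ∀ p₁ Z a q T X → ∣ ι T - X ∣≤ ι 2 → 0ℚ ≤ X → Unit q Z → HSum p₁ Z a q T ≤ bound q Z X
      HSum≤ p₁ zero a q T X cl 0≤X _ = ≤-via (∑-cong T (λ t _ → *-identityʳ (rough z (a ℕ.+ q ℕ.* t)))) (rough-in-AP r a q T X cl 0≤X) (e (ι 2 * (X * ρ-off q z)) E)
        where
        e : ∀ x y → x + y ≡ x * 1ℚ + y * 1ℚ
        e = solve-∀ ℚring
      HSum≤ p₁ (suc Z) a q T X cl 0≤X unit = ≤-via (trans (∑-cong T (λ t _ → e₀ (rough z (n t)) (H p₁ (suc Z) (n t)))) (trans (step p₁ Z a q T (λ _ → 0ℚ)) (cong (_+ rest) (∑-cong T (λ t _ → sym (e₀ (rough z (n t)) (H p₁ Z (n t))))))))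
        (+-mono-≤ (HSum≤ p₁ Z a q T X cl 0≤X (λ l<Z → unit (ℕP.m<n⇒m<1+n l<Z)))
          (sub-bound p₁ Z a q T X cl 0≤X unit (λ a' T' cl' u → HSum≤ p₁ Z a' (q ℕ.* Z) T' (X * inv Z) cl' (0≤* 0≤X (0≤inv Z)) u)))
        (e (ι 2 * (X * ρ-off q z)) (Π Z) (Π (suc Z)) E (Π' Z) (Π' (suc Z)))
        where
        n : ℕ → ℕ
        n t = a ℕ.+ q ℕ.* t
        rest : ℚ
        rest = μ Z * inv (Z ℕ.∸ 2) * ∑ T (λ t → ⟨ cg? Z (n t) p₁ ⟩ * (rough z (n t) * H p₁ Z (n t)))
        e₀ : ∀ x y → x * y ≡ x * (y - 0ℚ)
        e₀ = solve-∀ ℚring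
        e : ∀ x p p₁ y p' p₁' → x * p + y * p' + (x * (p₁ - p) + y * (p₁' - p')) ≡ x * p₁ + y * p₁'
        e = solve-∀ ℚring

    -- Here the empty product contributes nothing, so only the increments of Π are collected. The
    -- resulting Π - 1 is the whole saving of the method.
    excess : ∀ p₁ Z a q T X → ∣ ι T - X ∣≤ ι 2 → 0ℚ ≤ X → (∀ {l} → l ℕ.< Z → M l → ¬ l ℕD.∣ q) →
      ∑ T (λ t → rough z (a ℕ.+ q ℕ.* t) * (H p₁ Z (a ℕ.+ q ℕ.* t) - 1ℚ)) ≤ ι 2 * (X * ρ-off q z) * (Π Z - 1ℚ) + E * (Π' Z - 1ℚ)
    excess p₁ zero a q T X cl 0≤X _ = ≤-reflexive (trans (trans (∑-cong T (λ t _ → e₀ (rough z (a ℕ.+ q ℕ.* t)))) (∑-zero T)) (e (ι 2 * (X * ρ-off q z)) E))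
      where
      e₀ : ∀ x → x * (1ℚ - 1ℚ) ≡ 0ℚ
      e₀ = solve-∀ ℚring
      e : ∀ x y → 0ℚ ≡ x * (1ℚ - 1ℚ) + y * (1ℚ - 1ℚ)
      e = solve-∀ ℚring
    excess p₁ (suc Z) a q T X cl 0≤X unit = ≤-via (step p₁ Z a q T (λ _ → 1ℚ))
        (+-mono-≤ (excess p₁ Z a q T X cl 0≤X (λ l<Z → unit (ℕP.m<n⇒m<1+n l<Z)))
          (sub-bound p₁ Z a q T X cl 0≤X unit (λ a' T' cl' u → HSum≤ p₁ Z a' (q ℕ.* Z) T' (X * inv Z) cl' (0≤* 0≤X (0≤inv Z)) u)))
        (e (ι 2 * (X * ρ-off q z)) (Π Z) (Π (suc Z)) E (Π' Z) (Π' (suc Z)))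
      where
      e : ∀ x p p₁ y p' p₁' → x * (p - 1ℚ) + y * (p' - 1ℚ) + (x * (p₁ - p) + y * (p₁' - p')) ≡ x * (p₁ - 1ℚ) + y * (p₁' - 1ℚ)
      e = solve-∀ ℚring

    private
      W+d : W ℕ.+ (z ℕ.∸ W) ≡ z
      W+d = ℕP.m+[n∸m]≡n (bl-mono w≤r)

      μ-below : ∀ {l} → l ℕ.< W → μ l ≡ 0ℚ
      μ-below l<W = ⟨⟩-no (M? _) λ (_ , W≤l , _) → ℕP.<⇒≱ l<W W≤l

      256≤W : 256 ℕ.≤ W
      256≤W = bl-mono {3} 3≤w

      3≤W : 3 ℕ.≤ W
      3≤W = ℕP.≤-trans (ℕP.≤ᵇ⇒≤ 3 256 _) 256≤W

      initial : ∀ (f : ℕ → ℚ) (c : ℕ → ℚ) → (∀ l → f l ≡ 1ℚ + μ l * c l) → ∏ W f ≡ 1ℚ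
      initial f c h = trans (∏-cong W (λ l l<W → trans (h l) (trans (cong (λ u → 1ℚ + u * c l) (μ-below l<W)) (e (c l))))) (∏-one W)
        where
        e : ∀ x → 1ℚ + 0ℚ * x ≡ 1ℚ
        e = solve-∀ ℚring

      offset : ∀ k → Σ ℕ λ m → W ℕ.+ k ≡ suc (suc (suc (suc m)))
      offset k = (W ℕ.+ k) ℕ.∸ 4 , sym (ℕP.m+[n∸m]≡n (ℕP.≤-trans (ℕP.≤-trans (ℕP.≤ᵇ⇒≤ 4 256 _) 256≤W) (ℕP.m≤m+n W k)))

      μ≤1 : ∀ l → μ l ≤ 1ℚ
      μ≤1 l = ⟨⟩≤1 (M? l)

    -- Over all integers l ≥ W the factors (l - 1) / (l - 2) telescope.
    Π'≤ : Π' z ≤ ι z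
    Π'≤ = ≤-trans (subst (λ Z → Π' Z ≤ ι (Z ℕ.∸ 2)) W+d (go (z ℕ.∸ W))) (ι-mono (ℕP.m∸n≤m z 2))
      where
      go : ∀ k → Π' (W ℕ.+ k) ≤ ι (W ℕ.+ k ℕ.∸ 2)
      go zero = ≤-via (trans (cong Π' (ℕP.+-identityʳ W)) (initial (λ l → 1ℚ + μ l * inv (l ℕ.∸ 2)) (λ l → inv (l ℕ.∸ 2)) (λ _ → refl)))
        (≤-via (sym ι1≡1) (ι-mono (ℕP.∸-monoˡ-≤ 2 3≤W)) (cong (λ k → ι (k ℕ.∸ 2)) (sym (ℕP.+-identityʳ W)))) refl
      go (suc k) = ≤-via (cong Π' (ℕP.+-suc W k)) (≤-trans (*-mono (≤-trans 0≤1 (∏-≥1 (W ℕ.+ k) (λ l _ → x≤x+y (0≤* (0≤μ l) (0≤inv (l ℕ.∸ 2)))))) (0≤+ 0≤1 (0≤inv (W ℕ.+ k ℕ.∸ 2))) (go k)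
          (+-monoʳ-≤ 1ℚ (≤-via refl (*-monoˡ (0≤inv (W ℕ.+ k ℕ.∸ 2)) (μ≤1 (W ℕ.+ k))) (*-identityˡ (inv (W ℕ.+ k ℕ.∸ 2))))))
          (≤-reflexive (shape (offset k)))) (cong (λ k → ι (k ℕ.∸ 2)) (sym (ℕP.+-suc W k)))
        where
        shape : (Σ ℕ λ m → W ℕ.+ k ≡ suc (suc (suc (suc m)))) → ι (W ℕ.+ k ℕ.∸ 2) * (1ℚ + inv (W ℕ.+ k ℕ.∸ 2)) ≡ ι (suc (W ℕ.+ k) ℕ.∸ 2)
        shape (m , eq) = trans (cong (λ k → ι (k ℕ.∸ 2) * (1ℚ + inv (k ℕ.∸ 2))) eq) (trans (e (ι (suc (suc m))) (inv (suc (suc m)))) (trans (cong (_+ ι (suc (suc m))) (ι-inv (suc m))) (trans (sym (ι-suc (suc (suc m)))) (cong (λ k → ι (suc k ℕ.∸ 2)) (sym eq)))))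
          where
          e : ∀ x y → x * (1ℚ + y) ≡ x * y + x
          e = solve-∀ ℚring

    -- The factors (l - 2) / (l - 1) over all integers telescope. This crude bound is only compared
    -- with large powers of z.
    V₀-lower : inv z ≤ V₀
    V₀-lower = ≤-trans (inv-anti (ℕP.m<n⇒0<n∸m (ℕP.≤-trans 3≤W (bl-mono w≤r))) (ℕP.m∸n≤m z 2)) (subst (λ Z → inv (Z ℕ.∸ 2) ≤ ∏ Z (λ l → 1ℚ - κ l)) W+d (go (z ℕ.∸ W)))
      where
      go : ∀ k → inv (W ℕ.+ k ℕ.∸ 2) ≤ ∏ (W ℕ.+ k) (λ l → 1ℚ - κ l)
      go zero = ≤-via refl (inv≤1 (W ℕ.+ 0 ℕ.∸ 2)) (sym (trans (cong (λ Z → ∏ Z (λ l → 1ℚ - κ l)) (ℕP.+-identityʳ W)) (initial (λ l → 1ℚ - κ l) (λ l → - inv (l ℕ.∸ 1)) (λ l → e (μ l) (inv (l ℕ.∸ 1))))))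
        where
        e : ∀ m x → 1ℚ - m * x ≡ 1ℚ + m * (- x)
        e = solve-∀ ℚring
      go (suc k) = ≤-via (trans (cong (λ k → inv (k ℕ.∸ 2)) (ℕP.+-suc W k)) (shape (offset k))) (*-mono (0≤inv (W ℕ.+ k ℕ.∸ 2)) (gap (κ≤1 (W ℕ.+ k))) (go k)
          (+-monoʳ-≤ 1ℚ (neg-antimono-≤ (≤-via refl (*-monoˡ (0≤inv (W ℕ.+ k ℕ.∸ 1)) (μ≤1 (W ℕ.+ k))) (*-identityˡ (inv (W ℕ.+ k ℕ.∸ 1)))))))
          (cong (λ Z → ∏ Z (λ l → 1ℚ - κ l)) (sym (ℕP.+-suc W k)))
        where
        shape : (Σ ℕ λ m → W ℕ.+ k ≡ suc (suc (suc (suc m)))) → inv (suc (W ℕ.+ k) ℕ.∸ 2) ≡ inv (W ℕ.+ k ℕ.∸ 2) * (1ℚ - inv (W ℕ.+ k ℕ.∸ 1))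
        shape (m , eq) = trans (cong (λ k → inv (suc k ℕ.∸ 2)) eq) (trans (sym (inv-step (suc m))) (cong (λ k → inv (k ℕ.∸ 2) * (1ℚ - inv (k ℕ.∸ 1))) (sym eq)))

    -- The majorant B starts at 1 and stays below 2, so the factor at l adds at most 4 / (l (l - 2))
    -- ≤ 4 / ((l - 2)(l - 3)), which is the increment of B.
    Π≤ : Π z - 1ℚ ≤ ι 4 * inv (W ℕ.∸ 3)
    Π≤ = ≤-trans (+-monoˡ-≤ (- 1ℚ) (subst (λ Z → Π Z ≤ B Z) W+d (go (z ℕ.∸ W)))) (nonneg⇒≤ (0≤* (0≤ι 4) (0≤inv (z ℕ.∸ 3))) (e (ι 4) (inv (W ℕ.∸ 3)) (inv (z ℕ.∸ 3))))
      where
      u : ℚ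
      u = inv (W ℕ.∸ 3)
      B : ℕ → ℚ
      B Z = 1ℚ + ι 4 * (u - inv (Z ℕ.∸ 3))
      e : ∀ c u v → 1ℚ + c * (u - v) - 1ℚ + c * v ≡ c * u
      e = solve-∀ ℚring
      B≤2 : ∀ Z → B Z ≤ ι 2
      B≤2 Z = ≤-via refl (+-monoʳ-≤ 1ℚ (≤-trans (*-monoʳ (0≤ι 4) (1-≤u Z)) (≤-via refl (*-monoʳ (0≤ι 4) (inv-anti {4} (s≤s z≤n) (ℕP.≤-trans (ℕP.≤ᵇ⇒≤ 4 253 _) (ℕP.∸-monoˡ-≤ 3 256≤W)))) (ι-inv 3)))) (sym ι2≡)
        where
        1-≤u : ∀ Z → u - inv (Z ℕ.∸ 3) ≤ u
        1-≤u Z = nonneg⇒≤ (0≤inv (Z ℕ.∸ 3)) (e' u (inv (Z ℕ.∸ 3)))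
          where
          e' : ∀ u v → u - v + v ≡ u
          e' = solve-∀ ℚring
      go : ∀ k → Π (W ℕ.+ k) ≤ B (W ℕ.+ k)
      go zero = ≤-reflexive (trans (trans (cong Π (ℕP.+-identityʳ W)) (initial (λ l → 1ℚ + μ l * (ι 2 * (inv l * inv (l ℕ.∸ 2)))) (λ l → ι 2 * (inv l * inv (l ℕ.∸ 2))) (λ _ → refl)))
          (sym (trans (cong (λ k → 1ℚ + ι 4 * (u - inv (k ℕ.∸ 3))) (ℕP.+-identityʳ W)) (e' (ι 4) u))))
        where
        e' : ∀ c u → 1ℚ + c * (u - u) ≡ 1ℚ
        e' = solve-∀ ℚring
      go (suc k) = ≤-via (cong Π (ℕP.+-suc W k)) (≤-trans (*-mono (≤-trans 0≤1 (∏-≥1 Z (λ l _ → x≤x+y (0≤* (0≤μ l) (0≤* (0≤ι 2) (0≤* (0≤inv l) (0≤inv (l ℕ.∸ 2)))))))) (0≤+ 0≤1 0≤y) (go k)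
          (+-monoʳ-≤ 1ℚ (≤-via refl (*-monoˡ 0≤y (μ≤1 Z)) (*-identityˡ y))))
          (nonneg⇒≤ (0≤+ (0≤* (gap (B≤2 Z)) 0≤y) (0≤* (0≤* (0≤ι 4) (0≤inv (Z ℕ.∸ 2))) (gap (inv-anti {Z ℕ.∸ 3} (ℕP.m<n⇒0<n∸m (ℕP.≤-trans (ℕP.≤ᵇ⇒≤ 4 256 _) (ℕP.≤-trans 256≤W (ℕP.m≤m+n W k)))) (ℕP.m∸n≤m Z 3))))) (fin (offset k))))
          (cong B (sym (ℕP.+-suc W k)))
        where
        Z : ℕ
        Z = W ℕ.+ k
        y : ℚ
        y = ι 2 * (inv Z * inv (Z ℕ.∸ 2))
        0≤y : 0ℚ ≤ y
        0≤y = 0≤* (0≤ι 2) (0≤* (0≤inv Z) (0≤inv (Z ℕ.∸ 2)))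
        fin : (Σ ℕ λ m → Z ≡ suc (suc (suc (suc m)))) → B Z * (1ℚ + y) + ((ι 2 - B Z) * y + ι 4 * inv (Z ℕ.∸ 2) * (inv (Z ℕ.∸ 3) - inv Z)) ≡ B (suc Z)
        fin (m , eq) = trans (e₁ (B Z) (ι 2) (ι 4) (inv (Z ℕ.∸ 2)) (inv (Z ℕ.∸ 3)) (inv Z)) (trans (cong (λ q → B Z + (ι 2 * ι 2 - q) * inv Z * inv (Z ℕ.∸ 2) + q * (inv (Z ℕ.∸ 2) * inv (Z ℕ.∸ 3))) (ι-* 2 2))
          (trans (cong (λ q → B Z + (ι 2 * ι 2 - ι 2 * ι 2) * inv Z * inv (Z ℕ.∸ 2) + ι 2 * ι 2 * q) diff) (trans (cong (λ q → 1ℚ + q * (u - inv (Z ℕ.∸ 3)) + (ι 2 * ι 2 - ι 2 * ι 2) * inv Z * inv (Z ℕ.∸ 2) + ι 2 * ι 2 * (inv (Z ℕ.∸ 3) - inv (Z ℕ.∸ 2))) (ι-* 2 2)) (trans (e₂ (ι 2) u (inv (Z ℕ.∸ 3)) (inv (Z ℕ.∸ 2)) (inv Z)) (trans (cong (λ q → 1ℚ + q * (u - inv (Z ℕ.∸ 2))) (sym (ι-* 2 2))) refl)))))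
          where
          diff : inv (Z ℕ.∸ 2) * inv (Z ℕ.∸ 3) ≡ inv (Z ℕ.∸ 3) - inv (Z ℕ.∸ 2)
          diff = trans (cong (λ Z → inv (Z ℕ.∸ 2) * inv (Z ℕ.∸ 3)) eq) (trans (inv-diff {suc (suc m)} (s≤s (s≤s z≤n))) (cong (λ Z → inv (Z ℕ.∸ 3) - inv (Z ℕ.∸ 2)) (sym eq)))
          e₁ : ∀ B t q a b c → B * (1ℚ + t * (c * a)) + ((t - B) * (t * (c * a)) + q * a * (b - c)) ≡ B + (t * t - q) * c * a + q * (a * b)
          e₁ = solve-∀ ℚring
          e₂ : ∀ t u b a c → 1ℚ + t * t * (u - b) + (t * t - t * t) * c * a + t * t * (b - a) ≡ 1ℚ + t * t * (u - a)
          e₂ = solve-∀ ℚring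

-- Correlation of f (p₁ m) and f (p₂ m) over rough m.

module DispersionMethod where

  open Rationals
  open FiniteSums
  open Congruences
  open FundamentalLemma
  open ChebyshevBounds using (isPrime?)
  open MertensBounds
  open Sieves
  open TypeISums
  open Correlations
  open import Data.Nat as ℕ using (ℕ)
  import Data.Nat.Properties as ℕP
  import Data.Nat.Divisibility as ℕD
  open import Data.Nat.Coprimality using (1-coprimeTo)
  open import Data.Nat.Primality using (Prime)
  open import Data.Rational using (ℚ; 0ℚ; 1ℚ; _+_; _*_; -_; _-_; _≤_)
  open import Data.Rational.Properties
  open import Data.Product using (proj₁; proj₂)
  open import Data.Sum using (inj₁; inj₂)
  open import Relation.Nullary using (Dec; yes; no; ¬_; contradiction)
  open import Relation.Binary.PropositionalEquality using (_≡_; refl; sym; trans; cong; cong₂; subst)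
  open import Tactic.RingSolver using (solve-∀)

  ∑-restrict : ∀ {T T'} φ → T ℕ.≤ T' → ∑ T φ ≡ ∑ T' (λ i → ⟨ i ℕ.<? T ⟩ * φ i)
  ∑-restrict {T} {T'} φ T≤T' = sym (trans (cong (λ k → ∑ k (λ i → ⟨ i ℕ.<? T ⟩ * φ i)) (sym (ℕP.m+[n∸m]≡n T≤T')))
    (trans (∑-split T (T' ℕ.∸ T) (λ i → ⟨ i ℕ.<? T ⟩ * φ i)) (trans (cong₂ _+_
      (∑-cong T (λ i i<T → trans (cong (_* φ i) (⟨⟩-yes (i ℕ.<? T) i<T)) (*-identityˡ (φ i))))
      (trans (∑-cong (T' ℕ.∸ T) (λ i _ → trans (cong (_* φ (T ℕ.+ i)) (⟨⟩-no (T ℕ.+ i ℕ.<? T) (λ p → ℕP.<⇒≱ p (ℕP.m≤m+n T i)))) (*-zeroˡ (φ (T ℕ.+ i))))) (∑-zero (T' ℕ.∸ T))))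
      (+-identityʳ (∑ T φ)))))

  ∑-product : ∀ m n (x y : ℕ → ℚ) → ∑ m x * ∑ n y ≡ ∑ m (λ i → ∑ n (λ k → x i * y k))
  ∑-product m n x y = trans (sym (∑-*ʳ m (∑ n y) x)) (∑-cong m (λ i _ → sym (∑-*ˡ n (x i) y)))

  -- Replaces Cauchy-Schwarz and its square roots: q is the expected size of S, chosen in advance.
  -- The weight g is raised to R only where S is nonnegative; otherwise the left side is at most 0.
  am-gm : ∀ {q g R S} → 0ℚ ≤ q → 0ℚ ≤ g → g ≤ R → q * (g * S) ≤ R * (q * q + S * S)
  am-gm {q} {g} {R} {S} 0≤q 0≤g g≤R with ≤-total 0ℚ S
  ... | inj₁ 0≤S = ≤-trans (*-monoʳ 0≤q (*-monoˡ 0≤S g≤R)) (nonneg⇒≤ (0≤* 0≤R (0≤+ (0≤sq (q - S)) (0≤* 0≤q 0≤S))) (e q R S))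
    where
    0≤R : 0ℚ ≤ R
    0≤R = ≤-trans 0≤g g≤R
    e : ∀ q R S → q * (R * S) + R * ((q - S) * (q - S) + q * S) ≡ R * (q * q + S * S)
    e = solve-∀ ℚring
  ... | inj₂ S≤0 = nonneg⇒≤ (0≤+ (0≤* 0≤q (0≤* 0≤g (gap S≤0))) (0≤* (≤-trans 0≤g g≤R) (0≤+ (0≤sq q) (0≤sq S)))) (e q g R S)
    where
    e : ∀ q g R S → q * (g * S) + (q * (g * (0ℚ - S)) + R * (q * q + S * S)) ≡ R * (q * q + S * S)
    e = solve-∀ ℚring

  module Dispersion (w r N : ℕ) (3≤w : 3 ℕ.≤ w) (w≤r : w ℕ.≤ r) where
    open Setup w r N 3≤w
    open Correlation w r N 3≤w w≤r

    Unit : ℕ → Set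
    Unit p = ∀ {l} → M l → ¬ l ℕD.∣ p

    private
      -- The class of the m with p m ≡ N mod l, which exists because l does not divide p; outside M
      -- it is set to 0.
      solution : ∀ {l} p → Unit p → Dec (M l) → ℕ
      solution {l} p u (yes m) = proj₁ (root l p 0 N (prime⇒1≤ (proj₁ m)) (coprime-sym (∤⇒coprime (proj₁ m) (u m))))
      solution p u (no _) = 0

      solution-spec : ∀ {l} p (u : Unit p) (d : Dec (M l)) → M l → Cg l (p ℕ.* solution p u d) N
      solution-spec {l} p u (yes m) _ = proj₂ (proj₂ (root l p 0 N (prime⇒1≤ (proj₁ m)) (coprime-sym (∤⇒coprime (proj₁ m) (u m)))))
      solution-spec p u (no ¬m) m = contradiction m ¬m

    abstract
      class : ∀ p → Unit p → ℕ → ℕ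
      class p u l = solution p u (M? l)

      class-spec : ∀ {l} p (u : Unit p) → M l → Cg l (p ℕ.* class p u l) N
      class-spec {l} p u = solution-spec p u (M? l)

    private
      class≢0 : ∀ {l} p (u : Unit p) → M l → ¬ Cg l (class p u l) 0
      class≢0 {l} p u m c = N≢0 m (cg-trans (cg-sym (class-spec p u m)) (subst (Cg l (p ℕ.* class p u l)) (ℕP.*-zeroʳ p) (cg-* p c)))

      in-class : ∀ {l} p (u : Unit p) m → μ l * ⟨ cg? l m (class p u l) ⟩ ≡ μ l * ⟨ cg? l (p ℕ.* m) N ⟩
      in-class {l} p u m = go (M? l)
        where
        go : (d : Dec (M l)) → ⟨ d ⟩ * ⟨ cg? l m (class p u l) ⟩ ≡ ⟨ d ⟩ * ⟨ cg? l (p ℕ.* m) N ⟩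
        go (no _) = trans (*-zeroˡ ⟨ cg? l m (class p u l) ⟩) (sym (*-zeroˡ ⟨ cg? l (p ℕ.* m) N ⟩))
        go (yes ml) = cong (1ℚ *_) (⟨⟩-⇔ (cg? l m (class p u l)) (cg? l (p ℕ.* m) N) (λ c → cg-trans (cg-* p c) (class-spec p u ml))
          (λ c → cg-cancel-* p (∤⇒coprime (proj₁ ml) (u ml)) (cg-trans c (cg-sym (class-spec p u ml)))))

    module Pair (p₁ p₂ : ℕ) (u₁ : Unit p₁) (u₂ : Unit p₂) where
      open Build Prime M isPrime? M? (λ p → p) proj₁ M⇒6≤ (class p₁ u₁) (class p₂ u₂) (class≢0 p₁ u₁) (class≢0 p₂ u₂) public

      h≡ : ∀ m → h z m ≡ rough z m * (χ (p₁ ℕ.* m) * χ (p₂ ℕ.* m))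
      h≡ m = trans (∏-cong z (λ l _ → trans (1-β l m) (cong₂ (λ a b → (1ℚ - pr l * ⟨ cg? l m 0 ⟩) * ((1ℚ - a) * (1ℚ - b))) (in-class p₁ u₁ m) (in-class p₂ u₂ m))))
        (trans (∏-* z (λ l → 1ℚ - pr l * ⟨ cg? l m 0 ⟩) (λ l → (1ℚ - μ l * ⟨ cg? l (p₁ ℕ.* m) N ⟩) * (1ℚ - μ l * ⟨ cg? l (p₂ ℕ.* m) N ⟩)))
          (cong (rough z m *_) (∏-* z (λ l → 1ℚ - μ l * ⟨ cg? l (p₁ ℕ.* m) N ⟩) (λ l → 1ℚ - μ l * ⟨ cg? l (p₂ ℕ.* m) N ⟩))))

      -- If the classes of p₁ and p₂ coincide, some unit m mod l has p₁ m ≡ N ≡ p₂ m, whence p₁ ≡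
      -- p₂. These are the l recorded by `H`.
      V≤ : V z ≤ ρ z * (V₀ * (V₀ * H p₁ z p₂))
      V≤ = ≤-via refl (∏-mono z (λ l _ → gap (g≤1 l)) (λ l _ → 1-g-pair (λ l → ⟨ cg? l p₂ p₁ ⟩) (λ l → 0≤⟨⟩ (cg? l p₂ p₁)) same l))
        (trans (∏-* z (λ l → 1ℚ - pr l * inv l) (λ l → (1ℚ - κ l) * ((1ℚ - κ l) * (1ℚ + μ l * (⟨ cg? l p₂ p₁ ⟩ * inv (l ℕ.∸ 2))))))
          (cong (ρ z *_) (trans (∏-* z (λ l → 1ℚ - κ l) (λ l → (1ℚ - κ l) * (1ℚ + μ l * (⟨ cg? l p₂ p₁ ⟩ * inv (l ℕ.∸ 2))))) (cong (V₀ *_) (∏-* z (λ l → 1ℚ - κ l) (λ l → 1ℚ + μ l * (⟨ cg? l p₂ p₁ ⟩ * inv (l ℕ.∸ 2))))))))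
        where
        same : ∀ {l} → M l → Cg l (class p₁ u₁ l) (class p₂ u₂ l) → ⟨ cg? l p₂ p₁ ⟩ ≡ 1ℚ
        same {l} m c = ⟨⟩-yes (cg? l p₂ p₁) (cg-cancel-* (class p₁ u₁ l) (∤⇒coprime (proj₁ m) (λ d → class≢0 p₁ u₁ m (∣⇒cg0 d)))
          (subst₂' (cg-trans (cg-trans (cg-* p₂ c) (class-spec p₂ u₂ m)) (cg-sym (class-spec p₁ u₁ m)))))
          where
          subst₂' : Cg l (p₂ ℕ.* class p₁ u₁ l) (p₁ ℕ.* class p₁ u₁ l) → Cg l (class p₁ u₁ l ℕ.* p₂) (class p₁ u₁ l ℕ.* p₁)
          subst₂' p = subst (λ x → Cg l x (class p₁ u₁ l ℕ.* p₁)) (ℕP.*-comm p₂ (class p₁ u₁ l)) (subst (Cg l (p₂ ℕ.* class p₁ u₁ l)) (ℕP.*-comm p₁ (class p₁ u₁ l)) p)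

      private
        count : ∀ T → Large r (ι T) → ∣ S (bl r) 0 1 T - ι T * V (bl r) ∣≤ ι T * (V (bl r) * hp 200)
        count T big = fundamental-lemma r 200 0 1 T (ι T) cop (close-refl T) big
          where
          cop : Cop 1 (bl r)
          cop {l} _ _ = 1-coprimeTo l

        sum≡ : ∀ T → S (bl r) 0 1 T ≡ ∑ T (λ m → rough z m * (χ (p₁ ℕ.* m) * χ (p₂ ℕ.* m)))
        sum≡ T = ∑-cong T (λ m _ → trans (cong (h z) (n≡0+1*n m)) (h≡ m))

      near : ∀ T → Large r (ι T) → ∣ ∑ T (λ m → rough z m * (χ (p₁ ℕ.* m) * χ (p₂ ℕ.* m))) - ι T * V z ∣≤ ι T * (V z * ε)
      near T big = abs-≡ (cong (λ a → a - ι T * V z) (sum≡ T)) (count T big)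

      pair-upper : ∀ T → Large r (ι T) → ∑ T (λ m → rough z m * (χ (p₁ ℕ.* m) * χ (p₂ ℕ.* m))) ≤ ι T * (ρ z * (V₀ * (V₀ * H p₁ z p₂))) * (1ℚ + ε)
      pair-upper T big = ≤-trans (abs-hi {∑ T (λ m → rough z m * (χ (p₁ ℕ.* m) * χ (p₂ ℕ.* m)))} {ι T * V z} (near T big))
        (≤-via (e (ι T) (V z) ε) (*-monoˡ (0≤+ 0≤1 0≤ε) (*-monoʳ (0≤ι T) V≤)) refl)
        where
        e : ∀ t v ε → t * v + t * (v * ε) ≡ t * v * (1ℚ + ε)
        e = solve-∀ ℚring

    -- The pair sieve with p₁ = p₂ = p: both classes coincide and χ² = χ.
    single-lower : ∀ p → Unit p → ∀ T → Large r (ι T) → ι T * (ρ z * V₀) * (1ℚ - ε) ≤ ∑ T (λ m → rough z m * χ (p ℕ.* m))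
    single-lower p u T big = ≤-via (trans (cong (λ v → ι T * v * (1ℚ - ε)) (sym V≡)) (e (ι T) (V z) ε))
        (abs-lo {∑ T (λ m → rough z m * (χ (p ℕ.* m) * χ (p ℕ.* m)))} {ι T * V z} (near T big))
        (∑-cong T (λ m _ → cong (rough z m *_) (trans (sym (∏-* z (λ l → 1ℚ - μ l * ⟨ cg? l (p ℕ.* m) N ⟩) (λ l → 1ℚ - μ l * ⟨ cg? l (p ℕ.* m) N ⟩))) (∏-cong z (λ l _ → idem (M? l) (cg? l (p ℕ.* m) N))))))
      where
      open Pair p p u u
      V≡ : V z ≡ ρ z * V₀
      V≡ = trans (∏-cong z (λ l _ → 1-g-same (λ _ → cg-refl) l)) (∏-* z (λ l → 1ℚ - pr l * inv l) (λ l → 1ℚ - κ l))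
      e : ∀ t v ε → t * v * (1ℚ - ε) ≡ t * v - t * (v * ε)
      e = solve-∀ ℚring

    -- Expanding (χ - V₀)(χ - V₀) gives main terms H, -1, -1 and 1 times T ρ V₀². The errors add ε
    -- (H + 3), and ε ≤ 1 turns this into 2 (H - 1) + 4 ε.
    correlation : ∀ p₁ p₂ → Unit p₁ → Unit p₂ → ∀ T → Large r (ι T) →
      ∑ T (λ m → rough z m * (f (p₁ ℕ.* m) * f (p₂ ℕ.* m))) ≤ ι T * (ρ z * (V₀ * V₀)) * (ι 2 * (H p₁ z p₂ - 1ℚ) + ι 4 * ε)
    correlation p₁ p₂ u₁ u₂ T big = ≤-trans (≤-via expand
        (+-mono-≤ (+-mono-≤ (+-mono-≤ (Pair.pair-upper p₁ p₂ u₁ u₂ T big) (neg-antimono-≤ (*-monoʳ 0≤V₀ (single-lower p₁ u₁ T big)))) (neg-antimono-≤ (*-monoʳ 0≤V₀ (single-lower p₂ u₂ T big))))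
          (*-monoʳ (0≤* 0≤V₀ 0≤V₀) (abs-hi {∑ T (rough z)} {ι T * ρ z} (rough-count r T big))))
        refl) (nonneg⇒≤ (0≤* (0≤* (0≤ι T) (0≤* (0≤ρ z) (0≤* 0≤V₀ 0≤V₀))) (0≤* (gap (hp≤1 200)) (gap (1≤H p₁ z p₂))))
          (trans (e (ι T) (ρ z) V₀ (H p₁ z p₂) ε) (cong₂ (λ a b → ι T * (ρ z * (V₀ * V₀)) * (a * (H p₁ z p₂ - 1ℚ) + b * ε)) (sym ι2≡) (sym (trans (ι-* 2 2) (cong₂ _*_ ι2≡ ι2≡))))))
      where
      R : ℕ → ℚ
      R = rough z
      c₁ c₂ : ℕ → ℚ
      c₁ m = χ (p₁ ℕ.* m)
      c₂ m = χ (p₂ ℕ.* m)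
      e : ∀ t ρ v H ε → t * (ρ * (v * (v * H))) * (1ℚ + ε) + - (v * (t * (ρ * v) * (1ℚ - ε))) + - (v * (t * (ρ * v) * (1ℚ - ε))) + v * v * (t * ρ + t * (ρ * ε)) + t * (ρ * (v * v)) * ((1ℚ - ε) * (H - 1ℚ))
        ≡ t * (ρ * (v * v)) * ((1ℚ + 1ℚ) * (H - 1ℚ) + (1ℚ + 1ℚ) * (1ℚ + 1ℚ) * ε)
      e = solve-∀ ℚring
      e₁ : ∀ R a b v → R * ((a - v) * (b - v)) ≡ R * (a * b) + - v * (R * a) + - v * (R * b) + v * v * R
      e₁ = solve-∀ ℚring
      expand : ∑ T (λ m → R m * (f (p₁ ℕ.* m) * f (p₂ ℕ.* m))) ≡ ∑ T (λ m → R m * (c₁ m * c₂ m)) + - (V₀ * ∑ T (λ m → R m * c₁ m)) + - (V₀ * ∑ T (λ m → R m * c₂ m)) + V₀ * V₀ * ∑ T R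
      expand = trans (∑-cong T (λ m _ → e₁ (R m) (c₁ m) (c₂ m) V₀))
        (trans (∑-+ T (λ m → R m * (c₁ m * c₂ m) + - V₀ * (R m * c₁ m) + - V₀ * (R m * c₂ m)) (λ m → V₀ * V₀ * R m))
          (cong₂ _+_ (trans (∑-+ T (λ m → R m * (c₁ m * c₂ m) + - V₀ * (R m * c₁ m)) (λ m → - V₀ * (R m * c₂ m)))
            (cong₂ _+_ (trans (∑-+ T (λ m → R m * (c₁ m * c₂ m)) (λ m → - V₀ * (R m * c₁ m))) (cong (∑ T (λ m → R m * (c₁ m * c₂ m)) +_) (neg-out c₁))) (neg-out c₂)))
            (∑-*ˡ T (V₀ * V₀) R)))
        where
        neg-out : ∀ c → ∑ T (λ m → - V₀ * (R m * c m)) ≡ - (V₀ * ∑ T (λ m → R m * c m))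
        neg-out c = trans (∑-*ˡ T (- V₀) (λ m → R m * c m)) (sym (neg-distribˡ-* V₀ (∑ T (λ m → R m * c m))))

-- Bilinear sums with p in one dyadic shell.

module ShellSums where

  open Rationals
  open FiniteSums
  open Congruences
  open FundamentalLemma
  open ChebyshevBounds using (isPrime?)
  open MertensBounds
  open TypeISums
  open Correlations
  open DispersionMethod
  open import Data.Nat as ℕ using (ℕ; zero; suc; z≤n; s≤s)
  import Data.Nat.Properties as ℕP
  import Data.Nat.Divisibility as ℕD
  open import Data.Nat.Primality using (Prime)
  import Data.Nat.Tactic.RingSolver as ℕSolver
  open import Data.Rational using (ℚ; 0ℚ; 1ℚ; _+_; _*_; -_; _-_; _≤_; _<_; positive)
  open import Data.Rational.Properties
  open import Data.Product using (_×_; _,_; proj₁; proj₂)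
  open import Data.Sum using (_⊎_; inj₁; inj₂)
  open import Relation.Nullary using (Dec; yes; no)
  open import Relation.Binary.PropositionalEquality using (_≡_; refl; sym; trans; cong; cong₂; subst)
  open import Tactic.RingSolver using (solve-∀)

  0<* : ∀ {x y} → 0ℚ < x → 0ℚ < y → 0ℚ < x * y
  0<* {x} {y} p q = positive⁻¹ (x * y) {{pos*pos⇒pos x {{positive p}} y {{positive q}}}}

  0<inv′ : ∀ {n} → 1 ℕ.≤ n → 0ℚ < inv n
  0<inv′ (s≤s {n = n} _) = 0<inv n

  ρ-lower′ : ∀ {Z} → 2 ℕ.≤ Z → inv Z ≤ ρ Z
  ρ-lower′ {suc zero} (s≤s ())
  ρ-lower′ {suc (suc m)} _ = ≤-trans (inv-anti (s≤s z≤n) (ℕP.n≤1+n (suc m))) (ρ-lower m)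

  -- The number of multiples of p among 0 , … , N₁ - 1.
  quot : ℕ → ℕ → ℕ
  quot N₁ zero = 0
  quot N₁ p@(suc _) = proj₁ (multiples p N₁ (s≤s z≤n))

  quot-lower : ∀ N₁ p → 1 ℕ.≤ p → N₁ ℕ.≤ p ℕ.* quot N₁ p
  quot-lower N₁ (suc p) _ = proj₁ (proj₂ (multiples (suc p) N₁ (s≤s z≤n)))

  quot-upper : ∀ N₁ p → 1 ℕ.≤ p → p ℕ.* quot N₁ p ℕ.< N₁ ℕ.+ p
  quot-upper N₁ (suc p) _ = proj₁ (proj₂ (proj₂ (multiples (suc p) N₁ (s≤s z≤n))))

  quot-sum : ∀ N₁ p → 1 ℕ.≤ p → ∀ (φ : ℕ → ℚ) → ∑ N₁ (λ n → ⟨ p ℕD.∣? n ⟩ * φ n) ≡ ∑ (quot N₁ p) (λ m → φ (p ℕ.* m))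
  quot-sum N₁ (suc p) _ = proj₂ (proj₂ (proj₂ (multiples (suc p) N₁ (s≤s z≤n))))

  quot-anti : ∀ N₁ {p p'} → 1 ℕ.≤ p → p ℕ.≤ p' → quot N₁ p' ℕ.≤ quot N₁ p
  quot-anti N₁ {p} {p'} 1≤p p≤p' = go (quot N₁ p') (quot-upper N₁ p' (ℕP.≤-trans 1≤p p≤p'))
    where
    go : ∀ t → p' ℕ.* t ℕ.< N₁ ℕ.+ p' → t ℕ.≤ quot N₁ p
    go zero _ = z≤n
    go (suc t) lt = ℕP.*-cancelˡ-< p t (quot N₁ p) (ℕP.≤-<-trans (ℕP.*-monoˡ-≤ t p≤p')
      (ℕP.<-≤-trans (ℕP.+-cancelʳ-< p' (p' ℕ.* t) N₁ (subst (ℕ._< N₁ ℕ.+ p') (trans (ℕP.*-suc p' t) (ℕP.+-comm p' (p' ℕ.* t))) lt)) (quot-lower N₁ p 1≤p)))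

  ind-min : ∀ m a b → ⟨ m ℕ.<? a ⟩ * ⟨ m ℕ.<? b ⟩ ≡ ⟨ m ℕ.<? a ℕ.⊓ b ⟩
  ind-min m a b = go (m ℕ.<? a) (m ℕ.<? b)
    where
    go : (d : Dec (m ℕ.< a)) (d' : Dec (m ℕ.< b)) → ⟨ d ⟩ * ⟨ d' ⟩ ≡ ⟨ m ℕ.<? a ℕ.⊓ b ⟩
    go (yes p) (yes q) = sym (⟨⟩-yes (m ℕ.<? a ℕ.⊓ b) (ℕP.⊓-glb p q))
    go (yes p) (no ¬q) = sym (⟨⟩-no (m ℕ.<? a ℕ.⊓ b) (λ lt → ¬q (ℕP.<-≤-trans lt (ℕP.m⊓n≤n a b))))
    go (no ¬p) d' = trans (*-zeroˡ ⟨ d' ⟩) (sym (⟨⟩-no (m ℕ.<? a ℕ.⊓ b) (λ lt → ¬p (ℕP.<-≤-trans lt (ℕP.m⊓n≤m a b)))))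

  pr≥ : ℕ → ℕ → ℚ
  pr≥ y p = pr p * ⟨ y ℕ.≤? p ⟩

  pr≥-cases : ∀ y p → pr≥ y p ≡ 0ℚ ⊎ (Prime p × y ℕ.≤ p × pr≥ y p ≡ 1ℚ)
  pr≥-cases y p = go (isPrime? p) (y ℕ.≤? p)
    where
    go : (d : Dec (Prime p)) (d' : Dec (y ℕ.≤ p)) → ⟨ d ⟩ * ⟨ d' ⟩ ≡ 0ℚ ⊎ (Prime p × y ℕ.≤ p × ⟨ d ⟩ * ⟨ d' ⟩ ≡ 1ℚ)
    go (yes pp) (yes q) = inj₂ (pp , q , *-identityˡ 1ℚ)
    go (yes pp) (no _) = inj₁ (*-zeroʳ 1ℚ)
    go (no _) d' = inj₁ (*-zeroˡ ⟨ d' ⟩)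

  module Shells (w r N N₁ : ℕ) (7≤w : 7 ℕ.≤ w) (w≤r : w ℕ.≤ r) where

    3≤w : 3 ℕ.≤ w
    3≤w = ℕP.≤-trans (ℕP.≤ᵇ⇒≤ 3 7 _) 7≤w

    open Setup w r N 3≤w
    open Correlation w r N 3≤w w≤r
    open Dispersion w r N 3≤w w≤r

    y : ℕ
    y = bl (r ℕ.+ 10)

    z≤y : z ℕ.≤ y
    z≤y = bl-mono (ℕP.m≤m+n r 10)

    prime-unit : ∀ {p} → Prime p → y ℕ.≤ p → Unit p
    prime-unit pp y≤p (pl , _ , l<z , _) l∣p = ℕP.<⇒≢ (ℕP.<-≤-trans l<z (ℕP.≤-trans z≤y y≤p)) (prime∣prime pl pp l∣p)

    prime-rough : ∀ {p} → Prime p → y ℕ.≤ p → rough z p ≡ 1ℚ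
    prime-rough pp y≤p = rough-one λ pl l<z l∣p → ℕP.<⇒≢ (ℕP.<-≤-trans l<z (ℕP.≤-trans z≤y y≤p)) (prime∣prime pl pp l∣p)

    -- Primality of p₁ and p₂ is relaxed to roughness, over which the sieve can average. This is
    -- legitimate because the bound, unlike the correlation itself, is nonnegative.
    weighted-correlation : ∀ p₁ p₂ T T' → Large r (ι T) → T ℕ.≤ T' →
      pr≥ y p₁ * pr≥ y p₂ * ∑ T (λ m → rough z m * (f (p₁ ℕ.* m) * f (p₂ ℕ.* m))) ≤
      rough z p₁ * (rough z p₂ * (ι T' * (ρ z * (V₀ * V₀)) * (ι 2 * (H p₁ z p₂ - 1ℚ) + ι 4 * ε)))
    weighted-correlation p₁ p₂ T T' big T≤T' = go (pr≥-cases y p₁) (pr≥-cases y p₂)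
      where
      σ bound : ℚ
      σ = ∑ T (λ m → rough z m * (f (p₁ ℕ.* m) * f (p₂ ℕ.* m)))
      bound = ι T' * (ρ z * (V₀ * V₀)) * (ι 2 * (H p₁ z p₂ - 1ℚ) + ι 4 * ε)
      0≤tail : 0ℚ ≤ ι 2 * (H p₁ z p₂ - 1ℚ) + ι 4 * ε
      0≤tail = 0≤+ (0≤* (0≤ι 2) (gap (1≤H p₁ z p₂))) (0≤* (0≤ι 4) 0≤ε)
      0≤density : 0ℚ ≤ ρ z * (V₀ * V₀)
      0≤density = 0≤* (0≤ρ z) (0≤* 0≤V₀ 0≤V₀)
      0≤RHS : 0ℚ ≤ rough z p₁ * (rough z p₂ * bound)
      0≤RHS = 0≤* (0≤rough z p₁) (0≤* (0≤rough z p₂) (0≤* (0≤* (0≤ι T') 0≤density) 0≤tail))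
      go : pr≥ y p₁ ≡ 0ℚ ⊎ (Prime p₁ × y ℕ.≤ p₁ × pr≥ y p₁ ≡ 1ℚ) → pr≥ y p₂ ≡ 0ℚ ⊎ (Prime p₂ × y ℕ.≤ p₂ × pr≥ y p₂ ≡ 1ℚ) →
        pr≥ y p₁ * pr≥ y p₂ * σ ≤ rough z p₁ * (rough z p₂ * bound)
      go (inj₁ e) _ = ≤-via (trans (cong (λ a → a * pr≥ y p₂ * σ) e) (e₀ (pr≥ y p₂) σ)) 0≤RHS refl
        where
        e₀ : ∀ a b → 0ℚ * a * b ≡ 0ℚ
        e₀ = solve-∀ ℚring
      go (inj₂ _) (inj₁ e) = ≤-via (trans (cong (λ a → pr≥ y p₁ * a * σ) e) (e₀ (pr≥ y p₁) σ)) 0≤RHS refl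
        where
        e₀ : ∀ a b → a * 0ℚ * b ≡ 0ℚ
        e₀ = solve-∀ ℚring
      go (inj₂ (pp₁ , y≤p₁ , e₁)) (inj₂ (pp₂ , y≤p₂ , e₂)) = ≤-via (trans (cong₂ (λ a b → a * b * σ) e₁ e₂) (e₀ σ))
          (≤-trans (correlation p₁ p₂ (prime-unit pp₁ y≤p₁) (prime-unit pp₂ y≤p₂) T big) (*-monoˡ 0≤tail (*-monoˡ 0≤density (ι-mono T≤T'))))
          (sym (trans (cong₂ (λ a b → a * (b * bound)) (prime-rough pp₁ y≤p₁) (prime-rough pp₂ y≤p₂)) (e₃ bound)))
        where
        e₀ : ∀ a → 1ℚ * 1ℚ * a ≡ a
        e₀ = solve-∀ ℚring
        e₃ : ∀ a → 1ℚ * (1ℚ * a) ≡ a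
        e₃ = solve-∀ ℚring

    2^ : ℕ
    2^ = 2 ℕ.^ r

    1≤2^r : 1 ℕ.≤ 2^
    1≤2^r = 1≤2^ r

    y≡ : y ≡ 2 ℕ.^ (2^ ℕ.* 1024)
    y≡ = cong (2 ℕ.^_) (ℕP.^-distribˡ-+-* 2 r 10)

    2≤z : 2 ℕ.≤ z
    2≤z = ℕP.^-monoʳ-≤ 2 {1} 1≤2^r

    0<ρz : 0ℚ < ρ z
    0<ρz = <-≤-trans (0<inv′ (1≤bl r)) (ρ-lower′ 2≤z)

    0<V₀ : 0ℚ < V₀
    0<V₀ = <-≤-trans (0<inv′ (1≤bl r)) V₀-lower

    module Shell (P : ℕ) (y≤P : y ℕ.≤ P) (Py≤N₁ : P ℕ.* y ℕ.≤ N₁) (g : ℕ → ℚ) (0≤g : ∀ m → 0ℚ ≤ g m) (g≤rough : ∀ m → g m ≤ rough z m) where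

      T̂ : ℕ → ℕ
      T̂ i = quot N₁ (P ℕ.+ i)

      Tₘ : ℕ
      Tₘ = quot N₁ P

      1≤P : 1 ℕ.≤ P
      1≤P = ℕP.≤-trans (1≤bl (r ℕ.+ 10)) y≤P

      T̂≤ : ∀ i → T̂ i ℕ.≤ Tₘ
      T̂≤ i = quot-anti N₁ 1≤P (ℕP.m≤m+n P i)

      private
        -- As p ≤ 2 P and P y ≤ N₁, at least y / 2 values of m remain, more than 2 ^ (706 · 2 ^ r).
        2^706≤T̂ : ∀ i → i ℕ.≤ P → 2 ℕ.^ (2^ ℕ.* 706) ℕ.≤ T̂ i
        2^706≤T̂ i i≤P = ℕP.*-cancelˡ-≤ 2 (ℕP.≤-trans half y≤2T)
          where
          half : 2 ℕ.* 2 ℕ.^ (2^ ℕ.* 706) ℕ.≤ y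
          half = ℕP.≤-trans (ℕP.^-monoʳ-≤ 2 {suc (2^ ℕ.* 706)} (ℕP.≤-trans (ℕP.+-monoˡ-≤ (2^ ℕ.* 706) 1≤2^r) (ℕP.≤-trans (ℕP.≤-reflexive (sym (ℕP.*-suc 2^ 706))) (ℕP.*-monoʳ-≤ 2^ (ℕP.≤ᵇ⇒≤ 707 1024 _))))) (ℕP.≤-reflexive (sym y≡))
          y≤2T : y ℕ.≤ 2 ℕ.* T̂ i
          y≤2T = ℕP.*-cancelˡ-≤ P {{ℕ.>-nonZero 1≤P}} (ℕP.≤-trans Py≤N₁ (ℕP.≤-trans (quot-lower N₁ (P ℕ.+ i) (ℕP.≤-trans 1≤P (ℕP.m≤m+n P i))) (ℕP.≤-trans (ℕP.*-monoˡ-≤ (T̂ i) (ℕP.+-monoʳ-≤ P i≤P)) (ℕP.≤-reflexive (e P (T̂ i))))))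
            where
            e : ∀ P t → (P ℕ.+ P) ℕ.* t ≡ P ℕ.* (2 ℕ.* t)
            e = ℕSolver.solve-∀

      large-T̂ : ∀ i k → i ℕ.≤ P → k ℕ.≤ P → Large r (ι (T̂ i ℕ.⊓ T̂ k))
      large-T̂ i k i≤P k≤P = ι-mono (ℕP.⊓-glb (2^706≤T̂ i i≤P) (2^706≤T̂ k k≤P))

      a : ℕ → ℚ
      a i = pr≥ y (P ℕ.+ i)

      s : ℕ → ℕ → ℚ
      s m i = a i * (⟨ m ℕ.<? T̂ i ⟩ * f ((P ℕ.+ i) ℕ.* m))

      S : ℕ → ℚ
      S m = ∑ P (s m)

      G : ℚ
      G = ∑ P (λ i → a i * ∑ (T̂ i) (λ m → g m * f ((P ℕ.+ i) ℕ.* m)))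

      G≡ : G ≡ ∑ Tₘ (λ m → g m * S m)
      G≡ = trans (∑-cong P (λ i _ → trans (cong (a i *_) (∑-restrict (λ m → g m * f ((P ℕ.+ i) ℕ.* m)) (T̂≤ i))) (trans (sym (∑-*ˡ Tₘ (a i) (λ m → ⟨ m ℕ.<? T̂ i ⟩ * (g m * f ((P ℕ.+ i) ℕ.* m))))) (∑-cong Tₘ (λ m _ → e (a i) ⟨ m ℕ.<? T̂ i ⟩ (g m) (f ((P ℕ.+ i) ℕ.* m)))))))
        (trans (∑-swap P Tₘ (λ i m → g m * s m i)) (∑-cong Tₘ (λ m _ → ∑-*ˡ P (g m) (s m))))
        where
        e : ∀ a b g f → a * (b * (g * f)) ≡ g * (a * (b * f))
        e = solve-∀ ℚring

      second-moment≡ : ∑ Tₘ (λ m → rough z m * (S m * S m)) ≡ ∑ P (λ i → ∑ P (λ k → a i * a k * ∑ (T̂ i ℕ.⊓ T̂ k) (λ m → rough z m * (f ((P ℕ.+ i) ℕ.* m) * f ((P ℕ.+ k) ℕ.* m)))))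
      second-moment≡ = trans (∑-cong Tₘ (λ m _ → trans (cong (rough z m *_) (∑-product P P (s m) (s m))) (trans (sym (∑-*ˡ P (rough z m) (λ i → ∑ P (λ k → s m i * s m k)))) (∑-cong P (λ i _ → sym (∑-*ˡ P (rough z m) (λ k → s m i * s m k)))))))
        (trans (∑-swap Tₘ P (λ m i → ∑ P (λ k → rough z m * (s m i * s m k)))) (∑-cong P (λ i _ → trans (∑-swap Tₘ P (λ m k → rough z m * (s m i * s m k))) (∑-cong P (λ k _ → inner i k)))))
        where
        ff : ℕ → ℕ → ℕ → ℚ
        ff i k m = rough z m * (f ((P ℕ.+ i) ℕ.* m) * f ((P ℕ.+ k) ℕ.* m))
        e : ∀ R a a' b b' x x' → R * (a * (b * x) * (a' * (b' * x'))) ≡ a * a' * (b * b' * (R * (x * x')))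
        e = solve-∀ ℚring
        inner : ∀ i k → ∑ Tₘ (λ m → rough z m * (s m i * s m k)) ≡ a i * a k * ∑ (T̂ i ℕ.⊓ T̂ k) (ff i k)
        inner i k = trans (∑-cong Tₘ (λ m _ → trans (e (rough z m) (a i) (a k) ⟨ m ℕ.<? T̂ i ⟩ ⟨ m ℕ.<? T̂ k ⟩ (f ((P ℕ.+ i) ℕ.* m)) (f ((P ℕ.+ k) ℕ.* m))) (cong (λ b → a i * a k * (b * ff i k m)) (ind-min m (T̂ i) (T̂ k)))))
          (trans (∑-*ˡ Tₘ (a i * a k) (λ m → ⟨ m ℕ.<? T̂ i ℕ.⊓ T̂ k ⟩ * ff i k m)) (cong (a i * a k *_) (sym (∑-restrict (ff i k) (ℕP.≤-trans (ℕP.m⊓n≤m (T̂ i) (T̂ k)) (T̂≤ i))))))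

      -- Here u is the expected number of rough p in the shell, c the expected mass of rough m times
      -- V₀², and η the saving in the second moment, with 12 = 3 · 2 · 2 and 42 = 3 · 2 + 3 · 4 · 3.
      u c η : ℚ
      u = ι P * ρ z
      c = ι Tₘ * (ρ z * (V₀ * V₀))
      η = ι 12 * (Π z - 1ℚ) + ι 42 * ε

      0<u : 0ℚ < u
      0<u = 0<* (<-≤-trans 0<1 (≤-via (sym ι1≡1) (ι-mono 1≤P) refl)) 0<ρz

      0≤u : 0ℚ ≤ u
      0≤u = <⇒≤ 0<u

      0≤c : 0ℚ ≤ c
      0≤c = 0≤* (0≤ι Tₘ) (0≤* (0≤ρ z) (0≤* 0≤V₀ 0≤V₀))

      1≤Π' : 1ℚ ≤ Π' z
      1≤Π' = ∏-≥1 z (λ l _ → x≤x+y (0≤* (0≤μ l) (0≤inv (l ℕ.∸ 2))))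

      1≤Π : 1ℚ ≤ Π z
      1≤Π = ∏-≥1 z (λ l _ → x≤x+y (0≤* (0≤μ l) (0≤* (0≤ι 2) (0≤* (0≤inv l) (0≤inv (l ℕ.∸ 2))))))

      private
        e₁ : ℕ
        e₁ = 2^ ℕ.* 706 ℕ.+ 1 ℕ.+ 2^

        -- In multiples of 2 ^ r: 706 from E, 1 for doubling it, 1 from Π', 200 from ε, against 1024
        -- - 1 in u.
        exps : e₁ ℕ.+ 200 ℕ.≤ 2^ ℕ.* 1023
        exps = ℕP.≤-trans (ℕP.+-mono-≤ (ℕP.+-mono-≤ (ℕP.+-monoʳ-≤ (2^ ℕ.* 706) 1≤2^r) (ℕP.≤-refl {2^})) (ℕP.m≤n*m 200 2^ {{ℕ.>-nonZero 1≤2^r}}))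
          (ℕP.≤-trans (ℕP.≤-reflexive collect) (ℕP.*-monoʳ-≤ 2^ (ℕP.≤ᵇ⇒≤ 908 1023 _)))
          where
          suc* : ∀ k → 2^ ℕ.* k ℕ.+ 2^ ≡ 2^ ℕ.* suc k
          suc* k = trans (ℕP.+-comm (2^ ℕ.* k) 2^) (sym (ℕP.*-suc 2^ k))
          collect : 2^ ℕ.* 706 ℕ.+ 2^ ℕ.+ 2^ ℕ.+ 2^ ℕ.* 200 ≡ 2^ ℕ.* 908
          collect = trans (cong (λ k → k ℕ.+ 2^ ℕ.+ 2^ ℕ.* 200) (suc* 706)) (trans (cong (ℕ._+ 2^ ℕ.* 200) (suc* 707)) (sym (ℕP.*-distribˡ-+ 2^ 708 200)))

        E≤ : E ≤ pw (2^ ℕ.* 706 ℕ.+ 1)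
        E≤ = ≤-trans (+-monoʳ-≤ (pw (2^ ℕ.* 706)) two≤) (≤-reflexive (trans (e (pw (2^ ℕ.* 706))) (trans (cong (pw (2^ ℕ.* 706) *_) (sym ι2≡)) (sym (pw-+ (2^ ℕ.* 706) 1)))))
          where
          two≤ : ι 2 ≤ pw (2^ ℕ.* 706)
          two≤ = pw-mono {1} {2^ ℕ.* 706} (ℕP.≤-trans 1≤2^r (ℕP.m≤m*n 2^ 706))
          e : ∀ x → x + x ≡ x * (1ℚ + 1ℚ)
          e = solve-∀ ℚring

        u≥ : pw (2^ ℕ.* 1023) ≤ u
        u≥ = ≤-trans (≤-reflexive (sym split)) (*-mono (0≤pw (2^ ℕ.* 1024)) (0≤ρ z) (ι-mono (ℕP.≤-trans (ℕP.≤-reflexive (sym y≡)) y≤P)) (ρ-lower′ 2≤z))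
          where
          split : pw (2^ ℕ.* 1024) * hp 2^ ≡ pw (2^ ℕ.* 1023)
          split = trans (cong (λ k → pw k * hp 2^) (ℕP.*-suc 2^ 1023)) (trans (*-comm (pw (2^ ℕ.+ 2^ ℕ.* 1023)) (hp 2^)) (hp-pw-+ 2^ (2^ ℕ.* 1023)))

        pw≤ : pw e₁ ≤ hp 200 * pw (2^ ℕ.* 1023)
        pw≤ = ≤-trans (≤-reflexive (sym cancel)) (*-monoʳ (0≤hp 200) (pw-mono exps))
          where
          cancel : hp 200 * pw (e₁ ℕ.+ 200) ≡ pw e₁
          cancel = trans (cong (λ k → hp 200 * pw k) (ℕP.+-comm e₁ 200)) (hp-pw-+ 200 e₁)

      -- E stems from the progressions too short for the fundamental lemma; it is negligible as P ≥ z ^ 1024.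
      EΠ'≤ : E * Π' z ≤ ε * u
      EΠ'≤ = ≤-trans (*-mono 0≤E (0≤pw 2^) E≤ Π'≤) (≤-trans (≤-reflexive (sym (pw-+ (2^ ℕ.* 706 ℕ.+ 1) 2^))) (≤-trans pw≤ (*-monoʳ (0≤hp 200) u≥)))

      private
        at : ∀ i → P ℕ.+ 1 ℕ.* i ≡ P ℕ.+ i
        at i = cong (P ℕ.+_) (ℕP.+-identityʳ i)

        E≤εu : E ≤ ε * u
        E≤εu = ≤-trans (≤-via (sym (*-identityʳ E)) (*-monoʳ 0≤E 1≤Π') refl) EΠ'≤

        uρ : ι P * ρ-off 1 z ≡ u
        uρ = cong (ι P *_) (ρ-off-1 z)

      rough-in-shell : ∑ P (λ i → rough z (P ℕ.+ i)) ≤ ι 3 * u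
      rough-in-shell = ≤-trans (≤-trans (≤-reflexive (∑-cong P (λ i _ → cong (rough z) (sym (at i))))) (rough-in-AP r P 1 P (ι P) (close-refl P) (0≤ι P)))
        (nonneg⇒≤ (0≤+ (gap E≤εu) (0≤* (gap (hp≤1 200)) 0≤u)) (trans (cong (λ v → ι 2 * v + E + ((ε * u - E) + (1ℚ - ε) * u)) uρ) (trans (e (ι 2) u E ε) (cong (_* u) three))))
        where
        three : ι 2 + 1ℚ ≡ ι 3
        three = trans (+-comm (ι 2) 1ℚ) (sym (ι-suc 2))
        e : ∀ t u E ε → t * u + E + ((ε * u - E) + (1ℚ - ε) * u) ≡ (t + 1ℚ) * u
        e = solve-∀ ℚring

      excess-in-shell : ∀ p₁ → ∑ P (λ k → rough z (P ℕ.+ k) * (H p₁ z (P ℕ.+ k) - 1ℚ)) ≤ ι 2 * u * (Π z - 1ℚ) + ε * u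
      excess-in-shell p₁ = ≤-trans (≤-via (∑-cong P (λ k _ → cong (λ n → rough z n * (H p₁ z n - 1ℚ)) (sym (at k)))) (excess p₁ z P 1 P (ι P) (close-refl P) (0≤ι P) (λ _ m → M⇒1≢0 m)) refl)
        (nonneg⇒≤ (0≤+ (gap EΠ'≤) 0≤E) (trans (cong (λ v → ι 2 * v * (Π z - 1ℚ) + E * (Π' z - 1ℚ) + ((ε * u - E * Π' z) + E)) uρ) (e (ι 2 * u * (Π z - 1ℚ)) E (Π' z) (ε * u))))
        where
        e : ∀ x E p y → x + E * (p - 1ℚ) + ((y - E * p) + E) ≡ x + y
        e = solve-∀ ℚring

      -- For fixed p₁ the bound is summed over all rough p₂. The diagonal p₁ = p₂ is not separated:
      -- it is one term of the mean of H.
      second-moment : ∑ Tₘ (λ m → rough z m * (S m * S m)) ≤ c * (u * u) * η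
      second-moment = ≤-via second-moment≡ (≤-trans
          (∑-mono P (λ i i<P → ∑-mono P (λ k k<P → weighted-correlation (P ℕ.+ i) (P ℕ.+ k) (T̂ i ℕ.⊓ T̂ k) Tₘ (large-T̂ i k (ℕP.<⇒≤ i<P) (ℕP.<⇒≤ k<P)) (ℕP.≤-trans (ℕP.m⊓n≤m (T̂ i) (T̂ k)) (T̂≤ i)))))
          (≤-trans (∑-mono P (λ i _ → row i)) (≤-trans (≤-reflexive (∑-*ʳ P K (λ i → rough z (P ℕ.+ i)))) (*-monoˡ 0≤K rough-in-shell))))
          (trans (e (ι 3) u c (ι 2) (ι 4) (Π z - 1ℚ) ε) (cong (λ w → c * (u * u) * w) (cong₂ (λ p q → p * (Π z - 1ℚ) + q * ε) twelve forty-two)))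
        where
        K : ℚ
        K = c * (ι 2 * (ι 2 * u * (Π z - 1ℚ) + ε * u) + ι 4 * ε * (ι 3 * u))
        0≤K : 0ℚ ≤ K
        0≤K = 0≤* 0≤c (0≤+ (0≤* (0≤ι 2) (0≤+ (0≤* (0≤* (0≤ι 2) 0≤u) (gap 1≤Π)) (0≤* 0≤ε 0≤u))) (0≤* (0≤* (0≤ι 4) 0≤ε) (0≤* (0≤ι 3) 0≤u)))
        e : ∀ t u c two four p ε → t * u * (c * (two * (two * u * p + ε * u) + four * ε * (t * u))) ≡ c * (u * u) * (t * (two * two) * p + (t * two + t * (four * t)) * ε)
        e = solve-∀ ℚring
        twelve : ι 3 * (ι 2 * ι 2) ≡ ι 12
        twelve = trans (cong (ι 3 *_) (sym (ι-* 2 2))) (sym (ι-* 3 4))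
        forty-two : ι 3 * ι 2 + ι 3 * (ι 4 * ι 3) ≡ ι 42
        forty-two = trans (cong₂ _+_ (sym (ι-* 3 2)) (trans (cong (ι 3 *_) (sym (ι-* 4 3))) (sym (ι-* 3 12)))) (sym (ι-+ 6 36))
        row : ∀ i → ∑ P (λ k → rough z (P ℕ.+ i) * (rough z (P ℕ.+ k) * (c * (ι 2 * (H (P ℕ.+ i) z (P ℕ.+ k) - 1ℚ) + ι 4 * ε)))) ≤ rough z (P ℕ.+ i) * K
        row i = ≤-via (∑-*ˡ P (rough z (P ℕ.+ i)) (λ k → rough z (P ℕ.+ k) * (c * (ι 2 * (H (P ℕ.+ i) z (P ℕ.+ k) - 1ℚ) + ι 4 * ε))))
          (*-monoʳ (0≤rough z (P ℕ.+ i)) (≤-via expand (*-monoʳ 0≤c (+-mono-≤ (*-monoʳ (0≤ι 2) (excess-in-shell (P ℕ.+ i))) (*-monoʳ (0≤* (0≤ι 4) 0≤ε) rough-in-shell))) refl)) refl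
          where
          x y' : ℕ → ℚ
          x k = rough z (P ℕ.+ k) * (H (P ℕ.+ i) z (P ℕ.+ k) - 1ℚ)
          y' k = rough z (P ℕ.+ k)
          e' : ∀ R c t h q → R * (c * (t * h + q)) ≡ c * (t * (R * h) + q * R)
          e' = solve-∀ ℚring
          expand : ∑ P (λ k → rough z (P ℕ.+ k) * (c * (ι 2 * (H (P ℕ.+ i) z (P ℕ.+ k) - 1ℚ) + ι 4 * ε))) ≡ c * (ι 2 * ∑ P x + ι 4 * ε * ∑ P y')
          expand = trans (∑-cong P (λ k _ → e' (rough z (P ℕ.+ k)) c (ι 2) (H (P ℕ.+ i) z (P ℕ.+ k) - 1ℚ) (ι 4 * ε)))
            (trans (∑-*ˡ P c (λ k → ι 2 * x k + ι 4 * ε * y' k)) (cong (c *_) (trans (∑-+ P (λ k → ι 2 * x k) (λ k → ι 4 * ε * y' k)) (cong₂ _+_ (∑-*ˡ P (ι 2) x) (∑-*ˡ P (ι 4 * ε) y')))))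

      private
        -- W is at least 2 ^ 128 because w ≥ 7.
        Π-small : Π z - 1ℚ ≤ hp 125
        Π-small = ≤-trans Π≤ (≤-trans (*-monoʳ (0≤ι 4) inv≤) (≤-reflexive (pw-hp-+ 2 125)))
          where
          inv≤ : inv (W ℕ.∸ 3) ≤ hp 127
          inv≤ = inv-anti (1≤2^ 127) (ℕP.≤-trans (ℕP.≤ᵇ⇒≤ (2 ℕ.^ 127) (2 ℕ.^ 128 ℕ.∸ 3) _) (ℕP.∸-monoˡ-≤ 3 (bl-mono {7} 7≤w)))

        first : ι 12 * (Π z - 1ℚ) ≤ hp 121
        first = ≤-trans (*-mono (0≤ι 12) (0≤hp 125) (ι-mono (ℕP.≤ᵇ⇒≤ 12 16 _)) Π-small) (≤-reflexive (pw-hp-+ 4 121))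

        second : ι 42 * ε ≤ hp 121
        second = ≤-trans (*-monoˡ 0≤ε (ι-mono (ℕP.≤ᵇ⇒≤ 42 64 _))) (≤-trans (≤-reflexive (pw-hp-+ 6 194)) (hp-anti {121} {194} (ℕP.≤ᵇ⇒≤ 121 194 _)))

        doubled : hp 121 + hp 121 ≡ hp 120
        doubled = trans (e (hp 121)) (trans (cong (_* hp 121) (sym ι2≡)) (pw-hp-+ 1 120))
          where
          e : ∀ x → x + x ≡ (1ℚ + 1ℚ) * x
          e = solve-∀ ℚring

      η≤ : η ≤ hp 112
      η≤ = ≤-trans (+-mono-≤ first second) (≤-trans (≤-reflexive doubled) (hp-anti {112} {120} (ℕP.≤ᵇ⇒≤ 112 120 _)))

      private
        -- τ is the square root of the bound 2 ^ -112 for η. Thus q is the root mean square size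
        -- that the second moment allows for S, where the two terms of `am-gm` balance.
        τ q : ℚ
        τ = hp 56
        q = τ * (V₀ * u)

        0<q : 0ℚ < q
        0<q = 0<* (0<inv′ (1≤2^ 56)) (0<* 0<V₀ 0<u)

        three : ι 2 + 1ℚ ≡ ι 3
        three = trans (+-comm (ι 2) 1ℚ) (sym (ι-suc 2))

        large-Tₘ : Large r (ι Tₘ)
        large-Tₘ = ι-mono (subst (2 ℕ.^ (2^ ℕ.* 706) ℕ.≤_) (cong (quot N₁) (ℕP.+-identityʳ P)) (2^706≤T̂ 0 z≤n))

        ∑R : ∑ Tₘ (rough z) ≤ ι 2 * (ι Tₘ * ρ z)
        ∑R = ≤-trans (abs-hi {∑ Tₘ (rough z)} {ι Tₘ * ρ z} (rough-count r Tₘ large-Tₘ))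
          (nonneg⇒≤ (0≤* (0≤* (0≤ι Tₘ) (0≤ρ z)) (gap (hp≤1 200))) (trans (e (ι Tₘ) (ρ z) ε) (cong (_* (ι Tₘ * ρ z)) (sym ι2≡))))
          where
          e : ∀ t ρ ε → t * ρ + t * (ρ * ε) + t * ρ * (1ℚ - ε) ≡ (1ℚ + 1ℚ) * (t * ρ)
          e = solve-∀ ℚring

        first-moment : q * G ≤ ∑ Tₘ (λ m → rough z m * (q * q + S m * S m))
        first-moment = ≤-trans (≤-reflexive (trans (cong (q *_) G≡) (sym (∑-*ˡ Tₘ q (λ m → g m * S m)))))
          (∑-mono Tₘ (λ m _ → am-gm {q} {g m} {rough z m} {S m} (<⇒≤ 0<q) (0≤g m) (g≤rough m)))

        expand-moments : ∑ Tₘ (λ m → rough z m * (q * q + S m * S m)) ≡ ∑ Tₘ (rough z) * (q * q) + ∑ Tₘ (λ m → rough z m * (S m * S m))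
        expand-moments = trans (∑-cong Tₘ (λ m _ → *-distribˡ-+ (rough z m) (q * q) (S m * S m))) (trans (∑-+ Tₘ (λ m → rough z m * (q * q)) (λ m → rough z m * (S m * S m)))
          (cong (_+ ∑ Tₘ (λ m → rough z m * (S m * S m))) (∑-*ʳ Tₘ (q * q) (rough z))))

        collect : ι 2 * (ι Tₘ * ρ z) * (q * q) + c * (u * u) * hp 112 ≡ q * (ι 3 * (ι Tₘ * ρ z) * q)
        collect = trans (cong (λ h → ι 2 * (ι Tₘ * ρ z) * (q * q) + c * (u * u) * h) (hp-+ 56 56)) (trans (e (ι 2) (ι Tₘ) (ρ z) τ V₀ u) (cong (λ t → q * (t * (ι Tₘ * ρ z) * q)) three))
          where
          e : ∀ two T ρ τ V u → two * (T * ρ) * (τ * (V * u) * (τ * (V * u))) + T * (ρ * (V * V)) * (u * u) * (τ * τ) ≡ τ * (V * u) * ((two + 1ℚ) * (T * ρ) * (τ * (V * u)))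
          e = solve-∀ ℚring

        moments : ∑ Tₘ (λ m → rough z m * (q * q + S m * S m)) ≤ q * (ι 3 * (ι Tₘ * ρ z) * q)
        moments = ≤-trans (≤-reflexive expand-moments) (≤-trans (+-mono-≤ (*-monoˡ (0≤sq q) ∑R) (≤-trans second-moment (*-monoʳ (0≤* 0≤c (0≤sq u)) η≤))) (≤-reflexive collect))

        PT≤ : ι Tₘ * ι P ≤ ι 2 * ι N₁
        PT≤ = ≤-trans (≤-reflexive (trans (*-comm (ι Tₘ) (ι P)) (sym (ι-* P Tₘ)))) (≤-trans (ι-mono PT≤2N₁) (≤-reflexive (ι-* 2 N₁)))
          where
          P≤N₁ : P ℕ.≤ N₁
          P≤N₁ = ℕP.≤-trans (ℕP.m≤m*n P y {{ℕ.>-nonZero (1≤bl (r ℕ.+ 10))}}) Py≤N₁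
          PT≤2N₁ : P ℕ.* Tₘ ℕ.≤ 2 ℕ.* N₁
          PT≤2N₁ = ℕP.≤-trans (ℕP.<⇒≤ (quot-upper N₁ P 1≤P)) (ℕP.≤-trans (ℕP.+-monoʳ-≤ N₁ P≤N₁) (ℕP.≤-reflexive (cong (N₁ ℕ.+_) (sym (ℕP.+-identityʳ N₁)))))

        final : ι 3 * (ι Tₘ * ρ z) * q ≤ ι 6 * hp 56 * (ι N₁ * (ρ z * ρ z * V₀))
        final = ≤-trans (≤-reflexive (e (ι 3) (ι Tₘ) (ρ z) τ V₀ (ι P))) (≤-trans (*-monoʳ (0≤* (0≤* (0≤ι 3) (0≤hp 56)) (0≤* (0≤* (0≤ρ z) (0≤ρ z)) 0≤V₀)) PT≤)
          (≤-reflexive (trans (e' (ι 3) τ (ρ z) V₀ (ι 2) (ι N₁)) (cong (λ t → t * τ * (ι N₁ * (ρ z * ρ z * V₀))) (sym (ι-* 3 2))))))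
          where
          e : ∀ t T ρ τ V P → t * (T * ρ) * (τ * (V * (P * ρ))) ≡ t * τ * (ρ * ρ * V) * (T * P)
          e = solve-∀ ℚring
          e' : ∀ t τ ρ V two n → t * τ * (ρ * ρ * V) * (two * n) ≡ t * two * τ * (n * (ρ * ρ * V))
          e' = solve-∀ ℚring

      -- The inequality for q G is divided by q. Two densities ρ are present because both p and m
      -- were sifted; one of them will pay for the number of shells.
      shell-bound : G ≤ ι 6 * hp 56 * (ι N₁ * (ρ z * ρ z * V₀))
      shell-bound = ≤-trans (*-cancel 0<q (≤-trans first-moment moments)) final

-- Primes as rough numbers minus weighted products p m.

module PrimeDetection where

  open Rationals
  open FiniteSums
  open Congruences
  open ChebyshevBounds using (isPrime?; prime-factor)
  open MertensBounds
  open Sieves using (inv-diff)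
  open TypeISums
  open ShellSums
  open import Data.Nat as ℕ using (ℕ; zero; suc; z≤n; s≤s)
  import Data.Nat.Properties as ℕP
  import Data.Nat.Divisibility as ℕD
  import Data.Nat.DivMod as ℕM
  open import Data.Nat.Primality using (Prime; euclidsLemma; prime[2])
  open import Data.Rational using (ℚ; 0ℚ; 1ℚ; _+_; _*_; -_; _-_; _≤_; _<_)
  open import Data.Rational.Properties
  open import Data.Product using (Σ; ∃; _×_; _,_)
  open import Data.Sum using (_⊎_; inj₁; inj₂)
  open import Relation.Nullary using (Dec; yes; no; ¬_; contradiction; _×-dec_)
  open import Relation.Binary.PropositionalEquality using (_≡_; refl; sym; trans; cong; cong₂; subst)
  open import Tactic.RingSolver using (solve-∀)

  -- Integer quotients, with junk value 0 for a zero divisor.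
  div : ℕ → ℕ → ℕ
  div n zero = 0
  div n p@(suc _) = n ℕM./ p

  div-* : ∀ p m → 1 ℕ.≤ p → div (p ℕ.* m) p ≡ m
  div-* p@(suc _) m _ = trans (cong (ℕM._/ p) (ℕP.*-comm p m)) (ℕM.m*n/n≡m m p)

  *-div : ∀ {p n} → 1 ℕ.≤ p → p ℕD.∣ n → n ≡ p ℕ.* div n p
  *-div {p} 1≤p (ℕD.divides q refl) = trans (ℕP.*-comm q p) (cong (p ℕ.*_) (sym (trans (cong (λ k → div k p) (ℕP.*-comm q p)) (div-* p q 1≤p))))

  ∑-square-tail : ∀ y K → 2 ℕ.≤ y → ∑ K (λ p → ⟨ y ℕ.≤? p ⟩ * (inv p * inv p)) ≤ inv (y ℕ.∸ 1)
  ∑-square-tail y K 2≤y = ≤-trans (∑-≤-len F 0≤F (ℕP.m≤n+m K y)) (≤-trans (go K) (1-≤' (0≤inv (y ℕ.+ K ℕ.∸ 1))))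
    where
    F : ℕ → ℚ
    F p = ⟨ y ℕ.≤? p ⟩ * (inv p * inv p)
    0≤F : ∀ p → 0ℚ ≤ F p
    0≤F p = 0≤* (0≤⟨⟩ (y ℕ.≤? p)) (0≤sq (inv p))
    1-≤' : ∀ {x u} → 0ℚ ≤ x → u - x ≤ u
    1-≤' {x} {u} 0≤x = nonneg⇒≤ 0≤x (e u x)
      where
      e : ∀ u x → u - x + x ≡ u
      e = solve-∀ ℚring
    go : ∀ k → ∑ (y ℕ.+ k) F ≤ inv (y ℕ.∸ 1) - inv (y ℕ.+ k ℕ.∸ 1)
    go zero = ≤-reflexive (trans (cong (λ k → ∑ k F) (ℕP.+-identityʳ y)) (trans (trans (∑-cong y (λ p p<y → trans (cong (_* (inv p * inv p)) (⟨⟩-no (y ℕ.≤? p) (ℕP.<⇒≱ p<y))) (*-zeroˡ (inv p * inv p)))) (∑-zero y)) (sym (trans (cong (λ k → inv (y ℕ.∸ 1) - inv (k ℕ.∸ 1)) (ℕP.+-identityʳ y)) (+-inverseʳ (inv (y ℕ.∸ 1)))))))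
    go (suc k) = ≤-trans (≤-reflexive (cong (λ j → ∑ j F) (ℕP.+-suc y k))) (≤-trans (+-mono-≤ (go k) term) (≤-reflexive (trans (e (inv (y ℕ.∸ 1)) (inv (l ℕ.∸ 1)) (inv l)) (cong (λ j → inv (y ℕ.∸ 1) - inv (j ℕ.∸ 1)) (sym (ℕP.+-suc y k))))))
      where
      l : ℕ
      l = y ℕ.+ k
      2≤l : 2 ℕ.≤ l
      2≤l = ℕP.≤-trans 2≤y (ℕP.m≤m+n y k)
      e : ∀ u a b → u - a + (a - b) ≡ u - b
      e = solve-∀ ℚring
      term : F l ≤ inv (l ℕ.∸ 1) - inv l
      term = ≤-trans (≤-trans (*-monoˡ (0≤sq (inv l)) (⟨⟩≤1 (y ℕ.≤? l))) (≤-reflexive (*-identityˡ (inv l * inv l))))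
        (≤-trans (*-monoʳ (0≤inv l) (inv-anti (ℕP.∸-monoˡ-≤ 1 2≤l) (ℕP.m∸n≤m l 1))) (≤-reflexive (inv-diff 2≤l)))

  abstract
    prime-divisor? : ∀ p m → Dec (Prime p × p ℕD.∣ m)
    prime-divisor? p m = isPrime? p ×-dec (p ℕD.∣? m)

  ω : ℕ → ℕ → ℕ
  ω zero m = 0
  ω (suc k) m with prime-divisor? k m
  ... | yes _ = suc (ω k m)
  ... | no _ = ω k m

  ∑≡ω : ∀ k m → ∑ k (λ p → ⟨ prime-divisor? p m ⟩) ≡ ι (ω k m)
  ∑≡ω zero m = sym ι0≡0
  ∑≡ω (suc k) m with prime-divisor? k m
  ... | yes _ = trans (cong (_+ 1ℚ) (∑≡ω k m)) (trans (+-comm (ι (ω k m)) 1ℚ) (sym (ι-suc (ω k m))))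
  ... | no _ = trans (+-identityʳ (∑ k (λ p → ⟨ prime-divisor? p m ⟩))) (∑≡ω k m)

  private
    ∑-δ≤1 : ∀ k p → ∑ k (λ l → ⟨ l ℕP.≟ p ⟩) ≤ 1ℚ
    ∑-δ≤1 k p = ≤-trans (∑-single k p (λ i i≢p → ≤-reflexive (⟨⟩-no (i ℕP.≟ p) i≢p)) (0≤⟨⟩ (p ℕP.≟ p))) (⟨⟩≤1 (p ℕP.≟ p))

  ω-upper : ∀ k p d → Prime p → ω k (p ℕ.* d) ℕ.≤ suc (ω k d)
  ω-upper k p d pp = ι-cancel-≤ (≤-trans (≤-reflexive (sym (∑≡ω k (p ℕ.* d)))) (≤-trans (∑-mono k (λ l _ → pointwise l))
      (≤-trans (≤-reflexive (∑-+ k (λ l → ⟨ l ℕP.≟ p ⟩) (λ l → ⟨ prime-divisor? l d ⟩))) (≤-trans (+-mono-≤ (∑-δ≤1 k p) (≤-reflexive (∑≡ω k d))) (≤-reflexive (sym (ι-suc (ω k d))))))))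
    where
    pointwise : ∀ l → ⟨ prime-divisor? l (p ℕ.* d) ⟩ ≤ ⟨ l ℕP.≟ p ⟩ + ⟨ prime-divisor? l d ⟩
    pointwise l = go (prime-divisor? l (p ℕ.* d)) (l ℕP.≟ p)
      where
      go : (a : Dec (Prime l × l ℕD.∣ p ℕ.* d)) (b : Dec (l ≡ p)) → ⟨ a ⟩ ≤ ⟨ b ⟩ + ⟨ prime-divisor? l d ⟩
      go (no _) b = 0≤+ (0≤⟨⟩ b) (0≤⟨⟩ (prime-divisor? l d))
      go (yes _) (yes _) = x≤x+y (0≤⟨⟩ (prime-divisor? l d))
      go (yes (pl , l∣pd)) (no l≢p) = divides-d (euclidsLemma p d pl l∣pd)
        where
        divides-d : l ℕD.∣ p ⊎ l ℕD.∣ d → 1ℚ ≤ 0ℚ + ⟨ prime-divisor? l d ⟩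
        divides-d (inj₁ l∣p) = contradiction (prime∣prime pl pp l∣p) l≢p
        divides-d (inj₂ l∣d) = ≤-reflexive (sym (trans (+-identityˡ ⟨ prime-divisor? l d ⟩) (⟨⟩-yes (prime-divisor? l d) (pl , l∣d))))

  ω-lower : ∀ k p d → Prime p → p ℕ.< k → ¬ p ℕD.∣ d → suc (ω k d) ℕ.≤ ω k (p ℕ.* d)
  ω-lower k p d pp p<k p∤d = ι-cancel-≤ (≤-trans (≤-reflexive (ι-suc (ω k d))) (≤-trans (+-mono-≤ one (≤-reflexive (sym (∑≡ω k d))))
      (≤-trans (≤-reflexive (sym (∑-+ k (λ l → ⟨ l ℕP.≟ p ⟩) (λ l → ⟨ prime-divisor? l d ⟩)))) (≤-trans (∑-mono k (λ l _ → pointwise l)) (≤-reflexive (∑≡ω k (p ℕ.* d)))))))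
    where
    one : 1ℚ ≤ ∑ k (λ l → ⟨ l ℕP.≟ p ⟩)
    one = ≤-trans (≤-reflexive (sym (⟨⟩-yes (p ℕP.≟ p) refl))) (term≤∑ k (λ l → ⟨ l ℕP.≟ p ⟩) (λ l → 0≤⟨⟩ (l ℕP.≟ p)) p p<k)
    pointwise : ∀ l → ⟨ l ℕP.≟ p ⟩ + ⟨ prime-divisor? l d ⟩ ≤ ⟨ prime-divisor? l (p ℕ.* d) ⟩
    pointwise l = go (l ℕP.≟ p) (prime-divisor? l d)
      where
      go : (b : Dec (l ≡ p)) (a : Dec (Prime l × l ℕD.∣ d)) → ⟨ b ⟩ + ⟨ a ⟩ ≤ ⟨ prime-divisor? l (p ℕ.* d) ⟩
      go (yes refl) (yes (_ , l∣d)) = contradiction l∣d p∤d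
      go (yes refl) (no _) = ≤-reflexive (sym (⟨⟩-yes (prime-divisor? l (p ℕ.* d)) (pp , ℕD.m∣m*n d)))
      go (no _) (yes (pl , l∣d)) = ≤-reflexive (sym (⟨⟩-yes (prime-divisor? l (p ℕ.* d)) (pl , ℕD.∣n⇒∣m*n p l∣d)))
      go (no _) (no _) = 0≤⟨⟩ (prime-divisor? l (p ℕ.* d))

  module Detection (y N₁ : ℕ) (3≤y : 3 ℕ.≤ y) where

    private
      v : ℕ → ℕ
      v = ω N₁

    -- Averaging over the prime factors p of n = p m gives a weight that depends on m only.
    γ : ℕ → ℚ
    γ m = rough y m * (⟨ 2 ℕ.≤? m ⟩ * inv (suc (v m)))

    0≤γ : ∀ m → 0ℚ ≤ γ m
    0≤γ m = 0≤* (0≤rough y m) (0≤* (0≤⟨⟩ (2 ℕ.≤? m)) (0≤inv (suc (v m))))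

    γ≤rough : ∀ m → γ m ≤ rough y m
    γ≤rough m = ≤-trans (*-monoʳ (0≤rough y m) (≤-trans (*-mono (0≤⟨⟩ (2 ℕ.≤? m)) 0≤1 (⟨⟩≤1 (2 ℕ.≤? m)) (inv≤1 (suc (v m)))) (≤-reflexive (*-identityʳ 1ℚ)))) (≤-reflexive (*-identityʳ (rough y m)))

    -- For 2 ≤ m < y some prime factor is below y, and m < 2 is excluded by the bracket.
    γ-small : ∀ m → m ℕ.< y → γ m ≡ 0ℚ
    γ-small m m<y = go (2 ℕ.≤? m)
      where
      go : (d : Dec (2 ℕ.≤ m)) → rough y m * (⟨ d ⟩ * inv (suc (v m))) ≡ 0ℚ
      go (no _) = trans (cong (rough y m *_) (*-zeroˡ (inv (suc (v m))))) (*-zeroʳ (rough y m))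
      go (yes 2≤m) = use (prime-factor m 2≤m)
        where
        use : (Σ ℕ λ p → Prime p × p ℕD.∣ m) → rough y m * (1ℚ * inv (suc (v m))) ≡ 0ℚ
        use (p , pp , p∣m) = trans (cong (_* (1ℚ * inv (suc (v m)))) (rough-zero pp (ℕP.≤-<-trans (ℕD.∣⇒≤ {{ℕ.>-nonZero (ℕP.≤-trans (s≤s z≤n) 2≤m)}} p∣m) m<y) p∣m)) (*-zeroˡ (1ℚ * inv (suc (v m))))

    t : ℕ → ℕ → ℚ
    t n p = pr≥ y p * (⟨ p ℕD.∣? n ⟩ * γ (div n p))

    c : ℕ → ℚ
    c n = ∑ N₁ (t n)

    0≤pr≥ : ∀ p → 0ℚ ≤ pr≥ y p
    0≤pr≥ p = 0≤* (0≤pr p) (0≤⟨⟩ (y ℕ.≤? p))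

    0≤t : ∀ n p → 0ℚ ≤ t n p
    0≤t n p = 0≤* (0≤pr≥ p) (0≤* (0≤⟨⟩ (p ℕD.∣? n)) (0≤γ (div n p)))

    0≤c : ∀ n → 0ℚ ≤ c n
    0≤c n = ∑-nonneg N₁ (λ p _ → 0≤t n p)

    -- The defect in the identity of rough numbers with products plus primes. For n < N₁ it can be
    -- nonzero only at n = 1 and at multiples of p² with p ≥ y.
    δ : ℕ → ℚ
    δ n = rough y n - c n - pr≥ y n

    -- The bracket 1 ≤ n removes n = 0, which every p² divides.
    error : ℕ → ℚ
    error n = ⟨ n ℕP.≟ 1 ⟩ + ∑ N₁ (λ p → pr≥ y p * (⟨ 1 ℕ.≤? n ⟩ * ⟨ p ℕ.* p ℕD.∣? n ⟩))

    0≤square-terms : ∀ n p → 0ℚ ≤ pr≥ y p * (⟨ 1 ℕ.≤? n ⟩ * ⟨ p ℕ.* p ℕD.∣? n ⟩)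
    0≤square-terms n p = 0≤* (0≤pr≥ p) (0≤* (0≤⟨⟩ (1 ℕ.≤? n)) (0≤⟨⟩ (p ℕ.* p ℕD.∣? n)))

    0≤error : ∀ n → 0ℚ ≤ error n
    0≤error n = 0≤+ (0≤⟨⟩ (n ℕP.≟ 1)) (∑-nonneg N₁ (λ p _ → 0≤square-terms n p))

    private
      t-zero-unless : ∀ n p → (Prime p → y ℕ.≤ p → p ℕD.∣ n → γ (div n p) ≡ 0ℚ) → t n p ≡ 0ℚ
      t-zero-unless n p h = go (pr≥-cases y p) (p ℕD.∣? n)
        where
        e₁ : ∀ a b c → a ≡ 0ℚ → a * (b * c) ≡ 0ℚ
        e₁ _ b c refl = *-zeroˡ (b * c)
        e₂ : ∀ a c → a * (0ℚ * c) ≡ 0ℚ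
        e₂ = solve-∀ ℚring
        e₃ : ∀ a b → a * (b * 0ℚ) ≡ 0ℚ
        e₃ = solve-∀ ℚring
        go : pr≥ y p ≡ 0ℚ ⊎ (Prime p × y ℕ.≤ p × pr≥ y p ≡ 1ℚ) → (d : Dec (p ℕD.∣ n)) → pr≥ y p * (⟨ d ⟩ * γ (div n p)) ≡ 0ℚ
        go (inj₁ e) d = e₁ (pr≥ y p) ⟨ d ⟩ (γ (div n p)) e
        go (inj₂ _) (no _) = e₂ (pr≥ y p) (γ (div n p))
        go (inj₂ (pp , y≤p , _)) (yes p∣n) = trans (cong (λ w → pr≥ y p * (1ℚ * w)) (h pp y≤p p∣n)) (e₃ (pr≥ y p) 1ℚ)

      c-zero : ∀ n → (∀ p → Prime p → y ℕ.≤ p → p ℕD.∣ n → γ (div n p) ≡ 0ℚ) → c n ≡ 0ℚ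
      c-zero n h = trans (∑-cong N₁ (λ p _ → t-zero-unless n p (h p))) (∑-zero N₁)

      Good : ℕ → Set
      Good n = (0ℚ ≤ δ n) × (δ n ≤ error n)

      good-zero : ∀ {n} → rough y n ≡ 0ℚ → c n ≡ 0ℚ → pr≥ y n ≡ 0ℚ → Good n
      good-zero {n} a b d = ≤-reflexive (sym δ≡0) , ≤-trans (≤-reflexive δ≡0) (0≤error n)
        where
        δ≡0 : δ n ≡ 0ℚ
        δ≡0 = trans (cong (λ x → x - c n - pr≥ y n) a) (trans (cong (λ x → 0ℚ - x - pr≥ y n) b) (cong (λ x → 0ℚ - 0ℚ - x) d))

      pr≥-no : ∀ n → ¬ (Prime n × y ℕ.≤ n) → pr≥ y n ≡ 0ℚ
      pr≥-no n h = use (pr≥-cases y n)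
        where
        use : pr≥ y n ≡ 0ℚ ⊎ (Prime n × y ℕ.≤ n × pr≥ y n ≡ 1ℚ) → pr≥ y n ≡ 0ℚ
        use (inj₁ e) = e
        use (inj₂ (pn , y≤n , _)) = contradiction (pn , y≤n) h

      pr≥-yes : ∀ {n} → Prime n → y ℕ.≤ n → pr≥ y n ≡ 1ℚ
      pr≥-yes {n} pn y≤n = trans (cong₂ _*_ (⟨⟩-yes (isPrime? n) pn) (⟨⟩-yes (y ℕ.≤? n) y≤n)) (*-identityˡ 1ℚ)

      small-factor : ∀ n l → Prime l → l ℕ.< y → l ℕD.∣ n → Good n
      small-factor n l pl l<y l∣n = good-zero (rough-zero pl l<y l∣n)
        (c-zero n (λ p pp y≤p p∣n → trans (cong (_* (⟨ 2 ℕ.≤? div n p ⟩ * inv (suc (v (div n p))))) (rough-zero pl l<y (l∣div p pp y≤p p∣n (euclidsLemma p (div n p) pl (subst (l ℕD.∣_) (*-div (prime⇒1≤ pp) p∣n) l∣n))))) (*-zeroˡ (⟨ 2 ℕ.≤? div n p ⟩ * inv (suc (v (div n p)))))))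
        (pr≥-no n (λ (pn , y≤n) → ℕP.<⇒≱ (subst (ℕ._< y) (prime∣prime pl pn l∣n) l<y) y≤n))
        where
        l∣div : ∀ p → Prime p → y ℕ.≤ p → p ℕD.∣ n → l ℕD.∣ p ⊎ l ℕD.∣ div n p → l ℕD.∣ div n p
        l∣div p pp y≤p _ (inj₁ l∣p) = contradiction (subst (y ℕ.≤_) (sym (prime∣prime pl pp l∣p)) y≤p) (ℕP.<⇒≱ l<y)
        l∣div p pp y≤p _ (inj₂ d) = d

      module NoSmallFactor (n : ℕ) (n<N₁ : n ℕ.< N₁) (no-small : ∀ {l} → Prime l → l ℕ.< y → ¬ l ℕD.∣ n) where

        rough≡1 : rough y n ≡ 1ℚ
        rough≡1 = rough-one no-small

        large-factor : ∀ {p} → Prime p → p ℕD.∣ n → y ℕ.≤ p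
        large-factor pp p∣n = ℕP.≮⇒≥ λ p<y → no-small pp p<y p∣n

        one : n ≡ 1 → Good n
        one refl = ≤-trans 0≤1 (≤-reflexive (sym δ≡1)) , ≤-trans (≤-reflexive δ≡1) (x≤x+y (∑-nonneg N₁ (λ p _ → 0≤square-terms 1 p)))
          where
          c≡0 : c 1 ≡ 0ℚ
          c≡0 = c-zero 1 λ p pp _ p∣1 → contradiction (subst (2 ℕ.≤_) (ℕD.∣1⇒≡1 p∣1) (prime⇒2≤ pp)) λ { (s≤s ()) }
          δ≡1 : δ 1 ≡ 1ℚ
          δ≡1 = trans (cong (λ x → x - c 1 - pr≥ y 1) rough≡1) (trans (cong (λ x → 1ℚ - x - pr≥ y 1) c≡0) (cong (λ x → 1ℚ - 0ℚ - x) (pr≥-no 1 (λ (_ , y≤1) → ℕP.<⇒≱ (ℕP.≤-trans (s≤s (s≤s z≤n)) 3≤y) y≤1))))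

        prime : Prime n → Good n
        prime pn = ≤-reflexive (sym δ≡0) , ≤-trans (≤-reflexive δ≡0) (0≤error n)
          where
          1≤n : 1 ℕ.≤ n
          1≤n = prime⇒1≤ pn
          div≡1 : ∀ p → Prime p → p ℕD.∣ n → div n p ≡ 1
          div≡1 p pp p∣n = trans (cong (div n) (prime∣prime pp pn p∣n)) (trans (cong (λ k → div k n) (sym (ℕP.*-identityʳ n))) (div-* n 1 1≤n))
          c≡0 : c n ≡ 0ℚ
          c≡0 = c-zero n λ p pp _ p∣n → trans (cong γ (div≡1 p pp p∣n)) (γ-small 1 (ℕP.≤-trans (s≤s (s≤s z≤n)) 3≤y))
          δ≡0 : δ n ≡ 0ℚ
          δ≡0 = trans (cong (λ x → x - c n - pr≥ y n) rough≡1) (trans (cong (λ x → 1ℚ - x - pr≥ y n) c≡0) (cong (λ x → 1ℚ - 0ℚ - x) (pr≥-yes pn (large-factor pn ℕD.∣-refl))))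

        module Composite (2≤n : 2 ℕ.≤ n) (¬pn : ¬ Prime n) where

          instance
            n≢0 : ℕ.NonZero n
            n≢0 = ℕ.>-nonZero (ℕP.≤-trans (s≤s z≤n) 2≤n)

          i : ℚ
          i = inv (v n)

          1≤v : 1 ℕ.≤ v n
          1≤v = use (prime-factor n 2≤n)
            where
            use : (Σ ℕ λ p → Prime p × p ℕD.∣ n) → 1 ℕ.≤ v n
            use (p , pp , p∣n) = ι-cancel-≤ (≤-trans (≤-reflexive (trans ι1≡1 (sym (⟨⟩-yes (prime-divisor? p n) (pp , p∣n)))))
              (≤-trans (term≤∑ N₁ (λ p → ⟨ prime-divisor? p n ⟩) (λ p → 0≤⟨⟩ (prime-divisor? p n)) p (ℕP.≤-<-trans (ℕD.∣⇒≤ p∣n) n<N₁)) (≤-reflexive (∑≡ω N₁ n))))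

          total : ∑ N₁ (λ p → ⟨ prime-divisor? p n ⟩ * i) ≡ 1ℚ
          total = trans (∑-*ʳ N₁ i (λ p → ⟨ prime-divisor? p n ⟩)) (trans (cong (_* i) (∑≡ω N₁ n)) (ι-inv′ 1≤v))

          term : ∀ p → Prime p → p ℕD.∣ n → t n p ≡ inv (suc (v (div n p)))
          term p pp p∣n = trans (cong₂ (λ a b → a * (b * γ (div n p))) (pr≥-yes pp (large-factor pp p∣n)) (⟨⟩-yes (p ℕD.∣? n) p∣n))
            (trans (cong₂ (λ a b → 1ℚ * (1ℚ * (a * (b * inv (suc (v (div n p))))))) (rough-one div-rough) (⟨⟩-yes (2 ℕ.≤? div n p) 2≤div)) (e (inv (suc (v (div n p))))))
            where
            n≡ : n ≡ p ℕ.* div n p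
            n≡ = *-div (prime⇒1≤ pp) p∣n
            div-rough : ∀ {l} → Prime l → l ℕ.< y → ¬ l ℕD.∣ div n p
            div-rough pl l<y l∣div = no-small pl l<y (subst (_ ℕD.∣_) (sym n≡) (ℕD.∣n⇒∣m*n p l∣div))
            2≤div : 2 ℕ.≤ div n p
            2≤div = at-least-2 (div n p) n≡
              where
              at-least-2 : ∀ k → n ≡ p ℕ.* k → 2 ℕ.≤ k
              at-least-2 zero e = contradiction (subst (2 ℕ.≤_) (trans e (ℕP.*-zeroʳ p)) 2≤n) λ ()
              at-least-2 (suc zero) e = contradiction (subst Prime (sym (trans e (ℕP.*-identityʳ p))) pp) ¬pn
              at-least-2 (suc (suc k)) _ = s≤s (s≤s z≤n)
            e : ∀ x → 1ℚ * (1ℚ * (1ℚ * (1ℚ * x))) ≡ x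
            e = solve-∀ ℚring

          -- ω (n) ≤ ω (n / p) + 1, so each of the ω (n) terms is at most 1 / ω (n). Equality holds
          -- when p² does not divide n, which settles the squarefree case.
          t≤ : ∀ p → t n p ≤ ⟨ prime-divisor? p n ⟩ * i
          t≤ p = go (prime-divisor? p n)
            where
            go : (d : Dec (Prime p × p ℕD.∣ n)) → t n p ≤ ⟨ d ⟩ * i
            go (no ¬d) = ≤-reflexive (trans (t-zero-unless n p (λ pp _ p∣n → contradiction (pp , p∣n) ¬d)) (sym (*-zeroˡ i)))
            go (yes (pp , p∣n)) = ≤-trans (≤-reflexive (term p pp p∣n)) (≤-trans (inv-anti 1≤v (subst (λ k → v k ℕ.≤ suc (v (div n p))) (sym (*-div (prime⇒1≤ pp) p∣n)) (ω-upper N₁ p (div n p) pp))) (≤-reflexive (sym (*-identityˡ i))))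

          c≤1 : c n ≤ 1ℚ
          c≤1 = ≤-trans (∑-mono N₁ (λ p _ → t≤ p)) (≤-reflexive total)

          δ≡ : δ n ≡ 1ℚ - c n
          δ≡ = trans (cong₂ (λ a b → a - c n - b) rough≡1 (pr≥-no n (λ (pn , _) → ¬pn pn))) (e (c n))
            where
            e : ∀ x → 1ℚ - x - 0ℚ ≡ 1ℚ - x
            e = solve-∀ ℚring

          square : ∃ (λ p → p ℕ.< N₁ × Prime p × p ℕ.* p ℕD.∣ n) → δ n ≤ error n
          square (p , p<N₁ , pp , pp∣n) = ≤-trans (≤-reflexive δ≡) (≤-trans (1-≤1 (0≤c n)) (≤-trans (≤-reflexive (sym term≡1))
            (≤-trans (term≤∑ N₁ (λ p → pr≥ y p * (⟨ 1 ℕ.≤? n ⟩ * ⟨ p ℕ.* p ℕD.∣? n ⟩)) (0≤square-terms n) p p<N₁) (≤-trans (≤-reflexive (sym (+-identityˡ _))) (+-monoˡ-≤ _ (0≤⟨⟩ (n ℕP.≟ 1)))))))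
            where
            term≡1 : pr≥ y p * (⟨ 1 ℕ.≤? n ⟩ * ⟨ p ℕ.* p ℕD.∣? n ⟩) ≡ 1ℚ
            term≡1 = trans (cong₂ (λ a b → a * (b * ⟨ p ℕ.* p ℕD.∣? n ⟩)) (pr≥-yes pp (large-factor pp (ℕD.∣-trans (ℕD.m∣m*n p) pp∣n))) (⟨⟩-yes (1 ℕ.≤? n) (ℕP.≤-trans (s≤s z≤n) 2≤n)))
              (trans (cong (λ w → 1ℚ * (1ℚ * w)) (⟨⟩-yes (p ℕ.* p ℕD.∣? n) pp∣n)) refl)

          squarefree : ¬ ∃ (λ p → p ℕ.< N₁ × Prime p × p ℕ.* p ℕD.∣ n) → δ n ≤ error n
          squarefree ¬sq = ≤-trans (≤-reflexive (trans δ≡ (trans (cong (λ w → 1ℚ - w) c≡1) (+-inverseʳ 1ℚ)))) (0≤error n)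
            where
            t≡ : ∀ p → p ℕ.< N₁ → t n p ≡ ⟨ prime-divisor? p n ⟩ * i
            t≡ p p<N₁ = go (prime-divisor? p n)
              where
              go : (d : Dec (Prime p × p ℕD.∣ n)) → t n p ≡ ⟨ d ⟩ * i
              go (no ¬d) = trans (t-zero-unless n p (λ pp _ p∣n → contradiction (pp , p∣n) ¬d)) (sym (*-zeroˡ i))
              go (yes (pp , p∣n)) = trans (term p pp p∣n) (trans (cong inv (ℕP.≤-antisym lower upper)) (sym (*-identityˡ i)))
                where
                n≡ : n ≡ p ℕ.* div n p
                n≡ = *-div (prime⇒1≤ pp) p∣n
                upper : v n ℕ.≤ suc (v (div n p))
                upper = subst (λ k → v k ℕ.≤ suc (v (div n p))) (sym n≡) (ω-upper N₁ p (div n p) pp)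
                p∤div : ¬ p ℕD.∣ div n p
                p∤div d = ¬sq (p , p<N₁ , pp , subst (p ℕ.* p ℕD.∣_) (sym n≡) (ℕD.*-monoʳ-∣ p d))
                lower : suc (v (div n p)) ℕ.≤ v n
                lower = subst (λ k → suc (v (div n p)) ℕ.≤ v k) (sym n≡) (ω-lower N₁ p (div n p) pp p<N₁ p∤div)
            c≡1 : c n ≡ 1ℚ
            c≡1 = trans (∑-cong N₁ t≡) total

          good : Good n
          good = ≤-trans (gap c≤1) (≤-reflexive (sym δ≡)) , decide (ℕP.anyUpTo? (λ p → isPrime? p ×-dec (p ℕ.* p ℕD.∣? n)) N₁)
            where
            decide : Dec (∃ (λ p → p ℕ.< N₁ × Prime p × p ℕ.* p ℕD.∣ n)) → δ n ≤ error n
            decide (yes sq) = square sq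
            decide (no ¬sq) = squarefree ¬sq

    good : ∀ n → n ℕ.< N₁ → (0ℚ ≤ δ n) × (δ n ≤ error n)
    good n n<N₁ = small (ℕP.anyUpTo? (λ l → prime-divisor? l n) y)
      where
      small : Dec (∃ (λ l → l ℕ.< y × Prime l × l ℕD.∣ n)) → Good n
      small (yes (l , l<y , pl , l∣n)) = small-factor n l pl l<y l∣n
      small (no ¬small) = size n refl
        where
        no-small : ∀ {l} → Prime l → l ℕ.< y → ¬ l ℕD.∣ n
        no-small {l} pl l<y l∣n = ¬small (l , l<y , pl , l∣n)
        open NoSmallFactor n n<N₁ no-small
        size : ∀ k → n ≡ k → Good n
        size 0 e = contradiction (subst (2 ℕD.∣_) (sym e) (2 ℕD.∣0)) (no-small prime[2] (ℕP.≤-trans (s≤s (s≤s (s≤s z≤n))) 3≤y))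
        size 1 e = one e
        size (suc (suc k)) e = decide (isPrime? n)
          where
          decide : Dec (Prime n) → Good n
          decide (yes pn) = prime pn
          decide (no ¬pn) = Composite.good (subst (2 ℕ.≤_) (sym e) (s≤s (s≤s z≤n))) ¬pn

    -- At most N₁ / p² positive n < N₁ are divisible by p², and the sum of 1 / p² over integers p ≥
    -- y is at most 1 / (y - 1).
    error-total : ∑ N₁ error ≤ 1ℚ + ι N₁ * inv (y ℕ.∸ 1)
    error-total = ≤-trans (≤-reflexive (∑-+ N₁ (λ n → ⟨ n ℕP.≟ 1 ⟩) (λ n → ∑ N₁ (λ p → pr≥ y p * (⟨ 1 ℕ.≤? n ⟩ * ⟨ p ℕ.* p ℕD.∣? n ⟩)))))
        (+-mono-≤ (∑-δ≤1 N₁ 1) (≤-trans (≤-reflexive (trans (∑-swap N₁ N₁ (λ n p → pr≥ y p * (⟨ 1 ℕ.≤? n ⟩ * ⟨ p ℕ.* p ℕD.∣? n ⟩))) (∑-cong N₁ (λ p _ → ∑-*ˡ N₁ (pr≥ y p) (λ n → ⟨ 1 ℕ.≤? n ⟩ * ⟨ p ℕ.* p ℕD.∣? n ⟩)))))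
          (≤-trans (∑-mono N₁ (λ p _ → row p)) (≤-trans (≤-reflexive (∑-*ˡ N₁ (ι N₁) (λ p → ⟨ y ℕ.≤? p ⟩ * (inv p * inv p)))) (*-monoʳ (0≤ι N₁) (∑-square-tail y N₁ (ℕP.≤-trans (s≤s (s≤s z≤n)) 3≤y)))))))
      where
      squares : ∀ p → 1 ℕ.≤ p → ∑ N₁ (λ n → ⟨ 1 ℕ.≤? n ⟩ * ⟨ p ℕ.* p ℕD.∣? n ⟩) ≤ ι N₁ * (inv p * inv p)
      squares p 1≤p = ≤-trans (≤-reflexive (trans (∑-cong N₁ (λ n _ → *-comm ⟨ 1 ℕ.≤? n ⟩ ⟨ p ℕ.* p ℕD.∣? n ⟩)) (quot-sum N₁ (p ℕ.* p) 1≤pp (λ n → ⟨ 1 ℕ.≤? n ⟩))))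
          (≤-trans (count (quot N₁ (p ℕ.* p)) (quot-upper N₁ (p ℕ.* p) 1≤pp)) (≤-reflexive (cong (ι N₁ *_) (inv-* p p 1≤p 1≤p))))
        where
        1≤pp : 1 ℕ.≤ p ℕ.* p
        1≤pp = ℕP.*-mono-≤ 1≤p 1≤p
        -- The multiple 0 does not count, which makes up for the rounding up in `quot`.
        first : ∀ q k → ∑ (suc k) (λ s → ⟨ 1 ℕ.≤? q ℕ.* s ⟩) ≤ ι k
        first q zero = ≤-reflexive (trans (+-identityˡ ⟨ 1 ℕ.≤? q ℕ.* 0 ⟩) (trans (⟨⟩-no (1 ℕ.≤? q ℕ.* 0) (λ h → ℕP.<⇒≢ h (sym (ℕP.*-zeroʳ q)))) (sym ι0≡0)))
        first q (suc k) = ≤-trans (+-mono-≤ (first q k) (⟨⟩≤1 (1 ℕ.≤? q ℕ.* suc k))) (≤-reflexive (trans (+-comm (ι k) 1ℚ) (sym (ι-suc k))))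
        count : ∀ T → p ℕ.* p ℕ.* T ℕ.< N₁ ℕ.+ p ℕ.* p → ∑ T (λ s → ⟨ 1 ℕ.≤? p ℕ.* p ℕ.* s ⟩) ≤ ι N₁ * inv (p ℕ.* p)
        count zero _ = 0≤* (0≤ι N₁) (0≤inv (p ℕ.* p))
        count (suc T) lt = ≤-trans (first (p ℕ.* p) T) (≤-move 1≤pp (≤-trans (≤-reflexive (trans (*-comm (ι T) (ι (p ℕ.* p))) (sym (ι-* (p ℕ.* p) T))))
          (ι-mono (ℕP.<⇒≤ (ℕP.+-cancelʳ-< (p ℕ.* p) (p ℕ.* p ℕ.* T) N₁ (subst (ℕ._< N₁ ℕ.+ p ℕ.* p) (trans (ℕP.*-suc (p ℕ.* p) T) (ℕP.+-comm (p ℕ.* p) (p ℕ.* p ℕ.* T))) lt))))))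
      row : ∀ p → pr≥ y p * ∑ N₁ (λ n → ⟨ 1 ℕ.≤? n ⟩ * ⟨ p ℕ.* p ℕD.∣? n ⟩) ≤ ι N₁ * (⟨ y ℕ.≤? p ⟩ * (inv p * inv p))
      row p = go (pr≥-cases y p)
        where
        σ : ℚ
        σ = ∑ N₁ (λ n → ⟨ 1 ℕ.≤? n ⟩ * ⟨ p ℕ.* p ℕD.∣? n ⟩)
        go : pr≥ y p ≡ 0ℚ ⊎ (Prime p × y ℕ.≤ p × pr≥ y p ≡ 1ℚ) → pr≥ y p * σ ≤ ι N₁ * (⟨ y ℕ.≤? p ⟩ * (inv p * inv p))
        go (inj₁ e) = ≤-trans (≤-reflexive (trans (cong (_* σ) e) (*-zeroˡ σ))) (0≤* (0≤ι N₁) (0≤* (0≤⟨⟩ (y ℕ.≤? p)) (0≤sq (inv p))))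
        go (inj₂ (pp , y≤p , e)) = ≤-trans (≤-reflexive (trans (cong (_* σ) e) (*-identityˡ σ))) (≤-trans (squares p (prime⇒1≤ pp)) (≤-reflexive (cong (ι N₁ *_) (sym (trans (cong (_* (inv p * inv p)) (⟨⟩-yes (y ℕ.≤? p) y≤p)) (*-identityˡ (inv p * inv p)))))))

-- A lower bound for the primes p with N - p free of factors in M.

module LowerBound where

  open Rationals
  open FiniteSums
  open Congruences
  open FundamentalLemma using (bl; 1≤bl; bl-mono; bl-suc)
  open ChebyshevBounds using (isPrime?; n<2^n)
  open MertensBounds
  open TypeISums
  open Correlations
  open DispersionMethod
  open ShellSums
  open PrimeDetection
  open import Data.Nat as ℕ using (ℕ; suc; z≤n; s≤s)
  import Data.Nat.Properties as ℕP
  import Data.Nat.Divisibility as ℕD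
  open import Data.Nat.Primality using (Prime; ¬prime[0])
  import Data.Nat.Tactic.RingSolver as ℕSolver
  open import Data.Rational using (ℚ; 0ℚ; 1ℚ; _+_; _*_; -_; _-_; _≤_; _<_)
  open import Data.Rational.Properties
  open import Data.Product using (_×_; _,_; proj₁; proj₂)
  open import Data.Sum using (_⊎_; inj₁; inj₂)
  open import Relation.Nullary using (Dec; yes; no)
  open import Relation.Binary.PropositionalEquality using (_≡_; refl; sym; trans; cong; cong₂)
  open import Tactic.RingSolver using (solve-∀)

  n≤2^n : ∀ n → n ℕ.≤ 2 ℕ.^ n
  n≤2^n n = ℕP.<⇒≤ (n<2^n n)

  double : ∀ x → x + x ≡ ι 2 * x
  double x = trans (e x) (cong (_* x) (sym ι2≡))
    where
    e : ∀ x → x + x ≡ (1ℚ + 1ℚ) * x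
    e = solve-∀ ℚring

  hp-suc : ∀ k → hp k ≡ ι 2 * hp (suc k)
  hp-suc k = sym (pw-hp-+ 1 k)

  module Total (w r N N₁ : ℕ) (7≤w : 7 ℕ.≤ w) (w≤r : w ℕ.≤ r) (lo : bl (r ℕ.+ 20) ℕ.≤ N₁) (hi : N₁ ℕ.≤ bl (r ℕ.+ 21)) where

    open Shells w r N N₁ 7≤w w≤r using (3≤w; y; z≤y; 2^; 1≤2^r; y≡; 2≤z; 0<ρz; module Shell)
    open Setup w r N 3≤w
    open Correlation w r N 3≤w w≤r using (V₀-lower)

    3≤y : 3 ℕ.≤ y
    3≤y = ℕP.≤-trans (ℕP.≤ᵇ⇒≤ 3 (2 ℕ.^ 1024) _) (bl-mono {10} {r ℕ.+ 10} (ℕP.m≤n+m 10 r))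

    open Detection y N₁ 3≤y

    -- N₁ ≤ 2 ^ K, so K serves both as the logarithm in Chebyshev's bound and as the number of
    -- dyadic shells.
    K : ℕ
    K = 2 ℕ.^ (r ℕ.+ 21)

    n : ℚ
    n = ι N₁

    1≤y : 1 ℕ.≤ y
    1≤y = 1≤bl (r ℕ.+ 10)

    private
      F : ℕ → ℚ
      F p = pr≥ y p * ∑ (quot N₁ p) (λ m → γ m * f (p ℕ.* m))

      0*≡ : ∀ {a} b → a ≡ 0ℚ → a * b ≡ 0ℚ
      0*≡ b refl = *-zeroˡ b

      row : ∀ p → pr≥ y p * ∑ N₁ (λ k → ⟨ p ℕD.∣? k ⟩ * (γ (div k p) * f k)) ≡ F p
      row p = go (pr≥-cases y p)
        where
        go : pr≥ y p ≡ 0ℚ ⊎ (Prime p × y ℕ.≤ p × pr≥ y p ≡ 1ℚ) → pr≥ y p * ∑ N₁ (λ k → ⟨ p ℕD.∣? k ⟩ * (γ (div k p) * f k)) ≡ F p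
        go (inj₁ e) = trans (0*≡ (∑ N₁ (λ k → ⟨ p ℕD.∣? k ⟩ * (γ (div k p) * f k))) e) (sym (0*≡ (∑ (quot N₁ p) (λ m → γ m * f (p ℕ.* m))) e))
        go (inj₂ (pp , _)) = cong (pr≥ y p *_) (trans (quot-sum N₁ p (prime⇒1≤ pp) (λ k → γ (div k p) * f k)) (∑-cong (quot N₁ p) (λ m _ → cong (λ d → γ d * f (p ℕ.* m)) (div-* p m (prime⇒1≤ pp)))))

      c-sum : ∑ N₁ (λ k → c k * f k) ≡ ∑ N₁ F
      c-sum = trans (∑-cong N₁ (λ k _ → trans (sym (∑-*ʳ N₁ (f k) (t k))) (∑-cong N₁ (λ p _ → e (pr≥ y p) ⟨ p ℕD.∣? k ⟩ (γ (div k p)) (f k)))))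
        (trans (∑-swap N₁ N₁ (λ k p → pr≥ y p * (⟨ p ℕD.∣? k ⟩ * (γ (div k p) * f k)))) (∑-cong N₁ (λ p _ → trans (∑-*ˡ N₁ (pr≥ y p) (λ k → ⟨ p ℕD.∣? k ⟩ * (γ (div k p) * f k))) (row p))))
        where
        e : ∀ a b c d → a * (b * c) * d ≡ a * (b * (c * d))
        e = solve-∀ ℚring

      -- γ m = 0 for m < y, and p m < N₁ forces m < y.
      inner-zero : ∀ p → 1 ℕ.≤ p → N₁ ℕ.< p ℕ.* y ⊎ N₁ ℕ.≤ p → ∑ (quot N₁ p) (λ m → γ m * f (p ℕ.* m)) ≡ 0ℚ
      inner-zero p 1≤p h = trans (∑-cong (quot N₁ p) (λ m m<q → 0*≡ (f (p ℕ.* m)) (γ-small m (m<y m m<q h)))) (∑-zero (quot N₁ p))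
        where
        pm<N₁ : ∀ m → m ℕ.< quot N₁ p → p ℕ.* m ℕ.< N₁
        pm<N₁ m m<q = ℕP.+-cancelʳ-< p (p ℕ.* m) N₁ (ℕP.≤-<-trans (ℕP.≤-trans (ℕP.≤-reflexive (trans (ℕP.+-comm (p ℕ.* m) p) (sym (ℕP.*-suc p m)))) (ℕP.*-monoʳ-≤ p m<q)) (quot-upper N₁ p 1≤p))
        m<y : ∀ m → m ℕ.< quot N₁ p → N₁ ℕ.< p ℕ.* y ⊎ N₁ ℕ.≤ p → m ℕ.< y
        m<y m m<q (inj₁ lt) = ℕP.*-cancelˡ-< p m y (ℕP.<-trans (pm<N₁ m m<q) lt)
        m<y m m<q (inj₂ N₁≤p) = ℕP.≤-trans (ℕP.*-cancelˡ-< p m 1 (ℕP.<-≤-trans (pm<N₁ m m<q) (ℕP.≤-trans N₁≤p (ℕP.≤-reflexive (sym (ℕP.*-identityʳ p)))))) 1≤y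

      bound : ℚ
      bound = ι 6 * hp 56 * (n * (ρ z * ρ z * V₀))

      0≤bound : 0ℚ ≤ bound
      0≤bound = 0≤* (0≤* (0≤ι 6) (0≤hp 56)) (0≤* (0≤ι N₁) (0≤* (0≤* (0≤ρ z) (0≤ρ z)) 0≤V₀))

      -- Only shells with P ≥ y and P y ≤ N₁ contribute. If P y > N₁, then m < y and γ vanishes; if
      -- P < y, then 2 P ≤ y, both being powers of 2, and no p in the shell reaches y.
      shell : ∀ j → 0 ℕ.≤ j → ∑ (2 ℕ.^ j) (λ i → F (2 ℕ.^ j ℕ.+ i)) ≤ bound
      shell j _ = go (y ℕ.≤? P) (P ℕ.* y ℕ.≤? N₁)
        where
        P : ℕ
        P = 2 ℕ.^ j
        zero-shell : (∀ i → i ℕ.< P → F (P ℕ.+ i) ≡ 0ℚ) → ∑ P (λ i → F (P ℕ.+ i)) ≤ bound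
        zero-shell h = ≤-trans (≤-reflexive (trans (∑-cong P h) (∑-zero P))) 0≤bound
        go : Dec (y ℕ.≤ P) → Dec (P ℕ.* y ℕ.≤ N₁) → ∑ P (λ i → F (P ℕ.+ i)) ≤ bound
        go (yes y≤P) (yes Py≤N₁) = Shell.shell-bound P y≤P Py≤N₁ γ 0≤γ (λ m → ≤-trans (γ≤rough m) (rough-antitone m z≤y))
        go (yes y≤P) (no Py≰N₁) = zero-shell λ i _ → trans (cong (pr≥ y (P ℕ.+ i) *_) (inner-zero (P ℕ.+ i) (ℕP.≤-trans (1≤2^ j) (ℕP.m≤m+n P i)) (inj₁ (ℕP.<-≤-trans (ℕP.≰⇒> Py≰N₁) (ℕP.*-monoˡ-≤ y (ℕP.m≤m+n P i)))))) (*-zeroʳ (pr≥ y (P ℕ.+ i)))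
        go (no y≰P) _ = zero-shell λ i i<P → 0*≡ (∑ (quot N₁ (P ℕ.+ i)) (λ m → γ m * f ((P ℕ.+ i) ℕ.* m))) (small i i<P)
          where
          2P≤y : P ℕ.+ P ℕ.≤ y
          2P≤y = ℕP.≤-trans (ℕP.≤-reflexive (cong (P ℕ.+_) (sym (ℕP.+-identityʳ P)))) (ℕP.^-monoʳ-≤ 2 {suc j} {2 ℕ.^ (r ℕ.+ 10)} (ℕP.≰⇒> λ le → y≰P (ℕP.^-monoʳ-≤ 2 {2 ℕ.^ (r ℕ.+ 10)} {j} le)))
          small : ∀ i → i ℕ.< P → pr≥ y (P ℕ.+ i) ≡ 0ℚ
          small i i<P = trans (cong (pr (P ℕ.+ i) *_) (⟨⟩-no (y ℕ.≤? P ℕ.+ i) (ℕP.<⇒≱ (ℕP.<-≤-trans (ℕP.+-monoʳ-< P i<P) 2P≤y)))) (*-zeroʳ (pr (P ℕ.+ i)))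

      F-beyond : ∀ k → F (N₁ ℕ.+ k) ≡ 0ℚ
      F-beyond k = trans (cong (pr≥ y (N₁ ℕ.+ k) *_) (inner-zero (N₁ ℕ.+ k) (ℕP.≤-trans (ℕP.≤-trans (1≤bl (r ℕ.+ 20)) lo) (ℕP.m≤m+n N₁ k)) (inj₂ (ℕP.m≤m+n N₁ k)))) (*-zeroʳ (pr≥ y (N₁ ℕ.+ k)))

      F0 : F 0 ≡ 0ℚ
      F0 = 0*≡ (∑ (quot N₁ 0) (λ m → γ m * f (0 ℕ.* m))) (trans (cong (_* ⟨ y ℕ.≤? 0 ⟩) (⟨⟩-no (isPrime? 0) ¬prime[0])) (*-zeroˡ ⟨ y ℕ.≤? 0 ⟩))

    typeII : ∑ N₁ (λ k → c k * f k) ≤ ι K * bound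
    typeII = ≤-trans (≤-reflexive (trans c-sum extend)) (≤-trans (∑-dyadic F bound 0 shell K) (≤-reflexive (trans (cong (_+ ι K * bound) (trans (+-identityˡ (F 0)) F0)) (+-identityˡ (ι K * bound)))))
      where
      extend : ∑ N₁ F ≡ ∑ (2 ℕ.^ (0 ℕ.+ K)) F
      extend = sym (trans (cong (λ k → ∑ k F) (sym (ℕP.m+[n∸m]≡n hi))) (trans (∑-split N₁ (bl (r ℕ.+ 21) ℕ.∸ N₁) F) (trans (cong (∑ N₁ F +_) (trans (∑-cong (bl (r ℕ.+ 21) ℕ.∸ N₁) (λ k _ → F-beyond k)) (∑-zero (bl (r ℕ.+ 21) ℕ.∸ N₁)))) (+-identityʳ (∑ N₁ F)))))

    f≤1 : ∀ k → f k ≤ 1ℚ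
    f≤1 k = ≤-trans (nonneg⇒≤ 0≤V₀ (e (χ k) V₀)) (χ≤1 k)
      where
      e : ∀ x v → x - v + v ≡ x
      e = solve-∀ ℚring

    typeI-large : Large (r ℕ.+ 10) (ι N₁)
    typeI-large = large {r ℕ.+ 10} (ι-mono (ℕP.≤-trans (ℕP.≤-reflexive (cong bl (ℕP.+-assoc r 10 10))) lo))

    typeI-bound : - ((1ℚ + 1ℚ) * (n * (ρ y * V₀ * ε))) ≤ ∑ N₁ (λ k → rough y k * f k)
    typeI-bound = TypeI.typeI w r N N₁ 10 3≤w typeI-large

    G : ℚ
    G = ∑ N₁ (λ k → pr≥ y k * χ k)

    private
      π≥ : ℚ
      π≥ = ∑ N₁ (pr≥ y)

      -- As δ is nonnegative, f ≤ 1 turns this into a sum of δ, which `error` dominates.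
      δ-sum : ∑ N₁ (λ k → δ k * f k) ≤ 1ℚ + n * inv (y ℕ.∸ 1)
      δ-sum = ≤-trans (∑-mono N₁ (λ k k<N₁ → ≤-trans (*-monoʳ (proj₁ (good k k<N₁)) (f≤1 k)) (≤-trans (≤-reflexive (*-identityʳ (δ k))) (proj₂ (good k k<N₁))))) error-total

      decompose : G ≡ ∑ N₁ (λ k → rough y k * f k) - ∑ N₁ (λ k → c k * f k) - ∑ N₁ (λ k → δ k * f k) + V₀ * π≥
      decompose = trans (∑-cong N₁ (λ k _ → e (rough y k) (c k) (pr≥ y k) (χ k) V₀)) (trans (∑-+ N₁ (λ k → rough y k * f k - c k * f k - δ k * f k) (λ k → V₀ * pr≥ y k))
        (cong₂ _+_ (trans (∑-minus N₁ (λ k → rough y k * f k - c k * f k) (λ k → δ k * f k)) (cong (_- ∑ N₁ (λ k → δ k * f k)) (∑-minus N₁ (λ k → rough y k * f k) (λ k → c k * f k)))) (∑-*ˡ N₁ V₀ (pr≥ y))))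
        where
        e : ∀ R c p x V → p * x ≡ R * (x - V) - c * (x - V) - (R - c - p) * (x - V) + V * p
        e = solve-∀ ℚring

      π-lower : ∑ N₁ pr - ι y ≤ π≥
      π-lower = ≤-trans (+-monoʳ-≤ (∑ N₁ pr) (neg-antimono-≤ below)) (≤-trans (≤-reflexive (sym (∑-minus N₁ pr (λ k → ⟨ k ℕ.<? y ⟩)))) (∑-mono N₁ (λ k _ → pointwise k)))
        where
        y≤N₁ : y ℕ.≤ N₁
        y≤N₁ = ℕP.≤-trans (bl-mono (ℕP.+-monoʳ-≤ r (ℕP.≤ᵇ⇒≤ 10 20 _))) lo
        below : ∑ N₁ (λ k → ⟨ k ℕ.<? y ⟩) ≤ ι y
        below = ≤-trans (≤-reflexive (trans (∑-cong N₁ (λ k _ → sym (*-identityʳ ⟨ k ℕ.<? y ⟩))) (sym (∑-restrict (λ _ → 1ℚ) y≤N₁)))) (≤-reflexive (trans (∑-const y 1ℚ) (*-identityʳ (ι y))))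
        pointwise : ∀ k → pr k - ⟨ k ℕ.<? y ⟩ ≤ pr≥ y k
        pointwise k = go (k ℕ.<? y)
          where
          go : (d : Dec (k ℕ.< y)) → pr k - ⟨ d ⟩ ≤ pr≥ y k
          go (yes _) = ≤-trans (≤-trans (+-monoˡ-≤ (- 1ℚ) (pr≤1 k)) (≤-reflexive (+-inverseʳ 1ℚ))) (0≤pr≥ k)
          go (no k≮y) = ≤-reflexive (trans (+-identityʳ (pr k)) (sym (trans (cong (pr k *_) (⟨⟩-yes (y ℕ.≤? k) (ℕP.≮⇒≥ k≮y))) (*-identityʳ (pr k)))))

      v : ℚ
      v = n * V₀

      0≤v : 0ℚ ≤ v
      0≤v = 0≤* (0≤ι N₁) 0≤V₀

      ρ≤ : ∀ i → ρ (bl i) ≤ ι 2 * hp i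
      ρ≤ i = ≤-move (1≤2^ i) (mertens (2 ℕ.^ i))

      -- N₁ ≤ 4 K π with K = 2 ^ (r + 21), hence the exponent r + 23.
      main-term : v * hp (r ℕ.+ 23) ≤ V₀ * ∑ N₁ pr
      main-term = ≤-trans (≤-reflexive (e n V₀ (hp (r ℕ.+ 23)))) (*-monoʳ 0≤V₀ (≤-trans (*-monoˡ (0≤hp (r ℕ.+ 23)) chebyshev) (≤-reflexive collect)))
        where
        e : ∀ n V h → n * V * h ≡ V * (n * h)
        e = solve-∀ ℚring
        3≤N₁ : 3 ℕ.≤ N₁
        3≤N₁ = ℕP.≤-trans (ℕP.≤-trans 3≤y (bl-mono (ℕP.+-monoʳ-≤ r (ℕP.≤ᵇ⇒≤ 10 20 _)))) lo
        chebyshev : n ≤ ι 4 * (ι K * ∑ N₁ pr)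
        chebyshev = prime-count-lower N₁ K 3≤N₁ hi
        collect : ι 4 * (ι K * ∑ N₁ pr) * hp (r ℕ.+ 23) ≡ ∑ N₁ pr
        collect = trans (e' (pw 2) (pw (r ℕ.+ 21)) (∑ N₁ pr) (hp (r ℕ.+ 23))) (trans (cong (_* ∑ N₁ pr) (trans (cong (_* hp (r ℕ.+ 23)) (trans (sym (pw-+ 2 (r ℕ.+ 21))) (cong pw (e'' r)))) (pw-hp (r ℕ.+ 23)))) (*-identityˡ (∑ N₁ pr)))
          where
          e' : ∀ a b s h → a * (b * s) * h ≡ a * b * h * s
          e' = solve-∀ ℚring
          e'' : ∀ r → 2 ℕ.+ (r ℕ.+ 21) ≡ r ℕ.+ 23
          e'' = ℕSolver.solve-∀

      error-I : (1ℚ + 1ℚ) * (n * (ρ y * V₀ * ε)) ≤ v * hp (r ℕ.+ 30)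
      error-I = ≤-trans (≤-reflexive (trans (cong (_* (n * (ρ y * V₀ * ε))) (sym ι2≡)) (e (ι 2) n (ρ y) V₀ ε))) (*-monoʳ 0≤v small)
        where
        e : ∀ t n ρ V ε → t * (n * (ρ * V * ε)) ≡ n * V * (t * ε * ρ)
        e = solve-∀ ℚring
        two-ε : ι 2 * ε ≡ hp 199
        two-ε = pw-hp-+ 1 199
        two-more : hp 199 * ι 2 ≡ hp 198
        two-more = trans (*-comm (hp 199) (ι 2)) (pw-hp-+ 1 198)
        ρ-part : hp 199 * ρ y ≤ hp 198 * hp (r ℕ.+ 10)
        ρ-part = ≤-trans (*-monoʳ (0≤hp 199) (ρ≤ (r ℕ.+ 10))) (≤-reflexive (trans (sym (*-assoc (hp 199) (ι 2) (hp (r ℕ.+ 10)))) (cong (_* hp (r ℕ.+ 10)) two-more)))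
        weaken : hp 198 * hp (r ℕ.+ 10) ≤ hp 20 * hp (r ℕ.+ 10)
        weaken = *-monoˡ (0≤hp (r ℕ.+ 10)) (hp-anti {20} {198} (ℕP.≤ᵇ⇒≤ 20 198 _))
        join : hp 20 * hp (r ℕ.+ 10) ≡ hp (r ℕ.+ 30)
        join = trans (*-comm (hp 20) (hp (r ℕ.+ 10))) (trans (sym (hp-+ (r ℕ.+ 10) 20)) (cong hp (ℕP.+-assoc r 10 20)))
        small : ι 2 * ε * ρ y ≤ hp (r ℕ.+ 30)
        small = ≤-trans (≤-reflexive (cong (_* ρ y) two-ε)) (≤-trans ρ-part (≤-trans weaken (≤-reflexive join)))

      -- K ρ² is at most 2 ^ (r + 21) · 4 · 2 ^ -2r, so one density absorbs the shells; with 6 ≤ 8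
      -- and the saving 2 ^ -56 the exponent is 21 + 2 + 3 - 56 - r = -(r + 30).
      error-II : ι K * bound ≤ v * hp (r ℕ.+ 30)
      error-II = ≤-trans (≤-reflexive (e (ι K) (ι 6) (hp 56) n (ρ z) V₀)) (*-monoʳ 0≤v (≤-trans (*-mono 0≤A 0≤B' A≤ ρρ≤) (≤-reflexive collect)))
        where
        e : ∀ K s h n ρ V → K * (s * h * (n * (ρ * ρ * V))) ≡ n * V * (K * s * h * (ρ * ρ))
        e = solve-∀ ℚring
        0≤A : 0ℚ ≤ ι K * ι 6 * hp 56
        0≤A = 0≤* (0≤* (0≤ι K) (0≤ι 6)) (0≤hp 56)
        A≤ : ι K * ι 6 * hp 56 ≤ ι K * pw 3 * hp 56
        A≤ = *-monoˡ (0≤hp 56) (*-monoʳ (0≤ι K) (ι-mono (ℕP.≤ᵇ⇒≤ 6 8 _)))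
        ρρ≤ : ρ z * ρ z ≤ pw 1 * hp r * (pw 1 * hp r)
        ρρ≤ = *-mono (0≤ρ z) (0≤* (0≤pw 1) (0≤hp r)) (ρ≤ r) (ρ≤ r)
        0≤B' : 0ℚ ≤ pw 1 * hp r * (pw 1 * hp r)
        0≤B' = 0≤sq (pw 1 * hp r)
        e₁ : ∀ K a h b x → K * a * h * (b * x * (b * x)) ≡ K * x * (a * (b * b) * h) * x
        e₁ = solve-∀ ℚring
        K-part : ι K * hp r ≡ pw 21
        K-part = trans (*-comm (pw (r ℕ.+ 21)) (hp r)) (hp-pw-+ r 21)
        small-part : pw 3 * (pw 1 * pw 1) * hp 56 ≡ hp 51
        small-part = trans (cong (λ k → pw 3 * k * hp 56) (sym (pw-+ 1 1))) (trans (cong (_* hp 56) (sym (pw-+ 3 2))) (pw-hp-+ 5 51))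
        collect : ι K * pw 3 * hp 56 * (pw 1 * hp r * (pw 1 * hp r)) ≡ hp (r ℕ.+ 30)
        collect = trans (e₁ (ι K) (pw 3) (hp 56) (pw 1) (hp r)) (trans (cong₂ (λ a b → a * b * hp r) K-part small-part) (trans (cong (_* hp r) (pw-hp-+ 21 30)) (trans (*-comm (hp 30) (hp r)) (sym (hp-+ r 30)))))

      -- As y² ≤ N₁, the three terms are at most 1, 2 and 1 times N₁ / y, negligible against V₀ ≥ 1
      -- / z.
      error-III : 1ℚ + n * inv (y ℕ.∸ 1) + V₀ * ι y ≤ v * hp (r ℕ.+ 30)
      error-III = ≤-trans (+-mono-≤ (+-mono-≤ one≤ middle≤) last≤) (≤-trans (≤-reflexive (trans (e (n * inv y) (ι 2)) (trans (cong (_* (n * inv y)) four) (cong (λ h → pw 2 * (n * h)) inv-y)))) (≤-trans (≤-reflexive (e' (pw 2) n (hp (2^ ℕ.* 1024)))) (≤-trans (*-monoʳ (0≤ι N₁) tiny) (≤-trans (≤-reflexive (sym (*-assoc n (hp 2^) (hp (r ℕ.+ 30))))) (*-monoˡ (0≤hp (r ℕ.+ 30)) (*-monoʳ (0≤ι N₁) V₀-lower))))))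
        where
        y*y≤N₁ : y ℕ.* y ℕ.≤ N₁
        y*y≤N₁ = ℕP.≤-trans (ℕP.≤-reflexive (sym (bl-suc (r ℕ.+ 10)))) (ℕP.≤-trans (bl-mono (ℕP.≤-trans (ℕP.≤-reflexive (sym (ℕP.+-suc r 10))) (ℕP.+-monoʳ-≤ r (ℕP.≤ᵇ⇒≤ 11 20 _)))) lo)
        y≤n/y : ι y ≤ n * inv y
        y≤n/y = ≤-move 1≤y (≤-trans (≤-reflexive (sym (ι-* y y))) (ι-mono y*y≤N₁))
        one≤ : 1ℚ ≤ n * inv y
        one≤ = ≤-trans (≤-trans (≤-reflexive (sym ι1≡1)) (ι-mono 1≤y)) y≤n/y
        inv≤ : inv (y ℕ.∸ 1) ≤ ι 2 * inv y
        inv≤ = ≤-trans (≤-reflexive (sym (*-identityˡ (inv (y ℕ.∸ 1))))) ≤-move'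
          where
          1≤y-1 : 1 ℕ.≤ y ℕ.∸ 1
          1≤y-1 = ℕP.∸-monoˡ-≤ 1 (ℕP.≤-trans (s≤s (s≤s z≤n)) 3≤y)
          y≤ : y ℕ.≤ 2 ℕ.* (y ℕ.∸ 1)
          y≤ = ℕP.≤-trans (ℕP.≤-reflexive (sym (ℕP.m+[n∸m]≡n 1≤y))) (ℕP.≤-trans (ℕP.+-monoˡ-≤ (y ℕ.∸ 1) 1≤y-1) (ℕP.≤-reflexive (cong ((y ℕ.∸ 1) ℕ.+_) (sym (ℕP.+-identityʳ (y ℕ.∸ 1))))))
          ≤-move' : 1ℚ * inv (y ℕ.∸ 1) ≤ ι 2 * inv y
          ≤-move' = ≤-move 1≤y (≤-trans (≤-reflexive (e'' (inv (y ℕ.∸ 1)) (ι y))) (≤-trans (*-monoˡ (0≤inv (y ℕ.∸ 1)) (ι-mono y≤)) (≤-reflexive (trans (cong (_* inv (y ℕ.∸ 1)) (ι-* 2 (y ℕ.∸ 1))) (trans (*-assoc (ι 2) (ι (y ℕ.∸ 1)) (inv (y ℕ.∸ 1))) (trans (cong (ι 2 *_) (ι-inv′ 1≤y-1)) (*-identityʳ (ι 2))))))))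
            where
            e'' : ∀ i y → 1ℚ * i * y ≡ y * i
            e'' = solve-∀ ℚring
        middle≤ : n * inv (y ℕ.∸ 1) ≤ ι 2 * (n * inv y)
        middle≤ = ≤-trans (*-monoʳ (0≤ι N₁) inv≤) (≤-reflexive (e'' n (ι 2) (inv y)))
          where
          e'' : ∀ a b c → a * (b * c) ≡ b * (a * c)
          e'' = solve-∀ ℚring
        last≤ : V₀ * ι y ≤ n * inv y
        last≤ = ≤-trans (*-monoˡ (0≤ι y) V₀≤1) (≤-trans (≤-reflexive (*-identityˡ (ι y))) y≤n/y)
        e : ∀ x t → x + t * x + x ≡ (t + (1ℚ + 1ℚ)) * x
        e = solve-∀ ℚring
        four : ι 2 + (1ℚ + 1ℚ) ≡ pw 2
        four = trans (cong (ι 2 +_) (sym ι2≡)) (sym (ι-+ 2 2))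
        inv-y : inv y ≡ hp (2^ ℕ.* 1024)
        inv-y = cong inv y≡
        e' : ∀ a n h → a * (n * h) ≡ n * (a * h)
        e' = solve-∀ ℚring
        exps : 2 ℕ.+ (2^ ℕ.+ (r ℕ.+ 30)) ℕ.≤ 2^ ℕ.* 1024
        exps = ℕP.≤-trans (ℕP.≤-reflexive (ℕP.+-comm 2 (2^ ℕ.+ (r ℕ.+ 30)))) (ℕP.≤-trans (ℕP.+-mono-≤ (ℕP.+-mono-≤ (ℕP.≤-refl {2^}) (ℕP.+-mono-≤ (n≤2^n r) (ℕP.m≤n*m 30 2^ {{ℕ.>-nonZero 1≤2^r}}))) (ℕP.m≤n*m 2 2^ {{ℕ.>-nonZero 1≤2^r}}))
          (ℕP.≤-trans (ℕP.≤-reflexive (collect 2^)) (ℕP.*-monoʳ-≤ 2^ (ℕP.≤ᵇ⇒≤ 34 1024 _))))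
          where
          collect : ∀ x → x ℕ.+ (x ℕ.+ x ℕ.* 30) ℕ.+ x ℕ.* 2 ≡ x ℕ.* 34
          collect = ℕSolver.solve-∀
        tiny : pw 2 * hp (2^ ℕ.* 1024) ≤ hp 2^ * hp (r ℕ.+ 30)
        tiny = ≤-trans (*-monoʳ (0≤pw 2) (hp-anti exps)) (≤-reflexive (trans (pw-hp-+ 2 (2^ ℕ.+ (r ℕ.+ 30))) (hp-+ 2^ (r ℕ.+ 30))))

      three-errors : hp (r ℕ.+ 24) + (hp (r ℕ.+ 30) + hp (r ℕ.+ 30) + hp (r ℕ.+ 30)) ≤ hp (r ℕ.+ 23)
      three-errors = ≤-trans (+-monoʳ-≤ (hp (r ℕ.+ 24)) (≤-trans (x≤x+y (0≤hp (r ℕ.+ 30))) (≤-trans (≤-reflexive quadruple) (hp-anti (ℕP.+-monoʳ-≤ r (ℕP.≤ᵇ⇒≤ 24 28 _))))))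
        (≤-reflexive (trans (double (hp (r ℕ.+ 24))) (trans (cong (λ k → ι 2 * hp k) (ℕP.+-suc r 23)) (sym (hp-suc (r ℕ.+ 23))))))
        where
        quadruple : hp (r ℕ.+ 30) + hp (r ℕ.+ 30) + hp (r ℕ.+ 30) + hp (r ℕ.+ 30) ≡ hp (r ℕ.+ 28)
        quadruple = trans (e (hp (r ℕ.+ 30))) (trans (cong (_* hp (r ℕ.+ 30)) (trans (cong₂ _+_ (sym ι2≡) (sym ι2≡)) (sym (ι-+ 2 2)))) (trans (cong (λ k → pw 2 * hp k) (e' r)) (pw-hp-+ 2 (r ℕ.+ 28))))
          where
          e : ∀ x → x + x + x + x ≡ (1ℚ + 1ℚ + (1ℚ + 1ℚ)) * x
          e = solve-∀ ℚring
          e' : ∀ r → r ℕ.+ 30 ≡ 2 ℕ.+ (r ℕ.+ 28)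
          e' = ℕSolver.solve-∀

    -- Three errors of 2 ^ -(r + 30) leave more than half of the main term 2 ^ -(r + 23).
    G-lower : n * V₀ * hp (r ℕ.+ 24) ≤ G
    G-lower = ≤-trans (nonneg⇒≤ (0≤* 0≤v (gap three-errors)) (e₁ v (hp (r ℕ.+ 24)) (hp (r ℕ.+ 30)) (hp (r ℕ.+ 23))))
      (≤-trans (+-mono-≤ main-term (neg-antimono-≤ (+-mono-≤ (+-mono-≤ error-I error-II) error-III)))
        (≤-trans (nonneg⇒≤ (0≤+ (0≤+ (0≤+ (gap typeI-bound) (gap typeII)) (gap δ-sum)) (0≤* 0≤V₀ (gap π-lower)))
          (e₂ V₀ (∑ N₁ pr) (ι y) π≥ ((1ℚ + 1ℚ) * (n * (ρ y * V₀ * ε))) (ι K * bound) (n * inv (y ℕ.∸ 1)) (∑ N₁ (λ k → rough y k * f k)) (∑ N₁ (λ k → c k * f k)) (∑ N₁ (λ k → δ k * f k))))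
          (≤-reflexive (sym decompose))))
      where
      e₁ : ∀ v a b c → v * a + v * (c - (a + (b + b + b))) ≡ v * c + - (v * b + v * b + v * b)
      e₁ = solve-∀ ℚring
      e₂ : ∀ V p y π I II s R C D → V * p + - (I + II + (1ℚ + s + V * y)) + ((R - - I) + (II - C) + ((1ℚ + s) - D) + V * (π - (p - y))) ≡ R - C - D + V * π
      e₂ = solve-∀ ℚring

-- Prime factors below W on average, and the choice of p.

module SmallFactors where

  open Rationals
  open FiniteSums
  open Congruences
  open FundamentalLemma using (bl; 1≤bl; bl-mono; bl-suc; close-sub)
  open ChebyshevBounds using (isPrime?)
  open MertensBounds
  open TypeISums
  open Correlations
  open ShellSums
  open LowerBound
  open import Data.Nat as ℕ using (ℕ; zero; suc; s≤s)
  import Data.Nat.Properties as ℕP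
  import Data.Nat.Divisibility as ℕD
  open import Data.Nat.Coprimality using (Coprime; 1-coprimeTo)
  open import Data.Nat.Primality using (Prime; euclidsLemma)
  open import Data.Rational using (ℚ; 0ℚ; 1ℚ; _+_; _*_; -_; _-_; _≤_; _<_)
  open import Data.Rational.Properties
  open import Data.Product using (Σ; _×_; _,_; proj₁; proj₂)
  open import Data.Sum using (_⊎_; inj₁; inj₂)
  open import Relation.Nullary using (Dec; yes; no; ¬_; contradiction)
  open import Relation.Binary.PropositionalEquality using (_≡_; refl; sym; trans; cong; cong₂; subst)
  open import Tactic.RingSolver using (solve-∀)

  positive-term : ∀ n (g : ℕ → ℚ) → 0ℚ < ∑ n g → Σ ℕ λ i → i ℕ.< n × 0ℚ < g i
  positive-term zero g p = contradiction p (<-irrefl refl)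
  positive-term (suc n) g p with 0ℚ <? g n
  ... | yes q = n , ℕP.≤-refl , q
  ... | no ¬q = lift (positive-term n g (<-≤-trans p (≤-trans (+-monoʳ-≤ (∑ n g) (≮⇒≥ ¬q)) (≤-reflexive (+-identityʳ (∑ n g))))))
    where
    lift : (Σ ℕ λ i → i ℕ.< n × 0ℚ < g i) → Σ ℕ λ i → i ℕ.< suc n × 0ℚ < g i
    lift (i , i<n , q) = i , ℕP.m<n⇒m<1+n i<n , q

  prime∣power : ∀ {l q} k → Prime l → l ℕD.∣ q ℕ.^ k → l ℕD.∣ q
  prime∣power zero pl l∣1 = contradiction (subst (2 ℕ.≤_) (ℕD.∣1⇒≡1 l∣1) (prime⇒2≤ pl)) λ { (s≤s ()) }
  prime∣power {l} {q} (suc k) pl l∣ = go (euclidsLemma q (q ℕ.^ k) pl l∣)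
    where
    go : l ℕD.∣ q ⊎ l ℕD.∣ q ℕ.^ k → l ℕD.∣ q
    go (inj₁ d) = d
    go (inj₂ d) = prime∣power k pl d

  inv-power : ∀ q k → 1 ℕ.≤ q → inv (q ℕ.^ k) ≡ inv q ^ k
  inv-power q zero _ = inv1≡1
  inv-power q (suc k) 1≤q = trans (inv-* q (q ℕ.^ k) 1≤q (ℕP.m^n>0 q {{ℕ.>-nonZero 1≤q}} k)) (cong (inv q *_) (inv-power q k 1≤q))

  geometric : ∀ {x} e → 0ℚ ≤ x → ι 2 * x ≤ 1ℚ → ∑ e (λ k → x ^ suc k) ≤ ι 2 * x
  geometric {x} e 0≤x 2x≤1 = ≤-trans (x≤x+y (0≤* (0≤* (0≤ι 2) 0≤x) (0≤^ e 0≤x))) (go e)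
    where
    go : ∀ e → ∑ e (λ k → x ^ suc k) + ι 2 * x * x ^ e ≤ ι 2 * x
    go zero = ≤-reflexive (trans (+-identityˡ (ι 2 * x * 1ℚ)) (*-identityʳ (ι 2 * x)))
    go (suc e) = ≤-trans (nonneg⇒≤ (0≤* (0≤* 0≤x (0≤^ e 0≤x)) (gap 2x≤1)) (step (∑ e (λ k → x ^ suc k)) (ι 2) x (x ^ e) ι2≡)) (go e)
      where
      step : ∀ s t x y → t ≡ 1ℚ + 1ℚ → s + x * y + t * x * (x * y) + x * y * (1ℚ - t * x) ≡ s + t * x * y
      step s t x y refl = e' s x y
        where
        e' : ∀ s x y → s + x * y + (1ℚ + 1ℚ) * x * (x * y) + x * y * (1ℚ - (1ℚ + 1ℚ) * x) ≡ s + (1ℚ + 1ℚ) * x * y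
        e' = solve-∀ ℚring

  harmonic-upper : ∀ k → ∑ (2 ℕ.^ k) inv ≤ ι k
  harmonic-upper k = ≤-trans (∑-dyadic inv 1ℚ 0 (λ j _ → ≤-trans (∑-≤-const (2 ℕ.^ j) (hp j) (λ i → inv (2 ℕ.^ j ℕ.+ i)) (λ i _ → inv-anti (1≤2^ j) (ℕP.m≤m+n (2 ℕ.^ j) i))) (≤-reflexive (pw-hp j))) k)
    (≤-reflexive (trans (cong₂ _+_ (trans (+-identityˡ (inv 0)) inv0≡0) (*-identityʳ (ι k))) (+-identityˡ (ι k))))

  module SmallPrimes (w r N N₁ : ℕ) (7≤w : 7 ℕ.≤ w) (w≤r : w ℕ.≤ r) (lo : bl (r ℕ.+ 20) ℕ.≤ N₁) where

    open Shells w r N N₁ 7≤w w≤r using (3≤w; y; z≤y; 2^; 1≤2^r)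
    open Setup w r N 3≤w

    private
      -- One block below y: in a class mod Q only the length N₁ / Q ≥ bl (r + 19) is available,
      -- which supports sieving up to bl (r + 9).
      i : ℕ
      i = r ℕ.+ 9

      y' : ℕ
      y' = bl i

      z+d : z ℕ.+ (y' ℕ.∸ z) ≡ y'
      z+d = ℕP.m+[n∸m]≡n (bl-mono (ℕP.m≤m+n r 9))

      prime≤rough : ∀ n → pr≥ y n ≤ rough y' n
      prime≤rough n = go (pr≥-cases y n)
        where
        go : pr≥ y n ≡ 0ℚ ⊎ (Prime n × y ℕ.≤ n × pr≥ y n ≡ 1ℚ) → pr≥ y n ≤ rough y' n
        go (inj₁ e) = ≤-trans (≤-reflexive e) (0≤rough y' n)
        go (inj₂ (pn , y≤n , e)) = ≤-reflexive (trans e (sym (rough-one λ pl l<y' l∣n → ℕP.<⇒≢ (ℕP.<-≤-trans l<y' (ℕP.≤-trans (bl-mono (ℕP.+-monoʳ-≤ r (ℕP.n≤1+n 9))) y≤n)) (prime∣prime pl pn l∣n))))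

    module PrimePower (q k : ℕ) (pq : Prime q) (q<W : q ℕ.< W) (Q≤ : q ℕ.^ suc k ℕ.≤ bl (r ℕ.+ 19)) where

      Q : ℕ
      Q = q ℕ.^ suc k

      1≤Q : 1 ℕ.≤ Q
      1≤Q = ℕP.m^n>0 q {{ℕ.>-nonZero (prime⇒1≤ pq)}} (suc k)

      2≤Q : 2 ℕ.≤ Q
      2≤Q = ℕP.≤-trans (prime⇒2≤ pq) (ℕP.m≤m*n q (q ℕ.^ k) {{ℕ.>-nonZero (ℕP.m^n>0 q {{ℕ.>-nonZero (prime⇒1≤ pq)}} k)}})

      M⇒∤Q : ∀ {l} → M l → ¬ l ℕD.∣ Q
      M⇒∤Q (pl , W≤l , _) l∣Q = ℕP.<⇒≱ q<W (subst (W ℕ.≤_) (prime∣prime pl pq (prime∣power (suc k) pl l∣Q)) W≤l)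

      open Shifted Q M⇒∤Q

      X : ℚ
      X = ι N₁ * inv Q

      private
        0≤X : 0ℚ ≤ X
        0≤X = 0≤* (0≤ι N₁) (0≤inv Q)

        large-X : Large i X
        large-X = large {i} (≤-trans (ι-mono (ℕP.≤-reflexive (cong bl (ℕP.+-assoc r 9 10)))) (≤-move 1≤Q (≤-trans (≤-reflexive (sym (ι-* (bl (r ℕ.+ 19)) Q))) (ι-mono (ℕP.≤-trans (ℕP.*-monoʳ-≤ (bl (r ℕ.+ 19)) Q≤) (ℕP.≤-trans (ℕP.≤-reflexive square) lo))))))
          where
          square : bl (r ℕ.+ 19) ℕ.* bl (r ℕ.+ 19) ≡ bl (r ℕ.+ 20)
          square = trans (sym (bl-suc (r ℕ.+ 19))) (cong bl (sym (ℕP.+-suc r 19)))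

        cop : Cop (1 ℕ.* Q) y'
        cop {l} _ eq = subst (λ m → Coprime m l) (sym (ℕP.*-identityˡ Q)) (coprime-sym (∤⇒coprime (proj₁ (C⇒P eq)) (proj₂ (C⇒P eq))))

        -- Q has the single prime factor q, so leaving out the primes dividing Q costs a factor 2;
        -- Mertens bounds the full density by 2 · 2 ^ -i.
        V≤ : V y' ≤ ι 4 * hp i * V₀
        V≤ = ≤-trans (≤-reflexive (trans (cong V (sym z+d)) (trans (V≡ (y' ℕ.∸ z)) (cong (λ Z → ρ-off Q Z * V₀) z+d)))) (*-monoˡ 0≤V₀
            (≤-trans (ρ-off-extend 1 Q q y' (prime⇒2≤ pq) (λ {l} pl l≢q _ l∣Q → l≢q (prime∣prime pl pq (prime∣power (suc k) pl l∣Q))))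
              (≤-trans (*-monoʳ (0≤ι 2) (≤-trans (≤-reflexive (ρ-off-1 y')) (≤-move (1≤2^ i) (mertens (2 ℕ.^ i))))) (≤-reflexive (trans (sym (*-assoc (ι 2) (ι 2) (hp i))) (cong (_* hp i) (sym (ι-* 2 2))))))))

        φ : ℕ → ℚ
        φ n = rough y' n * χ n

        φ≤h : ∀ n → φ n ≤ h y' n
        φ≤h n = ≤-trans (*-monoˡ (0≤χ n) rough≤) (≤-reflexive (sym (trans (cong (λ Z → h Z n) (sym z+d)) (trans (h≡ (y' ℕ.∸ z) n) (cong (λ Z → ∏ Z (λ l → 1ℚ - ⟨ P? l ⟩ * ⟨ cg? l n 0 ⟩) * χ n) z+d)))))
          where
          rough≤ : rough y' n ≤ ∏ y' (λ l → 1ℚ - ⟨ P? l ⟩ * ⟨ cg? l n 0 ⟩)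
          rough≤ = ∏-mono y' (λ l _ → 0≤1-⟨⟩⟨⟩ (isPrime? l) (cg? l n 0)) (λ l _ → +-monoʳ-≤ 1ℚ (neg-antimono-≤ (*-monoˡ (0≤⟨⟩ (cg? l n 0)) (⟨⟩-⇒ (P? l) (isPrime? l) proj₁))))

        sieved : ∀ a T → ∣ ι T - X ∣≤ ι 2 → ∑ T (λ s → φ (a ℕ.+ 1 ℕ.* Q ℕ.* s)) ≤ ι 2 * (X * V y')
        sieved a T cl = ≤-trans (∑-mono T (λ s _ → φ≤h (a ℕ.+ 1 ℕ.* Q ℕ.* s))) (≤-trans upper (≤-reflexive (e (X * V y'))))
          where
          count : ∣ S y' a (1 ℕ.* Q) T - X * V y' ∣≤ X * (V y' * hp 200)
          count = fundamental-lemma i 200 a (1 ℕ.* Q) T X cop cl large-X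
          upper : S y' a (1 ℕ.* Q) T ≤ X * V y' + X * V y'
          upper = ≤-trans (abs-hi {S y' a (1 ℕ.* Q) T} {X * V y'} count) (+-monoʳ-≤ (X * V y') (*-monoʳ 0≤X (≤-trans (*-monoʳ (V≥0 y') (hp≤1 200)) (≤-reflexive (*-identityʳ (V y'))))))
          e : ∀ x → x + x ≡ ι 2 * x
          e = double

      -- An upper bound sieve in the class of N mod Q, which expects the share 1 / Q. The prime q is
      -- not sieved by, so the class may be arbitrary.
      count-power : ∑ N₁ (λ n → pr≥ y n * χ n * ⟨ cg? Q n N ⟩) ≤ ι N₁ * V₀ * (ι 8 * hp i) * inv Q
      count-power = ≤-trans (∑-mono N₁ (λ n _ → ≤-trans (*-monoˡ (0≤⟨⟩ (cg? Q n N)) (*-monoˡ (0≤χ n) (prime≤rough n))) (≤-reflexive (trans (*-comm (φ n) ⟨ cg? Q n N ⟩) (sym (cong₂ (λ a b → ⟨ cg? Q a N ⟩ * φ b) (n≡0+1*n n) (n≡0+1*n n)))))))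
          (use (subAP Q 1 0 N N₁ 1≤Q (1-coprimeTo Q)))
        where
        use : SubAP Q 1 0 N N₁ → ∑ N₁ (λ n → ⟨ cg? Q (0 ℕ.+ 1 ℕ.* n) N ⟩ * φ (0 ℕ.+ 1 ℕ.* n)) ≤ ι N₁ * V₀ * (ι 8 * hp i) * inv Q
        use (a , T , lo' , hi' , eq) = ≤-trans (≤-reflexive (eq φ)) (≤-trans (sieved a T (close-sub 2≤Q lo' hi' (close-refl N₁))) (≤-trans (*-monoʳ (0≤ι 2) (*-monoʳ 0≤X V≤)) (≤-reflexive (trans (e (ι 2) (ι N₁) (inv Q) (ι 4) (hp i) V₀) (cong (λ t → ι N₁ * V₀ * (t * hp i) * inv Q) (sym (ι-* 2 4)))))))
          where
          e : ∀ t n q f h V → t * (n * q * (f * h * V)) ≡ n * V * (t * f * h) * q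
          e = solve-∀ ℚring

    -- For q < W and k ≤ e the power q ^ k is at most bl (r + 19), whereas a multiplicity is at most 2 ^ 9 * e.
    e : ℕ
    e = 2 ℕ.^ (r ℕ.+ 12)

    -- For n < N, the number of prime factors of N - n below W with multiplicity, each multiplicity
    -- truncated at `e`.
    Φ : ℕ → ℚ
    Φ n = ∑ W (λ q → ∑ e (λ k → pr q * ⟨ cg? (q ℕ.^ suc k) n N ⟩))

    0≤Φ : ∀ n → 0ℚ ≤ Φ n
    0≤Φ n = ∑-nonneg W (λ q _ → ∑-nonneg e (λ k _ → 0≤* (0≤pr q) (0≤⟨⟩ (cg? (q ℕ.^ suc k) n N))))

    private
      K : ℚ
      K = ι N₁ * V₀ * (ι 8 * hp i)

      0≤K : 0ℚ ≤ K
      0≤K = 0≤* (0≤* (0≤ι N₁) 0≤V₀) (0≤* (0≤ι 8) (0≤hp i))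

      module Weighted (w≤7 : w ℕ.≤ 7) where

        Q≤ : ∀ q k → q ℕ.< W → k ℕ.< e → q ℕ.^ suc k ℕ.≤ bl (r ℕ.+ 19)
        Q≤ q k q<W k<e = ℕP.≤-trans (ℕP.^-monoˡ-≤ (suc k) (ℕP.<⇒≤ q<W)) (ℕP.≤-trans (ℕP.≤-reflexive (ℕP.^-*-assoc 2 (2 ℕ.^ w) (suc k))) (ℕP.^-monoʳ-≤ 2 (ℕP.≤-trans (ℕP.*-mono-≤ (ℕP.^-monoʳ-≤ 2 w≤7) k<e) (ℕP.≤-reflexive exponents))))
          where
          exponents : 2 ℕ.^ 7 ℕ.* 2 ℕ.^ (r ℕ.+ 12) ≡ 2 ℕ.^ (r ℕ.+ 19)
          exponents = trans (ℕP.*-comm (2 ℕ.^ 7) (2 ℕ.^ (r ℕ.+ 12))) (trans (sym (ℕP.^-distribˡ-+-* 2 (r ℕ.+ 12) 7)) (cong (2 ℕ.^_) (ℕP.+-assoc r 12 7)))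

        power-sum : ∀ q → q ℕ.< W → ∀ k → k ℕ.< e → ∑ N₁ (λ n → pr≥ y n * χ n * (pr q * ⟨ cg? (q ℕ.^ suc k) n N ⟩)) ≤ K * (pr q * inv (q ℕ.^ suc k))
        power-sum q q<W k k<e = ≤-trans (≤-reflexive (trans (∑-cong N₁ (λ n _ → e₁ (pr≥ y n * χ n) (pr q) ⟨ cg? (q ℕ.^ suc k) n N ⟩)) (∑-*ˡ N₁ (pr q) (λ n → pr≥ y n * χ n * ⟨ cg? (q ℕ.^ suc k) n N ⟩)))) (go (isPrime? q))
          where
          e₁ : ∀ a p c → a * (p * c) ≡ p * (a * c)
          e₁ = solve-∀ ℚring
          σ : ℚ
          σ = ∑ N₁ (λ n → pr≥ y n * χ n * ⟨ cg? (q ℕ.^ suc k) n N ⟩)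
          go : (d : Dec (Prime q)) → ⟨ d ⟩ * σ ≤ K * (⟨ d ⟩ * inv (q ℕ.^ suc k))
          go (no _) = ≤-trans (≤-reflexive (*-zeroˡ σ)) (0≤* 0≤K (0≤* ≤-refl (0≤inv (q ℕ.^ suc k))))
          go (yes pq) = ≤-trans (≤-reflexive (*-identityˡ σ)) (≤-trans (PrimePower.count-power q k pq q<W (Q≤ q k q<W k<e)) (≤-reflexive (cong (K *_) (sym (*-identityˡ (inv (q ℕ.^ suc k)))))))

        prime-sum : ∀ q → ∑ e (λ k → pr q * inv (q ℕ.^ suc k)) ≤ ι 2 * inv q
        prime-sum q = ≤-trans (≤-reflexive (∑-*ˡ e (pr q) (λ k → inv (q ℕ.^ suc k)))) (go (isPrime? q))
          where
          σ : ℚ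
          σ = ∑ e (λ k → inv (q ℕ.^ suc k))
          go : (d : Dec (Prime q)) → ⟨ d ⟩ * σ ≤ ι 2 * inv q
          go (no _) = ≤-trans (≤-reflexive (*-zeroˡ σ)) (0≤* (0≤ι 2) (0≤inv q))
          go (yes pq) = ≤-trans (≤-reflexive (trans (*-identityˡ σ) (∑-cong e (λ k _ → inv-power q (suc k) (prime⇒1≤ pq))))) (geometric e (0≤inv q) (≤-trans (*-monoˡ (0≤inv q) (ι-mono (prime⇒2≤ pq))) (≤-reflexive (ι-inv′ (prime⇒1≤ pq)))))

        -- The powers of q contribute at most 2 / q. The sum of 1 / q over all positive integers q <
        -- W is at most log₂ W, which is 2 ^ w ≤ 2 ^ 7.
        Φ-sum : ∑ N₁ (λ n → pr≥ y n * χ n * Φ n) ≤ K * (ι 2 * pw 7)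
        Φ-sum = ≤-trans (≤-reflexive rearrange) (≤-trans (∑-mono W (λ q q<W → ≤-trans (∑-mono e (λ k k<e → power-sum q q<W k k<e)) (≤-trans (≤-reflexive (∑-*ˡ e K (λ k → pr q * inv (q ℕ.^ suc k)))) (*-monoʳ 0≤K (prime-sum q)))))
            (≤-trans (≤-reflexive (trans (∑-*ˡ W K (λ q → ι 2 * inv q)) (cong (K *_) (∑-*ˡ W (ι 2) inv)))) (*-monoʳ 0≤K (*-monoʳ (0≤ι 2) (≤-trans (harmonic-upper (2 ℕ.^ w)) (pw-mono w≤7))))))
          where
          A : ℕ → ℚ
          A n = pr≥ y n * χ n
          B : ℕ → ℕ → ℕ → ℚ
          B n q k = A n * (pr q * ⟨ cg? (q ℕ.^ suc k) n N ⟩)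
          rearrange : ∑ N₁ (λ n → A n * Φ n) ≡ ∑ W (λ q → ∑ e (λ k → ∑ N₁ (λ n → B n q k)))
          rearrange = trans (∑-cong N₁ (λ n _ → trans (sym (∑-*ˡ W (A n) (λ q → ∑ e (λ k → pr q * ⟨ cg? (q ℕ.^ suc k) n N ⟩)))) (∑-cong W (λ q _ → sym (∑-*ˡ e (A n) (λ k → pr q * ⟨ cg? (q ℕ.^ suc k) n N ⟩))))))
            (trans (∑-swap N₁ W (λ n q → ∑ e (B n q))) (∑-cong W (λ q _ → ∑-swap N₁ e (λ n k → B n q k))))

    open Weighted public

  module Selection (w r N N₁ : ℕ) (7≤w : 7 ℕ.≤ w) (w≤7 : w ℕ.≤ 7) (w≤r : w ℕ.≤ r) (lo : bl (r ℕ.+ 20) ℕ.≤ N₁) (hi : N₁ ℕ.≤ bl (r ℕ.+ 21)) where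

    open Shells w r N N₁ 7≤w w≤r using (3≤w; y; z≤y; 0<V₀)
    open Setup w r N 3≤w
    open SmallPrimes w r N N₁ 7≤w w≤r lo using (e; Φ; 0≤Φ; Φ-sum)
    open Total w r N N₁ 7≤w w≤r lo hi using (G; G-lower)

    private
      v : ℚ
      v = ι N₁ * V₀

      weight : ℕ → ℚ
      weight n = pr≥ y n * χ n

      0<v : 0ℚ < v
      0<v = 0<* (<-≤-trans 0<1 (≤-trans (≤-reflexive (sym ι1≡1)) (ι-mono (ℕP.≤-trans (1≤bl (r ℕ.+ 20)) lo)))) 0<V₀

      upper≡ : v * (ι 8 * hp (r ℕ.+ 9)) * (ι 2 * pw 7) ≡ v * (pw 26 * hp (r ℕ.+ 24))
      upper≡ = trans (e' v (pw 3) (hp (r ℕ.+ 9)) (pw 1) (pw 7)) (cong (v *_) (trans (cong (_* hp (r ℕ.+ 9)) powers) (sym shift)))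
        where
        e' : ∀ v a h b c → v * (a * h) * (b * c) ≡ v * (a * (b * c) * h)
        e' = solve-∀ ℚring
        powers : pw 3 * (pw 1 * pw 7) ≡ pw 11
        powers = trans (cong (pw 3 *_) (sym (pw-+ 1 7))) (sym (pw-+ 3 8))
        split : hp (r ℕ.+ 24) ≡ hp (r ℕ.+ 9) * hp 15
        split = trans (cong hp (sym (ℕP.+-assoc r 9 15))) (hp-+ (r ℕ.+ 9) 15)
        pw26 : pw 26 * hp 15 ≡ pw 11
        pw26 = trans (*-comm (pw 26) (hp 15)) (hp-pw-+ 15 11)
        shift : pw 26 * hp (r ℕ.+ 24) ≡ pw 11 * hp (r ℕ.+ 9)
        shift = trans (cong (pw 26 *_) (trans split (*-comm (hp (r ℕ.+ 9)) (hp 15)))) (trans (sym (*-assoc (pw 26) (hp 15) (hp (r ℕ.+ 9)))) (cong (_* hp (r ℕ.+ 9)) pw26))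

      -- The mean of Φ over the weighted primes is at most 2 ^ 26, and the threshold 2 ^ 27 is twice
      -- that.
      surplus : 0ℚ < ∑ N₁ (λ n → weight n * (pw 27 - Φ n))
      surplus = <-≤-trans positive-part (≤-trans (nonneg⇒≤ (0≤+ (0≤* (0≤pw 27) (gap G-lower)) (gap Φ≤)) (e₁ (pw 27) v (hp (r ℕ.+ 24)) (pw 26) G (∑ N₁ (λ n → weight n * Φ n)))) (≤-reflexive (sym expand)))
        where
        Φ≤ : ∑ N₁ (λ n → weight n * Φ n) ≤ v * (pw 26 * hp (r ℕ.+ 24))
        Φ≤ = ≤-trans (Φ-sum w≤7) (≤-reflexive upper≡)
        e₁ : ∀ a v h b G s → (a - b) * (v * h) + (a * (G - v * h) + (v * (b * h) - s)) ≡ a * G - s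
        e₁ = solve-∀ ℚring
        e₂ : ∀ x a f → x * (a - f) ≡ a * x - x * f
        e₂ = solve-∀ ℚring
        expand : ∑ N₁ (λ n → weight n * (pw 27 - Φ n)) ≡ pw 27 * G - ∑ N₁ (λ n → weight n * Φ n)
        expand = trans (∑-cong N₁ (λ n _ → e₂ (weight n) (pw 27) (Φ n))) (trans (∑-minus N₁ (λ n → pw 27 * weight n) (λ n → weight n * Φ n)) (cong (_- ∑ N₁ (λ n → weight n * Φ n)) (∑-*ˡ N₁ (pw 27) weight)))
        pw27-26 : pw 26 ≤ pw 27 - pw 26
        pw27-26 = ≤-reflexive (trans (e₃ (pw 26)) (cong (_- pw 26) (trans (cong (_* pw 26) (sym ι2≡)) (sym (pw-+ 1 26)))))
          where
          e₃ : ∀ x → x ≡ (1ℚ + 1ℚ) * x - x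
          e₃ = solve-∀ ℚring
        positive-part : 0ℚ < (pw 27 - pw 26) * (v * hp (r ℕ.+ 24))
        positive-part = 0<* (<-≤-trans (0<pw 26) pw27-26) (0<* 0<v (0<inv′ (1≤2^ (r ℕ.+ 24))))

    -- A positive summand yields everything at once: its weight vanishes unless p is a prime from y
    -- on that meets the condition, and the second factor bounds Φ.
    selection : Σ ℕ λ p → p ℕ.< N₁ × Prime p × y ℕ.≤ p × (∀ {l} → M l → ¬ Cg l p N) × Φ p ≤ pw 27
    selection = use (positive-term N₁ (λ n → weight n * (pw 27 - Φ n)) surplus)
      where
      use : (Σ ℕ λ p → p ℕ.< N₁ × 0ℚ < weight p * (pw 27 - Φ p)) → Σ ℕ λ p → p ℕ.< N₁ × Prime p × y ℕ.≤ p × (∀ {l} → M l → ¬ Cg l p N) × Φ p ≤ pw 27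
      use (p , p<N₁ , pos) = finish (pr≥-cases y p)
        where
        zero-absurd : ∀ {x} → x ≡ 0ℚ → ¬ 0ℚ < x
        zero-absurd refl = <-irrefl refl
        0≤weight : 0ℚ ≤ weight p
        0≤weight = 0≤* (0≤* (0≤pr p) (0≤⟨⟩ (y ℕ.≤? p))) (0≤χ p)
        finish : pr≥ y p ≡ 0ℚ ⊎ (Prime p × y ℕ.≤ p × pr≥ y p ≡ 1ℚ) → Σ ℕ λ p → p ℕ.< N₁ × Prime p × y ℕ.≤ p × (∀ {l} → M l → ¬ Cg l p N) × Φ p ≤ pw 27
        finish (inj₁ e₀) = contradiction pos (zero-absurd (trans (cong (λ x → x * χ p * (pw 27 - Φ p)) e₀) (trans (cong (_* (pw 27 - Φ p)) (*-zeroˡ (χ p))) (*-zeroˡ (pw 27 - Φ p)))))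
        finish (inj₂ (pp , y≤p , _)) = p , p<N₁ , pp , y≤p , avoid , small
          where
          avoid : ∀ {l} → M l → ¬ Cg l p N
          avoid {l} m c = zero-absurd (trans (cong (λ x → pr≥ y p * x * (pw 27 - Φ p)) χ≡0) (trans (cong (_* (pw 27 - Φ p)) (*-zeroʳ (pr≥ y p))) (*-zeroˡ (pw 27 - Φ p)))) pos
            where
            χ≡0 : χ p ≡ 0ℚ
            χ≡0 = ∏-zero z (λ l → 1ℚ - μ l * ⟨ cg? l p N ⟩) l (proj₁ (proj₂ (proj₂ m))) (cong₂ (λ a b → 1ℚ - a * b) (⟨⟩-yes (M? l) m) (⟨⟩-yes (cg? l p N) c))
          small : Φ p ≤ pw 27
          small = ≮⇒≥ λ lt → <⇒≱′ pos (≤-trans (*-monoʳ 0≤weight (≤-trans (+-monoˡ-≤ (- Φ p) (<⇒≤ lt)) (≤-reflexive (+-inverseʳ (Φ p))))) (≤-reflexive (*-zeroʳ (weight p))))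
            where
            <⇒≱′ : ∀ {x y} → x < y → ¬ y ≤ x
            <⇒≱′ a b = <-irrefl refl (<-≤-trans a b)

-- From the chosen prime to the factorisation of N - p, and small N.

module Conclusion where

  open import Defs
  open Rationals using (ι; pw; pw-+; ι-suc; ι-*; ι-mono; 0≤ι; ι0≡0; ι-cancel-≤; 0≤pw; 1≤2^; *-monoʳ; 0≤*)
  open FiniteSums
  open Congruences
  open FundamentalLemma using (bl; bl-mono)
  open ChebyshevBounds using (isPrime?)
  open MertensBounds using (pr; 0≤pr)
  open TypeISums using (module Setup)
  open LowerBound using (n≤2^n)
  open SmallFactors
  open import Data.List using (List; []; _∷_; length)
  open import Data.Nat.ListAction using (product)
  open import Data.List.Relation.Unary.All using (All; []; _∷_)
  open import Data.Nat
  open import Data.Nat.Properties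
  open import Data.Nat.Divisibility
  open import Data.Nat.Primality using (Prime; prime[2])
  open import Data.Nat.Primality.Factorisation using (factorise; PrimeFactorisation)
  open import Data.Rational as ℚ using (ℚ; 0ℚ; 1ℚ)
  import Data.Rational.Properties as ℚP
  open import Data.Product using (Σ; ∃-syntax; _×_; _,_)
  open import Data.Sum using (_⊎_; inj₁; inj₂)
  open import Relation.Nullary using (Dec; yes; no; ¬_; contradiction)
  open import Relation.Binary.PropositionalEquality using (_≡_; refl; sym; trans; cong; cong₂; subst)

  multiplicity : ℕ → List ℕ → ℕ
  multiplicity q [] = 0
  multiplicity q (x ∷ xs) with x ≟ q
  ... | yes _ = suc (multiplicity q xs)
  ... | no _ = multiplicity q xs

  below above : ℕ → List ℕ → ℕ
  below W [] = 0
  below W (x ∷ xs) with x <? W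
  ... | yes _ = suc (below W xs)
  ... | no _ = below W xs
  above W [] = 0
  above W (x ∷ xs) with x <? W
  ... | yes _ = above W xs
  ... | no _ = suc (above W xs)

  length≡below+above : ∀ W xs → length xs ≡ below W xs + above W xs
  length≡below+above W [] = refl
  length≡below+above W (x ∷ xs) with x <? W
  ... | yes _ = cong suc (length≡below+above W xs)
  ... | no _ = trans (cong suc (length≡below+above W xs)) (sym (+-suc (below W xs) (above W xs)))

  power∣product : ∀ q xs → q ^ multiplicity q xs ∣ product xs
  power∣product q [] = ∣-refl
  power∣product q (x ∷ xs) with x ≟ q
  ... | yes refl = *-monoʳ-∣ x (power∣product x xs)
  ... | no _ = ∣n⇒∣m*n x (power∣product q xs)

  multiplicity-prime : ∀ q xs → All Prime xs → 1 ≤ multiplicity q xs → Prime q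
  multiplicity-prime q (x ∷ xs) (px ∷ pxs) h with x ≟ q
  ... | yes refl = px
  ... | no _ = multiplicity-prime q xs pxs h

  below≤∑ : ∀ W xs → ι (below W xs) ℚ.≤ ∑ W (λ q → ι (multiplicity q xs))
  below≤∑ W [] = ℚP.≤-trans (ℚP.≤-reflexive ι0≡0) (∑-nonneg W (λ q _ → 0≤ι 0))
  below≤∑ W (x ∷ xs) = ℚP.≤-trans head-tail (ℚP.≤-trans (ℚP.+-mono-≤ head (below≤∑ W xs)) (ℚP.≤-trans (ℚP.≤-reflexive (sym (∑-+ W (λ q → ⟨ x ≟ q ⟩) (λ q → ι (multiplicity q xs))))) (∑-mono W (λ q _ → step q))))
    where
    head-tail : ι (below W (x ∷ xs)) ℚ.≤ ⟨ x <? W ⟩ ℚ.+ ι (below W xs)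
    head-tail with x <? W
    ... | yes x<W = ℚP.≤-reflexive (trans (ι-suc (below W xs)) (cong (ℚ._+ ι (below W xs)) (sym (⟨⟩-yes (x <? W) x<W))))
    ... | no _ = ℚP.≤-trans (ℚP.≤-reflexive (sym (ℚP.+-identityˡ (ι (below W xs))))) (ℚP.+-monoˡ-≤ (ι (below W xs)) (0≤⟨⟩ (x <? W)))
    head : ⟨ x <? W ⟩ ℚ.≤ ∑ W (λ q → ⟨ x ≟ q ⟩)
    head = go (x <? W)
      where
      go : (d : Dec (x < W)) → ⟨ d ⟩ ℚ.≤ ∑ W (λ q → ⟨ x ≟ q ⟩)
      go (yes x<W) = ℚP.≤-trans (ℚP.≤-reflexive (sym (⟨⟩-yes (x ≟ x) refl))) (term≤∑ W (λ q → ⟨ x ≟ q ⟩) (λ q → 0≤⟨⟩ (x ≟ q)) x x<W)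
      go (no _) = ∑-nonneg W (λ q _ → 0≤⟨⟩ (x ≟ q))
    step : ∀ q → ⟨ x ≟ q ⟩ ℚ.+ ι (multiplicity q xs) ℚ.≤ ι (multiplicity q (x ∷ xs))
    step q with x ≟ q
    ... | yes _ = ℚP.≤-trans (ℚP.+-monoˡ-≤ (ι (multiplicity q xs)) (⟨⟩≤1 (x ≟ q))) (ℚP.≤-reflexive (sym (ι-suc (multiplicity q xs))))
    ... | no x≢q = ℚP.≤-reflexive (trans (cong (ℚ._+ ι (multiplicity q xs)) (⟨⟩-no (x ≟ q) x≢q)) (ℚP.+-identityˡ (ι (multiplicity q xs))))

  above-power : ∀ z W xs → All Prime xs → All (λ x → x < W ⊎ z ≤ x) xs → z ^ above W xs ≤ product xs
  above-power z W [] _ _ = ≤-refl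
  above-power z W (x ∷ xs) (px ∷ pxs) (h ∷ hs) with x <? W
  ... | yes _ = ≤-trans (above-power z W xs pxs hs) (m≤n*m (product xs) x {{>-nonZero (prime⇒1≤ px)}})
  ... | no x≮W = *-mono-≤ (large h) (above-power z W xs pxs hs)
    where
    large : x < W ⊎ z ≤ x → z ≤ x
    large (inj₁ x<W) = contradiction x<W x≮W
    large (inj₂ z≤x) = z≤x

  ^-cancelʳ-≤ : ∀ {a b} → 2 ^ a ≤ 2 ^ b → a ≤ b
  ^-cancelʳ-≤ {a} {b} p = ≮⇒≥ λ q → <⇒≱ (^-monoʳ-< 2 ≤-refl q) p

  prefix≤∑ : ∀ u e (g : ℕ → ℚ) → u ≤ e → (∀ k → 0ℚ ℚ.≤ g k) → (∀ k → k < u → g k ≡ 1ℚ) → ι u ℚ.≤ ∑ e g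
  prefix≤∑ u e g u≤e 0≤g h = ℚP.≤-trans (ℚP.≤-reflexive (sym (trans (∑-cong u h) (trans (∑-const u 1ℚ) (ℚP.*-identityʳ (ι u)))))) (∑-≤-len g 0≤g u≤e)

  2^length≤product : ∀ xs → All Prime xs → 2 ^ length xs ≤ product xs
  2^length≤product [] _ = ≤-refl
  2^length≤product (x ∷ xs) (px ∷ pxs) = *-mono-≤ (prime⇒2≤ px) (2^length≤product xs pxs)

  FewFactors : ℕ → ℕ → Set
  FewFactors m B = ∃[ qs ] (All Prime qs × 1 ≤ length qs × length qs ≤ B × m ≡ product qs)

  nonempty : ∀ {m} xs → 2 ≤ m → m ≡ product xs → 1 ≤ length xs
  nonempty [] 2≤m refl = contradiction 2≤m λ { (s≤s ()) }
  nonempty (_ ∷ _) _ _ = s≤s z≤n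

  few-factors : ∀ m K B → 2 ≤ m → m ≤ 2 ^ K → K ≤ B → FewFactors m B
  few-factors m K B 2≤m m≤ K≤B = use (factorise m {{>-nonZero (≤-trans (s≤s z≤n) 2≤m)}})
    where
    use : PrimeFactorisation m → FewFactors m B
    use record { factors = qs ; isFactorisation = e ; factorsPrime = ps } = qs , ps , nonempty qs 2≤m e ,
      ≤-trans (^-cancelʳ-≤ (≤-trans (2^length≤product qs ps) (≤-trans (≤-reflexive (sym e)) m≤))) K≤B , e

  abstract
    -- Kept opaque, so that neither these numbers nor towers of powers over them get unfolded.
    w₀ r₀ c₀ s₀ t₀ : ℕ
    w₀ = 7
    r₀ = 22
    c₀ = 2 ^ 9
    s₀ = 2 ^ 36
    t₀ = 2 ^ 21

    w₀≡ : w₀ ≡ 7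
    w₀≡ = refl

    r₀≡ : r₀ ≡ 22
    r₀≡ = refl

    c₀≡ : c₀ ≡ 2 ^ 9
    c₀≡ = refl

    s₀≡ : s₀ ≡ 2 ^ 36
    s₀≡ = refl

    t₀≡ : t₀ ≡ 2 ^ 21
    t₀≡ = refl

    s₀+t₀≤ : s₀ + t₀ ≤ expBound
    s₀+t₀≤ = ≤ᵇ⇒≤ (2 ^ 36 + 2 ^ 21) expBound _

  module FewFactorsOfDifference (w r N N₁ : ℕ) (7≤w : 7 ≤ w) (w≤7 : w ≤ 7) (w≤r : w ≤ r) (lo : bl (r + 20) ≤ N₁) (hi : N₁ ≤ bl (r + 21)) (N≡ : N ≡ suc N₁) where

    open Setup w r N (≤-trans (≤ᵇ⇒≤ 3 7 _) 7≤w) using (W; z; M)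
    open SmallPrimes w r N N₁ 7≤w w≤r lo using (e; Φ)

    module Chosen (p : ℕ) (p<N₁ : p < N₁) (pp : Prime p) (y≤p : bl (r + 10) ≤ p) (avoid : ∀ {l} → M l → ¬ Cg l p N) (Φ≤ : Φ p ℚ.≤ pw 27) where

      m : ℕ
      m = N ∸ p

      p≤N : p ≤ N
      p≤N = ≤-trans (<⇒≤ p<N₁) (≤-trans (n≤1+n N₁) (≤-reflexive (sym N≡)))

      -- Taking p below N₁ = N - 1 keeps the difference from being 1, so at least one prime factor
      -- exists.
      2≤m : 2 ≤ m
      2≤m = m+n≤o⇒m≤o∸n 2 (≤-trans (s≤s p<N₁) (≤-reflexive (sym N≡)))

      m≤ : m ≤ 2 ^ (2 ^ (r + 21))
      m≤ = ≤-trans (≤-trans (∸-monoʳ-≤ N (prime⇒1≤ pp)) (≤-reflexive (cong (_∸ 1) N≡))) hi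

      -- A prime factor l of N - p in [W, z) is excluded by the choice of p unless l divides N; then
      -- l divides p, so l = p, which is too large.
      range : ∀ {l} → Prime l → l ∣ m → l < W ⊎ z ≤ l
      range {l} pl l∣m = go (l <? W) (l <? z) (l ∣? N)
        where
        go : Dec (l < W) → Dec (l < z) → Dec (l ∣ N) → l < W ⊎ z ≤ l
        go (yes l<W) _ _ = inj₁ l<W
        go (no _) (no l≮z) _ = inj₂ (≮⇒≥ l≮z)
        go (no l≮W) (yes l<z) (no l∤N) = contradiction (cg-sym (∣∸⇒cg p≤N l∣m)) (avoid (pl , ≮⇒≥ l≮W , l<z , l∤N))
        go (no _) (yes l<z) (yes l∣N) = contradiction (prime∣prime pl pp (∣m+n∣m⇒∣n (subst (l ∣_) (sym (m∸n+n≡m p≤N)) l∣N) l∣m)) (<⇒≢ (<-≤-trans l<z (≤-trans (bl-mono (m≤m+n r 10)) y≤p)))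

      few : FewFactors m (s₀ + t₀)
      few = use (factorise m {{>-nonZero (≤-trans (s≤s z≤n) 2≤m)}})
        where
        use : PrimeFactorisation m → FewFactors m (s₀ + t₀)
        use record { factors = qs ; isFactorisation = m≡ ; factorsPrime = ps } = qs , ps , nonempty qs 2≤m m≡ ,
            ≤-trans (≤-reflexive (length≡below+above W qs)) (+-mono-≤ small large) , m≡
          where
          ranges : ∀ xs → All Prime xs → (∀ {l} → Prime l → l ∣ product xs → l ∣ m) → All (λ x → x < W ⊎ z ≤ x) xs
          ranges [] _ _ = []
          ranges (x ∷ xs) (px ∷ pxs) h = range px (h px (m∣m*n (product xs))) ∷ ranges xs pxs (λ pl d → h pl (∣n⇒∣m*n x d))
          -- m is at most 2 ^ 2 ^ (r + 21), and each such factor is at least z = 2 ^ 2 ^ r.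
          large′ : above W qs ≤ 2 ^ 21
          large′ = *-cancelˡ-≤ (2 ^ r) {{>-nonZero (1≤2^ r)}} (^-cancelʳ-≤ (≤-trans (≤-reflexive (sym (^-*-assoc 2 (2 ^ r) (above W qs))))
            (≤-trans (above-power z W qs ps (ranges qs ps (λ _ d → subst (_ ∣_) (sym m≡) d))) (≤-trans (≤-reflexive (sym m≡)) (≤-trans m≤ (≤-reflexive (cong (2 ^_) (^-distribˡ-+-* 2 r 21))))))))
          large : above W qs ≤ t₀
          large = subst (above W qs ≤_) (sym t₀≡) large′
          -- Undoes the truncation: a multiplicity v is at most 2 ^ (r + 21) = 2 ^ 9 e, so v ≤ 2 ^ 9
          -- min (v, e), and the first min (v, e) terms of the inner sum are all 1.
          term : ∀ q → ι (multiplicity q qs) ℚ.≤ pw 9 ℚ.* ∑ e (λ k → pr q ℚ.* ⟨ cg? (q ^ suc k) p N ⟩)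
          term q = go (multiplicity q qs) refl
            where
            g : ℕ → ℚ
            g k = pr q ℚ.* ⟨ cg? (q ^ suc k) p N ⟩
            0≤g : ∀ k → 0ℚ ℚ.≤ g k
            0≤g k = 0≤* (0≤pr q) (0≤⟨⟩ (cg? (q ^ suc k) p N))
            0≤RHS : 0ℚ ℚ.≤ pw 9 ℚ.* ∑ e g
            0≤RHS = 0≤* (0≤pw 9) (∑-nonneg e (λ k _ → 0≤g k))
            go : ∀ v → v ≡ multiplicity q qs → ι v ℚ.≤ pw 9 ℚ.* ∑ e g
            go zero _ = ℚP.≤-trans (ℚP.≤-reflexive ι0≡0) 0≤RHS
            go v@(suc _) v≡ = ℚP.≤-trans (ι-mono v≤) (ℚP.≤-trans (ℚP.≤-reflexive (trans (ι-* c₀ (v ⊓ e)) (cong (λ k → ι k ℚ.* ι (v ⊓ e)) c₀≡))) (*-monoʳ (0≤pw 9) (prefix≤∑ (v ⊓ e) e g (m⊓n≤n v e) 0≤g ones)))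
              where
              pq : Prime q
              pq = multiplicity-prime q qs ps (subst (1 ≤_) v≡ (s≤s z≤n))
              qᵛ∣m : q ^ v ∣ m
              qᵛ∣m = subst (λ u → q ^ u ∣ m) (sym v≡) (subst (q ^ multiplicity q qs ∣_) (sym m≡) (power∣product q qs))
              ones : ∀ k → k < v ⊓ e → g k ≡ 1ℚ
              ones k k< = trans (cong₂ ℚ._*_ (⟨⟩-yes (isPrime? q) pq) (⟨⟩-yes (cg? (q ^ suc k) p N) (cg-sym (∣∸⇒cg p≤N (∣-trans (^-∣ (<-≤-trans k< (m⊓n≤m v e))) qᵛ∣m))))) (ℚP.*-identityˡ 1ℚ)
                where
                ^-∣ : ∀ {a b} → a ≤ b → q ^ a ∣ q ^ b
                ^-∣ {a} {b} a≤b = divides (q ^ (b ∸ a)) (trans (cong (q ^_) (sym (m∸n+n≡m a≤b))) (^-distribˡ-+-* q (b ∸ a) a))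
              v≤2^ : v ≤ 2 ^ (r + 21)
              v≤2^ = ^-cancelʳ-≤ (≤-trans (^-monoˡ-≤ v (prime⇒2≤ pq)) (≤-trans (∣⇒≤ {{>-nonZero (≤-trans (s≤s z≤n) 2≤m)}} qᵛ∣m) m≤))
              v≤ : v ≤ c₀ * (v ⊓ e)
              v≤ = ≤-trans (⊓-glb (m≤n*m v c₀ {{>-nonZero (≤-trans (1≤2^ 9) (≤-reflexive (sym c₀≡)))}}) (≤-trans v≤2^ (≤-reflexive (trans (cong (2 ^_) (sym (+-assoc r 12 9))) (trans (^-distribˡ-+-* 2 (r + 12) 9) (trans (*-comm (2 ^ (r + 12)) (2 ^ 9)) (cong (_* e) (sym c₀≡)))))))) (≤-reflexive (sym (*-distribˡ-⊓ c₀ v e)))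
          small : below W qs ≤ s₀
          small = ι-cancel-≤ (ℚP.≤-trans (below≤∑ W qs) (ℚP.≤-trans (∑-mono W (λ q _ → term q)) (ℚP.≤-trans (ℚP.≤-reflexive (∑-*ˡ W (pw 9) (λ q → ∑ e (λ k → pr q ℚ.* ⟨ cg? (q ^ suc k) p N ⟩)))) (ℚP.≤-trans (*-monoʳ (0≤pw 9) Φ≤) (ℚP.≤-reflexive (trans (sym (pw-+ 9 27)) (cong ι (sym s₀≡))))))))

  scale : ∀ N₁ k → bl (r₀ + 20) ≤ N₁ → N₁ ≤ bl (r₀ + k + 20) → Σ ℕ λ r → r₀ ≤ r × bl (r + 20) ≤ N₁ × N₁ ≤ bl (r + 21)
  scale N₁ zero lo hi = r₀ , ≤-refl , lo , ≤-trans hi (bl-mono (≤-trans (≤-reflexive (cong (_+ 20) (+-identityʳ r₀))) (+-monoʳ-≤ r₀ (n≤1+n 20))))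
  scale N₁ (suc k) lo hi = go (N₁ ≤? bl (r₀ + k + 20))
    where
    go : Dec (N₁ ≤ bl (r₀ + k + 20)) → Σ ℕ λ r → r₀ ≤ r × bl (r + 20) ≤ N₁ × N₁ ≤ bl (r + 21)
    go (yes le) = scale N₁ k lo le
    go (no ¬le) = r₀ + k , m≤m+n r₀ k , <⇒≤ (≰⇒> ¬le) , ≤-trans hi (bl-mono (≤-reflexive (trans (cong (_+ 20) (+-suc r₀ k)) (sym (+-suc (r₀ + k) 20)))))

  representation : ∀ N → 4 ≤ N → ∃[ p ] (Prime p × p ≤ N × FewFactors (N ∸ p) expBound)
  representation (suc N₁) N≥4 = go (bl (r₀ + 20) ≤? N₁)
    where
    N : ℕ
    N = suc N₁
    Goal : Set
    Goal = ∃[ p ] (Prime p × p ≤ N × FewFactors (N ∸ p) expBound)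
    go : Dec (bl (r₀ + 20) ≤ N₁) → Goal
    go (no small) = 2 , prime[2] , ≤-trans (s≤s (s≤s z≤n)) N≥4 , few-factors (N ∸ 2) (2 ^ (r₀ + 20)) expBound (m+n≤o⇒m≤o∸n 2 N≥4) (≤-trans (∸-monoʳ-≤ N (s≤s {0} {1} z≤n)) (<⇒≤ (≰⇒> small))) exponent≤
      where
      exponent≤ : 2 ^ (r₀ + 20) ≤ expBound
      exponent≤ = subst (λ r → 2 ^ (r + 20) ≤ expBound) (sym r₀≡) (≤ᵇ⇒≤ (2 ^ 42) expBound _)
    -- N₁ itself serves as the number of blocks to search, by N₁ ≤ 2 ^ 2 ^ N₁.
    go (yes big) = at-scale (scale N₁ N₁ big (≤-trans (n≤2^n N₁) (^-monoʳ-≤ 2 (≤-trans (n≤2^n N₁) (^-monoʳ-≤ 2 (≤-trans (m≤n+m N₁ r₀) (m≤m+n (r₀ + N₁) 20)))))))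
      where
      at-scale : (Σ ℕ λ r → r₀ ≤ r × bl (r + 20) ≤ N₁ × N₁ ≤ bl (r + 21)) → Goal
      at-scale (r , r₀≤r , lo , hi) = from (Selection.selection w₀ r N N₁ 7≤w w≤7 w≤r lo hi)
        where
        7≤w : 7 ≤ w₀
        7≤w = ≤-reflexive (sym w₀≡)
        w≤7 : w₀ ≤ 7
        w≤7 = ≤-reflexive w₀≡
        w≤r : w₀ ≤ r
        w≤r = ≤-trans w≤7 (≤-trans (≤ᵇ⇒≤ 7 22 _) (≤-trans (≤-reflexive (sym r₀≡)) r₀≤r))
        open Setup w₀ r N (≤-trans (≤ᵇ⇒≤ 3 7 _) 7≤w) using (M)
        open SmallPrimes w₀ r N N₁ 7≤w w≤r lo using (Φ)
        from : (Σ ℕ λ p → p < N₁ × Prime p × bl (r + 10) ≤ p × (∀ {l} → M l → ¬ Cg l p N) × Φ p ℚ.≤ pw 27) → Goal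
        from (p , p<N₁ , pp , y≤p , avoid , Φ≤) = p , pp , ≤-trans (<⇒≤ p<N₁) (n≤1+n N₁) ,
          weaken (FewFactorsOfDifference.Chosen.few w₀ r N N₁ 7≤w w≤7 w≤r lo hi refl p p<N₁ pp y≤p avoid Φ≤)
          where
          weaken : FewFactors (N ∸ p) (s₀ + t₀) → FewFactors (N ∸ p) expBound
          weaken (qs , ps , 1≤ , ≤B , e) = qs , ps , 1≤ , ≤-trans ≤B s₀+t₀≤ , e

open import Defs
open import Data.Nat using (ℕ; _+_; _*_; _≤_; _≥_)
open import Data.Nat.Properties using (m+[n∸m]≡n)
open import Data.Nat.Divisibility using (_∣_)
open import Data.Nat.Primality using (Prime)
open import Data.List using (List; length)
open import Data.List.Relation.Unary.All using (All)
open import Data.Product using (Σ; _×_; _,_; ∃-syntax)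
open import Relation.Binary.PropositionalEquality using (_≡_; sym; trans; cong)
open Conclusion using (representation)

theorem5 : (N : ℕ) → 2 ∣ N → N ≥ 4 →
    ∃[ p ] ∃[ qs ] (Prime p × All Prime qs × 1 ≤ length qs × length qs ≤ expBound
    × N ≡ p + prodList qs)
theorem5 N _ N≥4 =
  let p , pp , p≤N , qs , ps , 1≤ , ≤B , e = representation N N≥4
  in p , qs , pp , ps , 1≤ , ≤B , trans (sym (m+[n∸m]≡n p≤N)) (cong (p +_) e)
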